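{- Let $\mathbb{F}$ be a field and let $\Delta$ be a (not necessarily connected) $d$-dimensional normal pseudomanifold with boundary, with $d\ge 3$. Then \[ g_2(\Delta,\partial\Delta)\ge\binom{d+2}{2}\Big(\tilde b_1(\Delta,\partial\Delta;\mathbb{F})-\tilde b_0(\Delta,\partial\Delta;\mathbb{F})\Big). \] Furthermore, if $\Delta$ is an $\mathbb{F}$-homology manifold with boundary for which this inequality is an equality, then the link of each interior vertex of $\Delta$ is a stacked sphere and the link of each boundary vertex of $\Delta$ is obtained from an $\mathbb{F}$-homology ball that has no interior vertices by forming connected sums with boundary complexes of simplices.
   Context: Simplicial complexes are finite families of subsets of a finite ground set closed under subsets; $\dim F=|F|-1$. For $\Gamma\subseteq\Delta$, the relative complex $(\Delta,\Gamma)$ consists of the faces of $\Delta$ not in $\Gamma$, with dimension the maximal dimension of these faces; $f_i(\Delta,\Gamma)$ is its number of $i$-dimensional faces ($i\ge -1$). If $\dim(\Delta,\Gamma)=D-1$, $h_j(\Delta,\Gamma)=\sum_{i=0}^j(-1)^{j-i}\binom{D-i}{D-j}f_{i-1}(\Delta,\Gamma)$, $g_0=h_0$, $g_j=h_j-h_{j-1}$ for $j\ge1$. Reduced relative homology $\tilde H_i(\Delta,\Gamma;\mathbb{F})$ is the homology of $C_\bullet(\Delta)/C_\bullet(\Gamma)$, where $C_k(\Delta)$ ($k\ge -1$) has basis the faces of cardinality $k+1$ ($C_{ -1}(\Delta)=\mathbb{F}$ if $\Delta\ne\emptyset$); $\tilde b_i=\dim\tilde H_i$. For $\Gamma\neq\emptyset$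 these are the ordinary relative Betti numbers. Link: $\mathrm{lk}_\Delta(G)=\{H\in\Delta:H\cup G\in\Delta,H\cap G=\emptyset\}$. A $d$-dimensional complex $\Delta$ is a normal pseudomanifold if it is pure, every $(d-1)$-face (ridge) lies in at most two facets, and the link of every nonempty face of dimension $\le d-2$ is connected; it is a normal pseudomanifold with boundary if some ridge lies in exactly one facet, and then its boundary $\partial\Delta$ is the pure $(d-1)$-dimensional complex whose facets are the ridges lying in exactly one facet. Faces not in $\partial\Delta$ are interior; a vertex $v$ is a boundary vertex if $\{v\}\in\partial\Delta$, interior otherwise. Homology manifolds: a $(k-1)$-dimensional complex is an $\mathbb{F}$-homology sphere if for every face $G$ (including $\emptyset$) $\mathrm{lk}(G)$ has the reduced $\mathbb{F}$-homology of $\mathbb{S}^{k-1-|G|}$. A $k$-dimensional complex is an $\mathbb{F}$-homology manifold with boundary if the link of each nonempty face $G$ has the reduced $\mathbb{F}$-homology of $\mathbb{S}^{k-|G|}$ or of $\mathbb{B}^{k-|G|}$ (zero), and the set of $\emptyset$ together with faces whose link has the homology of a ball (its boundary) is a $(k-1)$-dimensional homology manifold without boundary (i.e. all links of nonempty faces are homology spheres of the appropriate dimension). An $\mathbb{F}$-homology $k$-ball is an $\mathbb{F}$-homology $k$-manifold with boundary with vanishing reduced homology whose boundary is an $\mathbb{F}$-homology $(k-1)$-sphere. Connected sum: for pure complexes $\Delta',\Delta''$ of equal dimension on disjoint vertex sets, facets $F'\in\Delta'$, $F''\in\Delta''$ and a bijection $F'\to F''$, $\Delta'\#\Delta''$ is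 obtained by identifying $F'$ with $F''$ (and all their subfaces) via the bijection and removing the identified facet. A stacked sphere is a connected sum of (one or more) boundary complexes of simplices of the same dimension. -}

module Defs where

open import Level using (Level; _⊔_) renaming (suc to lsuc)
open import Data.Bool using (Bool; true; false; _∧_; _∨_; not; if_then_else_)
open import Data.Nat using (ℕ; zero; suc; _∸_; _≡ᵇ_; _≤_) renaming (_⊔_ to _⊔ℕ_)
open import Data.Nat.Combinatorics using (_C_)
open import Data.Vec using (Vec; []; _∷_; replicate)
open import Data.List using (List; []; _∷_; _++_; map; foldr; upTo)
open import Data.Fin using (Fin) renaming (zero to fzero; suc to fsuc)
open import Data.Integer using (ℤ; +_) renaming (-_ to negℤ; _+_ to _+ℤ_; _*_ to _*ℤ_; _-_ to _-ℤ_)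
open import Data.Product using (Σ; _×_; _,_)
open import Data.Sum using (_⊎_)
open import Algebra.Bundles using (CommutativeRing)
open import Relation.Binary.PropositionalEquality using (_≡_)
open import Relation.Nullary using (¬_)
open import Function.Bundles using (_⇔_)

record Field (c ℓ : Level) : Set (lsuc (c ⊔ ℓ)) where
  field
    commutativeRing : CommutativeRing c ℓ
  open CommutativeRing commutativeRing public
  field
    0≉1 : ¬ (0# ≈ 1#)
    inverse : ∀ x → ¬ (x ≈ 0#) → Σ Carrier (λ y → (x * y) ≈ 1#)

Sub : ℕ → Set
Sub n = Vec Bool n

allSubs : (n : ℕ) → List (Sub n)
allSubs zero = [] ∷ []
allSubs (suc n) = map (false ∷_) (allSubs n) ++ map (true ∷_) (allSubs n)

emptyS : ∀ {n} → Sub n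
emptyS = replicate _ false

single : ∀ {n} → Fin n → Sub n
single {suc n} fzero = true ∷ emptyS
single {suc n} (fsuc i) = false ∷ single i

mem : ∀ {n} → Fin n → Sub n → Bool
mem fzero (b ∷ s) = b
mem (fsuc i) (b ∷ s) = mem i s

card : ∀ {n} → Sub n → ℕ
card [] = 0
card (true ∷ s) = suc (card s)
card (false ∷ s) = card s

_⊆ᵇ_ : ∀ {n} → Sub n → Sub n → Bool
[] ⊆ᵇ [] = true
(a ∷ s) ⊆ᵇ (b ∷ t) = (not a ∨ b) ∧ (s ⊆ᵇ t)

_==ᵇ_ : ∀ {n} → Sub n → Sub n → Bool
s ==ᵇ t = (s ⊆ᵇ t) ∧ (t ⊆ᵇ s)

_∪ˢ_ : ∀ {n} → Sub n → Sub n → Sub n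
[] ∪ˢ [] = []
(a ∷ s) ∪ˢ (b ∷ t) = (a ∨ b) ∷ (s ∪ˢ t)

disjointᵇ : ∀ {n} → Sub n → Sub n → Bool
disjointᵇ [] [] = true
disjointᵇ (a ∷ s) (b ∷ t) = not (a ∧ b) ∧ disjointᵇ s t

Cx : ℕ → Set
Cx n = Sub n → Bool

emptyCx : ∀ {n} → Cx n
emptyCx _ = false

IsComplex : ∀ {n} → Cx n → Set
IsComplex K = ∀ σ τ → (τ ⊆ᵇ σ) ≡ true → K σ ≡ true → K τ ≡ true

link : ∀ {n} → Cx n → Sub n → Cx n
link K G H = K (H ∪ˢ G) ∧ disjointᵇ H G

countB : ∀ {n} → (Sub n → Bool) → ℕ
countB {n} P = foldr (λ σ acc → if P σ then suc acc else acc) 0 (allSubs n)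

anyB : ∀ {n} → (Sub n → Bool) → Bool
anyB {n} P = foldr (λ σ acc → P σ ∨ acc) false (allSubs n)

rel : ∀ {n} → Cx n → Cx n → Sub n → Bool
rel Δ Γ σ = Δ σ ∧ not (Γ σ)

-- K has maximal face cardinality exactly k  (i.e. dim K = k - 1)
HasTopCard : ∀ {n} → Cx n → ℕ → Set
HasTopCard K k = Σ _ (λ σ → K σ ≡ true × card σ ≡ k) × (∀ σ → K σ ≡ true → card σ ≤ k)

-- fc Δ Γ i = f_{i-1}(Δ,Γ) = number of faces of (Δ,Γ) of cardinality i
fc : ∀ {n} → Cx n → Cx n → ℕ → ℕ
fc Δ Γ i = countB (λ σ → rel Δ Γ σ ∧ (card σ ≡ᵇ i))

-- D = dim(Δ,Γ) + 1 = maximal cardinality of a face of (Δ,Γ)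
relTopCard : ∀ {n} → Cx n → Cx n → ℕ
relTopCard {n} Δ Γ = foldr (λ σ acc → if rel Δ Γ σ then card σ ⊔ℕ acc else acc) 0 (allSubs n)

signℤ : ℕ → ℤ
signℤ zero = + 1
signℤ (suc k) = negℤ (signℤ k)

sumℤ : List ℤ → ℤ
sumℤ = foldr _+ℤ_ (+ 0)

hnum : ∀ {n} → Cx n → Cx n → ℕ → ℤ
hnum Δ Γ j = sumℤ (map (λ i → signℤ (j ∸ i) *ℤ (+ ((D ∸ i) C (D ∸ j)) *ℤ + fc Δ Γ i)) (upTo (suc j)))
  where D = relTopCard Δ Γ

gnum : ∀ {n} → Cx n → Cx n → ℕ → ℤ
gnum Δ Γ zero = hnum Δ Γ zero
gnum Δ Γ (suc j) = hnum Δ Γ (suc j) -ℤ hnum Δ Γ j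

facetCount : ∀ {n} → Cx n → ℕ → Sub n → ℕ
facetCount Δ d ρ = countB (λ σ → Δ σ ∧ (card σ ≡ᵇ suc d) ∧ (ρ ⊆ᵇ σ))

pair : ∀ {n} → Fin n → Fin n → Sub n
pair u w = single u ∪ˢ single w

data Path {n} (K : Cx n) : Fin n → Fin n → Set where
  here : ∀ u → Path K u u
  step : ∀ u w v → K (pair u w) ≡ true → Path K w v → Path K u v

Connected : ∀ {n} → Cx n → Set
Connected K = ∀ u v → K (single u) ≡ true → K (single v) ≡ true → Path K u v

IsNormalPseudomanifold : ∀ {n} → Cx n → ℕ → Set
IsNormalPseudomanifold Δ d =
  IsComplex Δ × HasTopCard Δ (suc d)
  × (∀ σ → Δ σ ≡ true → Σ _ (λ F → Δ F ≡ true × card F ≡ suc d × (σ ⊆ᵇ F) ≡ true))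
  × (∀ ρ → Δ ρ ≡ true → card ρ ≡ d → facetCount Δ d ρ ≤ 2)
  × (∀ G → Δ G ≡ true → 1 ≤ card G → suc (card G) ≤ d → Connected (link Δ G))

IsNormalPseudomanifoldWithBoundary : ∀ {n} → Cx n → ℕ → Set
IsNormalPseudomanifoldWithBoundary Δ d =
  IsNormalPseudomanifold Δ d
  × Σ _ (λ ρ → Δ ρ ≡ true × card ρ ≡ d × facetCount Δ d ρ ≡ 1)

bdry : ∀ {n} → Cx n → ℕ → Cx n
bdry Δ d τ = anyB (λ ρ → Δ ρ ∧ (card ρ ≡ᵇ d) ∧ (facetCount Δ d ρ ≡ᵇ 1) ∧ (τ ⊆ᵇ ρ))

InteriorVertex : ∀ {n} → Cx n → ℕ → Fin n → Set
InteriorVertex Δ d v = Δ (single v) ≡ true × bdry Δ d (single v) ≡ false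

BoundaryVertex : ∀ {n} → Cx n → ℕ → Fin n → Set
BoundaryVertex Δ d v = bdry Δ d (single v) ≡ true

-- Connected sum with the boundary of a simplex, glued along a facet Fc
-- of K; the simplex has vertex set Fc ∪ {w}, w a new vertex.

connSumSimplex : ∀ {n} → Cx n → Sub n → Fin n → Cx n
connSumSimplex K Fc w σ =
  (K σ ∧ not (σ ==ᵇ Fc))
  ∨ ((σ ⊆ᵇ (Fc ∪ˢ single w)) ∧ not (σ ==ᵇ (Fc ∪ˢ single w)) ∧ not (σ ==ᵇ Fc))

data BuiltBySums {a n} (Base : Cx n → Set a) (m : ℕ) : Cx n → Set a where
  base : ∀ K K' → Base K → (∀ σ → K' σ ≡ K σ) → BuiltBySums Base m K'
  sumStep : ∀ K K' Fc w → BuiltBySums Base m K → K Fc ≡ true → card Fc ≡ m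
    → (∀ σ → K σ ≡ true → mem w σ ≡ false)
    → (∀ σ → K' σ ≡ connSumSimplex K Fc w σ) → BuiltBySums Base m K'

IsSimplexBoundary : ∀ {n} → ℕ → Cx n → Set
IsSimplexBoundary m K = Σ _ (λ S → card S ≡ suc m × (∀ σ → K σ ≡ ((σ ⊆ᵇ S) ∧ not (σ ==ᵇ S))))

-- stacked (m-1)-sphere
IsStackedSphere : ∀ {n} → ℕ → Cx n → Set
IsStackedSphere m K = BuiltBySums (IsSimplexBoundary m) m K

module Homology {c ℓ} (𝔽 : Field c ℓ) where
  open Field 𝔽

  Chain : ℕ → Set c
  Chain n = Sub n → Carrier

  sumL : ∀ {n} → (Sub n → Carrier) → Carrier
  sumL {n} f = foldr (λ σ acc → f σ + acc) 0# (allSubs n)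

  sumFin : (b : ℕ) → (Fin b → Carrier) → Carrier
  sumFin zero f = 0#
  sumFin (suc b) f = f fzero + sumFin b (λ j → f (fsuc j))

  signF : ℕ → Carrier
  signF zero = 1#
  signF (suc k) = - signF k

  -- for τ = σ minus one element x: number of elements of σ before x
  pos : ∀ {n} → Sub n → Sub n → ℕ
  pos [] [] = 0
  pos (a ∷ s) (b ∷ t) = if a ∧ not b then 0 else (if b then suc (pos s t) else pos s t)

  -- boundary map of C(Δ)/C(Γ) (on all cardinalities at once)
  bd : ∀ {n} → Cx n → Cx n → Chain n → Chain n
  bd Δ Γ w τ = sumL (λ σ → if rel Δ Γ σ ∧ (τ ⊆ᵇ σ) ∧ (card σ ≡ᵇ suc (card τ))
                            then signF (pos σ τ) * w σ else 0#)

  -- equality in C_{k-1}(Δ)/C_{k-1}(Γ) (faces of cardinality k)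
  EqIn : ∀ {n} → Cx n → Cx n → ℕ → Chain n → Chain n → Set (ℓ)
  EqIn Δ Γ k x y = ∀ σ → rel Δ Γ σ ≡ true → card σ ≡ k → x σ ≈ y σ

  Cycle : ∀ {n} → Cx n → Cx n → ℕ → Chain n → Set ℓ
  Cycle Δ Γ k z = ∀ τ → rel Δ Γ τ ≡ true → suc (card τ) ≡ k → bd Δ Γ z τ ≈ 0#

  lin : ∀ {n} (b : ℕ) → (Fin b → Carrier) → (Fin b → Chain n) → Chain n
  lin b a z σ = sumFin b (λ j → a j * z j σ)

  -- IsBetti Δ Γ k b  :⇔  b̃_{k-1}(Δ,Γ;𝔽) = b, i.e. the homology in the
  -- degree of faces of cardinality k has a basis of b classes.
  IsBetti : ∀ {n} → Cx n → Cx n → ℕ → ℕ → Set (c ⊔ ℓ)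
  IsBetti {n} Δ Γ k b =
    Σ (Fin b → Chain n) λ z →
      (∀ j → Cycle Δ Γ k (z j))
      × (∀ a (w : Chain n) → EqIn Δ Γ k (lin b a z) (bd Δ Γ w) → ∀ j → a j ≈ 0#)
      × (∀ z' → Cycle Δ Γ k z' → Σ (Fin b → Carrier) λ a → Σ (Chain n) λ w →
            EqIn Δ Γ k z' (λ σ → lin b a z σ + bd Δ Γ w σ))

  -- reduced homology of S^{m'-1} (nonzero only in cardinality-degree m')
  SphereHomology : ∀ {n} → Cx n → ℕ → Set (c ⊔ ℓ)
  SphereHomology K m' = ∀ k → IsBetti K emptyCx k (if k ≡ᵇ m' then 1 else 0)

  ZeroHomology : ∀ {n} → Cx n → Set (c ⊔ ℓ)
  ZeroHomology K = ∀ k → IsBetti K emptyCx k 0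

  -- 𝔽-homology (k-1)-sphere
  IsHomSphere : ∀ {n} → Cx n → ℕ → Set (c ⊔ ℓ)
  IsHomSphere K k = IsComplex K × HasTopCard K k
    × (∀ G → K G ≡ true → SphereHomology (link K G) (k ∸ card G))

  -- (k-1)-dimensional 𝔽-homology manifold without boundary
  IsHomManifoldNoBdry : ∀ {n} → Cx n → ℕ → Set (c ⊔ ℓ)
  IsHomManifoldNoBdry K k = IsComplex K × HasTopCard K k
    × (∀ G → K G ≡ true → 1 ≤ card G → IsHomSphere (link K G) (k ∸ card G))

  IsHomBoundary : ∀ {n} → Cx n → Cx n → Set (c ⊔ ℓ)
  IsHomBoundary K B = ∀ σ → (B σ ≡ true) ⇔ ((σ ≡ emptyS) ⊎ (K σ ≡ true × 1 ≤ card σ × ZeroHomology (link K σ)))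

  -- k-dimensional 𝔽-homology manifold with boundary
  IsHomManifoldWithBdry : ∀ {n} → Cx n → ℕ → Set (c ⊔ ℓ)
  IsHomManifoldWithBdry K k = IsComplex K × HasTopCard K (suc k)
    × (∀ G → K G ≡ true → 1 ≤ card G →
         SphereHomology (link K G) (suc k ∸ card G) ⊎ ZeroHomology (link K G))
    × Σ (Cx _) (λ B → IsHomBoundary K B × IsHomManifoldNoBdry B k)

  -- k-dimensional 𝔽-homology ball
  IsHomBall : ∀ {n} → Cx n → ℕ → Set (c ⊔ ℓ)
  IsHomBall K k = IsHomManifoldWithBdry K k × ZeroHomology K
    × Σ (Cx _) (λ B → IsHomBoundary K B × IsHomSphere B k)

  NoInteriorVertices : ∀ {n} → Cx n → Set (c ⊔ ℓ)
  NoInteriorVertices K = ∀ v → K (single v) ≡ true → ZeroHomology (link K (single v))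

{-# OPTIONS --safe #-}
-- Order the vertices at random and let W be the set of vertices preceding v. Relative Morse inequalities in degrees
-- 0 and 1, averaged over all orders, bound n!·(b₁ + f₀ − b₀) by the total number of surplus components of the graphs
-- induced on W ∪ {0} in the link graphs of the vertices v; here 0 is a cone point over the boundary.
-- For one vertex v the expected number of components is bounded by growing a set of vertices of the link graph, from
-- a facet or from the boundary vertices: a new vertex with d neighbours costs at most a fixed amount T, with equality
-- only if its degree is exactly d and its neighbours form a clique. A cycle modulo 2 through the part already built
-- either supplies such a vertex or splits after the contraction of an edge, under which the component counts are
-- modular; hence the whole link is reached. Summing over v gives the inequality.
-- In the case of equality every link arises by adding vertices of degree exactly d. Removing these again, one at a
-- time, exhibits the link as a connected sum with simplex boundaries, and the homology of links is carried along.

module Submission where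

open import Defs
open import Level using (Level; _⊔_)
open import Data.Bool using (Bool; true; false; _∧_; _∨_; _xor_; not; if_then_else_)
open import Data.Bool.Properties using (∨-comm; ∨-assoc; ∧-zeroʳ; ∨-identityʳ; ∨-zeroʳ; ∧-identityʳ; xor-same; xor-assoc; xor-comm; xor-identityʳ)
open import Data.Nat using (ℕ; zero; suc; _+_; _*_; _∸_; _≤_; _<_; z≤n; s≤s; _!; _≡ᵇ_; _≤ᵇ_; _≤?_; pred; NonZero; >-nonZero) renaming (_⊔_ to _⊔ℕ_)
open import Data.Nat.Properties hiding (_≟_; ≡-irrelevant)
open import Data.Fin using (Fin; _≟_; punchIn; splitAt; join) renaming (zero to fzero; suc to fsuc)
open import Data.Fin.Properties using (splitAt-join; join-splitAt) renaming (suc-injective to fsuc-injective)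
open import Data.Vec using ([]; _∷_)
open import Data.List using (List; []; _∷_; _++_; foldr; length; lookup) renaming (map to mapL)
open import Data.Product using (Σ; _×_; _,_; proj₁; proj₂; ∃)
open import Data.Sum using (_⊎_; inj₁; inj₂; [_,_]′)
open import Data.Empty using (⊥; ⊥-elim)
open import Function using (_∘_; id)
open import Function.Bundles using (mk⇔; module Equivalence)
open import Relation.Nullary using (¬_; yes; no; contradiction)
open import Relation.Nullary.Decidable using (⌊_⌋)
open import Relation.Binary.PropositionalEquality using (_≡_; _≢_; refl; sym; trans; cong; cong₂; subst; subst₂; module ≡-Reasoning)
open import Data.Nat.Solver using (module +-*-Solver)
open import Data.Vec.Functional using (insertAt)
open import Data.Vec.Functional.Properties using (insertAt-lookup; insertAt-punchIn)
import Algebra.Properties.Ring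
import Relation.Binary.Reasoning.Setoid
import Data.Integer as ℤ
import Data.Integer.Properties as ℤₚ
import Data.Integer.Solver as ℤSolver
import Data.Nat.Combinatorics as Comb

-- The constant is a probability. Among a vertex, `d` of its neighbours and a mark in random order,
-- the vertex comes before the mark and all the neighbours after it with probability 1/((d+1)(d+2)).
-- This bounds the expected number of components that the vertex adds, and (d+1)(d+2) is twice the
-- binomial coefficient of the theorem; `unit` is this probability times (n+1)!. The obstacle is a
-- set that is stuck: vertices are left, but none has `d` neighbours in the set. An edge `uv`
-- leaving the set is then contracted. The cycle found in the contraction lifts to the link up to
-- facets that contain both `u` and `v`. If none is missing, the lift is a smaller cycle and
-- induction applies to it. Otherwise the missing facets yield `d - 1` common neighbours of `u` and
-- `v`, which is exactly what makes `v` affordable when the contraction is undone. This detour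
-- always ends strictly below the bound. Hence equality leaves only additions of vertices of degree
-- exactly `d`, and this is why costs are carried as an alternative between a strict inequality and
-- a record of the additions.

-- Booleans, finite sets and their cardinalities

infix 4 _∈_ _∉_ _⊑_

_∈_ _∉_ : ∀ {n} → Fin n → Sub n → Set
x ∈ s = mem x s ≡ true
x ∉ s = mem x s ≡ false

_⊑_ : ∀ {n} → Sub n → Sub n → Set
s ⊑ t = ∀ x → x ∈ s → x ∈ t

t≢f : ∀ {b} → b ≡ true → b ≡ false → ⊥
t≢f refl ()

∧-el : ∀ {a b} → a ∧ b ≡ true → a ≡ true × b ≡ true
∧-el {true} p = refl , p

∧-in : ∀ {a b} → a ≡ true → b ≡ true → a ∧ b ≡ true
∧-in refl refl = refl

∧-falseˡ : ∀ {a} b → a ≡ false → a ∧ b ≡ false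
∧-falseˡ _ refl = refl

∧-falseʳ : ∀ a {b} → b ≡ false → a ∧ b ≡ false
∧-falseʳ a refl = ∧-zeroʳ a

∨-inˡ : ∀ {a} b → a ≡ true → a ∨ b ≡ true
∨-inˡ _ refl = refl

∨-inʳ : ∀ a {b} → b ≡ true → a ∨ b ≡ true
∨-inʳ a refl = ∨-zeroʳ a

∨-el : ∀ {a b} → a ∨ b ≡ true → a ≡ true ⊎ b ≡ true
∨-el {true} _ = inj₁ refl
∨-el {false} p = inj₂ p

not-el : ∀ {a} → not a ≡ true → a ≡ false
not-el {false} _ = refl

not-in : ∀ {a} → a ≡ false → not a ≡ true
not-in refl = refl

bool-iff : ∀ {a b} → (a ≡ true → b ≡ true) → (b ≡ true → a ≡ true) → a ≡ b
bool-iff {true} f _ = sym (f refl)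
bool-iff {false} {true} _ g = g refl
bool-iff {false} {false} _ _ = refl

decB : ∀ b → b ≡ true ⊎ b ≡ false
decB true = inj₁ refl
decB false = inj₂ refl

falseI : ∀ {b} → ¬ (b ≡ true) → b ≡ false
falseI {true} h = ⊥-elim (h refl)
falseI {false} _ = refl

xor-el : ∀ {a b} → a xor b ≡ true → a ≡ true ⊎ b ≡ true
xor-el {true} _ = inj₁ refl
xor-el {false} p = inj₂ p

abstract
  eqF : ∀ {n} → Fin n → Fin n → Bool
  eqF i j = ⌊ i ≟ j ⌋

  eqF-refl : ∀ {n} (i : Fin n) → eqF i i ≡ true
  eqF-refl i with i ≟ i
  ... | yes _ = refl
  ... | no h = ⊥-elim (h refl)

  eqF-≢ : ∀ {n} {i j : Fin n} → i ≢ j → eqF i j ≡ false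
  eqF-≢ {i = i} {j} h with i ≟ j
  ... | yes e = ⊥-elim (h e)
  ... | no _ = refl

  eqF⇒ : ∀ {n} {i j : Fin n} → eqF i j ≡ true → i ≡ j
  eqF⇒ {i = i} {j} p with i ≟ j
  ... | yes e = e
  ... | no _ = contradiction p λ ()

eqF-sym : ∀ {n} (x y : Fin n) → eqF x y ≡ eqF y x
eqF-sym x y = bool-iff (λ p → trans (cong (eqF y) (eqF⇒ p)) (eqF-refl y)) (λ p → trans (cong (eqF x) (eqF⇒ p)) (eqF-refl x))

∧-swap : ∀ a b k → a ∧ (b ∧ k) ≡ b ∧ (a ∧ k)
∧-swap true b k = refl
∧-swap false b k = sym (∧-zeroʳ b)

∉⇒≢ : ∀ {n} (s : Sub n) i j → i ∈ s → j ∉ s → i ≢ j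
∉⇒≢ s i j i∈ j∉ refl = t≢f i∈ j∉

ext : ∀ {n} {s t : Sub n} → (∀ i → mem i s ≡ mem i t) → s ≡ t
ext {s = []} {[]} _ = refl
ext {s = a ∷ s} {b ∷ t} h = cong₂ _∷_ (h fzero) (ext (λ i → h (fsuc i)))

⊑-antisym : ∀ {n} {s t : Sub n} → s ⊑ t → t ⊑ s → s ≡ t
⊑-antisym h k = ext (λ i → bool-iff (h i) (k i))

mem-empty : ∀ {n} (i : Fin n) → i ∉ emptyS
mem-empty fzero = refl
mem-empty (fsuc i) = mem-empty i

mem-∪ : ∀ {n} (i : Fin n) s t → mem i (s ∪ˢ t) ≡ mem i s ∨ mem i t
mem-∪ fzero (a ∷ s) (b ∷ t) = refl
mem-∪ (fsuc i) (a ∷ s) (b ∷ t) = mem-∪ i s t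

mem-single-same : ∀ {n} (i : Fin n) → i ∈ single i
mem-single-same fzero = refl
mem-single-same (fsuc i) = mem-single-same i

mem-single-other : ∀ {n} (i j : Fin n) → i ≢ j → i ∉ single j
mem-single-other fzero fzero h = ⊥-elim (h refl)
mem-single-other fzero (fsuc j) h = refl
mem-single-other (fsuc i) fzero h = mem-empty i
mem-single-other (fsuc i) (fsuc j) h = mem-single-other i j (λ e → h (cong fsuc e))

single-∈ : ∀ {n} (i j : Fin n) → i ∈ single j → i ≡ j
single-∈ i j p with i ≟ j
... | yes e = e
... | no h = ⊥-elim (t≢f p (mem-single-other i j h))

_∩ˢ_ : ∀ {n} → Sub n → Sub n → Sub n
[] ∩ˢ [] = []
(a ∷ s) ∩ˢ (b ∷ t) = (a ∧ b) ∷ (s ∩ˢ t)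

mem-∩ : ∀ {n} (i : Fin n) s t → mem i (s ∩ˢ t) ≡ mem i s ∧ mem i t
mem-∩ fzero (a ∷ s) (b ∷ t) = refl
mem-∩ (fsuc i) (a ∷ s) (b ∷ t) = mem-∩ i s t

∩-in : ∀ {n} (i : Fin n) s t → i ∈ s → i ∈ t → i ∈ (s ∩ˢ t)
∩-in i s t p q = trans (mem-∩ i s t) (∧-in p q)

∩-el : ∀ {n} (i : Fin n) s t → i ∈ (s ∩ˢ t) → i ∈ s × i ∈ t
∩-el i s t p = ∧-el (trans (sym (mem-∩ i s t)) p)

∪-el : ∀ {n} (i : Fin n) s t → i ∈ (s ∪ˢ t) → i ∈ s ⊎ i ∈ t
∪-el i s t p = ∨-el (trans (sym (mem-∪ i s t)) p)

∪-inˡ : ∀ {n} (i : Fin n) s t → i ∈ s → i ∈ (s ∪ˢ t)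
∪-inˡ i s t p = trans (mem-∪ i s t) (∨-inˡ _ p)

∪-inʳ : ∀ {n} (i : Fin n) s t → i ∈ t → i ∈ (s ∪ˢ t)
∪-inʳ i s t p = trans (mem-∪ i s t) (∨-inʳ (mem i s) p)

tab : ∀ {n} → (Fin n → Bool) → Sub n
tab {zero} P = []
tab {suc n} P = P fzero ∷ tab (λ i → P (fsuc i))

mem-tab : ∀ {n} (P : Fin n → Bool) i → mem i (tab P) ≡ P i
mem-tab P fzero = refl
mem-tab P (fsuc i) = mem-tab (λ j → P (fsuc j)) i

ins : ∀ {n} → Fin n → Sub n → Sub n
ins x s = s ∪ˢ single x

del : ∀ {n} → Fin n → Sub n → Sub n
del fzero (b ∷ s) = false ∷ s
del (fsuc i) (b ∷ s) = b ∷ del i s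

mem-ins-same : ∀ {n} (x : Fin n) s → x ∈ ins x s
mem-ins-same x s = ∪-inʳ x s (single x) (mem-single-same x)

mem-ins-other : ∀ {n} (i x : Fin n) s → i ≢ x → mem i (ins x s) ≡ mem i s
mem-ins-other i x s h = trans (mem-∪ i s (single x)) (trans (cong (mem i s ∨_) (mem-single-other i x h)) (∨-identityʳ _))

ins-⊒ : ∀ {n} (x : Fin n) s → s ⊑ ins x s
ins-⊒ x s i = ∪-inˡ i s (single x)

ins-el : ∀ {n} (i : Fin n) x s → i ∈ ins x s → i ≡ x ⊎ i ∈ s
ins-el i x s p with ∪-el i s (single x) p
... | inj₁ q = inj₂ q
... | inj₂ q = inj₁ (single-∈ i x q)

ins-⊑ : ∀ {n} (x : Fin n) {s t} → s ⊑ t → x ∈ t → ins x s ⊑ t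
ins-⊑ x {s} h k i p with ins-el i x s p
... | inj₁ refl = k
... | inj₂ q = h i q

mem-del-same : ∀ {n} (x : Fin n) s → x ∉ del x s
mem-del-same fzero (b ∷ s) = refl
mem-del-same (fsuc x) (b ∷ s) = mem-del-same x s

mem-del-other : ∀ {n} (i x : Fin n) s → i ≢ x → mem i (del x s) ≡ mem i s
mem-del-other fzero fzero _ h = ⊥-elim (h refl)
mem-del-other fzero (fsuc x) (b ∷ s) h = refl
mem-del-other (fsuc i) fzero (b ∷ s) h = refl
mem-del-other (fsuc i) (fsuc x) (b ∷ s) h = mem-del-other i x s (λ e → h (cong fsuc e))

del-⊑ : ∀ {n} (x : Fin n) s → del x s ⊑ s
del-⊑ x s i p with i ≟ x
... | yes refl = ⊥-elim (t≢f p (mem-del-same i s))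
... | no h = trans (sym (mem-del-other i x s h)) p

del-∈ : ∀ {n} (i : Fin n) x s → i ∈ del x s → i ≢ x × i ∈ s
del-∈ i x s p = (λ { refl → t≢f p (mem-del-same x s) }) , del-⊑ x s i p

del-in : ∀ {n} (i : Fin n) x s → i ≢ x → i ∈ s → i ∈ del x s
del-in i x s h p = trans (mem-del-other i x s h) p

ins-∉ : ∀ {n} (i : Fin n) x s → i ≢ x → i ∉ s → i ∉ ins x s
ins-∉ i x s h p = trans (mem-ins-other i x s h) p

∉-ins : ∀ {n} (i : Fin n) x s → i ∉ ins x s → i ≢ x × i ∉ s
∉-ins i x s p = (λ { refl → t≢f (mem-ins-same x s) p }) , falseI (λ q → t≢f (ins-⊒ x s i q) p)

del-∉ : ∀ {n} (i : Fin n) x s → i ∉ s → i ∉ del x s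
del-∉ i x s h = falseI (λ q → t≢f (del-⊑ x s i q) h)

⊑-∉ : ∀ {n} {s t : Sub n} i → s ⊑ t → i ∉ t → i ∉ s
⊑-∉ i h k = falseI (λ q → t≢f (h i q) k)

mem-ins : ∀ {n} (i x : Fin n) s → mem i (ins x s) ≡ eqF i x ∨ mem i s
mem-ins i x s with i ≟ x
... | yes refl = trans (mem-ins-same i s) (sym (cong (_∨ mem i s) (eqF-refl i)))
... | no h = trans (mem-ins-other i x s h) (sym (cong (_∨ mem i s) (eqF-≢ h)))

ins-del : ∀ {n} (x : Fin n) s → x ∈ s → ins x (del x s) ≡ s
ins-del x s p = ext h
  where
  h : ∀ i → mem i (ins x (del x s)) ≡ mem i s
  h i with i ≟ x
  ... | yes refl = trans (mem-ins-same i (del i s)) (sym p)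
  ... | no e = trans (mem-ins-other i x _ e) (mem-del-other i x s e)

del-ins : ∀ {n} (x : Fin n) s → x ∉ s → del x (ins x s) ≡ s
del-ins x s p = ext h
  where
  h : ∀ i → mem i (del x (ins x s)) ≡ mem i s
  h i with i ≟ x
  ... | yes refl = trans (mem-del-same i (ins i s)) (sym p)
  ... | no e = trans (mem-del-other i x _ e) (mem-ins-other i x s e)

ins-comm : ∀ {n} (x y : Fin n) s → ins x (ins y s) ≡ ins y (ins x s)
ins-comm x y s = ext h
  where
  h : ∀ i → mem i (ins x (ins y s)) ≡ mem i (ins y (ins x s))
  h i rewrite mem-ins i x (ins y s) | mem-ins i y s | mem-ins i y (ins x s) | mem-ins i x s
    with eqF i x | eqF i y
  ... | true | true = refl
  ... | true | false = refl
  ... | false | true = refl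
  ... | false | false = refl

del-ins-other : ∀ {n} (x y : Fin n) s → x ≢ y → del x (ins y s) ≡ ins y (del x s)
del-ins-other x y s x≢y = ext h
  where
  h : ∀ i → mem i (del x (ins y s)) ≡ mem i (ins y (del x s))
  h i with i ≟ x
  ... | yes refl = trans (mem-del-same i (ins y s)) (sym (ins-∉ i y (del i s) x≢y (mem-del-same i s)))
  ... | no e with i ≟ y
  ...   | yes refl = trans (mem-del-other i x _ e) (trans (mem-ins-same i s) (sym (mem-ins-same i (del x s))))
  ...   | no e' = trans (mem-del-other i x _ e) (trans (mem-ins-other i y s e') (sym (trans (mem-ins-other i y _ e') (mem-del-other i x s e))))

∪-empty : ∀ {n} (s : Sub n) → s ∪ˢ emptyS ≡ s
∪-empty [] = refl
∪-empty (b ∷ s) = cong₂ _∷_ (∨-identityʳ b) (∪-empty s)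

∪-comm : ∀ {n} (s t : Sub n) → s ∪ˢ t ≡ t ∪ˢ s
∪-comm [] [] = refl
∪-comm (a ∷ s) (b ∷ t) = cong₂ _∷_ (∨-comm a b) (∪-comm s t)

∪-assoc : ∀ {n} (s t u : Sub n) → (s ∪ˢ t) ∪ˢ u ≡ s ∪ˢ (t ∪ˢ u)
∪-assoc [] [] [] = refl
∪-assoc (a ∷ s) (b ∷ t) (c ∷ u) = cong₂ _∷_ (∨-assoc a b c) (∪-assoc s t u)

card-empty : ∀ n → card (emptyS {n}) ≡ 0
card-empty zero = refl
card-empty (suc n) = card-empty n

card-single : ∀ {n} (i : Fin n) → card (single i) ≡ 1
card-single {suc n} fzero = cong suc (card-empty n)
card-single (fsuc i) = card-single i

card-0 : ∀ {n} (s : Sub n) → card s ≡ 0 → s ≡ emptyS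
card-0 [] _ = refl
card-0 (false ∷ s) p = cong (false ∷_) (card-0 s p)

card-ins : ∀ {n} (x : Fin n) s → x ∉ s → card (ins x s) ≡ suc (card s)
card-ins fzero (false ∷ s) refl = cong (suc ∘ card) (∪-empty s)
card-ins (fsuc x) (true ∷ s) p = cong suc (card-ins x s p)
card-ins (fsuc x) (false ∷ s) p = card-ins x s p

card-del : ∀ {n} (x : Fin n) s → x ∈ s → suc (card (del x s)) ≡ card s
card-del x s p = trans (sym (card-ins x (del x s) (mem-del-same x s))) (cong card (ins-del x s p))

card-mono : ∀ {n} {s t : Sub n} → s ⊑ t → card s ≤ card t
card-mono {s = []} {[]} h = z≤n
card-mono {s = true ∷ s} {true ∷ t} h = s≤s (card-mono (λ i → h (fsuc i)))
card-mono {s = true ∷ s} {false ∷ t} h = contradiction (h fzero refl) λ ()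
card-mono {s = false ∷ s} {true ∷ t} h = m≤n⇒m≤1+n (card-mono (λ i → h (fsuc i)))
card-mono {s = false ∷ s} {false ∷ t} h = card-mono (λ i → h (fsuc i))

card-eq : ∀ {n} {s t : Sub n} → s ⊑ t → card t ≤ card s → s ≡ t
card-eq {s = []} {[]} h le = refl
card-eq {s = true ∷ s} {true ∷ t} h (s≤s le) = cong (true ∷_) (card-eq (λ i → h (fsuc i)) le)
card-eq {s = true ∷ s} {false ∷ t} h le = contradiction (h fzero refl) λ ()
card-eq {s = false ∷ s} {true ∷ t} h le = ⊥-elim (<-irrefl refl (≤-trans le (card-mono (λ i → h (fsuc i)))))
card-eq {s = false ∷ s} {false ∷ t} h le = cong (false ∷_) (card-eq (λ i → h (fsuc i)) le)

card-bound : ∀ {n} (s : Sub n) → card s ≤ n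
card-bound [] = z≤n
card-bound (true ∷ s) = s≤s (card-bound s)
card-bound (false ∷ s) = m≤n⇒m≤1+n (card-bound s)

card-∪∩ : ∀ {n} (s t : Sub n) → card (s ∪ˢ t) + card (s ∩ˢ t) ≡ card s + card t
card-∪∩ [] [] = refl
card-∪∩ (true ∷ s) (true ∷ t) = cong suc (trans (+-suc _ _) (trans (cong suc (card-∪∩ s t)) (sym (+-suc _ _))))
card-∪∩ (true ∷ s) (false ∷ t) = cong suc (card-∪∩ s t)
card-∪∩ (false ∷ s) (true ∷ t) = trans (cong suc (card-∪∩ s t)) (sym (+-suc _ _))
card-∪∩ (false ∷ s) (false ∷ t) = card-∪∩ s t

extra : ∀ {n} (s t : Sub n) → card s < card t → Σ (Fin n) λ x → x ∈ t × x ∉ s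
extra (true ∷ s) (true ∷ t) (s≤s h) with extra s t h
... | x , p = fsuc x , p
extra (true ∷ s) (false ∷ t) h with extra s t (<-trans (n<1+n _) h)
... | x , p = fsuc x , p
extra (false ∷ s) (true ∷ t) h = fzero , refl , refl
extra (false ∷ s) (false ∷ t) h with extra s t h
... | x , p = fsuc x , p

inhabited : ∀ {n} (s : Sub n) → 1 ≤ card s → Σ (Fin n) (_∈ s)
inhabited {n} s h with extra emptyS s (subst (_< card s) (sym (card-empty n)) h)
... | x , p , _ = x , p

-- The recursion runs on the cardinality, because a bit vector is not built up by inserting
-- arbitrary elements.
sub-ind : ∀ {n ℓ} (P : Sub n → Set ℓ) → P emptyS → (∀ x s → x ∉ s → P s → P (ins x s)) → ∀ s → P s
sub-ind P p0 ps s = go (card s) s refl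
  where
  go : ∀ k s → card s ≡ k → P s
  go zero s e = subst P (sym (card-0 s e)) p0
  go (suc k) s e with inhabited s (subst (1 ≤_) (sym e) (s≤s z≤n))
  ... | x , x∈ = subst P (ins-del x s x∈)
    (ps x (del x s) (mem-del-same x s) (go k (del x s) (suc-injective (trans (card-del x s x∈) e))))

-- Injectivity is required on `s` only. When `x` is split off from `s`, the image `f x` is deleted
-- from `t`, and the remaining images stay inside.
card-inj : ∀ {m n} (f : Fin m → Fin n) (s : Sub m) (t : Sub n) → (∀ x → x ∈ s → f x ∈ t)
  → (∀ x y → x ∈ s → y ∈ s → f x ≡ f y → x ≡ y) → card s ≤ card t
card-inj {m} {n} f = sub-ind P (λ t _ _ → subst (_≤ card t) (sym (card-empty m)) z≤n) adjoin
  where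
  P : Sub m → Set
  P s = (t : Sub n) → (∀ x → x ∈ s → f x ∈ t) → (∀ x y → x ∈ s → y ∈ s → f x ≡ f y → x ≡ y) → card s ≤ card t
  adjoin : ∀ x s → x ∉ s → P s → P (ins x s)
  adjoin x s x∉ ih t maps inj =
    subst₂ _≤_ (sym (card-ins x s x∉)) (card-del (f x) t (maps x (mem-ins-same x s)))
      (s≤s (ih (del (f x) t)
        (λ y y∈ → del-in (f y) (f x) t (λ e → ∉⇒≢ s y x y∈ x∉ (inj y x (ins-⊒ x s y y∈) (mem-ins-same x s) e)) (maps y (ins-⊒ x s y y∈)))
        (λ y z y∈ z∈ → inj y z (ins-⊒ x s y y∈) (ins-⊒ x s z z∈))))

⊆ᵇ⇒ : ∀ {n} {s t : Sub n} → (s ⊆ᵇ t) ≡ true → s ⊑ t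
⊆ᵇ⇒ {s = true ∷ s} {true ∷ t} h fzero p = refl
⊆ᵇ⇒ {s = a ∷ s} {b ∷ t} h (fsuc i) p = ⊆ᵇ⇒ {s = s} {t} (proj₂ (∧-el {not a ∨ b} h)) i p

⇒⊆ᵇ : ∀ {n} {s t : Sub n} → s ⊑ t → (s ⊆ᵇ t) ≡ true
⇒⊆ᵇ {s = []} {[]} h = refl
⇒⊆ᵇ {s = true ∷ s} {b ∷ t} h rewrite h fzero refl = ⇒⊆ᵇ {s = s} {t} (λ i → h (fsuc i))
⇒⊆ᵇ {s = false ∷ s} {b ∷ t} h = ⇒⊆ᵇ {s = s} {t} (λ i → h (fsuc i))

==ᵇ⇒ : ∀ {n} {s t : Sub n} → (s ==ᵇ t) ≡ true → s ≡ t
==ᵇ⇒ {s = s} {t} h = ⊑-antisym (⊆ᵇ⇒ (proj₁ (∧-el {s ⊆ᵇ t} h))) (⊆ᵇ⇒ (proj₂ (∧-el {s ⊆ᵇ t} h)))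

==ᵇ-refl : ∀ {n} (s : Sub n) → (s ==ᵇ s) ≡ true
==ᵇ-refl s = ∧-in (⇒⊆ᵇ {s = s} {s} (λ _ p → p)) (⇒⊆ᵇ {s = s} {s} (λ _ p → p))

==ᵇ-≢ : ∀ {n} {s t : Sub n} → s ≢ t → (s ==ᵇ t) ≡ false
==ᵇ-≢ h = falseI (λ p → h (==ᵇ⇒ p))

disj⇒ : ∀ {n} {s t : Sub n} → disjointᵇ s t ≡ true → ∀ i → i ∈ s → i ∉ t
disj⇒ {s = true ∷ s} {false ∷ t} h fzero p = refl
disj⇒ {s = a ∷ s} {b ∷ t} h (fsuc i) p = disj⇒ {s = s} {t} (proj₂ (∧-el {not (a ∧ b)} h)) i p

⇒disj : ∀ {n} {s t : Sub n} → (∀ i → i ∈ s → i ∉ t) → disjointᵇ s t ≡ true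
⇒disj {s = []} {[]} h = refl
⇒disj {s = true ∷ s} {b ∷ t} h rewrite h fzero refl = ⇒disj {s = s} {t} (λ i → h (fsuc i))
⇒disj {s = false ∷ s} {b ∷ t} h = ⇒disj {s = s} {t} (λ i → h (fsuc i))

disj-single : ∀ {n} (x : Fin n) s → x ∉ s → disjointᵇ s (single x) ≡ true
disj-single x s h = ⇒disj (λ i p → mem-single-other i x (∉⇒≢ s i x p h))

single-disj : ∀ {n} (x : Fin n) s → disjointᵇ s (single x) ≡ true → x ∉ s
single-disj x s h = falseI (λ p → t≢f (mem-single-same x) (disj⇒ {s = s} h x p))

eqᵇ⇒ : ∀ {m n} → (m ≡ᵇ n) ≡ true → m ≡ n
eqᵇ⇒ {zero} {zero} _ = refl
eqᵇ⇒ {suc m} {suc n} p = cong suc (eqᵇ⇒ p)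

⇒eqᵇ : ∀ {m n} → m ≡ n → (m ≡ᵇ n) ≡ true
⇒eqᵇ {zero} refl = refl
⇒eqᵇ {suc m} refl = ⇒eqᵇ {m} refl

leᵇ⇒ : ∀ {m n} → (m ≤ᵇ n) ≡ true → m ≤ n
leᵇ⇒ {m} {n} p = ≤ᵇ⇒≤ m n (subst Data.Bool.T (sym p) _)
  where import Data.Bool

⇒leᵇ : ∀ {m n} → m ≤ n → (m ≤ᵇ n) ≡ true
⇒leᵇ {m} {n} p with m ≤ᵇ n | ≤⇒≤ᵇ p
... | true | _ = refl

searchF : ∀ {n} (P : Fin n → Bool) → (Σ (Fin n) λ x → P x ≡ true) ⊎ (∀ x → P x ≡ false)
searchF {zero} P = inj₂ (λ ())
searchF {suc n} P with decB (P fzero) | searchF (λ i → P (fsuc i))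
... | inj₁ p | _ = inj₁ (fzero , p)
... | inj₂ _ | inj₁ (i , p) = inj₁ (fsuc i , p)
... | inj₂ q | inj₂ h = inj₂ λ { fzero → q ; (fsuc i) → h i }

anyF : ∀ {n} → (Fin n → Bool) → Bool
anyF P with searchF P
... | inj₁ _ = true
... | inj₂ _ = false

anyF⇒ : ∀ {n} (P : Fin n → Bool) → anyF P ≡ true → Σ (Fin n) λ x → P x ≡ true
anyF⇒ P h with searchF P
... | inj₁ x = x
... | inj₂ _ = contradiction h λ ()

⇒anyF : ∀ {n} (P : Fin n → Bool) x → P x ≡ true → anyF P ≡ true
⇒anyF P x p with searchF P
... | inj₁ _ = refl
... | inj₂ h = ⊥-elim (t≢f p (h x))

searchS : ∀ {n} (P : Sub n → Bool) → (Σ (Sub n) λ s → P s ≡ true) ⊎ (∀ s → P s ≡ false)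
searchS {zero} P with decB (P [])
... | inj₁ p = inj₁ ([] , p)
... | inj₂ q = inj₂ λ { [] → q }
searchS {suc n} P with searchS (λ s → P (true ∷ s)) | searchS (λ s → P (false ∷ s))
... | inj₁ (s , p) | _ = inj₁ (true ∷ s , p)
... | inj₂ _ | inj₁ (s , p) = inj₁ (false ∷ s , p)
... | inj₂ h | inj₂ k = inj₂ λ { (true ∷ s) → h s ; (false ∷ s) → k s }

-- Connected components of induced subgraphs

record Graph (N : ℕ) : Set where
  field
    adj : Fin N → Fin N → Bool
    adj-sym : ∀ x y → adj x y ≡ true → adj y x ≡ true
open Graph

-- The equivalence relation generated by the edges inside `W`. With symmetry and transitivity as
-- constructors, an invariant has to be checked on edges only.
data Conn {N} (G : Graph N) (W : Sub N) : Fin N → Fin N → Set where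
  crefl : ∀ {x} → x ∈ W → Conn G W x x
  cedge : ∀ {x y} → x ∈ W → y ∈ W → adj G x y ≡ true → Conn G W x y
  csym : ∀ {x y} → Conn G W x y → Conn G W y x
  ctrans : ∀ {x y z} → Conn G W x y → Conn G W y z → Conn G W x z

conn-∈ : ∀ {N} {G : Graph N} {W x y} → Conn G W x y → x ∈ W × y ∈ W
conn-∈ (crefl p) = p , p
conn-∈ (cedge p q _) = p , q
conn-∈ (csym c) = let p , q = conn-∈ c in q , p
conn-∈ (ctrans c d) = proj₁ (conn-∈ c) , proj₂ (conn-∈ d)

conn-inv : ∀ {N a} {A : Set a} {G : Graph N} {W} (f : Fin N → A)
  → (∀ x y → x ∈ W → y ∈ W → adj G x y ≡ true → f x ≡ f y) → ∀ {x y} → Conn G W x y → f x ≡ f y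
conn-inv f h (crefl _) = refl
conn-inv f h (cedge p q e) = h _ _ p q e
conn-inv f h (csym c) = sym (conn-inv f h c)
conn-inv f h (ctrans c d) = trans (conn-inv f h c) (conn-inv f h d)

conn-map : ∀ {N} {G G' : Graph N} {W W'} → W ⊑ W'
  → (∀ x y → x ∈ W → y ∈ W → adj G x y ≡ true → Conn G' W' x y) → ∀ {x y} → Conn G W x y → Conn G' W' x y
conn-map i h (crefl {x} p) = crefl (i x p)
conn-map i h (cedge p q e) = h _ _ p q e
conn-map i h (csym c) = csym (conn-map i h c)
conn-map i h (ctrans c d) = ctrans (conn-map i h c) (conn-map i h d)

conn-mono : ∀ {N} {G : Graph N} {W W'} → W ⊑ W' → ∀ {x y} → Conn G W x y → Conn G W' x y
conn-mono i = conn-map i (λ x y p q e → cedge (i x p) (i y q) e)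

-- A labelling of the components by vertices of their own: `joined` prevents two components from
-- sharing a label, `flat` prevents one component from having two. The components are counted by the
-- fixed points of `rep`.
record Comp {N} (G : Graph N) (W : Sub N) : Set where
  field
    rep : Fin N → Fin N
    joined : ∀ x → x ∈ W → Conn G W x (rep x)
    flat : ∀ x y → x ∈ W → y ∈ W → adj G x y ≡ true → rep x ≡ rep y

  roots : Sub N
  roots = tab (λ x → mem x W ∧ eqF (rep x) x)

  rep-conn : ∀ {x y} → Conn G W x y → rep x ≡ rep y
  rep-conn = conn-inv rep flat

  roots-el : ∀ x → x ∈ roots → x ∈ W × rep x ≡ x
  roots-el x p = let q , r = ∧-el (trans (sym (mem-tab (λ x → mem x W ∧ eqF (rep x) x) x)) p) in q , eqF⇒ r

  roots-in : ∀ x → x ∈ W → rep x ≡ x → x ∈ roots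
  roots-in x p q = trans (mem-tab (λ x → mem x W ∧ eqF (rep x) x) x) (∧-in p (trans (cong (λ z → eqF z x) q) (eqF-refl x)))

  rep-root : ∀ x → x ∈ W → rep x ∈ roots
  rep-root x p = roots-in (rep x) (proj₂ (conn-∈ (joined x p))) (sym (rep-conn (joined x p)))
open Comp

-- Distinct roots have distinct images: if `f x` and `f y` coincide, then `x` and `y` are connected
-- and carry the same label.
roots-dom : ∀ {N} {G : Graph N} {W} (Co : Comp G W) (X : Sub N) (f : Fin N → Fin N)
  → (∀ x → x ∈ W → f x ∈ X × Conn G W x (f x)) → card (roots Co) ≤ card X
roots-dom {G = G} {W} Co X f h = card-inj f (roots Co) X (λ x p → proj₁ (h x (proj₁ (roots-el Co x p)))) inj
  where
  inj : ∀ x y → x ∈ roots Co → y ∈ roots Co → f x ≡ f y → x ≡ y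
  inj x y p q e =
    let x∈ , rx = roots-el Co x p
        y∈ , ry = roots-el Co y q
    in trans (sym rx) (trans (rep-conn Co (proj₂ (h x x∈)))
         (trans (cong (rep Co) e) (trans (sym (rep-conn Co (proj₂ (h y y∈)))) ry)))

roots-mono : ∀ {N} {G G' : Graph N} {W} (Co : Comp G W) (Co' : Comp G' W)
  → (∀ x y → x ∈ W → y ∈ W → adj G x y ≡ true → adj G' x y ≡ true) → card (roots Co') ≤ card (roots Co)
roots-mono Co Co' h = roots-dom Co' (roots Co) (rep Co) (λ x p → rep-root Co x p ,
  conn-map (λ _ q → q) (λ x y p q e → cedge p q (h x y p q e)) (joined Co x p))

filt : ∀ {n} → Sub n → (Fin n → Bool) → Sub n
filt s P = tab (λ x → mem x s ∧ P x)

filt-el : ∀ {n} x (s : Sub n) P → x ∈ filt s P → x ∈ s × P x ≡ true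
filt-el x s P p = ∧-el (trans (sym (mem-tab (λ x → mem x s ∧ P x) x)) p)

filt-in : ∀ {n} x (s : Sub n) P → x ∈ s → P x ≡ true → x ∈ filt s P
filt-in x s P p q = trans (mem-tab (λ x → mem x s ∧ P x) x) (∧-in p q)

card-filt : ∀ {n} (s : Sub n) P → card (filt s P) + card (filt s (not ∘ P)) ≡ card s
card-filt [] P = refl
card-filt (false ∷ s) P = card-filt s (P ∘ fsuc)
card-filt (true ∷ s) P with P fzero
... | true = cong suc (card-filt s (P ∘ fsuc))
... | false = trans (+-suc _ _) (cong suc (card-filt s (P ∘ fsuc)))

module _ {N} {G : Graph N} {W : Sub N} (Co : Comp G W) (u : Fin N) where

  touched : Fin N → Bool
  touched ℓ = anyF (λ y → mem y W ∧ (adj G u y ∧ eqF (rep Co y) ℓ))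

  touched-el : ∀ ℓ → touched ℓ ≡ true → Σ (Fin N) λ y → y ∈ W × adj G u y ≡ true × rep Co y ≡ ℓ
  touched-el ℓ p with anyF⇒ (λ y → mem y W ∧ (adj G u y ∧ eqF (rep Co y) ℓ)) p
  ... | y , q = let a , b = ∧-el q ; c , d = ∧-el {adj G u y} b in y , a , c , eqF⇒ d

  touched-in : ∀ y → y ∈ W → adj G u y ≡ true → touched (rep Co y) ≡ true
  touched-in y p q = ⇒anyF _ y (∧-in p (∧-in q (eqF-refl (rep Co y))))

  -- The labels of those components of `W` that contain a neighbour of `u`; adding `u` fuses exactly
  -- these.
  touch : Sub N
  touch = filt (roots Co) touched

  touch-in : ∀ y → y ∈ W → adj G u y ≡ true → rep Co y ∈ touch
  touch-in y p q = filt-in (rep Co y) (roots Co) touched (rep-root Co y p) (touched-in y p q)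

  module _ (u∉ : u ∉ W) where

    rep⁺ : Fin N → Fin N
    rep⁺ x = if eqF x u then u else if touched (rep Co x) then u else rep Co x

    rep⁺-u : rep⁺ u ≡ u
    rep⁺-u rewrite eqF-refl u = refl

    rep⁺-t : ∀ x → x ≢ u → touched (rep Co x) ≡ true → rep⁺ x ≡ u
    rep⁺-t x h t rewrite eqF-≢ h | t = refl

    rep⁺-f : ∀ x → x ≢ u → touched (rep Co x) ≡ false → rep⁺ x ≡ rep Co x
    rep⁺-f x h t rewrite eqF-≢ h | t = refl

    W⁺ : Sub N
    W⁺ = ins u W

    extend : Comp G W⁺
    extend = record { rep = rep⁺ ; joined = joined⁺ ; flat = flat⁺ }
      where
      lift : ∀ {x y} → Conn G W x y → Conn G W⁺ x y
      lift = conn-mono (ins-⊒ u W)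
      old : ∀ x → x ∈ W → Conn G W⁺ x (rep⁺ x)
      old x p with decB (touched (rep Co x))
      ... | inj₂ t = subst (Conn G W⁺ x) (sym (rep⁺-f x (∉⇒≢ W x u p u∉) t)) (lift (joined Co x p))
      ... | inj₁ t with touched-el (rep Co x) t
      ...   | y , y∈ , e , r = subst (Conn G W⁺ x) (sym (rep⁺-t x (∉⇒≢ W x u p u∉) t))
        (ctrans (lift (joined Co x p)) (ctrans (csym (subst (Conn G W⁺ y) r (lift (joined Co y y∈))))
          (csym (cedge (mem-ins-same u W) (ins-⊒ u W y y∈) e))))
      joined⁺ : ∀ x → x ∈ W⁺ → Conn G W⁺ x (rep⁺ x)
      joined⁺ x p with ins-el x u W p
      ... | inj₁ refl = subst (Conn G W⁺ x) (sym rep⁺-u) (crefl p)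
      ... | inj₂ q = old x q
      flat⁺ : ∀ x y → x ∈ W⁺ → y ∈ W⁺ → adj G x y ≡ true → rep⁺ x ≡ rep⁺ y
      flat⁺ x y p q e with ins-el x u W p | ins-el y u W q
      ... | inj₁ refl | inj₁ refl = refl
      ... | inj₁ refl | inj₂ y∈ = trans rep⁺-u (sym (rep⁺-t y (∉⇒≢ W y u y∈ u∉) (touched-in y y∈ e)))
      ... | inj₂ x∈ | inj₁ refl = trans (rep⁺-t x (∉⇒≢ W x u x∈ u∉) (touched-in x x∈ (adj-sym G x y e))) (sym rep⁺-u)
      ... | inj₂ x∈ | inj₂ y∈ with decB (touched (rep Co x))
      ...   | inj₁ t = trans (rep⁺-t x (∉⇒≢ W x u x∈ u∉) t)
          (sym (rep⁺-t y (∉⇒≢ W y u y∈ u∉) (trans (cong touched (sym (flat Co x y x∈ y∈ e))) t)))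
      ...   | inj₂ t = trans (rep⁺-f x (∉⇒≢ W x u x∈ u∉) t) (trans (flat Co x y x∈ y∈ e)
          (sym (rep⁺-f y (∉⇒≢ W y u y∈ u∉) (trans (cong touched (sym (flat Co x y x∈ y∈ e))) t))))

    roots-extend : roots extend ≡ ins u (filt (roots Co) (not ∘ touched))
    roots-extend = ⊑-antisym to from
      where
      to : roots extend ⊑ ins u (filt (roots Co) (not ∘ touched))
      to x p with roots-el extend x p
      ... | x∈ , r with ins-el x u W x∈
      ...   | inj₁ refl = mem-ins-same u _
      ...   | inj₂ q with decB (touched (rep Co x))
      ...     | inj₁ t = ⊥-elim (∉⇒≢ W x u q u∉ (trans (sym r) (rep⁺-t x (∉⇒≢ W x u q u∉) t)))
      ...     | inj₂ t = let rx = trans (sym (rep⁺-f x (∉⇒≢ W x u q u∉) t)) r in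
        ins-⊒ u _ x (filt-in x (roots Co) (not ∘ touched) (roots-in Co x q rx) (not-in (trans (cong touched (sym rx)) t)))
      from : ins u (filt (roots Co) (not ∘ touched)) ⊑ roots extend
      from x p with ins-el x u _ p
      ... | inj₁ refl = roots-in extend u (mem-ins-same u W) rep⁺-u
      ... | inj₂ q with filt-el x (roots Co) (not ∘ touched) q
      ...   | r , t with roots-el Co x r
      ...     | x∈ , rx = roots-in extend x (ins-⊒ u W x x∈)
        (trans (rep⁺-f x (∉⇒≢ W x u x∈ u∉) (trans (cong touched rx) (not-el t))) rx)

    -- The vertex `u` brings one component and swallows every touched one. Both sides are sums, so
    -- that no truncated subtraction occurs.
    card-roots-extend : card (roots extend) + card touch ≡ suc (card (roots Co))
    card-roots-extend = begin
      card (roots extend) + card touch                        ≡⟨ cong (λ s → card s + card touch) roots-extend ⟩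
      card (ins u (filt (roots Co) (not ∘ touched))) + card touch ≡⟨ cong (_+ card touch) (card-ins u _ u∉R) ⟩
      suc (card (filt (roots Co) (not ∘ touched)) + card touch) ≡⟨ cong suc (+-comm _ (card touch)) ⟩
      suc (card touch + card (filt (roots Co) (not ∘ touched))) ≡⟨ cong suc (card-filt (roots Co) touched) ⟩
      suc (card (roots Co)) ∎
      where
      open ≡-Reasoning
      u∉R : u ∉ filt (roots Co) (not ∘ touched)
      u∉R = falseI (λ q → t≢f (proj₁ (roots-el Co u (proj₁ (filt-el u (roots Co) (not ∘ touched) q)))) u∉)

abstract
  comp : ∀ {N} (G : Graph N) W → Comp G W
  comp {N} G = sub-ind (Comp G)
    (record { rep = id ; joined = λ x p → ⊥-elim (t≢f p (mem-empty x)) ; flat = λ x _ p → ⊥-elim (t≢f p (mem-empty x)) })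
    (λ u W u∉ Co → extend Co u u∉)

  c : ∀ {N} → Graph N → Sub N → ℕ
  c G W = card (roots (comp G W))

  -- Two labellings bound each other, so the count does not depend on the choice; later proofs may
  -- use whichever labelling is convenient.
  c-roots : ∀ {N} {G : Graph N} {W} (Co : Comp G W) → c G W ≡ card (roots Co)
  c-roots {G = G} {W} Co = ≤-antisym (roots-mono Co (comp G W) (λ _ _ _ _ e → e)) (roots-mono (comp G W) Co (λ _ _ _ _ e → e))

c-mono : ∀ {N} {G G' : Graph N} {W} → (∀ x y → x ∈ W → y ∈ W → adj G x y ≡ true → adj G' x y ≡ true) → c G' W ≤ c G W
c-mono {G = G} {G'} {W} h = subst₂ _≤_ (sym (c-roots (comp G' W))) (sym (c-roots (comp G W))) (roots-mono (comp G W) (comp G' W) h)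

c-dom : ∀ {N} {G : Graph N} {W} (X : Sub N) (f : Fin N → Fin N)
  → (∀ x → x ∈ W → f x ∈ X × Conn G W x (f x)) → c G W ≤ card X
c-dom {G = G} {W} X f h = subst (_≤ card X) (sym (c-roots (comp G W))) (roots-dom (comp G W) X f h)

c-add : ∀ {N} {G : Graph N} {W} (Co : Comp G W) u → u ∉ W → c G (ins u W) + card (touch Co u) ≡ suc (c G W)
c-add Co u u∉ = trans (cong (_+ card (touch Co u)) (c-roots (extend Co u u∉)))
  (trans (card-roots-extend Co u u∉) (cong suc (sym (c-roots Co))))

c-pos : ∀ {N} (G : Graph N) W x → x ∈ W → 1 ≤ c G W
c-pos G W x p = subst (1 ≤_) (sym (c-roots (comp G W)))
  (subst (_≤ card (roots (comp G W))) (card-single (rep (comp G W) x))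
    (card-mono (λ i q → subst (_∈ roots (comp G W)) (sym (single-∈ i _ q)) (rep-root (comp G W) x p))))

c-add-≤suc : ∀ {N} (G : Graph N) W u → u ∉ W → c G (ins u W) ≤ suc (c G W)
c-add-≤suc G W u u∉ = subst (c G (ins u W) ≤_) (c-add (comp G W) u u∉) (m≤m+n _ _)

1≤card : ∀ {N} (s : Sub N) x → x ∈ s → 1 ≤ card s
1≤card s x p = subst (_≤ card s) (card-single x) (card-mono (λ i q → subst (_∈ s) (sym (single-∈ i x q)) p))

2≤card : ∀ {N} (s : Sub N) x y → x ∈ s → y ∈ s → x ≢ y → 2 ≤ card s
2≤card s x y p q h = subst (2 ≤_) (card-del x s p) (s≤s (1≤card (del x s) y (del-in y x s (λ e → h (sym e)) q)))

c-add-≤ : ∀ {N} (G : Graph N) W u y → u ∉ W → y ∈ W → adj G u y ≡ true → c G (ins u W) ≤ c G W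
c-add-≤ G W u y u∉ y∈ e = +-cancelʳ-≤ 1 _ _ (≤-trans (+-monoʳ-≤ (c G (ins u W)) (1≤card (touch (comp G W) u) (rep (comp G W) y) (touch-in (comp G W) u y y∈ e)))
  (≤-reflexive (trans (c-add (comp G W) u u∉) (+-comm 1 _))))

c-add-< : ∀ {N} (G : Graph N) W u y z → u ∉ W → y ∈ W → z ∈ W → adj G u y ≡ true → adj G u z ≡ true
  → ¬ Conn G W y z → c G (ins u W) < c G W
c-add-< G W u y z u∉ y∈ z∈ e f h = +-cancelʳ-≤ 1 _ _ (≤-trans (≤-reflexive (sym (+-suc (c G (ins u W)) 1)))
  (≤-trans (+-monoʳ-≤ (c G (ins u W)) (2≤card (touch Co u) (rep Co y) (rep Co z) (touch-in Co u y y∈ e) (touch-in Co u z z∈ f) ne))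
  (≤-reflexive (trans (c-add Co u u∉) (+-comm 1 _)))))
  where
  Co : Comp G W
  Co = comp G W
  ne : rep Co y ≢ rep Co z
  ne r = h (ctrans (joined Co y y∈) (subst (λ w → Conn G W w z) (sym r) (csym (joined Co z z∈))))

-- Edge contraction on a fixed vertex set: `v` becomes isolated and `u` inherits its neighbours. An
-- edge `uv` leaves a loop at `u`, which has no effect on connectivity.
contract : ∀ {N} → Graph N → Fin N → Fin N → Graph N
contract {N} G u v = record { adj = a ; adj-sym = s }
  where
  a : Fin N → Fin N → Bool
  a x y = not (eqF x v) ∧ (not (eqF y v) ∧ (adj G x y ∨ ((eqF x u ∧ adj G v y) ∨ (eqF y u ∧ adj G x v))))
  s : ∀ x y → a x y ≡ true → a y x ≡ true
  s x y p with ∧-el {not (eqF x v)} p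
  ... | p1 , p2 with ∧-el {not (eqF y v)} p2
  ... | p3 , p4 with ∨-el {adj G x y} p4
  ... | inj₁ e = ∧-in p3 (∧-in p1 (∨-inˡ _ (adj-sym G x y e)))
  ... | inj₂ p5 with ∨-el {eqF x u ∧ adj G v y} p5
  ... | inj₁ q = let q1 , q2 = ∧-el q in ∧-in p3 (∧-in p1 (∨-inʳ (adj G y x) (∨-inʳ (eqF y u ∧ adj G v x) (∧-in q1 (adj-sym G v y q2)))))
  ... | inj₂ q = let q1 , q2 = ∧-el q in ∧-in p3 (∧-in p1 (∨-inʳ (adj G y x) (∨-inˡ _ (∧-in q1 (adj-sym G x v q2)))))

module _ {N} (G : Graph N) (u v : Fin N) where

  contract-old : ∀ x y → x ≢ v → y ≢ v → adj G x y ≡ true → adj (contract G u v) x y ≡ true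
  contract-old x y h k e = ∧-in (not-in (eqF-≢ h)) (∧-in (not-in (eqF-≢ k)) (∨-inˡ _ e))

  contract-new : ∀ y → u ≢ v → y ≢ v → adj G v y ≡ true → adj (contract G u v) u y ≡ true
  contract-new y h k e = ∧-in (not-in (eqF-≢ h)) (∧-in (not-in (eqF-≢ k)) (∨-inʳ (adj G u y) (∨-inˡ _ (∧-in (eqF-refl u) e))))

  contract-el : ∀ x y → adj (contract G u v) x y ≡ true → x ≢ v × y ≢ v
    × (adj G x y ≡ true ⊎ (x ≡ u × adj G v y ≡ true) ⊎ (y ≡ u × adj G x v ≡ true))
  contract-el x y p with ∧-el {not (eqF x v)} p
  ... | p1 , p2 with ∧-el {not (eqF y v)} p2
  ... | p3 , p4 = (λ e → t≢f (trans (cong (λ z → eqF z v) e) (eqF-refl v)) (not-el p1)) ,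
    (λ e → t≢f (trans (cong (λ z → eqF z v) e) (eqF-refl v)) (not-el p3)) , third
    where
    third : adj G x y ≡ true ⊎ (x ≡ u × adj G v y ≡ true) ⊎ (y ≡ u × adj G x v ≡ true)
    third with ∨-el {adj G x y} p4
    ... | inj₁ e = inj₁ e
    ... | inj₂ p5 with ∨-el {eqF x u ∧ adj G v y} p5
    ... | inj₁ q = let q1 , q2 = ∧-el q in inj₂ (inj₁ (eqF⇒ q1 , q2))
    ... | inj₂ q = let q1 , q2 = ∧-el q in inj₂ (inj₂ (eqF⇒ q1 , q2))

  module _ (u≢v : u ≢ v) where

    contract-u : ∀ y → y ≢ u → y ≢ v → adj (contract G u v) u y ≡ true → adj G u y ≡ true ⊎ adj G v y ≡ true
    contract-u y h k p with proj₂ (proj₂ (contract-el u y p))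
    ... | inj₁ e = inj₁ e
    ... | inj₂ (inj₁ (_ , e)) = inj₂ e
    ... | inj₂ (inj₂ (e , _)) = ⊥-elim (h e)

    module _ (W : Sub N) (u∉ : u ∉ W) (v∉ : v ∉ W) where

      private
        Co : Comp G W
        Co = comp G W
        -- Away from `u` and `v` the two graphs agree, so one labelling serves both.
        Co' : Comp (contract G u v) W
        Co' = record { rep = rep Co
          ; joined = λ x p → conn-map (λ _ q → q) (λ x y p q e → cedge p q (contract-old x y (∉⇒≢ W x v p v∉) (∉⇒≢ W y v q v∉) e)) (joined Co x p)
          ; flat = λ x y p q e → flat Co x y p q (back x y p q e) }
          where
          back : ∀ x y → x ∈ W → y ∈ W → adj (contract G u v) x y ≡ true → adj G x y ≡ true
          back x y p q e with proj₂ (proj₂ (contract-el x y e))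
          ... | inj₁ r = r
          ... | inj₂ (inj₁ (r , _)) = ⊥-elim (∉⇒≢ W x u p u∉ r)
          ... | inj₂ (inj₂ (r , _)) = ⊥-elim (∉⇒≢ W y u q u∉ r)

      touch-contract : touch Co' u ≡ touch Co u ∪ˢ touch Co v
      touch-contract = ⊑-antisym to from
        where
        to : touch Co' u ⊑ (touch Co u ∪ˢ touch Co v)
        to ℓ p with filt-el ℓ (roots Co') (touched Co' u) p
        ... | r , t with touched-el Co' u ℓ t
        ...   | y , y∈ , e , refl with contract-u y (∉⇒≢ W y u y∈ u∉) (∉⇒≢ W y v y∈ v∉) e
        ...     | inj₁ e' = ∪-inˡ ℓ (touch Co u) (touch Co v) (touch-in Co u y y∈ e')
        ...     | inj₂ e' = ∪-inʳ ℓ (touch Co u) (touch Co v) (touch-in Co v y y∈ e')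
        from : (touch Co u ∪ˢ touch Co v) ⊑ touch Co' u
        from ℓ p with ∪-el ℓ (touch Co u) (touch Co v) p
        ... | inj₁ q with filt-el ℓ (roots Co) (touched Co u) q
        ...   | r , t with touched-el Co u ℓ t
        ...     | y , y∈ , e , refl = touch-in Co' u y y∈ (contract-old u y u≢v (∉⇒≢ W y v y∈ v∉) e)
        from ℓ p | inj₂ q with filt-el ℓ (roots Co) (touched Co v) q
        ...   | r , t with touched-el Co v ℓ t
        ...     | y , y∈ , e , refl = touch-in Co' u y y∈ (contract-new y u≢v (∉⇒≢ W y v y∈ v∉) e)

      shared : ℕ
      shared = card (touch Co u ∩ˢ touch Co v)

      -- Modularity of the rank of graphs: |A| + |B| = |A ∪ B| + |A ∩ B| for the sets A, B of components
      -- of G[W] that are met by the neighbourhoods of u and of v.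
      split-eq : (c G (ins u W) + c G (ins v W)) + shared ≡ suc (c G W + c (contract G u v) (ins u W))
      split-eq = +-cancelʳ-≡ (card (touch Co u ∪ˢ touch Co v)) _ _ (begin
        ((cu + cv) + shared) + card (touch Co u ∪ˢ touch Co v) ≡⟨ +-assoc (cu + cv) shared _ ⟩
        (cu + cv) + (shared + card (touch Co u ∪ˢ touch Co v)) ≡⟨ cong ((cu + cv) +_) (trans (+-comm shared _) (card-∪∩ (touch Co u) (touch Co v))) ⟩
        (cu + cv) + (card (touch Co u) + card (touch Co v)) ≡⟨ interchange cu cv _ _ ⟩
        (cu + card (touch Co u)) + (cv + card (touch Co v)) ≡⟨ cong₂ _+_ (c-add Co u u∉) (c-add Co v v∉) ⟩
        suc (c G W) + suc (c G W) ≡⟨ +-suc (suc (c G W)) _ ⟩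
        suc (suc (c G W + c G W)) ≡⟨ cong suc (sym (+-suc _ _)) ⟩
        suc (c G W + suc (c G W)) ≡⟨ cong (λ z → suc (c G W + suc z)) (trans (c-roots Co) (sym (c-roots Co'))) ⟩
        suc (c G W + suc (c (contract G u v) W)) ≡⟨ cong (λ z → suc (c G W + z)) (sym (c-add Co' u u∉)) ⟩
        suc (c G W + (c (contract G u v) (ins u W) + card (touch Co' u))) ≡⟨ cong suc (sym (+-assoc (c G W) _ _)) ⟩
        suc (c G W + c (contract G u v) (ins u W)) + card (touch Co' u) ≡⟨ cong (λ z → suc (c G W + c (contract G u v) (ins u W)) + card z) touch-contract ⟩
        suc (c G W + c (contract G u v) (ins u W)) + card (touch Co u ∪ˢ touch Co v) ∎)
        where
        open ≡-Reasoning
        cu cv : ℕ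
        cu = c G (ins u W)
        cv = c G (ins v W)
        interchange : ∀ a b x y → (a + b) + (x + y) ≡ (a + x) + (b + y)
        interchange = solve 4 (λ a b x y → (a :+ b) :+ (x :+ y) := (a :+ x) :+ (b :+ y)) refl
          where open +-*-Solver

      shared-pos : ∀ y z → y ∈ W → z ∈ W → adj G u y ≡ true → adj G v z ≡ true → Conn G W y z → 1 ≤ shared
      shared-pos y z y∈ z∈ e f cn = 1≤card (touch Co u ∩ˢ touch Co v) (rep Co y)
        (∩-in (rep Co y) (touch Co u) (touch Co v) (touch-in Co u y y∈ e)
          (subst (_∈ touch Co v) (sym (rep-conn Co cn)) (touch-in Co v z z∈ f)))

    -- Contracting an edge with both ends present does not change the number of components. Sending
    -- `v` to the label of `u` gives the direction that is used.
    c-merge : ∀ W → u ∈ W → v ∉ W → adj G u v ≡ true → c G (ins v W) ≤ c (contract G u v) W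
    c-merge W u∈ v∉ uv = subst (c G (ins v W) ≤_) (sym (c-roots Co)) (c-dom (roots Co) f h)
      where
      Co : Comp (contract G u v) W
      Co = comp (contract G u v) W
      f : Fin N → Fin N
      f x = if eqF x v then rep Co u else rep Co x
      u-v : Conn G (ins v W) u v
      u-v = cedge (ins-⊒ v W u u∈) (mem-ins-same v W) uv
      edge : ∀ x y → x ∈ W → y ∈ W → adj (contract G u v) x y ≡ true → Conn G (ins v W) x y
      edge x y p q e with proj₂ (proj₂ (contract-el x y e))
      ... | inj₁ r = cedge (ins-⊒ v W x p) (ins-⊒ v W y q) r
      ... | inj₂ (inj₁ (refl , r)) = ctrans u-v (cedge (mem-ins-same v W) (ins-⊒ v W y q) r)
      ... | inj₂ (inj₂ (refl , r)) = ctrans (cedge (ins-⊒ v W x p) (mem-ins-same v W) r) (csym u-v)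
      lift : ∀ {x y} → Conn (contract G u v) W x y → Conn G (ins v W) x y
      lift = conn-map (ins-⊒ v W) edge
      f-v : f v ≡ rep Co u
      f-v rewrite eqF-refl v = refl
      f-o : ∀ x → x ≢ v → f x ≡ rep Co x
      f-o x k rewrite eqF-≢ k = refl
      h : ∀ x → x ∈ ins v W → f x ∈ roots Co × Conn G (ins v W) x (f x)
      h x p with ins-el x v W p
      ... | inj₁ refl = subst (λ z → z ∈ roots Co × Conn G (ins v W) v z) (sym f-v)
          (rep-root Co u u∈ , ctrans (csym u-v) (lift (joined Co u u∈)))
      ... | inj₂ q = subst (λ z → z ∈ roots Co × Conn G (ins v W) x z) (sym (f-o x (∉⇒≢ W x v q v∉)))
          (rep-root Co x q , lift (joined Co x q))

-- Weighted sums over subsets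

ΣS : ∀ {n} → (Sub n → ℕ) → ℕ
ΣS {zero} f = f []
ΣS {suc n} f = ΣS (λ s → f (true ∷ s)) + ΣS (λ s → f (false ∷ s))

ΣS-cong : ∀ {n} {f g : Sub n → ℕ} → (∀ s → f s ≡ g s) → ΣS f ≡ ΣS g
ΣS-cong {zero} h = h []
ΣS-cong {suc n} h = cong₂ _+_ (ΣS-cong (λ s → h (true ∷ s))) (ΣS-cong (λ s → h (false ∷ s)))

ΣS-mono : ∀ {n} {f g : Sub n → ℕ} → (∀ s → f s ≤ g s) → ΣS f ≤ ΣS g
ΣS-mono {zero} h = h []
ΣS-mono {suc n} h = +-mono-≤ (ΣS-mono (λ s → h (true ∷ s))) (ΣS-mono (λ s → h (false ∷ s)))

ΣS-mono-< : ∀ {n} {f g : Sub n → ℕ} → (∀ s → f s ≤ g s) → ∀ s → f s < g s → ΣS f < ΣS g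
ΣS-mono-< h [] p = p
ΣS-mono-< h (true ∷ s) p = +-mono-<-≤ (ΣS-mono-< (λ s → h (true ∷ s)) s p) (ΣS-mono (λ s → h (false ∷ s)))
ΣS-mono-< h (false ∷ s) p = +-mono-≤-< (ΣS-mono (λ s → h (true ∷ s))) (ΣS-mono-< (λ s → h (false ∷ s)) s p)

+-interchange : ∀ a b x y → (a + b) + (x + y) ≡ (a + x) + (b + y)
+-interchange = solve 4 (λ a b x y → (a :+ b) :+ (x :+ y) := (a :+ x) :+ (b :+ y)) refl
  where open +-*-Solver

ΣS-+ : ∀ {n} (f g : Sub n → ℕ) → ΣS (λ s → f s + g s) ≡ ΣS f + ΣS g
ΣS-+ {zero} f g = refl
ΣS-+ {suc n} f g = trans (cong₂ _+_ (ΣS-+ (λ s → f (true ∷ s)) (λ s → g (true ∷ s))) (ΣS-+ (λ s → f (false ∷ s)) (λ s → g (false ∷ s))))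
  (+-interchange (ΣS (λ s → f (true ∷ s))) _ _ _)

ΣS-* : ∀ {n} k (f : Sub n → ℕ) → ΣS (λ s → k * f s) ≡ k * ΣS f
ΣS-* {zero} k f = refl
ΣS-* {suc n} k f = trans (cong₂ _+_ (ΣS-* k (λ s → f (true ∷ s))) (ΣS-* k (λ s → f (false ∷ s)))) (sym (*-distribˡ-+ k _ _))

ΣS-0 : ∀ {n} {f : Sub n → ℕ} → (∀ s → f s ≡ 0) → ΣS f ≡ 0
ΣS-0 {zero} h = h []
ΣS-0 {suc n} h = cong₂ _+_ (ΣS-0 (λ s → h (true ∷ s))) (ΣS-0 (λ s → h (false ∷ s)))

ΣS-pair : ∀ {n} (F : Sub n → ℕ) i → ΣS F ≡ ΣS (λ s → if mem i s then 0 else F s + F (ins i s))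
ΣS-pair {suc n} F fzero = sym (trans (cong₂ _+_ (ΣS-0 {n} (λ _ → refl)) (ΣS-cong (λ s → cong (λ z → F (false ∷ s) + F (true ∷ z)) (∪-empty s))))
  (trans (ΣS-+ (λ s → F (false ∷ s)) (λ s → F (true ∷ s))) (+-comm (ΣS (λ s → F (false ∷ s))) _)))
ΣS-pair {suc n} F (fsuc i) = cong₂ _+_ (ΣS-pair (λ s → F (true ∷ s)) i) (ΣS-pair (λ s → F (false ∷ s)) i)

quad : ∀ {n} → (Sub n → ℕ) → Fin n → Fin n → Sub n → ℕ
quad F i j s = (F s + F (ins i s)) + (F (ins j s) + F (ins i (ins j s)))

-- The sum is grouped into blocks `s`, `s + i`, `s + j`, `s + i + j`. The two functions compared
-- under a contraction are not comparable set by set, but they are after summation over such a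
-- block.
ΣS-quad : ∀ {n} (F : Sub n → ℕ) i j → i ≢ j → ΣS F ≡ ΣS (λ s → if mem j s then 0 else if mem i s then 0 else quad F i j s)
ΣS-quad {n} F i j i≢j = trans (ΣS-pair F i) (trans (ΣS-pair F₁ j) (ΣS-cong h))
  where
  F₁ : Sub n → ℕ
  F₁ s = if mem i s then 0 else F s + F (ins i s)
  h : ∀ s → (if mem j s then 0 else F₁ s + F₁ (ins j s)) ≡ (if mem j s then 0 else if mem i s then 0 else quad F i j s)
  h s rewrite mem-ins-other i j s i≢j with mem j s | mem i s
  ... | true | _ = refl
  ... | false | true = refl
  ... | false | false = refl

ΣS-quad-mono : ∀ {n} (F H : Sub n → ℕ) i j → i ≢ j → (∀ s → i ∉ s → j ∉ s → quad F i j s ≤ quad H i j s) → ΣS F ≤ ΣS H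
ΣS-quad-mono F H i j i≢j h = subst₂ _≤_ (sym (ΣS-quad F i j i≢j)) (sym (ΣS-quad H i j i≢j)) (ΣS-mono k)
  where
  k : ∀ s → (if mem j s then 0 else if mem i s then 0 else quad F i j s) ≤ (if mem j s then 0 else if mem i s then 0 else quad H i j s)
  k s with decB (mem j s) | decB (mem i s)
  ... | inj₁ p | _ rewrite p = z≤n
  ... | inj₂ p | inj₁ q rewrite p | q = z≤n
  ... | inj₂ p | inj₂ q rewrite p | q = h s q p

ΣS-quad-mono-< : ∀ {n} (F H : Sub n → ℕ) i j → i ≢ j → (∀ s → i ∉ s → j ∉ s → quad F i j s ≤ quad H i j s)
  → ∀ s → i ∉ s → j ∉ s → quad F i j s < quad H i j s → ΣS F < ΣS H
ΣS-quad-mono-< {n} F H i j i≢j h s₀ i∉ j∉ lt = subst₂ _<_ (sym (ΣS-quad F i j i≢j)) (sym (ΣS-quad H i j i≢j)) (ΣS-mono-< k s₀ k<)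
  where
  f g : Sub n → ℕ
  f s = if mem j s then 0 else if mem i s then 0 else quad F i j s
  g s = if mem j s then 0 else if mem i s then 0 else quad H i j s
  k : ∀ s → f s ≤ g s
  k s with decB (mem j s) | decB (mem i s)
  ... | inj₁ p | _ rewrite p = z≤n
  ... | inj₂ p | inj₁ q rewrite p | q = z≤n
  ... | inj₂ p | inj₂ q rewrite p | q = h s q p
  k< : f s₀ < g s₀
  k< rewrite j∉ | i∉ = lt

co : ∀ {n} → Sub n → ℕ
co [] = 0
co (true ∷ s) = co s
co (false ∷ s) = suc (co s)

co-ins : ∀ {n} (x : Fin n) s → x ∉ s → co s ≡ suc (co (ins x s))
co-ins fzero (false ∷ s) refl = cong (suc ∘ co) (sym (∪-empty s))
co-ins (fsuc x) (true ∷ s) p = co-ins x s p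
co-ins (fsuc x) (false ∷ s) p = cong suc (co-ins x s p)

card+co : ∀ {n} (s : Sub n) → card s + co s ≡ n
card+co [] = refl
card+co (true ∷ s) = cong suc (card+co s)
card+co (false ∷ s) = trans (+-suc _ _) (cong suc (card+co s))

-- The number of arrangements of `n` elements and one mark in which `s` is the set before the mark;
-- over all `s` these add up to (n+1)!.
wt : ∀ {n} → Sub n → ℕ
wt s = card s ! * co s !

-- With k undecided elements, mass k a b is (a + b + k + 1)! times the Beta integral of t^a (1 - t)^b:
-- the weights are those of a random order in which one marks a uniformly random position.
mass : ℕ → ℕ → ℕ → ℕ
mass zero a b = a ! * b !
mass (suc k) a b = mass k (suc a) b + mass k a (suc b)

-- The value a! b!/(a+b+1)! of the Beta integral with denominators cleared. The recursion in `k`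
-- corresponds to writing 1 as t + (1 - t) under the integral.
mass-closed : ∀ k a b → mass k a b * suc (a + b) ! ≡ (a ! * b !) * suc (a + b + k) !
mass-closed zero a b = cong (λ z → (a ! * b !) * suc z !) (sym (+-identityʳ (a + b)))
mass-closed (suc k) a b = *-cancelʳ-≡ _ _ (suc (suc (a + b))) (begin
  (m1 + m2) * f * suc (suc (a + b))           ≡⟨ e1 m1 m2 f (suc (suc (a + b))) ⟩
  m1 * (suc (suc (a + b)) * f) + m2 * (suc (suc (a + b)) * f) ≡⟨ cong₂ _+_ (mass-closed k (suc a) b) h2 ⟩
  (suc a ! * b !) * F' + (a ! * suc b !) * F' ≡⟨ e2 (a !) (b !) F' a b ⟩
  (a ! * b !) * F' * suc (suc (a + b))        ≡⟨ cong (λ z → (a ! * b !) * suc z ! * suc (suc (a + b))) (sym (+-suc (a + b) k)) ⟩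
  (a ! * b !) * suc (a + b + suc k) ! * suc (suc (a + b)) ∎)
  where
  open ≡-Reasoning
  m1 m2 f F' : ℕ
  m1 = mass k (suc a) b
  m2 = mass k a (suc b)
  f = suc (a + b) !
  F' = suc (suc (a + b + k)) !
  h2 : m2 * (suc (suc (a + b)) * f) ≡ (a ! * suc b !) * F'
  h2 = subst (λ z → m2 * suc z ! ≡ (a ! * suc b !) * suc (z + k) !) (+-suc a b) (mass-closed k a (suc b))
  open +-*-Solver
  e1 : ∀ x y f s → (x + y) * f * s ≡ x * (s * f) + y * (s * f)
  e1 = solve 4 (λ x y f s → (x :+ y) :* f :* s := x :* (s :* f) :+ y :* (s :* f)) refl
  e2 : ∀ p q F a b → (suc a * p) * q * F + (p * (suc b * q)) * F ≡ (p * q) * F * suc (suc (a + b))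
  e2 = solve 5 (λ p q F a b → ((con 1 :+ a) :* p) :* q :* F :+ (p :* ((con 1 :+ b) :* q)) :* F := (p :* q) :* F :* (con 2 :+ (a :+ b))) refl

ind : ∀ {n} → Sub n → Sub n → Sub n → ℕ
ind S D W = if (S ⊆ᵇ W) ∧ disjointᵇ W D then 1 else 0

card-disj : ∀ {n} (S D : Sub n) → (∀ i → i ∈ S → i ∉ D) → card S + card D ≤ n
card-disj [] [] h = z≤n
card-disj (true ∷ S) (true ∷ D) h = contradiction (h fzero refl) λ ()
card-disj (true ∷ S) (false ∷ D) h = s≤s (card-disj S D (λ i → h (fsuc i)))
card-disj (false ∷ S) (true ∷ D) h = ≤-trans (≤-reflexive (+-suc _ _)) (s≤s (card-disj S D (λ i → h (fsuc i))))
card-disj (false ∷ S) (false ∷ D) h = m≤n⇒m≤1+n (card-disj S D (λ i → h (fsuc i)))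

-- An element of `S` or of `D` has its side fixed and raises `a` or `b`; every other element may go
-- to either side, which is the recursion of `mass`. Their number is `k`.
mass-ind : ∀ {n} k a b (S D : Sub n) → (∀ i → i ∈ S → i ∉ D) → k + (card S + card D) ≡ n
  → ΣS (λ W → ((a + card W) ! * (b + co W) !) * ind S D W) ≡ mass k (a + card S) (b + card D)
mass-ind k a b [] [] h e rewrite trans (sym (+-identityʳ k)) e = *-identityʳ _
mass-ind k a b (true ∷ S) (true ∷ D) h e = contradiction (h fzero refl) λ ()
mass-ind {suc n} k a b (true ∷ S) (false ∷ D) h e = begin
  ΣS {n} (λ W → ((a + suc (card W)) ! * (b + co W) !) * ind S D W) + ΣS {n} (λ W → ((a + card W) ! * (b + suc (co W)) !) * 0)
    ≡⟨ cong₂ _+_ (ΣS-cong (λ W → cong (λ z → (z ! * (b + co W) !) * ind S D W) (+-suc a (card W)))) (ΣS-0 {n} (λ W → *-zeroʳ ((a + card W) ! * (b + suc (co W)) !))) ⟩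
  ΣS (λ W → ((suc a + card W) ! * (b + co W) !) * ind S D W) + 0
    ≡⟨ trans (+-identityʳ _) (mass-ind k (suc a) b S D (λ i → h (fsuc i)) (suc-injective (trans (sym (+-suc k _)) e))) ⟩
  mass k (suc a + card S) (b + card D) ≡⟨ cong (λ z → mass k z (b + card D)) (sym (+-suc a (card S))) ⟩
  mass k (a + suc (card S)) (b + card D) ∎
  where open ≡-Reasoning
mass-ind k a b (false ∷ S) (true ∷ D) h e = begin
  ΣS (λ W → ((a + suc (card W)) ! * (b + co W) !) * (if (S ⊆ᵇ W) ∧ false then 1 else 0)) + ΣS (λ W → ((a + card W) ! * (b + suc (co W)) !) * ind S D W)
    ≡⟨ cong₂ _+_ (ΣS-0 (λ W → trans (cong (λ z → ((a + suc (card W)) ! * (b + co W) !) * (if z then 1 else 0)) (∧-zeroʳ (S ⊆ᵇ W))) (*-zeroʳ ((a + suc (card W)) ! * (b + co W) !))))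
         (ΣS-cong (λ W → cong (λ z → ((a + card W) ! * z !) * ind S D W) (+-suc b (co W)))) ⟩
  ΣS (λ W → ((a + card W) ! * (suc b + co W) !) * ind S D W)
    ≡⟨ mass-ind k a (suc b) S D (λ i → h (fsuc i)) (suc-injective (trans (sym (+-suc k _)) (trans (cong (k +_) (sym (+-suc _ _))) e))) ⟩
  mass k (a + card S) (suc b + card D) ≡⟨ cong (mass k (a + card S)) (sym (+-suc b (card D))) ⟩
  mass k (a + card S) (b + suc (card D)) ∎
  where open ≡-Reasoning
mass-ind {suc n} zero a b (false ∷ S) (false ∷ D) h e = ⊥-elim (<-irrefl refl (subst (λ z → z ≤ n) e (card-disj S D (λ i → h (fsuc i)))))
mass-ind (suc k) a b (false ∷ S) (false ∷ D) h e = cong₂ _+_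
  (trans (ΣS-cong (λ W → cong (λ y → (y ! * (b + co W) !) * ind S D W) (+-suc a (card W))))
    (mass-ind k (suc a) b S D (λ i → h (fsuc i)) (suc-injective e)))
  (trans (ΣS-cong (λ W → cong (λ z → ((a + card W) ! * z !) * ind S D W) (+-suc b (co W))))
    (mass-ind k a (suc b) S D (λ i → h (fsuc i)) (suc-injective e)))

wt-ind : ∀ {n} (S D : Sub n) → (∀ i → i ∈ S → i ∉ D) → ΣS (λ W → wt W * ind S D W) ≡ mass (n ∸ (card S + card D)) (card S) (card D)
wt-ind {n} S D h = mass-ind (n ∸ (card S + card D)) 0 0 S D h (m∸n+n≡m (card-disj S D h))

wt-pos : ∀ {n} (W : Sub n) → 1 ≤ wt W
wt-pos W = *-mono-≤ (n!>0 (card W)) (n!>0 (co W))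
  where
  n!>0 : ∀ n → 1 ≤ n !
  n!>0 zero = s≤s z≤n
  n!>0 (suc n) = *-mono-≤ {1} {suc n} (s≤s z≤n) (n!>0 n)

ind-1 : ∀ {n} (S D W : Sub n) → S ⊑ W → (∀ i → i ∈ W → i ∉ D) → ind S D W ≡ 1
ind-1 S D W h k rewrite ⇒⊆ᵇ {s = S} {W} h | ⇒disj {s = W} {D} k = refl

ind-S : ∀ {n} (S D W : Sub n) i → i ∈ S → i ∉ W → ind S D W ≡ 0
ind-S S D W i p q with decB (S ⊆ᵇ W)
... | inj₁ r = ⊥-elim (t≢f (⊆ᵇ⇒ r i p) q)
... | inj₂ r rewrite r = refl

ind-D : ∀ {n} (S D W : Sub n) i → i ∈ W → i ∈ D → ind S D W ≡ 0
ind-D S D W i p q with decB (disjointᵇ W D)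
... | inj₁ r = ⊥-elim (t≢f q (disj⇒ {s = W} r i p))
... | inj₂ r rewrite r | ∧-zeroʳ (S ⊆ᵇ W) = refl

ind-D⇒ : ∀ {n} (S D W : Sub n) → S ⊑ W → (∃ λ i → i ∈ W × i ∈ D) ⊎ ind S D W ≡ 1
ind-D⇒ S D W h with searchF (λ i → mem i W ∧ mem i D)
... | inj₁ (i , p) = inj₁ (i , ∧-el p)
... | inj₂ k = inj₂ (ind-1 S D W h (λ i p → falseI (λ q → t≢f (∧-in p q) (k i))))

subset : ∀ {n} d (s : Sub n) → d ≤ card s → Σ (Sub n) λ t → t ⊑ s × card t ≡ d
subset {n} zero s _ = emptyS , (λ i p → ⊥-elim (t≢f p (mem-empty i))) , card-empty n
subset (suc d) s h with subset d s (≤-trans (n≤1+n d) h)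
... | t , t⊑ , e with extra t s (subst (_< card s) (sym e) h)
...   | x , x∈ , x∉ = ins x t , ins-⊑ x t⊑ x∈ , trans (card-ins x t x∉) (cong suc e)

cut : ∀ {n} → Sub (suc n) → Sub n → Sub (suc n)
cut J W = (true ∷ W) ∩ˢ J

-- Up to the factor (n+1)!, the expected number of components of G[J ∩ W] for the random set W of those
-- vertices that precede a marked position; the vertex 0 belongs to every W.
E : ∀ {n} → Graph (suc n) → Sub (suc n) → ℕ
E G J = ΣS (λ W → wt W * c G (cut J W))

cut-in : ∀ {n} (J : Sub (suc n)) W i → i ∈ W → fsuc i ∈ J → fsuc i ∈ cut J W
cut-in J W i p q = ∩-in (fsuc i) (true ∷ W) J p q

cut-J : ∀ {n} (J : Sub (suc n)) W x → x ∈ cut J W → x ∈ J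
cut-J J W x p = proj₂ (∩-el x (true ∷ W) J p)

cut-W : ∀ {n} (J : Sub (suc n)) W i → fsuc i ∈ cut J W → i ∈ W
cut-W J W i p = proj₁ (∩-el (fsuc i) (true ∷ W) J p)

cut-0 : ∀ {n} (J : Sub (suc n)) W → fzero ∈ J → fzero ∈ cut J W
cut-0 J W p = ∩-in fzero (true ∷ W) J refl p

cut-ins-W : ∀ {n} (J : Sub (suc n)) W i → fsuc i ∈ J → cut J (ins i W) ≡ ins (fsuc i) (cut J W)
cut-ins-W J W i p = ⊑-antisym to from
  where
  to : cut J (ins i W) ⊑ ins (fsuc i) (cut J W)
  to fzero q = ins-⊒ (fsuc i) (cut J W) fzero (cut-0 J W (cut-J J (ins i W) fzero q))
  to (fsuc k) q with ins-el k i W (cut-W J (ins i W) k q)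
  ... | inj₁ refl = mem-ins-same (fsuc i) (cut J W)
  ... | inj₂ r = ins-⊒ (fsuc i) (cut J W) (fsuc k) (cut-in J W k r (cut-J J (ins i W) (fsuc k) q))
  from : ins (fsuc i) (cut J W) ⊑ cut J (ins i W)
  from x q with ins-el x (fsuc i) (cut J W) q
  from x q | inj₁ refl = cut-in J (ins i W) i (mem-ins-same i W) p
  from fzero q | inj₂ r = cut-0 J (ins i W) (cut-J J W fzero r)
  from (fsuc k) q | inj₂ r = cut-in J (ins i W) k (ins-⊒ i W k (cut-W J W k r)) (cut-J J W (fsuc k) r)

cut-ins-W-out : ∀ {n} (J : Sub (suc n)) W i → fsuc i ∉ J → cut J (ins i W) ≡ cut J W
cut-ins-W-out J W i p = ⊑-antisym to from
  where
  to : cut J (ins i W) ⊑ cut J W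
  to fzero q = cut-0 J W (cut-J J (ins i W) fzero q)
  to (fsuc k) q with ins-el k i W (cut-W J (ins i W) k q)
  ... | inj₁ refl = ⊥-elim (t≢f (cut-J J (ins i W) (fsuc i) q) p)
  ... | inj₂ r = cut-in J W k r (cut-J J (ins i W) (fsuc k) q)
  from : cut J W ⊑ cut J (ins i W)
  from fzero q = cut-0 J (ins i W) (cut-J J W fzero q)
  from (fsuc k) q = cut-in J (ins i W) k (ins-⊒ i W k (cut-W J W k q)) (cut-J J W (fsuc k) q)

cut-ins-J-out : ∀ {n} (J : Sub (suc n)) W i → i ∉ W → cut (ins (fsuc i) J) W ≡ cut J W
cut-ins-J-out J W i p = ⊑-antisym to from
  where
  to : cut (ins (fsuc i) J) W ⊑ cut J W
  to x q with ins-el x (fsuc i) J (cut-J (ins (fsuc i) J) W x q)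
  to x q | inj₁ refl = ⊥-elim (t≢f (cut-W (ins (fsuc i) J) W i q) p)
  to fzero q | inj₂ r = cut-0 J W r
  to (fsuc k) q | inj₂ r = cut-in J W k (cut-W (ins (fsuc i) J) W k q) r
  from : cut J W ⊑ cut (ins (fsuc i) J) W
  from fzero q = cut-0 (ins (fsuc i) J) W (ins-⊒ (fsuc i) J fzero (cut-J J W fzero q))
  from (fsuc k) q = cut-in (ins (fsuc i) J) W k (cut-W J W k q) (ins-⊒ (fsuc i) J (fsuc k) (cut-J J W (fsuc k) q))

cut-ins-J : ∀ {n} (J : Sub (suc n)) W i → i ∈ W → cut (ins (fsuc i) J) W ≡ ins (fsuc i) (cut J W)
cut-ins-J J W i p = ⊑-antisym to from
  where
  to : cut (ins (fsuc i) J) W ⊑ ins (fsuc i) (cut J W)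
  to x q with ins-el x (fsuc i) J (cut-J (ins (fsuc i) J) W x q)
  to x q | inj₁ refl = mem-ins-same (fsuc i) (cut J W)
  to fzero q | inj₂ r = ins-⊒ (fsuc i) (cut J W) fzero (cut-0 J W r)
  to (fsuc k) q | inj₂ r = ins-⊒ (fsuc i) (cut J W) (fsuc k) (cut-in J W k (cut-W (ins (fsuc i) J) W k q) r)
  from : ins (fsuc i) (cut J W) ⊑ cut (ins (fsuc i) J) W
  from x q with ins-el x (fsuc i) (cut J W) q
  from x q | inj₁ refl = cut-in (ins (fsuc i) J) W i p (mem-ins-same (fsuc i) J)
  from fzero q | inj₂ r = cut-0 (ins (fsuc i) J) W (ins-⊒ (fsuc i) J fzero (cut-J J W fzero r))
  from (fsuc k) q | inj₂ r = cut-in (ins (fsuc i) J) W k (cut-W J W k r) (ins-⊒ (fsuc i) J (fsuc k) (cut-J J W (fsuc k) r))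

-- The cost of adding vertices

-- For d < n this is (n+1)! times the probability that a given vertex precedes the mark while `d`
-- other given vertices follow it.
unit : ℕ → ℕ → ℕ
unit n d = mass (n ∸ suc d) 1 d

unit-ind : ∀ {n} d (i : Fin n) (D : Sub n) → i ∉ D → card D ≡ d → ΣS (λ W → wt W * ind (single i) D W) ≡ unit n d
unit-ind {n} d i D i∉ e = trans (wt-ind (single i) D (λ j p → subst (_∉ D) (sym (single-∈ j i p)) i∉))
  (cong₂ (λ x y → mass (n ∸ (x + y)) x y) (card-single i) e)

wt-mono-< : ∀ {n} (W : Sub n) {x y} → x < y → wt W * x < wt W * y
wt-mono-< W {x} {y} lt with wt W | wt-pos W
... | suc w | _ = *-monoʳ-< (suc w) lt

nbr : ∀ {N} → Graph N → Sub N → Fin N → Sub N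
nbr G I v = filt I (adj G v)

-- Adjacency up to the vertex 0: since 0 belongs to every random set, two vertices adjacent to 0 are
-- connected whenever both are present.
weak : ∀ {n} → Graph (suc n) → Fin (suc n) → Fin (suc n) → Bool
weak G y z = adj G y z ∨ (adj G y fzero ∧ adj G z fzero)

isolated : ∀ {N} (G : Graph N) S y z → y ≢ z → (∀ b → b ∈ S → b ≢ y → adj G y b ≡ false) → ¬ Conn G S y z
isolated G S y z y≢z h cn = t≢f (trans (sym inv) (eqF-refl y)) (eqF-≢ (λ e → y≢z (sym e)))
  where
  edge : ∀ a b → a ∈ S → b ∈ S → adj G a b ≡ true → eqF a y ≡ eqF b y
  edge a b p q e with a ≟ y | b ≟ y
  ... | yes refl | yes refl = refl
  ... | yes refl | no b≢ = ⊥-elim (t≢f e (h b q b≢))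
  ... | no a≢ | yes refl = ⊥-elim (t≢f (adj-sym G a b e) (h a p a≢))
  ... | no a≢ | no b≢ = trans (eqF-≢ a≢) (sym (eqF-≢ b≢))
  inv : eqF y y ≡ eqF z y
  inv = conn-inv (λ x → eqF x y) edge cn

-- The additions for which the bound on the cost may be attained; in all other cases `add-cost`
-- gives a strict inequality.
Step : ∀ {n} → ℕ → Graph (suc n) → Sub (suc n) → Fin (suc n) → Set
Step d G I v = card (nbr G I v) ≡ d × (∀ y z → y ∈ nbr G I v → z ∈ nbr G I v → y ≢ z → weak G y z ≡ true)

module AddCost {n} (d : ℕ) (G : Graph (suc n)) (I : Sub (suc n)) (i : Fin n) (v∉ : fsuc i ∉ I)
  (0∈ : fzero ∈ I) (v≁0 : adj G (fsuc i) fzero ≡ false) where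

  private
    v : Fin (suc n)
    v = fsuc i

  module _ (D : Sub n) (D⊑ : (false ∷ D) ⊑ nbr G I v) (cD : card D ≡ d) where

    i∉D : i ∉ D
    i∉D = falseI (λ p → t≢f (proj₁ (filt-el v I (adj G v) (D⊑ v p))) v∉)

    -- A new component arises only if `v` is present and its whole neighbourhood, in particular `D`,
    -- is absent.
    pointwise : ∀ W → c G (cut (ins v I) W) ≤ c G (cut I W) + ind (single i) D W
    pointwise W with decB (mem i W)
    ... | inj₂ i∉ = subst (λ S → c G S ≤ c G (cut I W) + ind (single i) D W) (sym (cut-ins-J-out I W i i∉)) (m≤m+n _ _)
    ... | inj₁ i∈ rewrite cut-ins-J I W i i∈ with ind-D⇒ (single i) D W (λ j p → subst (_∈ W) (sym (single-∈ j i p)) i∈)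
    ...   | inj₂ e rewrite e = ≤-trans (c-add-≤suc G (cut I W) v (falseI (λ p → t≢f (cut-J I W v p) v∉))) (≤-reflexive (+-comm 1 _))
    ...   | inj₁ (k , k∈W , k∈D) = ≤-trans
      (c-add-≤ G (cut I W) v (fsuc k) (falseI (λ p → t≢f (cut-J I W v p) v∉))
        (cut-in I W k k∈W (proj₁ (filt-el (fsuc k) I (adj G v) (D⊑ (fsuc k) k∈D))))
        (proj₂ (filt-el (fsuc k) I (adj G v) (D⊑ (fsuc k) k∈D)))) (m≤m+n _ _)

    private
      total : ΣS (λ W → wt W * (c G (cut I W) + ind (single i) D W)) ≡ E G I + unit n d
      total = trans (ΣS-cong (λ W → *-distribˡ-+ (wt W) (c G (cut I W)) _))
        (trans (ΣS-+ (λ W → wt W * c G (cut I W)) _) (cong (E G I +_) (unit-ind d i D i∉D cD)))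

    add-≤ : E G (ins v I) ≤ E G I + unit n d
    add-≤ = subst (E G (ins v I) ≤_) total (ΣS-mono (λ W → *-monoʳ-≤ (wt W) (pointwise W)))

    add-< : ∀ W → c G (cut (ins v I) W) < c G (cut I W) + ind (single i) D W → E G (ins v I) < E G I + unit n d
    add-< W lt = subst (E G (ins v I) <_) total (ΣS-mono-< (λ W → *-monoʳ-≤ (wt W) (pointwise W)) W (wt-mono-< W lt))

    add-more : ∀ z → z ∈ nbr G I v → z ∉ (false ∷ D) → E G (ins v I) < E G I + unit n d
    add-more fzero p _ = ⊥-elim (t≢f (proj₂ (filt-el fzero I (adj G v) p)) v≁0)
    add-more (fsuc k) p k∉ = add-< W (subst (λ x → c G (cut (ins v I) W) < c G (cut I W) + x) (sym e)
        (subst (λ S → c G S < c G (cut I W) + 1) (sym (cut-ins-J I W i i∈))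
          (≤-trans (s≤s (c-add-≤ G (cut I W) v (fsuc k) (falseI (λ q → t≢f (cut-J I W v q) v∉))
            (cut-in I W k k∈ (proj₁ (filt-el (fsuc k) I (adj G v) p))) (proj₂ (filt-el (fsuc k) I (adj G v) p))))
            (≤-reflexive (+-comm 1 _)))))
      where
      -- Witness of strictness: only `v` and the extra neighbour are present, so the bound allows
      -- for a component that `v` does not create.
      W : Sub n
      W = ins i (single k)
      i∈ : i ∈ W
      i∈ = mem-ins-same i (single k)
      k∈ : k ∈ W
      k∈ = ins-⊒ i (single k) k (mem-single-same k)
      e : ind (single i) D W ≡ 1
      e = ind-1 (single i) D W (λ j q → subst (_∈ W) (sym (single-∈ j i q)) i∈) off
        where
        off : ∀ j → j ∈ W → j ∉ D
        off j q with ins-el j i (single k) q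
        ... | inj₁ refl = i∉D
        ... | inj₂ r = subst (_∉ D) (sym (single-∈ j k r)) k∉

    add-unlinked : ∀ y z → y ∈ nbr G I v → z ∈ nbr G I v → y ≢ z → weak G y z ≡ false → E G (ins v I) < E G I + unit n d
    add-unlinked fzero z p _ _ _ = ⊥-elim (t≢f (proj₂ (filt-el fzero I (adj G v) p)) v≁0)
    add-unlinked (fsuc k) fzero _ p _ _ = ⊥-elim (t≢f (proj₂ (filt-el fzero I (adj G v) p)) v≁0)
    add-unlinked (fsuc k) (fsuc l) p q k≢l nw = add-< W (≤-trans
        (subst (λ S → c G S < c G (cut I W)) (sym (cut-ins-J I W i i∈))
          (c-add-< G (cut I W) v y z (falseI (λ r → t≢f (cut-J I W v r) v∉))
            (cut-in I W k k∈ (proj₁ (filt-el y I (adj G v) p))) (cut-in I W l l∈ (proj₁ (filt-el z I (adj G v) q)))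
            (proj₂ (filt-el y I (adj G v) p)) (proj₂ (filt-el z I (adj G v) q)) sep)) (m≤m+n _ _))
      where
      y z : Fin (suc n)
      y = fsuc k
      z = fsuc l
      -- Witness of strictness: `v` with the two unlinked neighbours, which lie in different
      -- components until `v` joins them.
      W : Sub n
      W = ins i (ins k (single l))
      i∈ : i ∈ W
      i∈ = mem-ins-same i _
      k∈ : k ∈ W
      k∈ = ins-⊒ i _ k (mem-ins-same k (single l))
      l∈ : l ∈ W
      l∈ = ins-⊒ i _ l (ins-⊒ k (single l) l (mem-single-same l))
      y≁z : adj G y z ≡ false
      y≁z = falseI (λ e → t≢f (∨-inˡ _ e) nw)
      three : ∀ x → x ∈ cut I W → x ≡ fzero ⊎ x ≡ y ⊎ x ≡ z
      three fzero _ = inj₁ refl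
      three (fsuc j) r with ins-el j i (ins k (single l)) (cut-W I W j r)
      ... | inj₁ refl = ⊥-elim (t≢f (cut-J I W v r) v∉)
      ... | inj₂ r' with ins-el j k (single l) r'
      ...   | inj₁ refl = inj₂ (inj₁ refl)
      ...   | inj₂ r'' = inj₂ (inj₂ (cong fsuc (single-∈ j l r'')))
      -- Besides `y` and `z` only 0 is present, and it is adjacent to at most one of them; a vertex
      -- among the two that is not adjacent to 0 is isolated.
      sep : ¬ Conn G (cut I W) y z
      sep with decB (adj G y fzero)
      ... | inj₂ y≁0 = isolated G (cut I W) y z k≢l lone
        where
        lone : ∀ b → b ∈ cut I W → b ≢ y → adj G y b ≡ false
        lone b r b≢ with three b r
        ... | inj₁ refl = y≁0
        ... | inj₂ (inj₁ e) = ⊥-elim (b≢ e)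
        ... | inj₂ (inj₂ refl) = y≁z
      ... | inj₁ y~0 = λ cn → isolated G (cut I W) z y (λ e → k≢l (sym e)) lone (csym cn)
        where
        lone : ∀ b → b ∈ cut I W → b ≢ z → adj G z b ≡ false
        lone b r b≢ with three b r
        ... | inj₁ refl = falseI (λ e → t≢f (∨-inʳ (adj G y z) (∧-in y~0 e)) nw)
        ... | inj₂ (inj₁ refl) = falseI (λ e → t≢f (adj-sym G z y e) y≁z)
        ... | inj₂ (inj₂ e) = ⊥-elim (b≢ e)

  add-cost : d ≤ card (nbr G I v)
    → (Step d G I v × E G (ins v I) ≤ E G I + unit n d) ⊎ E G (ins v I) < E G I + unit n d
  add-cost d≤ with subset d (nbr G I v) d≤
  ... | true ∷ D , D⊑ , _ = ⊥-elim (t≢f (proj₂ (filt-el fzero I (adj G v) (D⊑ fzero refl))) v≁0)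
  ... | false ∷ D , D⊑ , cD with searchF (λ z → mem z (nbr G I v) ∧ not (mem z (false ∷ D)))
  ...   | inj₁ (z , p) = let a , b = ∧-el p in inj₂ (add-more D D⊑ cD z a (not-el b))
  ...   | inj₂ none with searchF (λ y → anyF (λ z → mem y (nbr G I v) ∧ (mem z (nbr G I v) ∧ (not (eqF y z) ∧ not (weak G y z)))))
  ...     | inj₁ (y , p) with anyF⇒ (λ z → mem y (nbr G I v) ∧ (mem z (nbr G I v) ∧ (not (eqF y z) ∧ not (weak G y z)))) p
  ...       | z , q = let q1 , q2 = ∧-el q ; q3 , q4 = ∧-el q2 ; q5 , q6 = ∧-el q4 in
    inj₂ (add-unlinked D D⊑ cD y z q1 q3 (λ e → t≢f (trans (cong (eqF y) (sym e)) (eqF-refl y)) (not-el q5)) (not-el q6))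
  add-cost d≤ | false ∷ D , D⊑ , cD | inj₂ none | inj₂ h = inj₁ ((same , clique) , add-≤ D D⊑ cD)
    where
    nbr≡ : nbr G I v ≡ false ∷ D
    nbr≡ = ⊑-antisym (λ z p → [ id , (λ q → ⊥-elim (t≢f (∧-in p (not-in q)) (none z))) ]′ (decB (mem z (false ∷ D)))) D⊑
    same : card (nbr G I v) ≡ d
    same = trans (cong card nbr≡) cD
    clique : ∀ y z → y ∈ nbr G I v → z ∈ nbr G I v → y ≢ z → weak G y z ≡ true
    clique y z p q y≢z with decB (weak G y z)
    ... | inj₁ w = w
    ... | inj₂ w = ⊥-elim (t≢f (⇒anyF _ z (∧-in p (∧-in q (∧-in (not-in (eqF-≢ y≢z)) (not-in w))))) (h y))

-- Adding `v` to `J` is compared with contracting `uv` while keeping `J`. The `d - 1` common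
-- neighbours in `D` together with `v` are the `d` vertices that have to be absent when `u` is
-- present; hence the difference has the same price `unit n d` as an ordinary addition.
module ContractCost {n} (d : ℕ) (G : Graph (suc n)) (J : Sub (suc n)) (i j : Fin n)
  (u∈ : fsuc i ∈ J) (v∉ : fsuc j ∉ J) (uv : adj G (fsuc i) (fsuc j) ≡ true)
  (D : Sub n) (D⊑ : ∀ k → k ∈ D → fsuc k ∈ J × adj G (fsuc i) (fsuc k) ≡ true × adj G (fsuc j) (fsuc k) ≡ true)
  (i∉D : i ∉ D) (cD : suc (card D) ≡ d) where

  private
    u v : Fin (suc n)
    u = fsuc i
    v = fsuc j
    G' : Graph (suc n)
    G' = contract G u v
    i≢j : i ≢ j
    i≢j refl = t≢f u∈ v∉
    u≢v : u ≢ v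
    u≢v e = i≢j (fsuc-injective e)
    D⁺ : Sub n
    D⁺ = ins j D
    j∉D : j ∉ D
    j∉D = falseI (λ p → t≢f (proj₁ (D⊑ j p)) v∉)
    F H : Sub n → ℕ
    F W = wt W * c G (cut (ins v J) W)
    H W = wt W * (c G' (cut J W) + ind (single i) D⁺ W)

    total : ΣS H ≡ E G' J + unit n d
    total = trans (ΣS-cong (λ W → *-distribˡ-+ (wt W) (c G' (cut J W)) _))
      (trans (ΣS-+ (λ W → wt W * c G' (cut J W)) _)
        (cong (E G' J +_) (unit-ind d i D⁺ (ins-∉ i j D i≢j i∉D) (trans (card-ins j D j∉D) cD))))

    module At (W : Sub n) (i∉ : i ∉ W) (j∉ : j ∉ W) where
      S : Sub (suc n)
      S = cut J W
      u∉S : u ∉ S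
      u∉S = falseI (λ p → t≢f (cut-W J W i p) i∉)
      v∉S : v ∉ S
      v∉S = falseI (λ p → t≢f (cut-W J W j p) j∉)
      w1 w0 w2 : ℕ
      w0 = wt W
      w1 = card (ins i W) ! * co (ins i W) !
      w2 = wt (ins i (ins j W))
      j∉i : j ∉ ins i W
      j∉i = ins-∉ j i W (λ e → i≢j (sym e)) j∉
      i∉j : i ∉ ins j W
      i∉j = ins-∉ i j W i≢j i∉
      wj : wt (ins j W) ≡ w1
      wj = cong₂ (λ a b → a ! * b !) (trans (card-ins j W j∉) (sym (card-ins i W i∉)))
        (suc-injective (trans (sym (co-ins j W j∉)) (co-ins i W i∉)))
      c0 c0' cu cv cx cuv ε : ℕ
      c0 = c G S
      c0' = c G' S
      cu = c G (ins u S)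
      cv = c G (ins v S)
      cx = c G' (ins u S)
      cuv = c G (ins v (ins u S))
      ε = ind (single i) D⁺ (ins i W)
      sh : ℕ
      sh = shared G u v u≢v S u∉S v∉S
      F≡ : quad F i j W ≡ (w0 * c0 + w1 * cu) + (w1 * cv + w2 * cuv)
      F≡ = cong₂ _+_
        (cong₂ _+_ (cong (λ z → w0 * c G z) (cut-ins-J-out J W j j∉))
          (cong (λ z → w1 * c G z) (trans (cut-ins-J-out J (ins i W) j j∉i) (cut-ins-W J W i u∈))))
        (cong₂ _+_ (cong₂ (λ a z → a * c G z) wj (trans (cut-ins-J J (ins j W) j (mem-ins-same j W)) (cong (ins v) (cut-ins-W-out J W j v∉))))
          (cong (λ z → w2 * c G z) (trans (cut-ins-J J (ins i (ins j W)) j (ins-⊒ i _ j (mem-ins-same j W)))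
            (cong (ins v) (trans (cut-ins-W J (ins j W) i u∈) (cong (ins u) (cut-ins-W-out J W j v∉)))))))
      H≡ : quad H i j W ≡ (w0 * c0' + w1 * (cx + ε)) + (w1 * c0' + w2 * cx)
      H≡ = cong₂ _+_
        (cong₂ _+_ (cong (w0 *_) (trans (cong (c0' +_) (ind-S (single i) D⁺ W i (mem-single-same i) i∉)) (+-identityʳ _)))
          (cong (λ z → w1 * (c G' z + ε)) (cut-ins-W J W i u∈)))
        (cong₂ _+_ (cong₂ _*_ wj (trans (cong₂ _+_ (cong (c G') (cut-ins-W-out J W j v∉)) (ind-S (single i) D⁺ (ins j W) i (mem-single-same i) i∉j)) (+-identityʳ _)))
          (cong (w2 *_) (trans (cong₂ _+_ (cong (c G') (trans (cut-ins-W J (ins j W) i u∈) (cong (ins u) (cut-ins-W-out J W j v∉))))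
            (ind-D (single i) D⁺ (ins i (ins j W)) j (ins-⊒ i _ j (mem-ins-same j W)) (mem-ins-same j D))) (+-identityʳ _))))
      c0≤ : c0 ≤ c0'
      c0≤ = c-mono {G = G'} {G} {S} back
        where
        back : ∀ x y → x ∈ S → y ∈ S → adj G' x y ≡ true → adj G x y ≡ true
        back x y p q e with proj₂ (proj₂ (contract-el G u v x y e))
        ... | inj₁ r = r
        ... | inj₂ (inj₁ (r , _)) = ⊥-elim (∉⇒≢ S x u p u∉S r)
        ... | inj₂ (inj₂ (r , _)) = ⊥-elim (∉⇒≢ S y u q u∉S r)
      cuv≤ : cuv ≤ cx
      cuv≤ = c-merge G u v u≢v (ins u S) (mem-ins-same u S) (ins-∉ v u S (λ e → u≢v (sym e)) v∉S) uv
      eq : (cu + cv) + sh ≡ suc (c0 + cx)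
      eq = split-eq G u v u≢v S u∉S v∉S
      -- Either the indicator pays, or a common neighbour from `D` is present and `u` and `v` meet a
      -- common component.
      ε⊎ : ε ≡ 1 ⊎ 1 ≤ sh
      ε⊎ with ind-D⇒ (single i) D⁺ (ins i W) (λ k p → subst (_∈ ins i W) (sym (single-∈ k i p)) (mem-ins-same i W))
      ... | inj₂ e = inj₁ e
      ... | inj₁ (k , k∈W , k∈D) with ins-el k i W k∈W
      ...   | inj₁ refl = ⊥-elim (t≢f k∈D (ins-∉ k j D i≢j i∉D))
      ...   | inj₂ q with ins-el k j D k∈D
      ...     | inj₁ refl = ⊥-elim (t≢f q j∉)
      ...     | inj₂ r = inj₂ (shared-pos G u v u≢v S u∉S v∉S (fsuc k) (fsuc k) k∈S k∈S (proj₁ (proj₂ (D⊑ k r))) (proj₂ (proj₂ (D⊑ k r))) (crefl k∈S))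
        where
        k∈S : fsuc k ∈ S
        k∈S = cut-in J W k q (proj₁ (D⊑ k r))
      -- The sets `W + i` and `W + j` have equal cardinality, hence equal weight. Only the sum of
      -- their two counts is controlled, by modularity.
      key : cu + cv ≤ c0' + (cx + ε)
      key with ε⊎
      ... | inj₁ e rewrite e = ≤-trans (m≤m+n (cu + cv) sh) (≤-trans (≤-reflexive eq)
        (≤-trans (s≤s (+-monoˡ-≤ cx c0≤)) (≤-reflexive (trans (+-comm 1 _) (+-assoc c0' cx 1)))))
      ... | inj₂ p = ≤-trans (+-cancelʳ-≤ 1 _ _ (≤-trans (+-monoʳ-≤ (cu + cv) p) (≤-trans (≤-reflexive eq) (≤-reflexive (+-comm 1 _)))))
        (+-mono-≤ c0≤ (m≤m+n cx ε))
      key< : ε ≡ 1 → 1 ≤ sh → cu + cv < c0' + (cx + ε)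
      key< e p rewrite e = ≤-trans (≤-trans (≤-reflexive (+-comm 1 (cu + cv))) (≤-trans (+-monoʳ-≤ (cu + cv) p) (≤-reflexive eq)))
        (≤-trans (s≤s (+-monoˡ-≤ cx c0≤)) (≤-reflexive (trans (+-comm 1 _) (+-assoc c0' cx 1))))
      regroup : ∀ a b c d → (w0 * a + w1 * b) + (w1 * c + w2 * d) ≡ (w0 * a + w2 * d) + w1 * (b + c)
      regroup = solve 7 (λ w0 w1 w2 a b c d → (w0 :* a :+ w1 :* b) :+ (w1 :* c :+ w2 :* d) := (w0 :* a :+ w2 :* d) :+ w1 :* (b :+ c)) refl w0 w1 w2
        where open +-*-Solver
      F≡' : quad F i j W ≡ (w0 * c0 + w2 * cuv) + w1 * (cu + cv)
      F≡' = trans F≡ (regroup c0 cu cv cuv)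
      H≡' : quad H i j W ≡ (w0 * c0' + w2 * cx) + w1 * (c0' + (cx + ε))
      H≡' = trans H≡ (trans (regroup c0' (cx + ε) c0' cx) (cong (λ z → (w0 * c0' + w2 * cx) + w1 * z) (+-comm (cx + ε) c0')))
      quad-≤ : quad F i j W ≤ quad H i j W
      quad-≤ = subst₂ _≤_ (sym F≡') (sym H≡') (+-mono-≤ (+-mono-≤ (*-monoʳ-≤ w0 c0≤) (*-monoʳ-≤ w2 cuv≤)) (*-monoʳ-≤ w1 key))
      quad-< : ε ≡ 1 → 1 ≤ sh → quad F i j W < quad H i j W
      quad-< e p = subst₂ _<_ (sym F≡') (sym H≡') (+-mono-≤-< (+-mono-≤ (*-monoʳ-≤ w0 c0≤) (*-monoʳ-≤ w2 cuv≤)) (wt-mono-< (ins i W) (key< e p)))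

  contract-≤ : E G (ins v J) ≤ E G' J + unit n d
  contract-≤ = subst (E G (ins v J) ≤_) total (ΣS-quad-mono F H i j i≢j (λ W i∉ j∉ → At.quad-≤ W i∉ j∉))

  -- As `D` is absent the indicator pays, and the connection from `y` to `z` makes `shared` positive
  -- as well. One of the two would have sufficed.
  contract-< : ∀ W → i ∉ W → j ∉ W → (∀ k → k ∈ W → k ∉ D) → ∀ y z → adj G u y ≡ true → adj G v z ≡ true
    → Conn G (cut J W) y z → E G (ins v J) < E G' J + unit n d
  contract-< W i∉ j∉ off y z e f cn = subst (E G (ins v J) <_) total
    (ΣS-quad-mono-< F H i j i≢j (λ W i∉ j∉ → At.quad-≤ W i∉ j∉) W i∉ j∉ (At.quad-< W i∉ j∉ ε≡1
      (shared-pos G u v u≢v (cut J W) (At.u∉S W i∉ j∉) (At.v∉S W i∉ j∉) y z (proj₁ (conn-∈ cn)) (proj₂ (conn-∈ cn)) e f cn)))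
    where
    ε≡1 : ind (single i) D⁺ (ins i W) ≡ 1
    ε≡1 = ind-1 (single i) D⁺ (ins i W) (λ k p → subst (_∈ ins i W) (sym (single-∈ k i p)) (mem-ins-same i W)) off⁺
      where
      off⁺ : ∀ k → k ∈ ins i W → k ∉ D⁺
      off⁺ k p with ins-el k i W p
      ... | inj₁ refl = ins-∉ k j D i≢j i∉D
      ... | inj₂ q = ins-∉ k j D (∉⇒≢ W k j q j∉) (off k q)

-- Inside a set that omits `v`, contraction can only create edges, so components can only merge.
contract-base : ∀ {n} (G : Graph (suc n)) (I : Sub (suc n)) u v → v ∉ I → E (contract G u v) I ≤ E G I
contract-base G I u v v∉ = ΣS-mono (λ W → *-monoʳ-≤ (wt W) (c-mono {G = G} {contract G u v} {cut I W} (λ x y p q e →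
  contract-old G u v x y (∉⇒≢ I x v (cut-J I W x p) v∉) (∉⇒≢ I y v (cut-J I W y q) v∉) e)))

-- Cycles modulo 2

xsum : ∀ {n} → (Fin n → Bool) → Bool
xsum {zero} f = false
xsum {suc n} f = f fzero xor xsum (λ i → f (fsuc i))

xsum-cong : ∀ {n} {f g : Fin n → Bool} → (∀ x → f x ≡ g x) → xsum f ≡ xsum g
xsum-cong {zero} h = refl
xsum-cong {suc n} h = cong₂ _xor_ (h fzero) (xsum-cong (λ i → h (fsuc i)))

xor-interchange : ∀ a b x y → (a xor b) xor (x xor y) ≡ (a xor x) xor (b xor y)
xor-interchange a b x y = begin
  (a xor b) xor (x xor y) ≡⟨ xor-assoc a b (x xor y) ⟩
  a xor (b xor (x xor y)) ≡⟨ cong (a xor_) (sym (xor-assoc b x y)) ⟩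
  a xor ((b xor x) xor y) ≡⟨ cong (λ z → a xor (z xor y)) (xor-comm b x) ⟩
  a xor ((x xor b) xor y) ≡⟨ cong (a xor_) (xor-assoc x b y) ⟩
  a xor (x xor (b xor y)) ≡⟨ sym (xor-assoc a x (b xor y)) ⟩
  (a xor x) xor (b xor y) ∎
  where open ≡-Reasoning

xsum-xor : ∀ {n} (f g : Fin n → Bool) → xsum (λ x → f x xor g x) ≡ xsum f xor xsum g
xsum-xor {zero} f g = refl
xsum-xor {suc n} f g = trans (cong ((f fzero xor g fzero) xor_) (xsum-xor (λ i → f (fsuc i)) (λ i → g (fsuc i))))
  (xor-interchange (f fzero) (g fzero) _ _)

xsum-0 : ∀ {n} {f : Fin n → Bool} → (∀ x → f x ≡ false) → xsum f ≡ false
xsum-0 {zero} h = refl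
xsum-0 {suc n} h = cong₂ _xor_ (h fzero) (xsum-0 (λ i → h (fsuc i)))

xsum-∧ : ∀ {n} b (f : Fin n → Bool) → xsum (λ x → b ∧ f x) ≡ b ∧ xsum f
xsum-∧ true f = refl
xsum-∧ {n} false f = xsum-0 {n} (λ _ → refl)

pt : ∀ {n} → Fin n → Bool → Fin n → Bool
pt u b x = eqF x u ∧ b

pt-same : ∀ {n} (u : Fin n) b → pt u b u ≡ b
pt-same u b rewrite eqF-refl u = refl

pt-other : ∀ {n} (u : Fin n) b {x} → x ≢ u → pt u b x ≡ false
pt-other u b h rewrite eqF-≢ h = refl

xsum-pt : ∀ {n} (u : Fin n) b → xsum (pt u b) ≡ b
xsum-pt {suc n} fzero b = trans (cong₂ _xor_ (pt-same {suc n} fzero b) (xsum-0 {n} {f = λ i → pt fzero b (fsuc i)} (λ i → pt-other fzero b {fsuc i} λ ()))) (xor-identityʳ b)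
xsum-pt (fsuc u) b = cong₂ _xor_ (pt-other (fsuc u) b {fzero} λ ()) (trans (xsum-cong {f = λ i → pt (fsuc u) b (fsuc i)} h) (xsum-pt u b))
  where
  h : ∀ i → pt (fsuc u) b (fsuc i) ≡ pt u b i
  h i with decB (eqF i u)
  ... | inj₁ p rewrite eqF⇒ p = trans (pt-same (fsuc u) b) (sym (pt-same u b))
  ... | inj₂ p = trans (pt-other (fsuc u) b ne) (sym (cong (_∧ b) p))
    where
    ne : fsuc i ≢ fsuc u
    ne e = t≢f (trans (cong (λ z → eqF z u) (fsuc-injective e)) (eqF-refl u)) p

xsum-∃ : ∀ {n} (f : Fin n → Bool) → xsum f ≡ true → ∃ λ x → f x ≡ true
xsum-∃ f e with searchF f
... | inj₁ p = p
... | inj₂ h = ⊥-elim (t≢f e (xsum-0 h))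

-- An even set with one member has another. This is how cycles are used to pass from one facet at a
-- ridge to the next.
xsum-other : ∀ {n} (f : Fin n → Bool) → xsum f ≡ false → ∀ x → f x ≡ true → ∃ λ y → y ≢ x × f y ≡ true
xsum-other f e x p with xsum-∃ (λ y → f y xor pt x true y) (trans (xsum-xor f (pt x true)) (cong₂ _xor_ e (xsum-pt x true)))
... | y , q with y ≟ x
...   | yes refl rewrite p | pt-same x true = contradiction q λ ()
...   | no ne rewrite pt-other x true ne = y , ne , trans (sym (xor-identityʳ (f y))) q

-- Off the diagonal the terms cancel in pairs; this is the reason for ∂∂ = 0 modulo 2.
xsum-sym : ∀ {n} (h : Fin n → Fin n → Bool) → (∀ x y → h x y ≡ h y x) → (∀ x → h x x ≡ false)
  → xsum (λ x → xsum (h x)) ≡ false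
xsum-sym {zero} h s d = refl
xsum-sym {suc n} h s d = begin
  (h fzero fzero xor r) xor xsum (λ i → h (fsuc i) fzero xor xsum (λ j → h (fsuc i) (fsuc j)))
    ≡⟨ cong₂ _xor_ (cong (_xor r) (d fzero)) (xsum-xor (λ i → h (fsuc i) fzero) _) ⟩
  r xor (xsum (λ i → h (fsuc i) fzero) xor xsum (λ i → xsum (λ j → h (fsuc i) (fsuc j))))
    ≡⟨ cong (r xor_) (cong₂ _xor_ (xsum-cong (λ i → s (fsuc i) fzero)) (xsum-sym (λ i j → h (fsuc i) (fsuc j)) (λ i j → s (fsuc i) (fsuc j)) (λ i → d (fsuc i)))) ⟩
  r xor (r xor false) ≡⟨ cong (r xor_) (xor-identityʳ r) ⟩
  r xor r ≡⟨ xor-same r ⟩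
  false ∎
  where
  open ≡-Reasoning
  r : Bool
  r = xsum (λ i → h fzero (fsuc i))

∂ : ∀ {N} → Cx N → Sub N → Bool
∂ K ρ = xsum (λ x → not (mem x ρ) ∧ K (ins x ρ))

-- A chain modulo 2 is identified with its support, here a family of `d`-sets that need not be
-- closed under subsets.
IsCycle : ∀ {N} → ℕ → Cx N → Set
IsCycle d K = (∀ σ → K σ ≡ true → card σ ≡ d) × (∀ ρ → ∂ K ρ ≡ false)

size : ∀ {N} → Cx N → ℕ
size K = ΣS (λ σ → if K σ then 1 else 0)

bit-mono : ∀ {a b} → (a ≡ true → b ≡ true) → (if a then 1 else 0) ≤ (if b then 1 else 0)
bit-mono {false} h = z≤n
bit-mono {true} {b} h rewrite h refl = s≤s z≤n

bit-xor : ∀ a b → (if a xor b then 1 else 0) ≤ (if a then 1 else 0) + (if b then 1 else 0)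
bit-xor true true = z≤n
bit-xor true false = s≤s z≤n
bit-xor false b = ≤-refl

size-< : ∀ {N} (M K : Cx N) → (∀ σ → M σ ≡ true → K σ ≡ true) → ∀ σ → M σ ≡ false → K σ ≡ true → size M < size K
size-< M K h σ p q = ΣS-mono-< (λ s → bit-mono (h s)) σ lt
  where
  lt : (if M σ then 1 else 0) < (if K σ then 1 else 0)
  lt rewrite p | q = s≤s z≤n

-- The image `Z` of the cycle `K` under the simplicial map sending `v` to `u`: sets containing both
-- vertices become degenerate and vanish, and two sets with the same image cancel.
module Push {N} (u v : Fin N) (u≢v : u ≢ v) (d : ℕ) (K : Cx N) (cyc : IsCycle d K) where

  v≢u : v ≢ u
  v≢u e = u≢v (sym e)

  Z : Cx N
  Z σ = not (mem v σ) ∧ (if mem u σ then K σ xor K (ins v (del u σ)) else K σ)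

  Z-v : ∀ σ → v ∈ σ → Z σ ≡ false
  Z-v σ p rewrite p = refl

  Z-u : ∀ σ → v ∉ σ → u ∈ σ → Z σ ≡ K σ xor K (ins v (del u σ))
  Z-u σ p q rewrite p | q = refl

  Z-o : ∀ σ → v ∉ σ → u ∉ σ → Z σ ≡ K σ
  Z-o σ p q rewrite p | q = refl

  Z-ins-u : ∀ s → u ∉ s → v ∉ s → Z (ins u s) ≡ K (ins u s) xor K (ins v s)
  Z-ins-u s p q = trans (Z-u (ins u s) (ins-∉ v u s v≢u q) (mem-ins-same u s)) (cong (λ z → K (ins u s) xor K (ins v z)) (del-ins u s p))

  swap-card : ∀ σ → v ∉ σ → u ∈ σ → card (ins v (del u σ)) ≡ card σ
  swap-card σ p q = trans (card-ins v (del u σ) (del-∉ v u σ p)) (card-del u σ q)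

  Z-card : ∀ σ → Z σ ≡ true → card σ ≡ d
  Z-card σ z with decB (mem v σ) | decB (mem u σ)
  ... | inj₁ p | _ = ⊥-elim (t≢f z (Z-v σ p))
  ... | inj₂ p | inj₂ q = proj₁ cyc σ (trans (sym (Z-o σ p q)) z)
  ... | inj₂ p | inj₁ q with xor-el {K σ} (trans (sym (Z-u σ p q)) z)
  ...   | inj₁ k = proj₁ cyc σ k
  ...   | inj₂ k = trans (sym (swap-card σ p q)) (proj₁ cyc _ k)

  Z-cycle : IsCycle d Z
  Z-cycle = Z-card , bdry-0
    where
    g : Sub N → Fin N → Bool
    g ρ x = not (mem x ρ) ∧ K (ins x ρ)
    bdry-0 : ∀ ρ → ∂ Z ρ ≡ false
    bdry-0 ρ with decB (mem v ρ) | decB (mem u ρ)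
    ... | inj₁ p | _ = xsum-0 (λ x → ∧-falseʳ (not (mem x ρ)) (Z-v (ins x ρ) (ins-⊒ x ρ v p)))
    ... | inj₂ p | inj₂ q = trans (xsum-cong same) (trans (xsum-xor (g ρ) _)
        (cong₂ _xor_ (proj₂ cyc ρ) (trans (xsum-xor (pt u k) (pt v k)) (trans (cong₂ _xor_ (xsum-pt u k) (xsum-pt v k)) (xor-same k)))))
      where
      k : Bool
      k = K (ins v ρ)
      -- In comparison with `∂ K ρ`, the contribution of `v` has moved to `u`.
      same : ∀ x → not (mem x ρ) ∧ Z (ins x ρ) ≡ g ρ x xor (pt u k x xor pt v k x)
      same x with x ≟ u
      ... | yes refl rewrite q | pt-same u k | pt-other v k u≢v | Z-ins-u ρ q p | xor-identityʳ k = refl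
      ... | no x≢u with x ≟ v
      ...   | yes refl rewrite p | pt-same v k | pt-other u k v≢u | Z-v (ins v ρ) (mem-ins-same v ρ) = sym (xor-same k)
      ...   | no x≢v rewrite pt-other u k x≢u | pt-other v k x≢v | Z-o (ins x ρ) (ins-∉ v x ρ (λ e → x≢v (sym e)) p) (ins-∉ u x ρ (λ e → x≢u (sym e)) q)
        = sym (xor-identityʳ _)
    ... | inj₂ p | inj₁ q = trans (xsum-cong same) (trans (xsum-xor (λ x → g ρ x xor g ρ' x) _)
        (trans (cong₂ _xor_ (trans (xsum-xor (g ρ) (g ρ')) (cong₂ _xor_ (proj₂ cyc ρ) (proj₂ cyc ρ')))
          (trans (xsum-xor (pt v k) (pt u k)) (cong₂ _xor_ (xsum-pt v k) (xsum-pt u k)))) (xor-same k)))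
      where
      ρ' : Sub N
      ρ' = ins v (del u ρ)
      k : Bool
      k = K (ins v ρ)
      u∉ρ' : u ∉ ρ'
      u∉ρ' = ins-∉ u v (del u ρ) u≢v (mem-del-same u ρ)
      uρ' : ins u ρ' ≡ ins v ρ
      uρ' = trans (ins-comm u v (del u ρ)) (cong (ins v) (ins-del u ρ q))
      -- The cofaces of `ρ` and of its mirror image `ρ'` are counted together. The set
      -- `ρ + v = ρ' + u` covers both and is degenerate, so it is taken out twice.
      same : ∀ x → not (mem x ρ) ∧ Z (ins x ρ) ≡ (g ρ x xor g ρ' x) xor (pt v k x xor pt u k x)
      same x with x ≟ u
      ... | yes refl rewrite q | u∉ρ' | uρ' | pt-same u k | pt-other v k u≢v = sym (xor-same k)
      ... | no x≢u with x ≟ v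
      ...   | yes refl rewrite p | mem-ins-same v (del u ρ) | pt-same v k | pt-other u k v≢u | Z-v (ins v ρ) (mem-ins-same v ρ)
        | xor-identityʳ k = sym (xor-same k)
      ...   | no x≢v rewrite pt-other u k x≢u | pt-other v k x≢v
        | Z-u (ins x ρ) (ins-∉ v x ρ (λ e → x≢v (sym e)) p) (ins-⊒ x ρ u q)
        | del-ins-other u x ρ (λ e → x≢u (sym e)) | ins-comm v x (del u ρ)
        | mem-ins-other x v (del u ρ) x≢v | mem-del-other x u ρ x≢u with mem x ρ
      ...     | true = refl
      ...     | false = sym (xor-identityʳ _)

  -- A set containing `u` and `v` has no image, and every other set has at most one.
  size-push : ∀ F → u ∈ F → v ∈ F → K F ≡ true → size Z < size K
  size-push F p q k = ΣS-quad-mono-< (λ σ → b (Z σ)) (λ σ → b (K σ)) u v u≢v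
    (λ s p q → ≤-trans (half s p q) (+-monoʳ-≤ (b (K s) + b (K (ins u s))) (m≤m+n (b (K (ins v s))) _))) s₀
    s₀u s₀v (≤-trans (s≤s (half s₀ s₀u s₀v)) (≤-trans (≤-reflexive (sym (+-suc (b (K s₀) + b (K (ins u s₀))) (b (K (ins v s₀)))))) (+-monoʳ-≤ (b (K s₀) + b (K (ins u s₀))) last)))
    where
    b : Bool → ℕ
    b x = if x then 1 else 0
    s₀ : Sub N
    s₀ = del u (del v F)
    s₀u : u ∉ s₀
    s₀u = mem-del-same u (del v F)
    s₀v : v ∉ s₀
    s₀v = del-∉ v u (del v F) (mem-del-same v F)
    half : ∀ s → u ∉ s → v ∉ s → quad (λ σ → b (Z σ)) u v s ≤ (b (K s) + b (K (ins u s))) + b (K (ins v s))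
    half s a c rewrite Z-v (ins v s) (mem-ins-same v s) | Z-v (ins u (ins v s)) (ins-⊒ u (ins v s) v (mem-ins-same v s))
      | Z-o s c a | Z-ins-u s a c | +-identityʳ (b (K s) + b (K (ins u s) xor K (ins v s)))
      = ≤-trans (+-monoʳ-≤ (b (K s)) (bit-xor (K (ins u s)) (K (ins v s)))) (≤-reflexive (sym (+-assoc (b (K s)) _ _)))
    F≡ : ins u (ins v s₀) ≡ F
    F≡ = trans (ins-comm u v s₀) (trans (cong (ins v) (ins-del u (del v F) (del-in u v F u≢v p))) (ins-del v F q))
    last : suc (b (K (ins v s₀))) ≤ b (K (ins v s₀)) + b (K (ins u (ins v s₀)))
    last rewrite F≡ | k = ≤-reflexive (+-comm 1 _)

  -- A subcycle `M` of the image is lifted to `K`. A member of `M` that contains `u` comes from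
  -- exactly one of two sets, because `Z` is their sum modulo 2; `Co₀` consists of these lifts and
  -- of the members of `M` without `u`.
  module Pull (M : Cx N) (cycM : IsCycle d M) (M⊆ : ∀ σ → M σ ≡ true → Z σ ≡ true) where

    ren : Sub N → Sub N
    ren σ = if mem v σ then ins u (del v σ) else σ

    Co₀ : Cx N
    Co₀ σ = K σ ∧ (not (mem u σ ∧ mem v σ) ∧ M (ren σ))

    Co₀⊆ : ∀ σ → Co₀ σ ≡ true → K σ ≡ true
    Co₀⊆ σ p = proj₁ (∧-el p)

    Co₀-uv : ∀ σ → u ∈ σ → v ∈ σ → Co₀ σ ≡ false
    Co₀-uv σ p q rewrite p | q = ∧-zeroʳ (K σ)

    Co₀-∌v : ∀ σ → v ∉ σ → Co₀ σ ≡ K σ ∧ M σ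
    Co₀-∌v σ q rewrite q | ∧-zeroʳ (mem u σ) = refl

    Co₀-ins-v : ∀ s → u ∉ s → v ∉ s → Co₀ (ins v s) ≡ K (ins v s) ∧ M (ins u s)
    Co₀-ins-v s p q rewrite ins-∉ u v s u≢v p | mem-ins-same v s | del-ins v s q = refl

    M-v : ∀ σ → v ∈ σ → M σ ≡ false
    M-v σ p = falseI (λ m → t≢f (M⊆ σ m) (Z-v σ p))

    absorb : ∀ k m → (m ≡ true → k ≡ true) → k ∧ m ≡ m
    absorb k true h rewrite h refl = refl
    absorb k false h = ∧-zeroʳ k

    absorb₂ : ∀ a b m → (m ≡ true → a xor b ≡ true) → (a ∧ m) xor (b ∧ m) ≡ m
    absorb₂ true true true h = h refl
    absorb₂ true false true h = refl
    absorb₂ false true true h = refl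
    absorb₂ false false true h = h refl
    absorb₂ a b false h rewrite ∧-zeroʳ a | ∧-zeroʳ b = refl

    Co₀-o : ∀ s → u ∉ s → v ∉ s → Co₀ s ≡ M s
    Co₀-o s p q = trans (Co₀-∌v s q) (absorb (K s) (M s) (λ m → trans (sym (Z-o s q p)) (M⊆ s m)))

    Co₀-pair : ∀ s → u ∉ s → v ∉ s → Co₀ (ins v s) xor Co₀ (ins u s) ≡ M (ins u s)
    Co₀-pair s p q rewrite Co₀-ins-v s p q | Co₀-∌v (ins u s) (ins-∉ v u s v≢u q) =
      trans (xor-comm (K (ins v s) ∧ M (ins u s)) _)
        (absorb₂ (K (ins u s)) (K (ins v s)) (M (ins u s)) (λ m → trans (sym (Z-ins-u s p q)) (M⊆ (ins u s) m)))

    -- The facets R ∪ {u, v} that have to be added to Co₀ to turn it into a cycle.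
    yt : Sub N → Fin N → Bool
    yt R y = not (mem y R) ∧ (not (eqF y u) ∧ (not (eqF y v) ∧ Co₀ (ins y (ins u R))))

    Y : Sub N → Bool
    Y R = xsum (yt R)

    yt-u : ∀ R → yt R u ≡ false
    yt-u R rewrite eqF-refl u = ∧-zeroʳ (not (mem u R))

    yt-v : ∀ R → yt R v ≡ false
    yt-v R rewrite eqF-refl v | ∧-zeroʳ (not (eqF v u)) = ∧-zeroʳ (not (mem v R))

    yt-o : ∀ R x → x ≢ u → x ≢ v → yt R x ≡ not (mem x R) ∧ Co₀ (ins x (ins u R))
    yt-o R x h k rewrite eqF-≢ h | eqF-≢ k = refl

    module _ (R : Sub N) (u∉ : u ∉ R) (v∉ : v ∉ R) where

      ∂-u : ∂ Co₀ (ins u R) ≡ Y R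
      ∂-u = xsum-cong same
        where
        same : ∀ x → not (mem x (ins u R)) ∧ Co₀ (ins x (ins u R)) ≡ yt R x
        same x with x ≟ u
        ... | yes refl rewrite mem-ins-same u R = sym (yt-u R)
        ... | no x≢u with x ≟ v
        ...   | yes refl = trans (∧-falseʳ (not (mem v (ins u R))) (Co₀-uv (ins v (ins u R)) (ins-⊒ v _ u (mem-ins-same u R)) (mem-ins-same v _))) (sym (yt-v R))
        ...   | no x≢v = trans (cong (λ z → not z ∧ Co₀ (ins x (ins u R))) (mem-ins-other x u R x≢u)) (sym (yt-o R x x≢u x≢v))

      -- The cofaces of `R + u` and those of `R + v` in `Co₀` together lift the cofaces of `R + u`
      -- in `M`, whose number is even. So both parities equal `Y R`, and adding `R ∪ {u, v}` repairs
      -- both ridges at once.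
      ∂-v : ∂ Co₀ (ins v R) ≡ Y R
      ∂-v = begin
        ∂ Co₀ (ins v R) ≡⟨ sym (xor-identityʳ _) ⟩
        ∂ Co₀ (ins v R) xor false ≡⟨ cong (∂ Co₀ (ins v R) xor_) (sym (xor-same (Y R))) ⟩
        ∂ Co₀ (ins v R) xor (Y R xor Y R) ≡⟨ sym (xor-assoc (∂ Co₀ (ins v R)) (Y R) (Y R)) ⟩
        (∂ Co₀ (ins v R) xor Y R) xor Y R ≡⟨ cong (_xor Y R) (trans (sym (xsum-xor _ (yt R))) (trans (xsum-cong same) (proj₂ cycM (ins u R)))) ⟩
        Y R ∎
        where
        open ≡-Reasoning
        same : ∀ x → (not (mem x (ins v R)) ∧ Co₀ (ins x (ins v R))) xor yt R x ≡ not (mem x (ins u R)) ∧ M (ins x (ins u R))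
        same x with x ≟ u
        ... | yes refl rewrite yt-u R | mem-ins-same u R | Co₀-uv (ins u (ins v R)) (mem-ins-same u _) (ins-⊒ u _ v (mem-ins-same v R))
          | ∧-zeroʳ (not (mem u (ins v R))) = refl
        ... | no x≢u with x ≟ v
        ...   | yes refl rewrite yt-v R | mem-ins-same v R | M-v (ins v (ins u R)) (mem-ins-same v _) = sym (∧-zeroʳ _)
        ...   | no x≢v rewrite yt-o R x x≢u x≢v | mem-ins-other x v R x≢v | mem-ins-other x u R x≢u with decB (mem x R)
        ...     | inj₁ p rewrite p = refl
        ...     | inj₂ p rewrite p | ins-comm x v R | ins-comm x u R =
          Co₀-pair (ins x R) (ins-∉ u x R (λ e → x≢u (sym e)) u∉) (ins-∉ v x R (λ e → x≢v (sym e)) v∉)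

    ∂-o : ∀ ρ → u ∉ ρ → v ∉ ρ → ∂ Co₀ ρ ≡ false
    ∂-o ρ p q = trans (xsum-cong same) (trans (xsum-xor (λ x → g x xor pt u m x) _)
        (trans (cong₂ _xor_ (trans (xsum-xor g (pt u m)) (cong₂ _xor_ (proj₂ cycM ρ) (xsum-pt u m)))
          (trans (xsum-xor (pt u a) (pt v b)) (trans (cong₂ _xor_ (xsum-pt u a) (xsum-pt v b)) (trans (xor-comm a b) (Co₀-pair ρ p q)))))
        (xor-same m)))
      where
      g : Fin N → Bool
      g x = not (mem x ρ) ∧ M (ins x ρ)
      m a b : Bool
      m = M (ins u ρ)
      a = Co₀ (ins u ρ)
      b = Co₀ (ins v ρ)
      same : ∀ x → not (mem x ρ) ∧ Co₀ (ins x ρ) ≡ (g x xor pt u m x) xor (pt u a x xor pt v b x)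
      same x with x ≟ u
      ... | yes refl rewrite p | pt-same u m | pt-same u a | pt-other v b u≢v | xor-same m = sym (xor-identityʳ a)
      ... | no x≢u with x ≟ v
      ...   | yes refl rewrite q | pt-other u m v≢u | pt-other u a v≢u | pt-same v b | M-v (ins v ρ) (mem-ins-same v ρ) = refl
      ...   | no x≢v rewrite pt-other u m x≢u | pt-other u a x≢u | pt-other v b x≢v
        | Co₀-o (ins x ρ) (ins-∉ u x ρ (λ e → x≢u (sym e)) p) (ins-∉ v x ρ (λ e → x≢v (sym e)) q)
        = sym (trans (xor-identityʳ _) (xor-identityʳ _))

    Co₀-cycle : (∀ R → u ∉ R → v ∉ R → Y R ≡ false) → IsCycle d Co₀
    Co₀-cycle none = (λ σ p → proj₁ cyc σ (Co₀⊆ σ p)) , bdry-0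
      where
      bdry-0 : ∀ ρ → ∂ Co₀ ρ ≡ false
      bdry-0 ρ with decB (mem u ρ) | decB (mem v ρ)
      ... | inj₁ p | inj₁ q = xsum-0 (λ x → ∧-falseʳ (not (mem x ρ)) (Co₀-uv (ins x ρ) (ins-⊒ x ρ u p) (ins-⊒ x ρ v q)))
      ... | inj₂ p | inj₂ q = ∂-o ρ p q
      ... | inj₁ p | inj₂ q = subst (λ z → ∂ Co₀ z ≡ false) (ins-del u ρ p)
        (trans (∂-u (del u ρ) (mem-del-same u ρ) (del-∉ v u ρ q)) (none (del u ρ) (mem-del-same u ρ) (del-∉ v u ρ q)))
      ... | inj₂ p | inj₁ q = subst (λ z → ∂ Co₀ z ≡ false) (ins-del v ρ q)
        (trans (∂-v (del v ρ) (del-∉ u v ρ p) (mem-del-same v ρ)) (none (del v ρ) (del-∉ u v ρ p) (mem-del-same v ρ)))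

    adm : Sub N → Fin N → Bool
    adm t x = not (mem x t) ∧ (not (eqF x u) ∧ not (eqF x v))

    adm-el : ∀ t x → adm t x ≡ true → x ∉ t × x ≢ u × x ≢ v
    adm-el t x p = let a , b = ∧-el p ; b₁ , b₂ = ∧-el b in not-el a ,
      (λ e → t≢f (trans (cong (λ z → eqF z u) e) (eqF-refl u)) (not-el b₁)) ,
      (λ e → t≢f (trans (cong (λ z → eqF z v) e) (eqF-refl v)) (not-el b₂))

    -- On the vertices other than `u` and `v`, the chain `Y` is the boundary of the link of `u` in
    -- `Co₀`; so the claim is an instance of ∂∂ = 0.
    Y-cycle : ∀ t → xsum (λ x → adm t x ∧ Y (ins x t)) ≡ false
    Y-cycle t = trans (xsum-cong (λ x → trans (sym (xsum-∧ (adm t x) (yt (ins x t)))) (xsum-cong (same x)))) (xsum-sym h h-sym h-diag)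
      where
      h : Fin N → Fin N → Bool
      h x y = adm t x ∧ (adm t y ∧ (not (eqF x y) ∧ Co₀ (ins y (ins x (ins u t)))))
      h-diag : ∀ x → h x x ≡ false
      h-diag x rewrite eqF-refl x | ∧-zeroʳ (adm t x) = ∧-zeroʳ (adm t x)
      h-sym : ∀ x y → h x y ≡ h y x
      h-sym x y rewrite eqF-sym x y | ins-comm y x (ins u t) = ∧-swap (adm t x) (adm t y) _
      same : ∀ x y → adm t x ∧ yt (ins x t) y ≡ h x y
      same x y rewrite mem-ins y x t | eqF-sym y x | ins-comm u x t = shuffle (adm t x) (eqF x y) (mem y t) (eqF y u) (eqF y v) _
        where
        shuffle : ∀ a e m p q k → a ∧ (not (e ∨ m) ∧ (not p ∧ (not q ∧ k))) ≡ a ∧ ((not m ∧ (not p ∧ not q)) ∧ (not e ∧ k))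
        shuffle false _ _ _ _ _ = refl
        shuffle true true m p q k = sym (∧-zeroʳ (not m ∧ (not p ∧ not q)))
        shuffle true false true p q k = refl
        shuffle true false false true q k = refl
        shuffle true false false false true k = refl
        shuffle true false false false false k = refl

    Y-u : ∀ R → u ∉ R → v ∉ R → Y R ≡ true → ∃ λ y → y ∉ R × y ≢ u × y ≢ v × Co₀ (ins y (ins u R)) ≡ true
    Y-u R p q e with xsum-∃ (yt R) e
    ... | y , f = let a , b = ∧-el f ; b₁ , b₂ = ∧-el b ; c₁ , c₂ = ∧-el b₂ in y , not-el a ,
      (λ r → t≢f (trans (cong (λ z → eqF z u) r) (eqF-refl u)) (not-el b₁)) ,
      (λ r → t≢f (trans (cong (λ z → eqF z v) r) (eqF-refl v)) (not-el c₁)) , c₂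

    Y-v : ∀ R → u ∉ R → v ∉ R → Y R ≡ true → ∃ λ y → Co₀ (ins y (ins v R)) ≡ true
    Y-v R p q e with xsum-∃ (λ x → not (mem x (ins v R)) ∧ Co₀ (ins x (ins v R))) (trans (∂-v R p q) e)
    ... | y , f = y , proj₂ (∧-el {not (mem y (ins v R))} f)

-- Spanning the vertex set of a cycle

data Reach {n} (d : ℕ) (G : Graph (suc n)) : Sub (suc n) → Sub (suc n) → Set where
  stop : ∀ {I} → Reach d G I I
  grow : ∀ {I J} v → v ∉ I → Step d G I v → Reach d G (ins v I) J → Reach d G I J

reach-⊑ : ∀ {n d} {G : Graph (suc n)} {I J} → Reach d G I J → I ⊑ J
reach-⊑ stop x p = p
reach-⊑ {I = I} (grow v _ _ r) x p = reach-⊑ r x (ins-⊒ v I x p)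

reach-trans : ∀ {n d} {G : Graph (suc n)} {I J L} → Reach d G I J → Reach d G J L → Reach d G I L
reach-trans stop s = s
reach-trans (grow v v∉ st r) s = grow v v∉ st (reach-trans r s)

chain-≤ : ∀ x y z a b k → y + a ≤ x + b → z + b ≤ y + k → z + a ≤ x + k
chain-≤ x y z a b k p q = +-cancelʳ-≤ (y + b) _ _ (subst₂ _≤_ (e₁ y z a b) (e₂ x y b k) (+-mono-≤ p q))
  where
  open +-*-Solver
  e₁ : ∀ y z a b → (y + a) + (z + b) ≡ (z + a) + (y + b)
  e₁ = solve 4 (λ y z a b → (y :+ a) :+ (z :+ b) := (z :+ a) :+ (y :+ b)) refl
  e₂ : ∀ x y b k → (x + b) + (y + k) ≡ (x + k) + (y + b)
  e₂ = solve 4 (λ x y b k → (x :+ b) :+ (y :+ k) := (x :+ k) :+ (y :+ b)) refl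

chain-<ˡ : ∀ x y z a b k → y + a < x + b → z + b ≤ y + k → z + a < x + k
chain-<ˡ x y z a b k p q = subst (_≤ x + k) (+-suc z a) (chain-≤ x y z (suc a) b k (subst (_≤ x + b) (sym (+-suc y a)) p) q)

chain-<ʳ : ∀ x y z a b k → y + a ≤ x + b → z + b < y + k → z + a < x + k
chain-<ʳ x y z a b k p q = chain-≤ x y (suc z) a b k p q

module _ {n} (d : ℕ) (G : Graph (suc n)) (I J : Sub (suc n)) where

  -- The increase from `E G I` to `E G J` is at most one unit per added vertex, written without
  -- subtraction. `Good` remembers that a bound not known to be strict comes with a sequence of
  -- `Step`s.
  Cost≤ Cost< Good : Set
  Cost≤ = E G J + card I * unit n d ≤ E G I + card J * unit n d
  Cost< = E G J + card I * unit n d < E G I + card J * unit n d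
  Good = (Reach d G I J × Cost≤) ⊎ Cost<

good-≤ : ∀ {n d} {G : Graph (suc n)} {I J} → Good d G I J → Cost≤ d G I J
good-≤ (inj₁ (_ , p)) = p
good-≤ (inj₂ p) = <⇒≤ p

good-trans : ∀ {n d} {G : Graph (suc n)} {I J L} → Good d G I J → Good d G J L → Good d G I L
good-trans {G = G} {I} {J} {L} (inj₁ (r , p)) (inj₁ (s , q)) = inj₁ (reach-trans r s , chain-≤ (E G I) (E G J) (E G L) _ _ _ p q)
good-trans {G = G} {I} {J} {L} (inj₁ (r , p)) (inj₂ q) = inj₂ (chain-<ʳ (E G I) (E G J) (E G L) _ _ _ p q)
good-trans {G = G} {I} {J} {L} (inj₂ p) q = inj₂ (chain-<ˡ (E G I) (E G J) (E G L) _ _ _ p (good-≤ q))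

cost-ins : ∀ {n} d (I : Sub (suc n)) v → v ∉ I → ∀ a b → a ≤ b + unit n d → a + card I * unit n d ≤ b + card (ins v I) * unit n d
cost-ins {n} d I v v∉ a b p rewrite card-ins v I v∉ =
  ≤-trans (+-monoˡ-≤ (card I * unit n d) p) (≤-reflexive (+-assoc b (unit n d) _))

-- The field `new` ensures that the vertex isolated by a contraction is never among the added ones.
-- The subcycle `M` passes through the prescribed `Q`; in the link of a vertex, strong connectedness
-- then makes it contain all facets.
record Outcome {n} (d : ℕ) (G : Graph (suc n)) (I : Sub (suc n)) (K : Cx (suc n)) (Q : Sub (suc n)) : Set where
  field
    J : Sub (suc n)
    I⊑J : I ⊑ J
    new : ∀ x → x ∈ J → x ∉ I → ∃ λ y → adj G x y ≡ true
    good : Good d G I J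
    M : Cx (suc n)
    cycM : IsCycle d M
    M⊆K : ∀ σ → M σ ≡ true → K σ ≡ true
    MQ : M Q ≡ true
    M⊑J : ∀ σ → M σ ≡ true → σ ⊑ J

HasEdges : ∀ {N} → Graph N → Cx N → Set
HasEdges G K = ∀ σ → K σ ≡ true → ∀ x y → x ∈ σ → y ∈ σ → x ≢ y → adj G x y ≡ true

-- All neighbours of 0 are in the set from the start. An added vertex thus has no neighbour that is
-- always present, as the count of costs requires.
Rooted : ∀ {n} → Graph (suc n) → Sub (suc n) → Set
Rooted G I = fzero ∈ I × (∀ v → v ∉ I → adj G v fzero ≡ false)

rooted-⊑ : ∀ {n} {G : Graph (suc n)} {I J} → I ⊑ J → Rooted G I → Rooted G J
rooted-⊑ h (p , q) = h fzero p , λ v v∉ → q v (⊑-∉ v h v∉)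

nbr-mono : ∀ {N} {G G' : Graph N} {I I' v v'} → I ⊑ I' → (∀ y → y ∈ I → adj G v y ≡ true → adj G' v' y ≡ true) → nbr G I v ⊑ nbr G' I' v'
nbr-mono {G = G} {G'} {I} {I'} {v} {v'} h k y p = let a , b = filt-el y I (adj G v) p in filt-in y I' (adj G' v') (h y a) (k y a b)

add-one : ∀ {n} (d : ℕ) (G : Graph (suc n)) I v → v ∉ I → Rooted G I → d ≤ card (nbr G I v) → Good d G I (ins v I)
add-one d G I fzero v∉ (0∈ , _) _ = ⊥-elim (t≢f 0∈ v∉)
add-one d G I (fsuc i) v∉ (0∈ , far) h with AddCost.add-cost d G I i v∉ 0∈ (far (fsuc i) v∉) h
... | inj₁ (st , le) = inj₁ (grow (fsuc i) v∉ st stop , cost-ins d I (fsuc i) v∉ (E G (ins (fsuc i) I)) (E G I) le)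
... | inj₂ lt = inj₂ (cost-ins d I (fsuc i) v∉ (suc (E G (ins (fsuc i) I))) (E G I) lt)

Stuck : ∀ {n} → ℕ → Graph (suc n) → Sub (suc n) → Set
Stuck d G I = ∀ y → y ∉ I → card (nbr G I y) < d

module Contracting {n} (d : ℕ) (G : Graph (suc n)) (I : Sub (suc n)) (root : Rooted G I) (stuck : Stuck d G I)
  (i j : Fin n) (u∈I : fsuc i ∈ I) (v∉I : fsuc j ∉ I) (uv : adj G (fsuc i) (fsuc j) ≡ true) where

  u v : Fin (suc n)
  u = fsuc i
  v = fsuc j

  G' : Graph (suc n)
  G' = contract G u v

  u≢v : u ≢ v
  u≢v e = t≢f (subst (_∈ I) e u∈I) v∉I

  old-edge : ∀ x y → adj G' x y ≡ true → x ≢ u → y ≢ u → adj G x y ≡ true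
  old-edge x y e h k with proj₂ (proj₂ (contract-el G u v x y e))
  ... | inj₁ r = r
  ... | inj₂ (inj₁ (r , _)) = ⊥-elim (h r)
  ... | inj₂ (inj₂ (r , _)) = ⊥-elim (k r)

  root' : Rooted G' I
  root' = proj₁ root , far
    where
    far : ∀ w → w ∉ I → adj G' w fzero ≡ false
    far w w∉ = falseI (λ e → t≢f (old-edge w fzero e (λ { refl → t≢f u∈I w∉ }) (λ ())) (proj₂ root w w∉))

  module _ (J : Sub (suc n)) (I⊑J : I ⊑ J) (v∉J : v ∉ J) (D : Sub n)
    (D⊑ : ∀ k → k ∈ D → fsuc k ∈ J × adj G u (fsuc k) ≡ true × adj G v (fsuc k) ≡ true)
    (i∉D : i ∉ D) (cD : suc (card D) ≡ d) where

    private
      module CC = ContractCost d G J i j (I⊑J u u∈I) v∉J uv D D⊑ i∉D cD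

      glue-≤< : E G (ins v J) ≤ E G' J + unit n d → Cost< d G' I J → Cost< d G I (ins v J)
      glue-≤< p q = subst (E G (ins v J) + card I * unit n d <_) (cong (λ z → E G I + z * unit n d) (sym (card-ins v J v∉J)))
        (≤-trans (s≤s (+-monoˡ-≤ (card I * unit n d) p)) (subst (_≤ E G I + suc (card J) * unit n d) (e₁ (E G' J) (unit n d) (card I * unit n d))
          (≤-trans (+-monoˡ-≤ (unit n d) (≤-trans q (+-monoˡ-≤ (card J * unit n d) (contract-base G I u v v∉I)))) (≤-reflexive (e₂ (E G I) (card J * unit n d) (unit n d))))))
        where
        open +-*-Solver
        e₁ : ∀ a t k → suc (a + k) + t ≡ suc (a + t + k)
        e₁ = solve 3 (λ a t k → con 1 :+ (a :+ k) :+ t := con 1 :+ (a :+ t :+ k)) refl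
        e₂ : ∀ a k t → (a + k) + t ≡ a + (t + k)
        e₂ = solve 3 (λ a k t → (a :+ k) :+ t := a :+ (t :+ k)) refl

      glue-<≤ : E G (ins v J) < E G' J + unit n d → Cost≤ d G' I J → Cost< d G I (ins v J)
      glue-<≤ p q = subst (E G (ins v J) + card I * unit n d <_) (cong (λ z → E G I + z * unit n d) (sym (card-ins v J v∉J)))
        (≤-trans (+-monoˡ-≤ (card I * unit n d) p) (subst (_≤ E G I + suc (card J) * unit n d) (e₁ (E G' J) (unit n d) (card I * unit n d))
          (≤-trans (+-monoˡ-≤ (unit n d) (≤-trans q (+-monoˡ-≤ (card J * unit n d) (contract-base G I u v v∉I)))) (≤-reflexive (e₂ (E G I) (card J * unit n d) (unit n d))))))
        where
        open +-*-Solver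
        e₁ : ∀ a t k → (a + k) + t ≡ a + t + k
        e₁ = solve 3 (λ a t k → (a :+ k) :+ t := a :+ t :+ k) refl
        e₂ : ∀ a k t → (a + k) + t ≡ a + (t + k)
        e₂ = solve 3 (λ a k t → (a :+ k) :+ t := a :+ (t :+ k)) refl

      v-many : ∀ s → s ⊑ nbr G I v → ¬ (d ≤ card s)
      v-many s h k = <-irrefl refl (≤-trans (stuck v v∉I) (≤-trans k (card-mono h)))

    -- The first vertex y reached in G' already yields strictness: since it could not be added in G, it is adjacent
    -- to v but not to u, and a neighbour p of y joins it to u unless all its d neighbours are neighbours of v.
    contract-good : Good d G' I J → Cost< d G I (ins v J)
    contract-good (inj₂ lt) = glue-≤< CC.contract-≤ lt
    -- If nothing is added in the contraction, then `D` lies in `I` and gives `v`, together with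
    -- `u`, already `d` neighbours.
    contract-good (inj₁ (stop , le)) = ⊥-elim (v-many (ins u (false ∷ D)) sub (≤-reflexive (trans (sym cD) (sym (card-ins u (false ∷ D) i∉D)))))
      where
      sub : ins u (false ∷ D) ⊑ nbr G I v
      sub x p with ins-el x u (false ∷ D) p
      sub x p | inj₁ refl = filt-in u I (adj G v) u∈I (adj-sym G u v uv)
      sub (fsuc k) p | inj₂ q = filt-in (fsuc k) I (adj G v) (proj₁ (D⊑ k q)) (proj₂ (proj₂ (D⊑ k q)))
    contract-good (inj₁ (grow fzero y∉ _ _ , _)) = ⊥-elim (t≢f (proj₁ root) y∉)
    contract-good (inj₁ (grow (fsuc a) y∉ (deg , clique) r , le)) with searchF (λ p → mem p (nbr G' I (fsuc a)) ∧ (not (eqF p u) ∧ (not (mem p (false ∷ D)) ∧ (adj G p u ∨ (adj G p fzero ∧ adj G u fzero)))))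
    ... | inj₁ (p₀ , h) with ∧-el {mem p₀ (nbr G' I (fsuc a))} h
    ...   | h₁ , h₂ with ∧-el {not (eqF p₀ u)} h₂
    ...     | h₃ , h₄ with ∧-el {not (mem p₀ (false ∷ D))} h₄
    ...       | h₅ , h₆ = found p₀ h₁ (λ e → t≢f (trans (cong (λ z → eqF z u) e) (eqF-refl u)) (not-el h₃)) (not-el h₅) (∨-el h₆)
      where
      y : Fin (suc n)
      y = fsuc a
      y∈J : y ∈ J
      y∈J = reach-⊑ r y (mem-ins-same y I)
      y≢u : y ≢ u
      y≢u e = t≢f (subst (_∈ I) (sym e) u∈I) y∉
      not-all-old : ¬ (nbr G' I y ⊑ nbr G I y)
      not-all-old s = <-irrefl refl (≤-trans (stuck y y∉) (≤-trans (≤-reflexive (sym deg)) (card-mono s)))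
      y≁u : adj G y u ≡ false
      y≁u = falseI (λ e → not-all-old (nbr-mono {G = G'} {G} {I} {I} {y} {y} (λ _ q → q) (λ z z∈ f → keep z f e)))
        where
        keep : ∀ z → adj G' y z ≡ true → adj G y u ≡ true → adj G y z ≡ true
        keep z f e with z ≟ u
        ... | yes refl = e
        ... | no z≢u = old-edge y z f y≢u z≢u
      y~v : adj G v y ≡ true
      y~v with decB (adj G' y u)
      ... | inj₂ none = ⊥-elim (not-all-old (nbr-mono {G = G'} {G} {I} {I} {y} {y} (λ _ q → q)
              (λ z z∈ f → old-edge y z f y≢u (λ e → t≢f (subst (λ w → adj G' y w ≡ true) e f) none))))
      ... | inj₁ e with proj₂ (proj₂ (contract-el G u v y u e))
      ...   | inj₁ e' = ⊥-elim (t≢f e' y≁u)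
      ...   | inj₂ (inj₁ (e' , _)) = ⊥-elim (y≢u e')
      ...   | inj₂ (inj₂ (_ , e')) = adj-sym G y v e'
      found : ∀ p → p ∈ nbr G' I y → p ≢ u → p ∉ (false ∷ D) → adj G p u ≡ true ⊎ (adj G p fzero ∧ adj G u fzero) ≡ true → Cost< d G I (ins v J)
      found fzero p∈ _ _ _ = ⊥-elim (t≢f (proj₂ (filt-el fzero I (adj G' y) p∈)) (proj₂ root' y y∉))
      found (fsuc b) p∈ p≢u p∉D link = glue-<≤ (go link) le
        where
        p : Fin (suc n)
        p = fsuc b
        p∈I : p ∈ I
        p∈I = proj₁ (filt-el p I (adj G' y) p∈)
        y~p : adj G y p ≡ true
        y~p = old-edge y p (proj₂ (filt-el p I (adj G' y) p∈)) y≢u p≢u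
        -- With `y` and `p` present, the edge `py`, preceded by the edge from 0 to `p` if needed,
        -- connects a neighbour of `u` to the neighbour `y` of `v`, while `D` stays absent.
        W : Sub n
        W = ins a (single b)
        cutb : p ∈ cut J W
        cutb = cut-in J W b (ins-⊒ a (single b) b (mem-single-same b)) (I⊑J p p∈I)
        cuta : y ∈ cut J W
        cuta = cut-in J W a (mem-ins-same a (single b)) y∈J
        i∉W : i ∉ W
        i∉W = ins-∉ i a (single b) (λ e → y≢u (cong fsuc (sym e))) (mem-single-other i b (λ e → p≢u (cong fsuc (sym e))))
        j∉W : j ∉ W
        j∉W = ins-∉ j a (single b) (λ { refl → t≢f y∈J v∉J }) (mem-single-other j b (λ { refl → t≢f (I⊑J p p∈I) v∉J }))
        off : ∀ k → k ∈ W → k ∉ D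
        off k q with ins-el k a (single b) q
        ... | inj₁ refl = falseI (λ w → t≢f (adj-sym G u y (proj₁ (proj₂ (D⊑ a w)))) y≁u)
        ... | inj₂ w rewrite single-∈ k b w = p∉D
        go : adj G p u ≡ true ⊎ (adj G p fzero ∧ adj G u fzero) ≡ true → E G (ins v J) < E G' J + unit n d
        go (inj₁ e) = CC.contract-< W i∉W j∉W off p y (adj-sym G p u e) y~v (csym (cedge cuta cutb y~p))
        go (inj₂ e) = CC.contract-< W i∉W j∉W off fzero y (proj₂ (∧-el e)) y~v
          (ctrans (csym (cedge cutb (cut-0 J W (I⊑J fzero (proj₁ root))) (proj₁ (∧-el e)))) (csym (cedge cuta cutb y~p)))
    contract-good (inj₁ (grow (fsuc a) y∉ (deg , clique) r , le)) | inj₂ none = ⊥-elim (v-many (nbr G' I (fsuc a)) sub (≤-reflexive (sym deg)))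
      where
      y : Fin (suc n)
      y = fsuc a
      y≢u : y ≢ u
      y≢u e = t≢f (subst (_∈ I) (sym e) u∈I) y∉
      deg-u : u ∈ nbr G' I y ⊎ ¬ (u ∈ nbr G' I y)
      deg-u with decB (mem u (nbr G' I y))
      ... | inj₁ p = inj₁ p
      ... | inj₂ p = inj₂ (λ q → t≢f q p)
      u∈ : u ∈ nbr G' I y
      u∈ with deg-u
      ... | inj₁ p = p
      ... | inj₂ h = ⊥-elim (<-irrefl refl (≤-trans (stuck y y∉) (≤-trans (≤-reflexive (sym deg))
          (card-mono (nbr-mono {G = G'} {G} {I} {I} {y} {y} (λ _ q → q) (λ z z∈ f → old-edge y z f y≢u (λ { refl → h (filt-in u I (adj G' y) z∈ f) })))))))
      linked : ∀ p → p ∈ nbr G' I y → p ≢ u → adj G p u ∨ (adj G p fzero ∧ adj G u fzero) ≡ true → adj G v p ≡ true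
      linked p p∈ p≢u w with decB (mem p (false ∷ D))
      ... | inj₂ q = ⊥-elim (t≢f (∧-in p∈ (∧-in (not-in (eqF-≢ p≢u)) (∧-in (not-in q) w))) (none p))
      linked (fsuc k) p∈ p≢u w | inj₁ q = proj₂ (proj₂ (D⊑ k q))
      sub : nbr G' I y ⊑ nbr G I v
      sub p p∈ = filt-in p I (adj G v) (proj₁ (filt-el p I (adj G' y) p∈)) go
        where
        go : adj G v p ≡ true
        go with p ≟ u
        ... | yes refl = adj-sym G u v uv
        ... | no p≢u with ∨-el {adj G' p u} (clique p u p∈ u∈ p≢u)
        ...   | inj₁ e with proj₂ (proj₂ (contract-el G u v p u e))
        ...     | inj₁ e' = linked p p∈ p≢u (∨-inˡ _ e')
        ...     | inj₂ (inj₁ (e' , _)) = ⊥-elim (p≢u e')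
        ...     | inj₂ (inj₂ (_ , e')) = adj-sym G p v e'
        go | no p≢u | inj₂ e = linked p p∈ p≢u (∨-inʳ (adj G p u) (∧-in (old-edge p fzero (proj₁ (∧-el e)) p≢u (λ ())) u~0))
          where
          u~0 : adj G u fzero ≡ true
          u~0 with proj₂ (proj₂ (contract-el G u v u fzero (proj₂ (∧-el {adj G' p fzero} e))))
          ... | inj₁ e' = e'
          ... | inj₂ (inj₁ (_ , e')) = ⊥-elim (t≢f e' (proj₂ root v v∉I))
          ... | inj₂ (inj₂ (() , _))

card-< : ∀ {n} {s t : Sub n} → s ⊑ t → ∀ x → x ∈ t → x ∉ s → card s < card t
card-< {s = s} {t} h x p q = subst (_≤ card t) (card-ins x s q) (card-mono (ins-⊑ x h p))

module Spanning {n : ℕ} (d : ℕ) (3≤d : 3 ≤ d) where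

  -- The induction is on the number of vertices outside `I` plus the size of the cycle: additions
  -- lower the former, contractions and lifts the latter.
  Spannable : ℕ → Set
  Spannable f = ∀ (G : Graph (suc n)) I K Q → IsCycle d K → HasEdges G K → K Q ≡ true → Q ⊑ I → Rooted G I
    → (suc n ∸ card I) + size K < f → Outcome d G I K Q

  measure : ∀ {I J : Sub (suc n)} (K : Cx (suc n)) → I ⊑ J → ∀ x → x ∈ J → x ∉ I → (suc n ∸ card J) + size K < (suc n ∸ card I) + size K
  measure {I} {J} K h x p q = +-monoˡ-< (size K) (∸-monoʳ-< (card-< h x p q) (card-bound J))

  -- J is spanned first, and then K from there.
  continue : ∀ {f} → Spannable f → ∀ G I K Q → IsCycle d K → HasEdges G K → K Q ≡ true → Q ⊑ I → Rooted G I
    → (suc n ∸ card I) + size K < suc f → ∀ J → I ⊑ J → ∀ x → x ∈ J → x ∉ I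
    → (∀ x → x ∈ J → x ∉ I → ∃ λ y → adj G x y ≡ true) → Good d G I J → Outcome d G I K Q
  continue ih G I K Q cyc edges KQ Q⊑ root lt J I⊑J x x∈ x∉ new good =
    prefix (ih G J K Q cyc edges KQ (λ y p → I⊑J y (Q⊑ y p)) (rooted-⊑ {G = G} I⊑J root)
      (≤-trans (measure K I⊑J x x∈ x∉) (≤-pred lt)))
    where
    prefix : Outcome d G J K Q → Outcome d G I K Q
    prefix o = record
      { J = O.J ; I⊑J = λ y p → O.I⊑J y (I⊑J y p)
      ; new = new'
      ; good = good-trans good O.good
      ; M = O.M ; cycM = O.cycM ; M⊆K = O.M⊆K ; MQ = O.MQ ; M⊑J = O.M⊑J }
      where
      module O = Outcome o
      new' : ∀ y → y ∈ O.J → y ∉ I → ∃ λ z → adj G y z ≡ true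
      new' y p q with decB (mem y J)
      ... | inj₁ r = new y r q
      ... | inj₂ r = O.new y p r

  module Stalled {f} (ih : Spannable f) (G : Graph (suc n)) (I : Sub (suc n)) (K : Cx (suc n)) (Q : Sub (suc n))
    (cyc : IsCycle d K) (edges : HasEdges G K) (KQ : K Q ≡ true) (Q⊑ : Q ⊑ I) (root : Rooted G I)
    (lt : (suc n ∸ card I) + size K < suc f) (stuck : Stuck d G I)
    (i j : Fin n) (u∈I : fsuc i ∈ I) (v∉I : fsuc j ∉ I) (F₀ : Sub (suc n)) (KF₀ : K F₀ ≡ true) (u∈F : fsuc i ∈ F₀) (v∈F : fsuc j ∈ F₀) where

    u v : Fin (suc n)
    u = fsuc i
    v = fsuc j

    u≢v : u ≢ v
    u≢v e = t≢f (subst (_∈ I) e u∈I) v∉I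

    uv : adj G u v ≡ true
    uv = edges F₀ KF₀ u v u∈F v∈F u≢v

    module P = Push u v u≢v d K cyc
    module B = Contracting d G I root stuck i j u∈I v∉I uv

    Z-edges : HasEdges B.G' P.Z
    Z-edges σ z x y x∈ y∈ x≢y with decB (mem v σ)
    ... | inj₁ p = ⊥-elim (t≢f z (P.Z-v σ p))
    ... | inj₂ p with decB (mem u σ)
    ...   | inj₂ q = contract-old G u v x y (∉⇒≢ σ x v x∈ p) (∉⇒≢ σ y v y∈ p) (edges σ (trans (sym (P.Z-o σ p q)) z) x y x∈ y∈ x≢y)
    ...   | inj₁ q with xor-el {K σ} (trans (sym (P.Z-u σ p q)) z)
    ...     | inj₁ k = contract-old G u v x y (∉⇒≢ σ x v x∈ p) (∉⇒≢ σ y v y∈ p) (edges σ k x y x∈ y∈ x≢y)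
    ...     | inj₂ k = go
      where
      σ' : Sub (suc n)
      σ' = ins v (del u σ)
      moved : ∀ w → w ∈ σ → w ≢ u → w ∈ σ'
      moved w w∈ h = ins-⊒ v (del u σ) w (del-in w u σ h w∈)
      via-v : ∀ w → w ∈ σ → w ≢ u → adj G v w ≡ true
      via-v w w∈ h = edges σ' k v w (mem-ins-same v (del u σ)) (moved w w∈ h) (λ e → ∉⇒≢ σ w v w∈ p (sym e))
      go : adj B.G' x y ≡ true
      go with x ≟ u | y ≟ u
      ... | yes refl | yes refl = ⊥-elim (x≢y refl)
      ... | yes refl | no y≢u = contract-new G u v y u≢v (∉⇒≢ σ y v y∈ p) (via-v y y∈ y≢u)
      ... | no x≢u | yes refl = adj-sym B.G' u x (contract-new G u v x u≢v (∉⇒≢ σ x v x∈ p) (via-v x x∈ x≢u))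
      ... | no x≢u | no y≢u = contract-old G u v x y (∉⇒≢ σ x v x∈ p) (∉⇒≢ σ y v y∈ p) (edges σ' k x y (moved x x∈ x≢u) (moved y y∈ y≢u) x≢y)

    v∉Q : v ∉ Q
    v∉Q = ⊑-∉ v Q⊑ v∉I

    -- The set `Q` survives the contraction: if the mirror image of `Q` were also in `K`, then `v`
    -- would be adjacent to all `d` vertices of `Q`, and `I` would not be stuck.
    ZQ : P.Z Q ≡ true
    ZQ with decB (mem u Q)
    ... | inj₂ q = trans (P.Z-o Q v∉Q q) KQ
    ... | inj₁ q = trans (P.Z-u Q v∉Q q) (cong₂ _xor_ KQ (falseI no-swap))
      where
      no-swap : ¬ (K (ins v (del u Q)) ≡ true)
      no-swap k = <-irrefl refl (≤-trans (stuck v v∉I) (≤-trans (≤-reflexive (sym (proj₁ cyc Q KQ))) (card-mono sub)))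
        where
        sub : Q ⊑ nbr G I v
        sub x x∈ = filt-in x I (adj G v) (Q⊑ x x∈) edge
          where
          edge : adj G v x ≡ true
          edge with x ≟ u
          ... | yes refl = adj-sym G u v uv
          ... | no x≢u = edges (ins v (del u Q)) k v x (mem-ins-same v (del u Q)) (ins-⊒ v (del u Q) x (del-in x u Q x≢u x∈)) (λ e → ∉⇒≢ Q x v x∈ v∉Q (sym e))

    module After (o : Outcome d B.G' I P.Z Q) where

      module O = Outcome o

      module L = P.Pull O.M O.cycM O.M⊆K

      v∉J : v ∉ O.J
      v∉J = falseI λ p → let y , e = O.new v p v∉I in proj₁ (contract-el G u v v y e) refl

      -- If no facet is missing, the lift is a cycle through `Q`. It is smaller than `K`, because
      -- `F₀` contains both `u` and `v`.
      pulled : (∀ R → u ∉ R → v ∉ R → L.Y R ≡ false) → Outcome d G I K Q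
      pulled none = widen (ih G I L.Co₀ Q (L.Co₀-cycle none) (λ σ p → edges σ (L.Co₀⊆ σ p))
          (trans (L.Co₀-∌v Q v∉Q) (∧-in KQ O.MQ)) Q⊑ root
          (≤-trans (+-monoʳ-< (suc n ∸ card I) (size-< L.Co₀ K L.Co₀⊆ F₀ (L.Co₀-uv F₀ u∈F v∈F) KF₀)) (≤-pred lt)))
        where
        widen : Outcome d G I L.Co₀ Q → Outcome d G I K Q
        widen o' = record { J = O'.J ; I⊑J = O'.I⊑J ; new = O'.new ; good = O'.good ; M = O'.M ; cycM = O'.cycM
            ; M⊆K = λ σ m → L.Co₀⊆ σ (O'.M⊆K σ m) ; MQ = O'.MQ ; M⊑J = O'.M⊑J }
          where module O' = Outcome o'

      -- An odd `Y R` supplies a set of `Co₀` over `R + u` and one over `R + v`, and these give the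
      -- edges. The former omits `v`, hence belongs to `M` and lies in the spanned set.
      common : ∀ R → u ∉ R → v ∉ R → L.Y R ≡ true → ∀ k → k ∈ R → k ∈ O.J × adj G u k ≡ true × adj G v k ≡ true
      common R u∉ v∉ YR k k∈ with L.Y-u R u∉ v∉ YR | L.Y-v R u∉ v∉ YR
      ... | y , _ , _ , y≢v , e | y' , e' =
        O.M⊑J τ (proj₂ (∧-el {K τ} (trans (sym (L.Co₀-∌v τ v∉τ)) e))) k k∈τ ,
        edges τ (L.Co₀⊆ τ e) u k (ins-⊒ y (ins u R) u (mem-ins-same u R)) k∈τ (λ { refl → t≢f k∈ u∉ }) ,
        edges (ins y' (ins v R)) (L.Co₀⊆ (ins y' (ins v R)) e') v k (ins-⊒ y' (ins v R) v (mem-ins-same v R)) (ins-⊒ y' (ins v R) k (ins-⊒ v R k k∈)) (λ { refl → t≢f k∈ v∉ })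
        where
        τ : Sub (suc n)
        τ = ins y (ins u R)
        v∉τ : v ∉ τ
        v∉τ = ins-∉ v y (ins u R) (λ q → y≢v (sym q)) (ins-∉ v u R (λ q → u≢v (sym q)) v∉)
        k∈τ : k ∈ τ
        k∈τ = ins-⊒ y (ins u R) k (ins-⊒ u R k k∈)

      advance : ∀ D → (∀ k → k ∈ D → k ∈ O.J × adj G u k ≡ true × adj G v k ≡ true) → u ∉ D → suc (card D) ≡ d → Outcome d G I K Q
      advance (true ∷ D) h _ _ = ⊥-elim (t≢f (proj₂ (proj₂ (h fzero refl))) (proj₂ root v v∉I))
      advance (false ∷ D) h u∉ cD = continue ih G I K Q cyc edges KQ Q⊑ root lt (ins v O.J) (λ y p → ins-⊒ v O.J y (O.I⊑J y p))
          v (mem-ins-same v O.J) v∉I new (inj₂ (B.contract-good O.J O.I⊑J v∉J D (λ k → h (fsuc k)) u∉ cD O.good))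
        where
        new : ∀ x → x ∈ ins v O.J → x ∉ I → ∃ λ y → adj G x y ≡ true
        new x p q with ins-el x v O.J p
        ... | inj₁ refl = u , adj-sym G u v uv
        ... | inj₂ r with O.new x r q
        ...   | y , e with proj₂ (proj₂ (contract-el G u v x y e))
        ...     | inj₁ e' = y , e'
        ...     | inj₂ (inj₁ (refl , _)) = v , uv
        ...     | inj₂ (inj₂ (_ , e')) = v , e'

      glued : ∀ R → u ∉ R → v ∉ R → L.Y R ≡ true → Outcome d G I K Q
      glued R u∉ v∉ YR with L.Y-u R u∉ v∉ YR
      ... | y , y∉R , y≢u , y≢v , e = go
        where
        cardR : suc (suc (card R)) ≡ d
        cardR = trans (sym (trans (card-ins y (ins u R) (ins-∉ y u R y≢u y∉R)) (cong suc (card-ins u R u∉)))) (proj₁ cyc (ins y (ins u R)) (L.Co₀⊆ (ins y (ins u R)) e))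
        -- As `R` has `d - 2` elements, `d ≥ 3` makes it nonempty. Since `Y` is a cycle, some `r` in
        -- `R` can be exchanged for another `x`, and `R + x` then consists of `d - 1` common
        -- neighbours of `u` and `v`.
        1≤R : 1 ≤ card R
        1≤R = ≤-pred (≤-pred (subst (3 ≤_) (sym cardR) 3≤d))
        go : Outcome d G I K Q
        go with inhabited R 1≤R
        ... | r , r∈ with xsum-other (λ x → L.adm (del r R) x ∧ L.Y (ins x (del r R))) (L.Y-cycle (del r R)) r
                (∧-in (∧-in (not-in (mem-del-same r R)) (∧-in (not-in (eqF-≢ (∉⇒≢ R r u r∈ u∉))) (not-in (eqF-≢ (∉⇒≢ R r v r∈ v∉)))))
                  (trans (cong L.Y (ins-del r R r∈)) YR))
        ...   | x , x≢r , h with ∧-el {L.adm (del r R) x} h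
        ...     | ad , Yx with L.adm-el (del r R) x ad
        ...       | x∉ , x≢u , x≢v = advance (ins x R) com (ins-∉ u x R (λ q → x≢u (sym q)) u∉) (trans (cong suc (card-ins x R x∉R)) cardR)
          where
          x∉R : x ∉ R
          x∉R = falseI (λ p → t≢f (del-in x r R x≢r p) x∉)
          R' : Sub (suc n)
          R' = ins x (del r R)
          com : ∀ k → k ∈ ins x R → k ∈ O.J × adj G u k ≡ true × adj G v k ≡ true
          com k k∈ with ins-el k x R k∈
          ... | inj₂ q = common R u∉ v∉ YR k q
          ... | inj₁ refl = common R' (ins-∉ u x (del r R) (λ q → x≢u (sym q)) (del-∉ u r R u∉)) (ins-∉ v x (del r R) (λ q → x≢v (sym q)) (del-∉ v r R v∉))
            Yx k (mem-ins-same k (del r R))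

      outcome : Outcome d G I K Q
      outcome with searchS (λ R → not (mem u R) ∧ (not (mem v R) ∧ L.Y R))
      ... | inj₁ (R , h) = let a , b = ∧-el {not (mem u R)} h ; b₁ , b₂ = ∧-el {not (mem v R)} b in glued R (not-el a) (not-el b₁) b₂
      ... | inj₂ h = pulled (λ R p q → falseI (λ r → t≢f (∧-in (not-in p) (∧-in (not-in q) r)) (h R)))

    outcome : Outcome d G I K Q
    outcome = After.outcome (ih B.G' I P.Z Q P.Z-cycle Z-edges ZQ Q⊑ B.root'
      (≤-trans (+-monoʳ-< (suc n ∸ card I) (P.size-push F₀ u∈F v∈F KF₀)) (≤-pred lt)))

  span : ∀ f → Spannable f
  span zero G I K Q _ _ _ _ _ ()
  span (suc f) G I K Q cyc edges KQ Q⊑ root lt with searchF (λ y → not (mem y I) ∧ (d ≤ᵇ card (nbr G I y)))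
  ... | inj₁ (y , h) with ∧-el {not (mem y I)} h
  ...   | h₁ , h₂ = continue (span f) G I K Q cyc edges KQ Q⊑ root lt (ins y I) (ins-⊒ y I) y (mem-ins-same y I) (not-el h₁) new
      (add-one d G I y (not-el h₁) root (leᵇ⇒ h₂))
    where
    new : ∀ x → x ∈ ins y I → x ∉ I → ∃ λ z → adj G x z ≡ true
    new x p q with ins-el x y I p
    ... | inj₂ r = ⊥-elim (t≢f r q)
    ... | inj₁ refl = let z , z∈ = inhabited (nbr G I y) (≤-trans (≤-trans (s≤s z≤n) 3≤d) (leᵇ⇒ h₂)) in z , proj₂ (filt-el z I (adj G y) z∈)
  span (suc f) G I K Q cyc edges KQ Q⊑ root lt | inj₂ none with searchS (∂ (λ σ → K σ ∧ (σ ⊆ᵇ I)))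
  ... | inj₂ closed = record { J = I ; I⊑J = λ _ p → p ; new = λ x p q → ⊥-elim (t≢f p q) ; good = inj₁ (stop , ≤-refl)
      ; M = λ σ → K σ ∧ (σ ⊆ᵇ I) ; cycM = (λ σ p → proj₁ cyc σ (proj₁ (∧-el p))) , closed ; M⊆K = λ σ p → proj₁ (∧-el p)
      ; MQ = ∧-in KQ (⇒⊆ᵇ Q⊑) ; M⊑J = λ σ p → ⊆ᵇ⇒ (proj₂ (∧-el {K σ} p)) }
  -- The set `ρ` has an odd number of cofaces inside `I` but an even number in `K`; so one of them
  -- adds a vertex `v` outside `I`.
  ... | inj₁ (ρ , odd) with xsum-∃ (λ x → not (mem x ρ) ∧ (K (ins x ρ) ∧ (ins x ρ ⊆ᵇ I))) odd | xsum-∃ (λ x → (not (mem x ρ) ∧ K (ins x ρ)) xor (not (mem x ρ) ∧ (K (ins x ρ) ∧ (ins x ρ ⊆ᵇ I))))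
        (trans (xsum-xor (λ x → not (mem x ρ) ∧ K (ins x ρ)) (λ x → not (mem x ρ) ∧ (K (ins x ρ) ∧ (ins x ρ ⊆ᵇ I)))) (cong₂ _xor_ (proj₂ cyc ρ) odd))
  ...   | x , p | v , q = go v v∉ρ Kv v∉I
    where
    KA : K (ins x ρ) ∧ (ins x ρ ⊆ᵇ I) ≡ true
    KA = proj₂ (∧-el {not (mem x ρ)} p)
    ρ⊑I : ρ ⊑ I
    ρ⊑I y y∈ = ⊆ᵇ⇒ (proj₂ (∧-el {K (ins x ρ)} KA)) y (ins-⊒ x ρ y y∈)
    split : ∀ a b k → (a ∧ b) xor (a ∧ (b ∧ k)) ≡ true → a ≡ true × b ≡ true × k ≡ false
    split true true false _ = refl , refl , refl
    v∉ρ : v ∉ ρ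
    v∉ρ = not-el (proj₁ (split (not (mem v ρ)) (K (ins v ρ)) _ q))
    Kv : K (ins v ρ) ≡ true
    Kv = proj₁ (proj₂ (split (not (mem v ρ)) (K (ins v ρ)) _ q))
    v∉I : v ∉ I
    v∉I = falseI (λ r → t≢f (⇒⊆ᵇ (ins-⊑ v ρ⊑I r)) (proj₂ (proj₂ (split (not (mem v ρ)) (K (ins v ρ)) _ q))))
    1≤ρ : 1 ≤ card ρ
    1≤ρ = ≤-pred (≤-trans (≤-trans (s≤s (s≤s z≤n)) 3≤d) (≤-reflexive (trans (sym (proj₁ cyc (ins v ρ) Kv)) (card-ins v ρ v∉ρ))))
    stuck : Stuck d G I
    stuck y y∉ = ≰⇒> (λ le → t≢f (∧-in (not-in y∉) (⇒leᵇ le)) (none y))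
    go : ∀ v → v ∉ ρ → K (ins v ρ) ≡ true → v ∉ I → Outcome d G I K Q
    go fzero _ _ z∉ = ⊥-elim (t≢f (proj₁ root) z∉)
    go (fsuc j) j∉ Kj v∉I with inhabited ρ 1≤ρ
    ... | fzero , 0∈ = ⊥-elim (t≢f (edges (ins (fsuc j) ρ) Kj (fsuc j) fzero (mem-ins-same (fsuc j) ρ) (ins-⊒ (fsuc j) ρ fzero 0∈) (λ ())) (proj₂ root (fsuc j) v∉I))
    ... | fsuc i , u∈ = Stalled.outcome (span f) G I K Q cyc edges KQ Q⊑ root lt stuck i j (ρ⊑I (fsuc i) u∈) v∉I (ins (fsuc j) ρ) Kj
      (ins-⊒ (fsuc j) ρ (fsuc i) u∈) (mem-ins-same (fsuc j) ρ)

-- Counting faces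

fold-++ : ∀ {a b} {A : Set a} {B : Set b} (_∙_ : B → B → B) ε → (∀ x y z → (x ∙ y) ∙ z ≡ x ∙ (y ∙ z)) → (∀ x → ε ∙ x ≡ x)
  → (h : A → B) → ∀ xs ys → foldr (λ σ acc → h σ ∙ acc) ε (xs ++ ys) ≡ (foldr (λ σ acc → h σ ∙ acc) ε xs ∙ foldr (λ σ acc → h σ ∙ acc) ε ys)
fold-++ _∙_ ε assoc idˡ h [] ys = sym (idˡ _)
fold-++ _∙_ ε assoc idˡ h (x ∷ xs) ys = trans (cong (h x ∙_) (fold-++ _∙_ ε assoc idˡ h xs ys)) (sym (assoc (h x) _ _))

-- Stated for an arbitrary associative operation with a left unit, since it is applied to sums,
-- disjunctions and maxima.
fold-allSubs : ∀ {b} {B : Set b} (_∙_ : B → B → B) ε → (∀ x y z → (x ∙ y) ∙ z ≡ x ∙ (y ∙ z)) → (∀ x → ε ∙ x ≡ x)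
  → ∀ {n} (h : Sub (suc n) → B) → foldr (λ σ acc → h σ ∙ acc) ε (allSubs (suc n))
    ≡ (foldr (λ σ acc → h (false ∷ σ) ∙ acc) ε (allSubs n) ∙ foldr (λ σ acc → h (true ∷ σ) ∙ acc) ε (allSubs n))
fold-allSubs _∙_ ε assoc idˡ {n} h = trans (fold-++ _∙_ ε assoc idˡ h (mapL (false ∷_) (allSubs n)) _)
  (cong₂ _∙_ (fold-map (false ∷_) (allSubs n)) (fold-map (true ∷_) (allSubs n)))
  where
  fold-map : ∀ (f : Sub n → Sub (suc n)) xs → foldr (λ σ acc → h σ ∙ acc) ε (mapL f xs) ≡ foldr (λ σ acc → h (f σ) ∙ acc) ε xs
  fold-map f [] = refl
  fold-map f (x ∷ xs) = cong (h (f x) ∙_) (fold-map f xs)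

bit : Bool → ℕ
bit b = if b then 1 else 0

countB-ΣS : ∀ {n} (P : Sub n → Bool) → countB P ≡ ΣS (λ σ → bit (P σ))
countB-ΣS {n} P = trans (as-sum (allSubs n)) (sum-ΣS n (λ σ → bit (P σ)))
  where
  as-sum : ∀ xs → foldr (λ σ acc → if P σ then suc acc else acc) 0 xs ≡ foldr (λ σ acc → bit (P σ) + acc) 0 xs
  as-sum [] = refl
  as-sum (x ∷ xs) with P x
  ... | true = cong suc (as-sum xs)
  ... | false = as-sum xs
  sum-ΣS : ∀ m (h : Sub m → ℕ) → foldr (λ σ acc → h σ + acc) 0 (allSubs m) ≡ ΣS h
  sum-ΣS zero h = +-identityʳ _
  sum-ΣS (suc m) h = trans (fold-allSubs _+_ 0 +-assoc (λ _ → refl) h)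
    (trans (cong₂ _+_ (sum-ΣS m (λ s → h (false ∷ s))) (sum-ΣS m (λ s → h (true ∷ s)))) (+-comm (ΣS (λ s → h (false ∷ s))) _))

anyB-suc : ∀ {n} (P : Sub (suc n) → Bool) → anyB P ≡ anyB (λ s → P (false ∷ s)) ∨ anyB (λ s → P (true ∷ s))
anyB-suc P = fold-allSubs _∨_ false ∨-assoc (λ _ → refl) P

anyB-el : ∀ {n} (P : Sub n → Bool) → anyB P ≡ true → ∃ λ σ → P σ ≡ true
anyB-el {zero} P h with ∨-el {P []} h
... | inj₁ p = [] , p
anyB-el {suc n} P h with ∨-el {anyB (λ s → P (false ∷ s))} (trans (sym (anyB-suc P)) h)
... | inj₁ p = let s , q = anyB-el (λ s → P (false ∷ s)) p in false ∷ s , q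
... | inj₂ p = let s , q = anyB-el (λ s → P (true ∷ s)) p in true ∷ s , q

anyB-in : ∀ {n} (P : Sub n → Bool) σ → P σ ≡ true → anyB P ≡ true
anyB-in P [] p = ∨-inˡ _ p
anyB-in P (false ∷ s) p = trans (anyB-suc P) (∨-inˡ _ (anyB-in (λ s → P (false ∷ s)) s p))
anyB-in P (true ∷ s) p = trans (anyB-suc P) (∨-inʳ (anyB (λ s → P (false ∷ s))) (anyB-in (λ s → P (true ∷ s)) s p))

ΣF : ∀ {n} → (Fin n → ℕ) → ℕ
ΣF {zero} f = 0
ΣF {suc n} f = f fzero + ΣF (λ i → f (fsuc i))

ΣF-cong : ∀ {n} {f g : Fin n → ℕ} → (∀ x → f x ≡ g x) → ΣF f ≡ ΣF g
ΣF-cong {zero} h = refl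
ΣF-cong {suc n} h = cong₂ _+_ (h fzero) (ΣF-cong (λ i → h (fsuc i)))

ΣF-0 : ∀ {n} {f : Fin n → ℕ} → (∀ x → f x ≡ 0) → ΣF f ≡ 0
ΣF-0 {zero} h = refl
ΣF-0 {suc n} h = cong₂ _+_ (h fzero) (ΣF-0 (λ i → h (fsuc i)))

ΣF-card : ∀ {n} (P : Fin n → Bool) → ΣF (λ x → bit (P x)) ≡ card (tab P)
ΣF-card {zero} P = refl
ΣF-card {suc n} P with P fzero
... | true = cong suc (ΣF-card (λ i → P (fsuc i)))
... | false = ΣF-card (λ i → P (fsuc i))

ΣS-exact : ∀ {n} (ρ : Sub n) (g : Sub n → ℕ) → ΣS (λ σ → if (ρ ⊆ᵇ σ) ∧ (card σ ≡ᵇ card ρ) then g σ else 0) ≡ g ρ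
ΣS-exact [] g = refl
ΣS-exact {suc n} (true ∷ ρ) g = trans (cong₂ _+_ (ΣS-exact ρ (λ s → g (true ∷ s))) (ΣS-0 {n} (λ _ → refl))) (+-identityʳ _)
ΣS-exact {suc n} (false ∷ ρ) g = cong₂ _+_ (ΣS-0 {n} none) (ΣS-exact ρ (λ s → g (false ∷ s)))
  where
  none : ∀ s → (if (ρ ⊆ᵇ s) ∧ (suc (card s) ≡ᵇ card ρ) then g (true ∷ s) else 0) ≡ 0
  none s with decB ((ρ ⊆ᵇ s) ∧ (suc (card s) ≡ᵇ card ρ))
  ... | inj₂ q rewrite q = refl
  ... | inj₁ q = let a , b = ∧-el {ρ ⊆ᵇ s} q in
    ⊥-elim (<-irrefl refl (≤-trans (≤-reflexive (eqᵇ⇒ {suc (card s)} b)) (card-mono {s = ρ} {s} (⊆ᵇ⇒ {s = ρ} a))))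

ΣS-cover : ∀ {n} (ρ : Sub n) (g : Sub n → ℕ) → ΣS (λ σ → if (ρ ⊆ᵇ σ) ∧ (card σ ≡ᵇ suc (card ρ)) then g σ else 0)
  ≡ ΣF (λ x → if mem x ρ then 0 else g (ins x ρ))
ΣS-cover [] g = refl
ΣS-cover {suc n} (true ∷ ρ) g = trans (cong₂ _+_ (ΣS-cover ρ (λ s → g (true ∷ s))) (ΣS-0 {n} (λ _ → refl))) (+-identityʳ _)
ΣS-cover (false ∷ ρ) g = cong₂ _+_ (trans (ΣS-exact ρ (λ s → g (true ∷ s))) (cong (λ s → g (true ∷ s)) (sym (∪-empty ρ)))) (ΣS-cover ρ (λ s → g (false ∷ s)))

parity : ℕ → Bool
parity zero = false
parity (suc n) = not (parity n)

xsum-parity : ∀ {n} (P : Fin n → Bool) → xsum P ≡ parity (card (tab P))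
xsum-parity {zero} P = refl
xsum-parity {suc n} P with P fzero
... | true = cong not (xsum-parity (λ i → P (fsuc i)))
... | false = xsum-parity (λ i → P (fsuc i))

3≤card : ∀ {N} (s : Sub N) x y z → x ∈ s → y ∈ s → z ∈ s → x ≢ y → x ≢ z → y ≢ z → 3 ≤ card s
3≤card s x y z p q r h k l = subst (3 ≤_) (card-del x s p)
  (s≤s (2≤card (del x s) y z (del-in y x s (λ e → h (sym e)) q) (del-in z x s (λ e → k (sym e)) r) l))

link-in : ∀ {n} (K : Cx n) τ H → K (H ∪ˢ τ) ≡ true → (∀ x → x ∈ H → x ∉ τ) → link K τ H ≡ true
link-in K τ H p h = ∧-in p (⇒disj h)

link-el : ∀ {n} (K : Cx n) τ H → link K τ H ≡ true → K (H ∪ˢ τ) ≡ true × (∀ x → x ∈ H → x ∉ τ)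
link-el K τ H p = let a , b = ∧-el p in a , disj⇒ {s = H} b

∪-⊑ : ∀ {n} (s t : Sub n) {u} → s ⊑ u → t ⊑ u → (s ∪ˢ t) ⊑ u
∪-⊑ s t h k x p = [ h x , k x ]′ (∪-el x s t p)

single-⊑ : ∀ {n} (x : Fin n) {s} → x ∈ s → single x ⊑ s
single-⊑ x {s} p y q rewrite single-∈ y x q = p

facet-ins : ∀ {n} (ρ F : Sub n) → ρ ⊑ F → card F ≡ suc (card ρ) → ∃ λ x → x ∉ ρ × F ≡ ins x ρ
facet-ins ρ F h e with extra ρ F (≤-reflexive (sym e))
... | x , x∈ , x∉ = x , x∉ , sym (card-eq (ins-⊑ x h x∈) (≤-reflexive (trans e (sym (card-ins x ρ x∉)))))

-- Normal pseudomanifolds and their boundary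

module Pseudomanifold {n} (d : ℕ) (Δ : Cx n) (pm : IsNormalPseudomanifold Δ d) where

  down : ∀ {σ τ} → τ ⊑ σ → Δ σ ≡ true → Δ τ ≡ true
  down {σ} {τ} h = proj₁ pm σ τ (⇒⊆ᵇ h)

  top : ∀ σ → Δ σ ≡ true → card σ ≤ suc d
  top = proj₂ (proj₁ (proj₂ pm))

  pure : ∀ σ → Δ σ ≡ true → Σ (Sub n) λ F → Δ F ≡ true × card F ≡ suc d × σ ⊑ F
  pure σ p = let F , a , b , e = proj₁ (proj₂ (proj₂ pm)) σ p in F , a , b , ⊆ᵇ⇒ e

  coface : Sub n → Fin n → Bool
  coface ρ x = not (mem x ρ) ∧ Δ (ins x ρ)

  cofaces : Sub n → Sub n
  cofaces ρ = tab (coface ρ)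

  cofaces-in : ∀ ρ x → x ∉ ρ → Δ (ins x ρ) ≡ true → x ∈ cofaces ρ
  cofaces-in ρ x p q = trans (mem-tab (coface ρ) x) (∧-in (not-in p) q)

  cofaces-el : ∀ ρ x → x ∈ cofaces ρ → x ∉ ρ × Δ (ins x ρ) ≡ true
  cofaces-el ρ x p = let a , b = ∧-el {not (mem x ρ)} (trans (sym (mem-tab (coface ρ) x)) p) in not-el a , b

  facetCount≡ : ∀ ρ → card ρ ≡ d → facetCount Δ d ρ ≡ card (cofaces ρ)
  facetCount≡ ρ e = trans (countB-ΣS (λ σ → Δ σ ∧ ((card σ ≡ᵇ suc d) ∧ (ρ ⊆ᵇ σ)))) (trans (ΣS-cong regroup) (trans (ΣS-cover ρ (λ σ → bit (Δ σ))) (trans (ΣF-cong as-bit) (ΣF-card (coface ρ)))))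
    where
    regroup : ∀ σ → bit (Δ σ ∧ ((card σ ≡ᵇ suc d) ∧ (ρ ⊆ᵇ σ))) ≡ (if (ρ ⊆ᵇ σ) ∧ (card σ ≡ᵇ suc (card ρ)) then bit (Δ σ) else 0)
    regroup σ rewrite e with Δ σ | card σ ≡ᵇ suc d | ρ ⊆ᵇ σ
    ... | true | true | true = refl
    ... | true | true | false = refl
    ... | true | false | true = refl
    ... | true | false | false = refl
    ... | false | true | true = refl
    ... | false | true | false = refl
    ... | false | false | true = refl
    ... | false | false | false = refl
    as-bit : ∀ x → (if mem x ρ then 0 else bit (Δ (ins x ρ))) ≡ bit (coface ρ x)
    as-bit x with mem x ρ
    ... | true = refl
    ... | false = refl

  cofaces≤2 : ∀ ρ → card ρ ≡ d → card (cofaces ρ) ≤ 2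
  cofaces≤2 ρ e with decB (Δ ρ)
  ... | inj₁ p = subst (_≤ 2) (facetCount≡ ρ e) (proj₁ (proj₂ (proj₂ (proj₂ pm))) ρ p e)
  ... | inj₂ p = subst (_≤ 2) (sym none) z≤n
    where
    none : card (cofaces ρ) ≡ 0
    none with decB (1 ≤ᵇ card (cofaces ρ))
    ... | inj₂ q = n<1⇒n≡0 (≰⇒> (λ le → t≢f (⇒leᵇ le) q))
    ... | inj₁ q = let x , x∈ = inhabited (cofaces ρ) (leᵇ⇒ q) in
      ⊥-elim (t≢f (down (ins-⊒ x ρ) (proj₂ (cofaces-el ρ x x∈))) p)

  no-three : ∀ ρ → card ρ ≡ d → ∀ x y z → x ∈ cofaces ρ → y ∈ cofaces ρ → z ∈ cofaces ρ → x ≢ y → x ≢ z → y ≢ z → ⊥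
  no-three ρ e x y z p q r h k l = <-irrefl refl (≤-trans (3≤card (cofaces ρ) x y z p q r h k l) (cofaces≤2 ρ e))

  one-of-two : ∀ {m} → m ≤ 2 → parity m ≡ true → m ≡ 1
  one-of-two {suc zero} _ _ = refl
  one-of-two {suc (suc (suc _))} (s≤s (s≤s ())) _

  ∂Δ : Cx n
  ∂Δ = bdry Δ d

  bdry-el : ∀ τ → ∂Δ τ ≡ true → Σ (Sub n) λ ρ → Δ ρ ≡ true × card ρ ≡ d × card (cofaces ρ) ≡ 1 × τ ⊑ ρ
  bdry-el τ h with anyB-el (λ ρ → Δ ρ ∧ ((card ρ ≡ᵇ d) ∧ ((facetCount Δ d ρ ≡ᵇ 1) ∧ (τ ⊆ᵇ ρ)))) h
  ... | ρ , p with ∧-el {Δ ρ} p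
  ...   | p₁ , p₂ with ∧-el {card ρ ≡ᵇ d} p₂
  ...     | p₃ , p₄ with ∧-el {facetCount Δ d ρ ≡ᵇ 1} p₄
  ...       | p₅ , p₆ = ρ , p₁ , eqᵇ⇒ p₃ , trans (sym (facetCount≡ ρ (eqᵇ⇒ p₃))) (eqᵇ⇒ p₅) , ⊆ᵇ⇒ p₆

  bdry-in : ∀ τ ρ → Δ ρ ≡ true → card ρ ≡ d → card (cofaces ρ) ≡ 1 → τ ⊑ ρ → ∂Δ τ ≡ true
  bdry-in τ ρ p e o h = anyB-in _ ρ (∧-in p (∧-in (⇒eqᵇ e) (∧-in (⇒eqᵇ (trans (facetCount≡ ρ e) o)) (⇒⊆ᵇ h))))

  bdry-down : ∀ {σ τ} → τ ⊑ σ → ∂Δ σ ≡ true → ∂Δ τ ≡ true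
  bdry-down {σ} {τ} h p with bdry-el σ p
  ... | ρ , a , b , e , k = bdry-in τ ρ a b e (λ x q → k x (h x q))

  bdry⊆ : ∀ τ → ∂Δ τ ≡ true → Δ τ ≡ true
  bdry⊆ τ p with bdry-el τ p
  ... | ρ , a , _ , _ , k = down k a

  bdry-card : ∀ τ → ∂Δ τ ≡ true → card τ ≤ d
  bdry-card τ p with bdry-el τ p
  ... | ρ , _ , b , _ , k = ≤-trans (card-mono k) (≤-reflexive b)

  bdry-ridge : ∀ ρ → card ρ ≡ d → ∂Δ ρ ≡ xsum (coface ρ)
  bdry-ridge ρ e = bool-iff to from
    where
    to : ∂Δ ρ ≡ true → xsum (coface ρ) ≡ true
    to p with bdry-el ρ p
    ... | ρ' , a , b , o , k with card-eq k (≤-reflexive (trans b (sym e)))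
    ...   | refl = trans (xsum-parity (coface ρ)) (cong parity o)
    from : xsum (coface ρ) ≡ true → ∂Δ ρ ≡ true
    from p with xsum-∃ (coface ρ) p
    ... | x , q = bdry-in ρ ρ (down (ins-⊒ x ρ) (proj₂ (∧-el {not (mem x ρ)} q))) e
      (one-of-two (cofaces≤2 ρ e) (trans (sym (xsum-parity (coface ρ))) p)) (λ _ r → r)

  -- Δ with its boundary coned off by the vertex 0.
  Δ̂ : Cx (suc n)
  Δ̂ (b ∷ σ) = if b then ∂Δ σ else Δ σ

  Δ̂-down : ∀ {σ τ} → τ ⊑ σ → Δ̂ σ ≡ true → Δ̂ τ ≡ true
  Δ̂-down {true ∷ σ} {true ∷ τ} h p = bdry-down (λ i → h (fsuc i)) p
  Δ̂-down {true ∷ σ} {false ∷ τ} h p = bdry⊆ τ (bdry-down (λ i → h (fsuc i)) p)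
  Δ̂-down {false ∷ σ} {true ∷ τ} h p = contradiction (h fzero refl) λ ()
  Δ̂-down {false ∷ σ} {false ∷ τ} h p = down (λ i → h (fsuc i)) p

  -- A ridge of `Δ` acquires a coface at 0 exactly when its number of cofaces in `Δ` is odd. For a
  -- ridge through 0 the statement becomes ∂∂ = 0.
  Δ̂-cycle : ∀ ρ → card ρ ≡ d → ∂ Δ̂ ρ ≡ false
  Δ̂-cycle (false ∷ ρ) e = trans (cong (λ z → ∂Δ z xor xsum (coface ρ)) (∪-empty ρ))
    (trans (cong (_xor xsum (coface ρ)) (bdry-ridge ρ e)) (xor-same (xsum (coface ρ))))
  Δ̂-cycle (true ∷ ρ) e = trans (xsum-cong expand) (xsum-sym h h-sym h-diag)
    where
    h : Fin n → Fin n → Bool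
    h x y = not (mem x ρ) ∧ (not (mem y ρ) ∧ (not (eqF x y) ∧ Δ (ins y (ins x ρ))))
    h-diag : ∀ x → h x x ≡ false
    h-diag x rewrite eqF-refl x | ∧-zeroʳ (not (mem x ρ)) = ∧-zeroʳ (not (mem x ρ))
    h-sym : ∀ x y → h x y ≡ h y x
    h-sym x y rewrite eqF-sym x y | ins-comm y x ρ = ∧-swap (not (mem x ρ)) (not (mem y ρ)) _
    shuffle : ∀ e m k → not (e ∨ m) ∧ k ≡ not m ∧ (not e ∧ k)
    shuffle true m k = sym (∧-zeroʳ (not m))
    shuffle false m k = refl
    expand : ∀ x → not (mem x ρ) ∧ ∂Δ (ins x ρ) ≡ xsum (h x)
    expand x with decB (mem x ρ)
    ... | inj₁ p rewrite p = sym (xsum-0 {n} (λ _ → refl))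
    ... | inj₂ p rewrite p = trans (bdry-ridge (ins x ρ) (trans (card-ins x ρ p) e))
      (xsum-cong (λ y → trans (cong (λ z → not z ∧ Δ (ins y (ins x ρ))) (trans (mem-ins y x ρ) (cong (_∨ mem y ρ) (eqF-sym y x)))) (shuffle (eqF x y) (mem y ρ) _)))

  Closed : Sub n → (Sub n → Bool) → Set
  Closed τ X = ∀ ρ x y → τ ⊑ ρ → card ρ ≡ d → x ∉ ρ → y ∉ ρ → Δ (ins x ρ) ≡ true → Δ (ins y ρ) ≡ true
    → X (ins x ρ) ≡ true → X (ins y ρ) ≡ true

  -- Any two facets containing `τ` are joined across ridges containing `τ`; a property `X` preserved
  -- by such moves replaces the path of facets. One follows a path in the connected link of `τ`, and
  -- around each of its vertices induction on the codimension of `τ` applies.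
  strongly-connected : ∀ k τ → Δ τ ≡ true → 1 ≤ card τ → k + card τ ≡ d → ∀ X → Closed τ X
    → ∀ F F' → τ ⊑ F → τ ⊑ F' → Δ F ≡ true → Δ F' ≡ true → card F ≡ suc d → card F' ≡ suc d → X F ≡ true → X F' ≡ true
  strongly-connected zero τ Δτ 1≤ e X cl F F' h h' ΔF ΔF' cF cF' XF
    with facet-ins τ F h (trans cF (cong suc (sym e))) | facet-ins τ F' h' (trans cF' (cong suc (sym e)))
  ... | x , x∉ , refl | y , y∉ , refl = cl τ x y (λ _ p → p) e x∉ y∉ ΔF ΔF' XF
  strongly-connected (suc k) τ Δτ 1≤ e X cl F F' h h' ΔF ΔF' cF cF' XF
    with extra τ F (subst (card τ <_) (sym cF) lt) | extra τ F' (subst (card τ <_) (sym cF') lt)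
    where
    lt : card τ < suc d
    lt = s≤s (subst (card τ ≤_) e (m≤n+m (card τ) (suc k)))
  ... | x , x∈ , x∉ | y , y∈ , y∉ = walk (proj₂ (proj₂ (proj₂ (proj₂ pm))) τ Δτ 1≤ (subst (suc (card τ) ≤_) e (s≤s (m≤n+m (card τ) k))) x y
      (vertex x F h ΔF x∈ x∉) (vertex y F' h' ΔF' y∈ y∉)) F h ΔF cF x∈ x∉ XF
    where
    vertex : ∀ x F → τ ⊑ F → Δ F ≡ true → x ∈ F → x ∉ τ → link Δ τ (single x) ≡ true
    vertex x F h ΔF x∈ x∉ = link-in Δ τ (single x) (down (∪-⊑ (single x) τ (single-⊑ x x∈) h) ΔF) (λ z p → subst (_∉ τ) (sym (single-∈ z x p)) x∉)
    move : ∀ x → x ∉ τ → ∀ F F' → τ ⊑ F → τ ⊑ F' → Δ F ≡ true → Δ F' ≡ true → card F ≡ suc d → card F' ≡ suc d → x ∈ F → x ∈ F' → X F ≡ true → X F' ≡ true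
    move x x∉ F F' h h' ΔF ΔF' cF cF' x∈ x∈' = strongly-connected k (ins x τ) (down (ins-⊑ x h x∈) ΔF)
      (subst (1 ≤_) (sym (card-ins x τ x∉)) (s≤s z≤n)) (trans (cong (k +_) (card-ins x τ x∉)) (trans (+-suc k _) e))
      X (λ ρ a b s → cl ρ a b (λ z p → s z (ins-⊒ x τ z p))) F F' (ins-⊑ x h x∈) (ins-⊑ x h' x∈') ΔF ΔF' cF cF'
    walk : ∀ {x} → Path (link Δ τ) x y → ∀ F → τ ⊑ F → Δ F ≡ true → card F ≡ suc d → x ∈ F → x ∉ τ → X F ≡ true → X F' ≡ true
    walk (here x) F h ΔF cF x∈ x∉ XF = move x x∉ F F' h h' ΔF ΔF' cF cF' x∈ y∈ XF
    walk (step x w .y xw rest) F h ΔF cF x∈ x∉ XF with link-el Δ τ (pair x w) xw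
    ... | Δxw , off with pure (pair x w ∪ˢ τ) Δxw
    ...   | F'' , ΔF'' , cF'' , sub = walk rest F'' h'' ΔF'' cF'' (sub w (∪-inˡ w (pair x w) τ w∈)) (off w w∈)
        (move x x∉ F F'' h h'' ΔF ΔF'' cF cF'' x∈ (sub x (∪-inˡ x (pair x w) τ (∪-inˡ x (single x) (single w) (mem-single-same x)))) XF)
      where
      w∈ : w ∈ pair x w
      w∈ = ∪-inʳ w (single x) (single w) (mem-single-same w)
      h'' : τ ⊑ F''
      h'' z p = sub z (∪-inʳ z (pair x w) τ p)

-- Values of the masses

unit-closed : ∀ n d → suc d ≤ n → unit n d * (suc d * suc (suc d)) ≡ suc n !
unit-closed n d h = *-cancelʳ-≡ _ _ (d !) {{d !≢0}} (begin
  unit n d * (suc d * suc (suc d)) * d ! ≡⟨ e (unit n d) d (d !) ⟩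
  unit n d * suc (suc d) ! ≡⟨ mass-closed (n ∸ suc d) 1 d ⟩
  (1 * d !) * suc (suc d + (n ∸ suc d)) ! ≡⟨ cong₂ (λ x y → x * suc y !) (*-identityˡ (d !)) (m+[n∸m]≡n h) ⟩
  d ! * suc n ! ≡⟨ *-comm (d !) _ ⟩
  suc n ! * d ! ∎)
  where
  open ≡-Reasoning
  open +-*-Solver
  e : ∀ t d f → t * (suc d * suc (suc d)) * f ≡ t * (suc (suc d) * (suc d * f))
  e = solve 3 (λ t d f → t :* ((con 1 :+ d) :* (con 2 :+ d)) :* f := t :* ((con 2 :+ d) :* ((con 1 :+ d) :* f))) refl

mass-total : ∀ n → mass n 0 0 ≡ suc n !
mass-total n = trans (sym (*-identityʳ _)) (trans (mass-closed n 0 0) (+-identityʳ _))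

-- None of `d` given vertices precedes the mark with probability 1/(d+1), and this is d + 2 units.
mass-avoid : ∀ n d → suc d ≤ n → mass (n ∸ d) 0 d ≡ suc (suc d) * unit n d
mass-avoid n d h = *-cancelʳ-≡ _ _ (suc d) (trans lhs (trans (sym (unit-closed n d h)) (e (unit n d) d)))
  where
  open +-*-Solver
  e : ∀ t d → t * (suc d * suc (suc d)) ≡ suc (suc d) * t * suc d
  e = solve 2 (λ t d → t :* ((con 1 :+ d) :* (con 2 :+ d)) := (con 2 :+ d) :* t :* (con 1 :+ d)) refl
  lhs : mass (n ∸ d) 0 d * suc d ≡ suc n !
  lhs = *-cancelʳ-≡ _ _ (d !) {{d !≢0}} (trans (*-assoc (mass (n ∸ d) 0 d) (suc d) (d !))
    (trans (mass-closed (n ∸ d) 0 d) (trans (cong₂ (λ x y → x * suc y !) (+-identityʳ (d !)) (m+[n∸m]≡n (≤-trans (n≤1+n d) h))) (*-comm (d !) _))))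

Σwt : ∀ n → ΣS (wt {n}) ≡ mass n 0 0
Σwt n = trans (ΣS-cong {n} (λ W → trans (sym (*-identityʳ (wt W))) (cong (wt W *_)
    (sym (ind-1 emptyS emptyS W (λ k p → ⊥-elim (t≢f p (mem-empty k))) (λ k _ → mem-empty k))))))
  (trans (wt-ind {n} emptyS emptyS (λ k _ → mem-empty k)) (cong (λ x → mass (n ∸ (x + x)) x x) (card-empty n)))

c-1 : ∀ {N} {G : Graph N} {S} z → (∀ x → x ∈ S → Conn G S x z) → c G S ≤ 1
c-1 z h = subst (_ ≤_) (card-single z) (c-dom (single z) (λ _ → z) (λ x p → mem-single-same z , h x p))

-- The link of a vertex with its boundary coned off

module VertexLink {n} (d : ℕ) (3≤d : 3 ≤ d) (Δ : Cx n) (pm : IsNormalPseudomanifold Δ d) (i : Fin n) where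
  open Pseudomanifold d Δ pm

  v : Fin (suc n)
  v = fsuc i

  tri-in : ∀ x y τ → Δ̂ τ ≡ true → v ∈ τ → x ∈ τ → y ∈ τ → Δ̂ (ins v (pair x y)) ≡ true
  tri-in x y τ p v∈ x∈ y∈ = Δ̂-down (ins-⊑ v (∪-⊑ (single x) (single y) (single-⊑ x x∈) (single-⊑ y y∈)) v∈) p

  tri-el : ∀ x y τ → Δ̂ (ins v (pair x y)) ≡ true → (∀ z → z ∈ τ → z ≡ v ⊎ z ≡ x ⊎ z ≡ y) → Δ̂ τ ≡ true
  tri-el x y τ p h = Δ̂-down sub p
    where
    sub : τ ⊑ ins v (pair x y)
    sub z z∈ with h z z∈
    ... | inj₁ refl = mem-ins-same v (pair x y)
    ... | inj₂ (inj₁ refl) = ins-⊒ v (pair x y) z (∪-inˡ z (single x) (single y) (mem-single-same x))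
    ... | inj₂ (inj₂ refl) = ins-⊒ v (pair x y) z (∪-inʳ z (single x) (single y) (mem-single-same y))

  pair-el : ∀ {m} (z x y : Fin m) → z ∈ pair x y → z ≡ x ⊎ z ≡ y
  pair-el z x y p = [ (λ q → inj₁ (single-∈ z x q)) , (λ q → inj₂ (single-∈ z y q)) ]′ (∪-el z (single x) (single y) p)

  -- The graph of the link of `v` in `Δ̂`. The vertex 0 is adjacent to those vertices that are
  -- joined to `v` by an edge of the boundary.
  graph : Graph (suc n)
  graph = record { adj = a ; adj-sym = s }
    where
    a : Fin (suc n) → Fin (suc n) → Bool
    a x y = not (eqF x v) ∧ (not (eqF y v) ∧ (not (eqF x y) ∧ Δ̂ (ins v (pair x y))))
    s : ∀ x y → a x y ≡ true → a y x ≡ true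
    s x y p rewrite eqF-sym y x | ∪-comm (single y) (single x) = trans (∧-swap (not (eqF y v)) (not (eqF x v)) _) p

  ≢-eqF : ∀ {m} {x y : Fin m} → not (eqF x y) ≡ true → x ≢ y
  ≢-eqF {x = x} p refl = t≢f (eqF-refl x) (not-el p)

  adj-in : ∀ x y τ → x ≢ v → y ≢ v → x ≢ y → Δ̂ τ ≡ true → v ∈ τ → x ∈ τ → y ∈ τ → adj graph x y ≡ true
  adj-in x y τ h k l p v∈ x∈ y∈ = ∧-in (not-in (eqF-≢ h)) (∧-in (not-in (eqF-≢ k)) (∧-in (not-in (eqF-≢ l)) (tri-in x y τ p v∈ x∈ y∈)))

  adj-el : ∀ x y → adj graph x y ≡ true → x ≢ v × y ≢ v × x ≢ y × Δ̂ (ins v (pair x y)) ≡ true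
  adj-el x y p with ∧-el {not (eqF x v)} p
  ... | p₁ , p₂ with ∧-el {not (eqF y v)} p₂
  ...   | p₃ , p₄ with ∧-el {not (eqF x y)} p₄
  ...     | p₅ , p₆ = ≢-eqF p₁ , ≢-eqF p₃ , ≢-eqF p₅ , p₆

  -- The facets of the link of `v` in `Δ̂`. They form a cycle modulo 2 because those of `Δ̂` do.
  K : Cx (suc n)
  K τ = not (mem v τ) ∧ ((card τ ≡ᵇ d) ∧ Δ̂ (ins v τ))

  K-in : ∀ τ → v ∉ τ → card τ ≡ d → Δ̂ (ins v τ) ≡ true → K τ ≡ true
  K-in τ p e q = ∧-in (not-in p) (∧-in (⇒eqᵇ e) q)

  K-el : ∀ τ → K τ ≡ true → v ∉ τ × card τ ≡ d × Δ̂ (ins v τ) ≡ true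
  K-el τ p with ∧-el {not (mem v τ)} p
  ... | p₁ , p₂ with ∧-el {card τ ≡ᵇ d} p₂
  ...   | p₃ , p₄ = not-el p₁ , eqᵇ⇒ p₃ , p₄

  K-cycle : IsCycle d K
  K-cycle = (λ σ p → proj₁ (proj₂ (K-el σ p))) , bdry-0
    where
    bdry-0 : ∀ ρ → ∂ K ρ ≡ false
    bdry-0 ρ with decB (mem v ρ)
    ... | inj₁ p = xsum-0 (λ x → ∧-falseʳ (not (mem x ρ)) (∧-falseˡ ((card (ins x ρ) ≡ᵇ d) ∧ Δ̂ (ins v (ins x ρ))) (cong not (ins-⊒ x ρ v p))))
    ... | inj₂ p with decB (suc (card ρ) ≡ᵇ d)
    ...   | inj₂ q = xsum-0 none
      where
      none : ∀ x → not (mem x ρ) ∧ K (ins x ρ) ≡ false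
      none x with decB (mem x ρ)
      ... | inj₁ r rewrite r = refl
      ... | inj₂ r rewrite r = falseI (λ k → t≢f (⇒eqᵇ (trans (sym (card-ins x ρ r)) (proj₁ (proj₂ (K-el (ins x ρ) k))))) q)
    ...   | inj₁ q = trans (xsum-cong same) (Δ̂-cycle (ins v ρ) (trans (card-ins v ρ p) (eqᵇ⇒ q)))
      where
      same : ∀ x → not (mem x ρ) ∧ K (ins x ρ) ≡ not (mem x (ins v ρ)) ∧ Δ̂ (ins x (ins v ρ))
      same x rewrite mem-ins x v ρ with decB (mem x ρ)
      ... | inj₁ r rewrite r | ∨-zeroʳ (eqF x v) = refl
      ... | inj₂ r with x ≟ v
      ...   | yes refl rewrite eqF-refl x | r | mem-ins-same x ρ = refl
      ...   | no x≢v rewrite r | eqF-≢ x≢v | ins-∉ v x ρ (λ e → x≢v (sym e)) p | card-ins x ρ r | q | ins-comm v x ρ = refl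

  K-edges : HasEdges graph K
  K-edges σ k x y x∈ y∈ x≢y = let v∉ , _ , p = K-el σ k in
    adj-in x y (ins v σ) (∉⇒≢ σ x v x∈ v∉) (∉⇒≢ σ y v y∈ v∉) x≢y p (mem-ins-same v σ) (ins-⊒ v σ x x∈) (ins-⊒ v σ y y∈)

  -- The neighbours of `i` in `Δ`, those along boundary edges, and those along interior edges.
  N B R : Sub n
  N = tab (λ k → not (eqF k i) ∧ Δ (pair k i))
  B = tab (λ k → not (eqF k i) ∧ ∂Δ (pair k i))
  R = tab (λ k → not (eqF k i) ∧ rel Δ ∂Δ (pair k i))

  N-in : ∀ k → k ≢ i → Δ (pair k i) ≡ true → k ∈ N
  N-in k h p = trans (mem-tab (λ k → not (eqF k i) ∧ Δ (pair k i)) k) (∧-in (not-in (eqF-≢ h)) p)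

  N-el : ∀ k → k ∈ N → k ≢ i × Δ (pair k i) ≡ true
  N-el k p = let a , b = ∧-el {not (eqF k i)} (trans (sym (mem-tab (λ k → not (eqF k i) ∧ Δ (pair k i)) k)) p) in ≢-eqF a , b

  B-in : ∀ k → k ≢ i → ∂Δ (pair k i) ≡ true → k ∈ B
  B-in k h p = trans (mem-tab (λ k → not (eqF k i) ∧ ∂Δ (pair k i)) k) (∧-in (not-in (eqF-≢ h)) p)

  B-el : ∀ k → k ∈ B → k ≢ i × ∂Δ (pair k i) ≡ true
  B-el k p = let a , b = ∧-el {not (eqF k i)} (trans (sym (mem-tab (λ k → not (eqF k i) ∧ ∂Δ (pair k i)) k)) p) in ≢-eqF a , b

  card-B+R : card B + card R ≡ card N
  card-B+R = begin
    card B + card R ≡⟨ cong₂ (λ x y → card x + card y) B≡ R≡ ⟩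
    card (filt N P) + card (filt N (not ∘ P)) ≡⟨ card-filt N P ⟩
    card N ∎
    where
    open ≡-Reasoning
    P : Fin n → Bool
    P k = ∂Δ (pair k i)
    B≡ : B ≡ filt N P
    B≡ = ext (λ k → trans (mem-tab _ k) (sym (trans (mem-tab (λ k → mem k N ∧ P k) k) (trans (cong (_∧ P k) (mem-tab _ k)) (drop (not (eqF k i)) (Δ (pair k i)) (P k) (bdry⊆ (pair k i)))))))
      where
      drop : ∀ a b p → (p ≡ true → b ≡ true) → (a ∧ b) ∧ p ≡ a ∧ p
      drop false b p h = refl
      drop true b false h = ∧-zeroʳ b
      drop true b true h rewrite h refl = refl
    R≡ : R ≡ filt N (not ∘ P)
    R≡ = ext (λ k → trans (mem-tab _ k) (sym (trans (mem-tab (λ k → mem k N ∧ not (P k)) k) (trans (cong (_∧ not (P k)) (mem-tab _ k)) (assoc (not (eqF k i)) _ _)))))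
      where
      assoc : ∀ a b p → (a ∧ b) ∧ p ≡ a ∧ (b ∧ p)
      assoc true b p = refl
      assoc false b p = refl

  -- The vertex 0 belongs to `J` for interior `i` too. It is then isolated, so that discounting its
  -- component leaves the full number of components of the link; for a boundary vertex the
  -- discounted component contains every present vertex joined to `i` by a boundary edge.
  J : Sub (suc n)
  J = true ∷ N

  link-facet : ∀ F → Δ F ≡ true → i ∈ F → card F ≡ suc d → K (false ∷ del i F) ≡ true
  link-facet F p i∈ e = K-in (false ∷ del i F) (mem-del-same i F) (suc-injective (trans (card-del i F i∈) e)) (trans (cong Δ (ins-del i F i∈)) p)

  module _ (M : Cx (suc n)) (cycM : IsCycle d M) (M⊆ : ∀ σ → M σ ≡ true → K σ ≡ true) where

    X : Sub n → Bool
    X F = M (false ∷ del i F)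

    -- At a ridge with a facet in `M` the cycle has a second coface. It is not at 0, since a ridge
    -- with two facets is not in the boundary; so it is the other facet, of which there is only one.
    X-closed : Closed (single i) X
    X-closed ρ x y i⊑ e x∉ y∉ Δx Δy Mx with x ≟ y
    ... | yes refl = Mx
    ... | no x≢y with xsum-other (λ z → not (mem z σ) ∧ M (ins z σ)) (proj₂ cycM σ) (fsuc x)
          (∧-in (not-in (del-∉ x i ρ x∉)) (trans (cong (λ z → M (false ∷ z)) (sym (del-ins-other i x ρ (λ q → i≢ x x∉ q)))) Mx))
      where
      σ : Sub (suc n)
      σ = false ∷ del i ρ
      i∈ρ : i ∈ ρ
      i∈ρ = i⊑ i (mem-single-same i)
      i≢ : ∀ x → x ∉ ρ → i ≢ x
      i≢ x x∉ refl = t≢f i∈ρ x∉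
    ...   | fzero , _ , g = ⊥-elim (<-irrefl (sym one) (2≤card (cofaces ρ) x y (cofaces-in ρ x x∉ Δx) (cofaces-in ρ y y∉ Δy) x≢y))
      where
      Kz : ∂Δ ((del i ρ ∪ˢ emptyS) ∪ˢ single i) ≡ true
      Kz = proj₂ (proj₂ (K-el _ (M⊆ _ (proj₂ (∧-el {not (mem fzero (false ∷ del i ρ))} g)))))
      ∂ρ : ∂Δ ρ ≡ true
      ∂ρ = subst (λ z → ∂Δ z ≡ true) (trans (cong (ins i) (∪-empty (del i ρ))) (ins-del i ρ (i⊑ i (mem-single-same i)))) Kz
      one : card (cofaces ρ) ≡ 1
      one = one-of-two (cofaces≤2 ρ e) (trans (sym (xsum-parity (coface ρ))) (trans (sym (bdry-ridge ρ e)) ∂ρ))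
    ...   | fsuc k , k≢x , g with y ≟ k
    ...     | yes refl = trans (cong (λ z → M (false ∷ z)) (del-ins-other i y ρ (λ { refl → t≢f (i⊑ i (mem-single-same i)) y∉ })))
                           (proj₂ (∧-el {not (mem (fsuc y) (false ∷ del i ρ))} g))
    ...     | no y≢k = ⊥-elim (no-three ρ e x y k (cofaces-in ρ x x∉ Δx) (cofaces-in ρ y y∉ Δy) (cofaces-in ρ k k∉ρ Δk)
                         x≢y (λ { refl → k≢x refl }) y≢k)
      where
      i∈ρ : i ∈ ρ
      i∈ρ = i⊑ i (mem-single-same i)
      kk : fsuc i ∉ (false ∷ ins k (del i ρ)) × card (false ∷ ins k (del i ρ)) ≡ d × Δ (ins i (ins k (del i ρ))) ≡ true
      kk = K-el (false ∷ ins k (del i ρ)) (M⊆ _ (proj₂ (∧-el {not (mem k (del i ρ))} g)))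
      i≢k : i ≢ k
      i≢k = proj₁ (∉-ins i k (del i ρ) (proj₁ kk))
      k∉ρ : k ∉ ρ
      k∉ρ = falseI (λ p → t≢f (del-in k i ρ (λ q → i≢k (sym q)) p) (not-el (proj₁ (∧-el {not (mem k (del i ρ))} g))))
      Δk : Δ (ins k ρ) ≡ true
      Δk = subst (λ z → Δ z ≡ true) (trans (ins-comm i k (del i ρ)) (cong (ins k) (ins-del i ρ i∈ρ))) (proj₂ (proj₂ kk))

    X-all : ∀ F F' → i ∈ F → i ∈ F' → Δ F ≡ true → Δ F' ≡ true → card F ≡ suc d → card F' ≡ suc d → X F ≡ true → X F' ≡ true
    X-all F F' p p' ΔF ΔF' e e' = strongly-connected (d ∸ 1) (single i) (down (single-⊑ i p) ΔF) (≤-reflexive (sym (card-single i)))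
      (trans (cong (d ∸ 1 +_) (card-single i)) (m∸n+n≡m (≤-trans (s≤s z≤n) 3≤d))) X X-closed F F' (single-⊑ i p) (single-⊑ i p') ΔF ΔF' e e'

  -- Every vertex of the link lies in a facet at `i`; all these facets belong to the cycle, whose
  -- sets lie in the spanned set.
  spanned : ∀ I Q → (o : Outcome d graph I K Q) → fzero ∈ I → (∀ k → fsuc k ∈ I → k ∈ N)
    → (∀ F → i ∈ F → Δ F ≡ true → card F ≡ suc d → Outcome.M o (false ∷ del i F) ≡ true) → Good d graph I J
  spanned I Q o 0∈ I⊑ all = subst (Good d graph I) (⊑-antisym to from) O.good
    where
    module O = Outcome o
    to : O.J ⊑ J
    to fzero _ = refl
    to (fsuc k) p with decB (mem (fsuc k) I)
    ... | inj₁ q = I⊑ k q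
    ... | inj₂ q with O.new (fsuc k) p q
    ...   | y , e = let k≢ , _ , _ , t = adj-el (fsuc k) y e in N-in k (λ r → k≢ (cong fsuc r)) (tri-el (fsuc k) y (false ∷ pair k i) t sub)
      where
      sub : ∀ z → z ∈ (false ∷ pair k i) → z ≡ v ⊎ z ≡ fsuc k ⊎ z ≡ y
      sub (fsuc z) r with pair-el z k i r
      ... | inj₁ refl = inj₂ (inj₁ refl)
      ... | inj₂ refl = inj₁ refl
    from : J ⊑ O.J
    from fzero _ = O.I⊑J fzero 0∈
    from (fsuc k) p with N-el k p
    ... | k≢i , Δk with pure (pair k i) Δk
    ...   | F , ΔF , e , sub = O.M⊑J (false ∷ del i F) (all F (sub i (∪-inʳ i (single k) (single i) (mem-single-same i))) ΔF e) (fsuc k)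
      (del-in k i F k≢i (sub k (∪-inˡ k (single k) (single i) (mem-single-same k))))

  private
    run : ∀ I Q → K Q ≡ true → Q ⊑ I → Rooted graph I → Outcome d graph I K Q
    run I Q KQ Q⊑ root = Spanning.span d 3≤d (suc (suc n ∸ card I + size K)) graph I K Q K-cycle K-edges KQ Q⊑ root ≤-refl

  adj-0 : ∀ k → adj graph (fsuc k) fzero ≡ true → ∂Δ (pair k i) ≡ true
  adj-0 k e = tri-el (fsuc k) fzero (true ∷ pair k i) (proj₂ (proj₂ (proj₂ (adj-el (fsuc k) fzero e)))) sub
    where
    sub : ∀ z → z ∈ (true ∷ pair k i) → z ≡ v ⊎ z ≡ fsuc k ⊎ z ≡ fzero
    sub fzero _ = inj₂ (inj₂ refl)
    sub (fsuc z) r with pair-el z k i r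
    ... | inj₁ refl = inj₂ (inj₁ refl)
    ... | inj₂ refl = inj₁ refl

  module Interior (F₀ : Sub n) (ΔF₀ : Δ F₀ ≡ true) (i∈F₀ : i ∈ F₀) (cF₀ : card F₀ ≡ suc d) (interior : ∂Δ (single i) ≡ false) where

    D : Sub n
    D = del i F₀

    I : Sub (suc n)
    I = true ∷ D

    cD : card D ≡ d
    cD = suc-injective (trans (card-del i F₀ i∈F₀) cF₀)

    far : ∀ k → adj graph (fsuc k) fzero ≡ false
    far k = falseI (λ e → t≢f (bdry-down (single-⊑ i (∪-inʳ i (single k) (single i) (mem-single-same i))) (adj-0 k e)) interior)

    good : Good d graph I J
    good = spanned I (false ∷ D) o refl (λ k p → let k≢i , k∈ = del-∈ k i F₀ p in
        N-in k k≢i (down (∪-⊑ (single k) (single i) (single-⊑ k k∈) (single-⊑ i i∈F₀)) ΔF₀))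
        (λ F p ΔF e → X-all O.M O.cycM O.M⊆K F₀ F i∈F₀ p ΔF₀ ΔF cF₀ e O.MQ)
      where
      o : Outcome d graph I K (false ∷ D)
      o = run I (false ∷ D) (link-facet F₀ ΔF₀ i∈F₀ cF₀) sub (refl , rooted)
        where
        sub : (false ∷ D) ⊑ I
        sub (fsuc k) p = p
        rooted : ∀ w → w ∉ I → adj graph w fzero ≡ false
        rooted (fsuc k) _ = far k
      module O = Outcome o

    -- The start is a clique together with the isolated vertex 0: two components, but only one if no
    -- vertex of the clique precedes the mark. The latter has probability 1/(d+1), which accounts
    -- for the d + 2 units.
    start : E graph I + suc (suc d) * unit n d ≤ 2 * mass n 0 0
    start = subst₂ _≤_ (trans (ΣS-+ (λ W → wt W * c graph (cut I W)) _) (cong (E graph I +_) avoid))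
        (trans (ΣS-cong {n} (λ W → *-comm (wt W) 2)) (trans (ΣS-* {n} 2 wt) (cong (2 *_) (Σwt n))))
        (ΣS-mono (λ W → subst (_≤ wt W * 2) (*-distribˡ-+ (wt W) (c graph (cut I W)) (ind emptyS D W)) (*-monoʳ-≤ (wt W) (pointwise W))))
      where
      none : ∀ k → k ∈ emptyS → k ∉ D
      none k p = ⊥-elim (t≢f p (mem-empty k))
      avoid : ΣS (λ W → wt W * ind emptyS D W) ≡ suc (suc d) * unit n d
      avoid = trans (wt-ind emptyS D none) (trans (cong₂ (λ x y → mass (n ∸ (x + y)) x y) (card-empty n) cD)
        (mass-avoid n d (subst (_≤ n) cF₀ (card-bound F₀))))
      pointwise : ∀ W → c graph (cut I W) + ind emptyS D W ≤ 2
      pointwise W with ind-D⇒ emptyS D W (λ k p → ⊥-elim (t≢f p (mem-empty k)))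
      ... | inj₁ (k , k∈W , k∈D) rewrite ind-D emptyS D W k k∈W k∈D | +-identityʳ (c graph (cut I W)) =
        subst (c graph (cut I W) ≤_) (trans (card-ins {suc n} (fsuc k) (single fzero) (mem-empty k)) (cong suc (card-single {suc n} fzero))) (c-dom (ins (fsuc k) (single fzero)) f h)
        where
        f : Fin (suc n) → Fin (suc n)
        f fzero = fzero
        f (fsuc _) = fsuc k
        h : ∀ x → x ∈ cut I W → f x ∈ ins (fsuc k) (single fzero) × Conn graph (cut I W) x (f x)
        h fzero p = ins-⊒ {suc n} (fsuc k) (single fzero) fzero refl , crefl p
        h (fsuc l) p = mem-ins-same {suc n} (fsuc k) (single fzero) , conn
          where
          l∈D : l ∈ D
          l∈D = cut-J I W (fsuc l) p
          conn : Conn graph (cut I W) (fsuc l) (fsuc k)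
          conn with l ≟ k
          ... | yes refl = crefl p
          ... | no l≢k = cedge p (cut-in I W k k∈W k∈D) (K-edges (false ∷ D) (link-facet F₀ ΔF₀ i∈F₀ cF₀) (fsuc l) (fsuc k) l∈D k∈D (λ e → l≢k (fsuc-injective e)))
      ... | inj₂ e rewrite e = subst (_≤ 2) (+-comm 1 _) (s≤s (c-1 fzero only))
        where
        only : ∀ x → x ∈ cut I W → Conn graph (cut I W) x fzero
        only fzero p = crefl p
        only (fsuc l) p = ⊥-elim (<-irrefl (trans (sym (ind-D emptyS D W l (cut-W I W l p) (cut-J I W (fsuc l) p))) e) (s≤s z≤n))

  module Boundary (boundary : ∂Δ (single i) ≡ true) where

    I : Sub (suc n)
    I = true ∷ B

    adj-B : ∀ k → k ∈ B → adj graph (fsuc k) fzero ≡ true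
    adj-B k p = let k≢i , q = B-el k p in adj-in (fsuc k) fzero (true ∷ pair k i) (λ e → k≢i (fsuc-injective e)) (λ ()) (λ ()) q
      (∪-inʳ i (single k) (single i) (mem-single-same i)) (∪-inˡ k (single k) (single i) (mem-single-same k)) refl

    -- Every vertex of `B` is adjacent to 0, which is always present.
    start : E graph I ≤ mass n 0 0
    start = subst (E graph I ≤_) (Σwt n) (ΣS-mono (λ W → subst (wt W * c graph (cut I W) ≤_) (*-identityʳ (wt W)) (*-monoʳ-≤ (wt W) (c-1 fzero (only W)))))
      where
      only : ∀ W x → x ∈ cut I W → Conn graph (cut I W) x fzero
      only W fzero p = crefl p
      only W (fsuc k) p = cedge p (cut-0 I W refl) (adj-B k (cut-J I W (fsuc k) p))

    good : Good d graph I J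
    good with bdry-el (single i) boundary
    ... | ρ , Δρ , cρ , one , sub = spanned I Q o refl (λ k p → let a , b = B-el k p in N-in k a (bdry⊆ (pair k i) b)) facets-in
      where
      i∈ρ : i ∈ ρ
      i∈ρ = sub i (mem-single-same i)
      ∂ρ : ∂Δ ρ ≡ true
      ∂ρ = bdry-in ρ ρ Δρ cρ one (λ _ p → p)
      Q : Sub (suc n)
      Q = true ∷ del i ρ
      KQ : K Q ≡ true
      KQ = K-in Q (mem-del-same i ρ) (trans (card-del i ρ i∈ρ) cρ) (trans (cong ∂Δ (ins-del i ρ i∈ρ)) ∂ρ)
      Q⊑ : Q ⊑ I
      Q⊑ fzero _ = refl
      Q⊑ (fsuc k) p = let k≢i , k∈ = del-∈ k i ρ p in B-in k k≢i (bdry-down (∪-⊑ (single k) (single i) (single-⊑ k k∈) (single-⊑ i i∈ρ)) ∂ρ)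
      rooted : ∀ w → w ∉ I → adj graph w fzero ≡ false
      rooted (fsuc k) k∉ = falseI (λ e → t≢f (B-in k (λ r → proj₁ (adj-el (fsuc k) fzero e) (cong fsuc r)) (adj-0 k e)) k∉)
      o : Outcome d graph I K Q
      o = run I Q KQ Q⊑ (refl , rooted)
      module O = Outcome o
      -- The cycle contains `Q`, which passes through 0. At the ridge opposite to 0 it has another
      -- coface, and this one comes from a facet of `Δ`, where strong connectedness takes over.
      facets-in : ∀ F → i ∈ F → Δ F ≡ true → card F ≡ suc d → O.M (false ∷ del i F) ≡ true
      facets-in F i∈F ΔF cF = conclude (xsum-other (λ z → not (mem z (false ∷ del i ρ)) ∧ O.M (ins z (false ∷ del i ρ))) (proj₂ O.cycM (false ∷ del i ρ)) fzero
          (trans (cong (λ z → O.M (true ∷ z)) (∪-empty (del i ρ))) O.MQ))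
        where
        conclude : (∃ λ y → y ≢ fzero × not (mem y (false ∷ del i ρ)) ∧ O.M (ins y (false ∷ del i ρ)) ≡ true) → O.M (false ∷ del i F) ≡ true
        conclude (fzero , ne , _) = ⊥-elim (ne refl)
        conclude (fsuc k , _ , g) = X-all O.M O.cycM O.M⊆K (ins k ρ) F (ins-⊒ k ρ i i∈ρ) i∈F Δk ΔF (trans (card-ins k ρ k∉ρ) (cong suc cρ)) cF
            (trans (cong (λ z → O.M (false ∷ z)) (del-ins-other i k ρ i≢k)) Mk)
          where
          Mk : O.M (false ∷ ins k (del i ρ)) ≡ true
          Mk = proj₂ (∧-el {not (mem k (del i ρ))} g)
          kk : fsuc i ∉ (false ∷ ins k (del i ρ)) × card (false ∷ ins k (del i ρ)) ≡ d × Δ (ins i (ins k (del i ρ))) ≡ true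
          kk = K-el (false ∷ ins k (del i ρ)) (O.M⊆K _ Mk)
          i≢k : i ≢ k
          i≢k = proj₁ (∉-ins i k (del i ρ) (proj₁ kk))
          k∉ρ : k ∉ ρ
          k∉ρ = falseI (λ p → t≢f (del-in k i ρ (λ q → i≢k (sym q)) p) (not-el (proj₁ (∧-el {not (mem k (del i ρ))} g))))
          Δk : Δ (ins k ρ) ≡ true
          Δk = subst (λ z → Δ z ≡ true) (trans (ins-comm i k (del i ρ)) (cong (ins k) (ins-del i ρ i∈ρ))) (proj₂ (proj₂ kk))

-- Averaging over orders of the vertices

ΣF-mono : ∀ {n} {f g : Fin n → ℕ} → (∀ x → f x ≤ g x) → ΣF f ≤ ΣF g
ΣF-mono {zero} h = z≤n
ΣF-mono {suc n} h = +-mono-≤ (h fzero) (ΣF-mono (λ i → h (fsuc i)))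

ΣF-mono-< : ∀ {n} {f g : Fin n → ℕ} → (∀ x → f x ≤ g x) → ∀ x → f x < g x → ΣF f < ΣF g
ΣF-mono-< h fzero p = +-mono-<-≤ p (ΣF-mono (λ i → h (fsuc i)))
ΣF-mono-< h (fsuc x) p = +-mono-≤-< (h fzero) (ΣF-mono-< (λ i → h (fsuc i)) x p)

ΣF-+ : ∀ {n} (f g : Fin n → ℕ) → ΣF (λ x → f x + g x) ≡ ΣF f + ΣF g
ΣF-+ {zero} f g = refl
ΣF-+ {suc n} f g = trans (cong ((f fzero + g fzero) +_) (ΣF-+ (f ∘ fsuc) (g ∘ fsuc))) (+-interchange (f fzero) (g fzero) _ _)

ΣF-* : ∀ {n} k (f : Fin n → ℕ) → ΣF (λ x → k * f x) ≡ k * ΣF f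
ΣF-* {zero} k f = sym (*-zeroʳ k)
ΣF-* {suc n} k f = trans (cong (k * f fzero +_) (ΣF-* k (f ∘ fsuc))) (sym (*-distribˡ-+ k (f fzero) _))

ΣF-ΣS : ∀ {m n} (h : Fin m → Sub n → ℕ) → ΣF (λ v → ΣS (h v)) ≡ ΣS (λ W → ΣF (λ v → h v W))
ΣF-ΣS {zero} {n} h = sym (ΣS-0 {n} (λ _ → refl))
ΣF-ΣS {suc m} h = trans (cong (ΣS (h fzero) +_) (ΣF-ΣS (λ v → h (fsuc v)))) (sym (ΣS-+ (h fzero) _))

ΣF-∈ : ∀ {n} (W : Sub n) k → ΣF (λ v → if mem v W then k else 0) ≡ card W * k
ΣF-∈ [] k = refl
ΣF-∈ (true ∷ W) k = cong (k +_) (ΣF-∈ W k)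
ΣF-∈ (false ∷ W) k = ΣF-∈ W k

ΣF-∉ : ∀ {n} (W : Sub n) k → ΣF (λ v → if mem v W then 0 else k) ≡ co W * k
ΣF-∉ [] k = refl
ΣF-∉ (true ∷ W) k = ΣF-∉ W k
ΣF-∉ (false ∷ W) k = cong (k +_) (ΣF-∉ W k)

data Seq {n} : Sub n → Set where
  [] : Seq emptyS
  snoc : ∀ {W} v → v ∉ W → Seq W → Seq (ins v W)

argmin : ∀ {n} (s : Sub n) (h : ∀ x → x ∈ s → ℕ) → 1 ≤ card s → Σ (Fin n) λ x → Σ (x ∈ s) λ p → ∀ y q → h x p ≤ h y q
argmin (false ∷ s) h le with argmin s (λ x → h (fsuc x)) le
... | x , p , min = fsuc x , p , λ { fzero () ; (fsuc y) q → min y q }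
argmin (true ∷ s) h le with decB (1 ≤ᵇ card s)
... | inj₂ none = fzero , refl , λ { fzero refl → ≤-refl ; (fsuc y) q → ⊥-elim (t≢f (⇒leᵇ (1≤card s y q)) none) }
... | inj₁ some with argmin s (λ x → h (fsuc x)) (leᵇ⇒ some)
...   | x , p , min with ≤-total (h fzero refl) (h (fsuc x) p)
...     | inj₁ q = fzero , refl , λ { fzero refl → ≤-refl ; (fsuc y) r → ≤-trans q (min y r) }
...     | inj₂ q = fsuc x , p , λ { fzero refl → q ; (fsuc y) r → min y r }

full : ∀ {n} → Sub n
full {zero} = []
full {suc n} = true ∷ full

∈-full : ∀ {n} (i : Fin n) → i ∈ full
∈-full fzero = refl
∈-full (fsuc i) = ∈-full i

co-full : ∀ {n} (W : Sub n) → co W ≡ 0 → W ≡ full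
co-full [] _ = refl
co-full (true ∷ W) e = cong (true ∷_) (co-full W e)

card-full : ∀ n → card (full {n}) ≡ n
card-full zero = refl
card-full (suc n) = cong suc (card-full n)

co-of-full : ∀ n → co (full {n}) ≡ 0
co-of-full zero = refl
co-of-full (suc n) = co-of-full n

-- Permutations are not summed over. The function `g` is the least total cost of an order of a set,
-- and the inequality `g (ins v W) ≤ g W + f v W` is added up with suitable weights; that the
-- minimum is at most the average follows by telescoping.
module Averaging {n} (f : Fin n → Sub n → ℕ) where

  total : ∀ {W : Sub n} → Seq W → ℕ
  total [] = 0
  total (snoc {W} v _ s) = total s + f v W

  Best : Sub n → Set
  Best W = Σ (Seq W) λ s → (s' : Seq W) → total s ≤ total s'

  best : ∀ k W → card W ≤ k → Best W
  best k W le with decB (1 ≤ᵇ card W)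
  ... | inj₂ none = subst Best (sym (card-0 W (n<1⇒n≡0 (≰⇒> (λ q → t≢f (⇒leᵇ q) none))))) ([] , λ _ → z≤n)
  best zero W le | inj₁ some = ⊥-elim (<-irrefl refl (≤-trans (leᵇ⇒ some) le))
  best (suc k) W le | inj₁ some = minimal (argmin W (λ v p → total (proj₁ (prior v p)) + f v (del v W)) (leᵇ⇒ some))
    where
    prior : ∀ v → v ∈ W → Best (del v W)
    prior v p = best k (del v W) (≤-pred (≤-trans (≤-reflexive (card-del v W p)) le))
    extended : ∀ v (p : v ∈ W) → Σ (Seq W) λ s → total s ≡ total (proj₁ (prior v p)) + f v (del v W)
    extended v p = subst (λ U → Σ (Seq U) λ s → total s ≡ total (proj₁ (prior v p)) + f v (del v W)) (ins-del v W p)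
      (snoc v (mem-del-same v W) (proj₁ (prior v p)) , refl)
    below : ∀ {U} (s : Seq U) → U ≡ W → ∃ λ v → Σ (v ∈ W) λ p → total (proj₁ (prior v p)) + f v (del v W) ≤ total s
    below [] e = ⊥-elim (<-irrefl refl (≤-trans (leᵇ⇒ some) (≤-reflexive (trans (cong card (sym e)) (card-empty n)))))
    below (snoc {U} v v∉ s) e = v , v∈ , compare (del v W) (prior v v∈) (trans (cong (del v) (sym e)) (del-ins v U v∉))
      where
      v∈ : v ∈ W
      v∈ = subst (v ∈_) e (mem-ins-same v U)
      compare : ∀ U' → (b : Best U') → U' ≡ U → total (proj₁ b) + f v U' ≤ total s + f v U
      compare U' b refl = +-monoˡ-≤ (f v U') (proj₂ b s)
    minimal : (Σ (Fin n) λ v → Σ (v ∈ W) λ p → ∀ y q → total (proj₁ (prior v p)) + f v (del v W) ≤ total (proj₁ (prior y q)) + f y (del y W)) → Best W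
    minimal (v , p , min) = proj₁ (extended v p) , λ s' → let y , q , le = below s' refl in
      ≤-trans (≤-reflexive (proj₂ (extended v p))) (≤-trans (min y q) le)

  abstract
    g : Sub n → ℕ
    g W = total (proj₁ (best (card W) W ≤-refl))

    g-step : ∀ v W → v ∉ W → g (ins v W) ≤ g W + f v W
    g-step v W v∉ = proj₂ (best (card (ins v W)) (ins v W) ≤-refl) (snoc v v∉ (proj₁ (best (card W) W ≤-refl)))

    g-empty : ∀ W → card W ≡ 0 → g W ≡ 0
    g-empty W e rewrite card-0 W e = n≤0⇒n≡0 (proj₂ (best (card (emptyS {n})) emptyS ≤-refl) [])

    g-attained : ∀ W → Σ (Seq W) λ s → total s ≡ g W
    g-attained W = proj₁ (best (card W) W ≤-refl) , refl

  -- For `v` outside `W`, `κ W` counts the orders of all `n` vertices in which `W` is the set of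
  -- predecessors of `v`; `κ'` expresses the same number through `W + v`.
  κ κ' : Sub n → ℕ
  κ W = card W ! * pred (co W) !
  κ' W = pred (card W) ! * co W !

  local : Fin n → ℕ
  local v = ΣS (λ W → if mem v W then 0 else κ W * f v W)

  private
    coκ : ∀ W → wt W ≡ co W * κ W + (if (full ⊆ᵇ W) ∧ (card W ≡ᵇ card (full {n})) then n ! else 0)
    coκ W with co W in e
    ... | zero rewrite co-full W e | ⇒⊆ᵇ {s = full {n}} {full} (λ _ p → p) | ⇒eqᵇ {card (full {n})} refl | card-full n = *-identityʳ (n !)
    ... | suc m with decB (full ⊆ᵇ W)
    ...   | inj₁ p = contradiction (trans (sym e) (trans (cong co (⊑-antisym {s = W} {full} (λ i _ → ∈-full i) (⊆ᵇ⇒ p))) (co-of-full n))) λ ()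
    ...   | inj₂ p rewrite p = trans (swap₁ (card W !) m (m !)) (sym (+-identityʳ _))
      where
      swap₁ : ∀ a m q → a * (suc m * q) ≡ suc m * (a * q)
      swap₁ = solve 3 (λ a m q → a :* ((con 1 :+ m) :* q) := (con 1 :+ m) :* (a :* q)) refl
        where open +-*-Solver

    cardκ' : ∀ W → wt W * g W ≡ card W * (κ' W * g W)
    cardκ' W with card W in e
    ... | zero rewrite g-empty W e = *-zeroʳ (1 * co W !)
    ... | suc m = assoc₁ m (m !) (co W !) (g W)
      where
      assoc₁ : ∀ m p q r → (suc m * p) * q * r ≡ suc m * (p * q * r)
      assoc₁ = solve 4 (λ m p q r → ((con 1 :+ m) :* p) :* q :* r := (con 1 :+ m) :* (p :* q :* r)) refl
        where open +-*-Solver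

    κ≡ : ∀ v W → v ∉ W → κ W ≡ κ' (ins v W)
    κ≡ v W v∉ = cong₂ (λ a b → a ! * b !) (cong pred (sym (card-ins v W v∉))) (cong pred (co-ins v W v∉))

    toggled : ∀ v → ΣS (λ W → if mem v W then κ' W * g W else 0) ≡ ΣS (λ W → if mem v W then 0 else κ W * g (ins v W))
    toggled v = trans (ΣS-pair _ v) (ΣS-cong h)
      where
      h : ∀ W → (if mem v W then 0 else (if mem v W then κ' W * g W else 0) + (if mem v (ins v W) then κ' (ins v W) * g (ins v W) else 0))
        ≡ (if mem v W then 0 else κ W * g (ins v W))
      h W with decB (mem v W)
      ... | inj₁ p rewrite p = refl
      ... | inj₂ p rewrite p | mem-ins-same v W | κ≡ v W p = refl

  -- Summed over all `v` and `W`, each `g W` has the same weight on both sides, except for the full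
  -- set, which precedes no vertex; its weight `n !` is what remains.
  average : n ! * g full ≤ ΣF local
  average = +-cancelˡ-≤ (ΣS (λ W → co W * κ W * g W)) _ _ (begin
    ΣS (λ W → co W * κ W * g W) + n ! * g full ≡⟨ cong (ΣS (λ W → co W * κ W * g W) +_) (sym last) ⟩
    ΣS (λ W → co W * κ W * g W) + ΣS (λ W → (if (full ⊆ᵇ W) ∧ (card W ≡ᵇ card (full {n})) then n ! else 0) * g W)
      ≡⟨ sym (trans (ΣS-cong (λ W → trans (cong (_* g W) (coκ W)) (*-distribʳ-+ (g W) (co W * κ W) _))) (ΣS-+ (λ W → co W * κ W * g W) _)) ⟩
    ΣS (λ W → wt W * g W) ≡⟨ ΣS-cong (λ W → trans (cardκ' W) (sym (ΣF-∈ W (κ' W * g W)))) ⟩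
    ΣS (λ W → ΣF (λ v → if mem v W then κ' W * g W else 0)) ≡⟨ sym (ΣF-ΣS (λ v W → if mem v W then κ' W * g W else 0)) ⟩
    ΣF (λ v → ΣS (λ W → if mem v W then κ' W * g W else 0)) ≡⟨ ΣF-cong toggled ⟩
    ΣF (λ v → ΣS (λ W → if mem v W then 0 else κ W * g (ins v W))) ≤⟨ ΣF-mono (λ v → ΣS-mono (each-≤ v)) ⟩
    ΣF (λ v → ΣS (λ W → (if mem v W then 0 else κ W * g W) + (if mem v W then 0 else κ W * f v W)))
      ≡⟨ trans (ΣF-cong (λ v → ΣS-+ (λ W → if mem v W then 0 else κ W * g W) _)) (ΣF-+ (λ v → ΣS (λ W → if mem v W then 0 else κ W * g W)) local) ⟩
    ΣF (λ v → ΣS (λ W → if mem v W then 0 else κ W * g W)) + ΣF local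
      ≡⟨ cong (_+ ΣF local) (trans (ΣF-ΣS (λ v W → if mem v W then 0 else κ W * g W)) (ΣS-cong (λ W → trans (ΣF-∉ W (κ W * g W)) (sym (*-assoc (co W) (κ W) (g W)))))) ⟩
    ΣS (λ W → co W * κ W * g W) + ΣF local ∎)
    where
    open ≤-Reasoning
    last : ΣS (λ W → (if (full ⊆ᵇ W) ∧ (card W ≡ᵇ card (full {n})) then n ! else 0) * g W) ≡ n ! * g full
    last = trans (ΣS-cong (λ W → push ((full ⊆ᵇ W) ∧ (card W ≡ᵇ card (full {n}))) (g W))) (ΣS-exact full (λ W → n ! * g W))
      where
      push : ∀ b x → (if b then n ! else 0) * x ≡ (if b then n ! * x else 0)
      push true x = refl
      push false x = refl
    each-≤ : ∀ v W → (if mem v W then 0 else κ W * g (ins v W)) ≤ (if mem v W then 0 else κ W * g W) + (if mem v W then 0 else κ W * f v W)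
    each-≤ v W with decB (mem v W)
    ... | inj₁ p rewrite p = z≤n
    ... | inj₂ p rewrite p = ≤-trans (*-monoʳ-≤ (κ W) (g-step v W p)) (≤-reflexive (*-distribˡ-+ (κ W) (g W) _))

  -- Forgetting the position of v itself costs a factor n + 1.
  local-total : ∀ v → (∀ W → v ∉ W → f v (ins v W) ≡ f v W) → suc n * local v ≡ ΣS (λ W → wt W * f v W)
  local-total v inv = sym (trans (ΣS-pair _ v) (trans (ΣS-cong h) (ΣS-* (suc n) (λ W → if mem v W then 0 else κ W * f v W))))
    where
    open +-*-Solver
    ring : ∀ p a b q f → p * (suc b * q) * f + (suc a * p) * q * f ≡ suc (a + suc b) * (p * q * f)
    ring = solve 5 (λ p a b q f → p :* ((con 1 :+ b) :* q) :* f :+ ((con 1 :+ a) :* p) :* q :* f := (con 1 :+ (a :+ (con 1 :+ b))) :* (p :* q :* f)) refl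
    h : ∀ W → (if mem v W then 0 else wt W * f v W + wt (ins v W) * f v (ins v W)) ≡ suc n * (if mem v W then 0 else κ W * f v W)
    h W with decB (mem v W)
    ... | inj₁ p rewrite p = sym (*-zeroʳ (suc n))
    ... | inj₂ p rewrite p | inv W p | card-ins v W p | co-ins v W p =
      trans (ring (card W !) (card W) (co (ins v W)) (co (ins v W) !) (f v W))
        (cong (λ z → suc z * (card W ! * co (ins v W) ! * f v W)) (trans (cong (card W +_) (sym (co-ins v W p))) (card+co W)))

-- Linear algebra over a field without decidable equality

module Linear {a ℓ} (𝔽 : Field a ℓ) where
  open Field 𝔽 using (Carrier; _≈_; 0#; 1#; -_; 0≉1; inverse; setoid; +-cong; *-cong; +-congˡ; +-congʳ; *-congˡ; *-congʳ; -‿cong;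
      -‿inverseˡ; -‿inverseʳ; zeroˡ; zeroʳ; distribˡ; distribʳ)
    renaming (_+_ to _⊕_; _*_ to _⊗_; refl to ≈-refl; sym to ≈-sym; trans to ≈-trans; reflexive to ≈-reflexive;
      +-assoc to ⊕-assoc; +-comm to ⊕-comm; +-identityˡ to ⊕-identityˡ; +-identityʳ to ⊕-identityʳ;
      *-assoc to ⊗-assoc; *-comm to ⊗-comm; *-identityˡ to ⊗-identityˡ; *-identityʳ to ⊗-identityʳ) public
  open Algebra.Properties.Ring (Field.ring 𝔽) using (-‿distribˡ-*; -‿distribʳ-*; -‿+-comm) renaming (-‿involutive to neg-neg; -0#≈0# to neg-0) public
  open Homology 𝔽 public
  open Relation.Binary.Reasoning.Setoid setoid

  ⊕-interchange : ∀ x y z w → (x ⊕ y) ⊕ (z ⊕ w) ≈ (x ⊕ z) ⊕ (y ⊕ w)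
  ⊕-interchange x y z w = begin
    (x ⊕ y) ⊕ (z ⊕ w) ≈⟨ ⊕-assoc x y (z ⊕ w) ⟩
    x ⊕ (y ⊕ (z ⊕ w)) ≈⟨ +-congˡ (≈-sym (⊕-assoc y z w)) ⟩
    x ⊕ ((y ⊕ z) ⊕ w) ≈⟨ +-congˡ (+-congʳ (⊕-comm y z)) ⟩
    x ⊕ ((z ⊕ y) ⊕ w) ≈⟨ +-congˡ (⊕-assoc z y w) ⟩
    x ⊕ (z ⊕ (y ⊕ w)) ≈⟨ ≈-sym (⊕-assoc x z (y ⊕ w)) ⟩
    (x ⊕ z) ⊕ (y ⊕ w) ∎

  ⊗-swap : ∀ x y z → x ⊗ (y ⊗ z) ≈ y ⊗ (x ⊗ z)
  ⊗-swap x y z = ≈-trans (≈-sym (⊗-assoc x y z)) (≈-trans (*-congʳ (⊗-comm x y)) (⊗-assoc y x z))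

  0⊕0 : ∀ {x y} → x ≈ 0# → y ≈ 0# → x ⊕ y ≈ 0#
  0⊕0 p q = ≈-trans (+-cong p q) (⊕-identityˡ 0#)

  ⊗0 : ∀ x {y} → y ≈ 0# → x ⊗ y ≈ 0#
  ⊗0 x p = ≈-trans (*-congˡ p) (zeroʳ x)

  neg-⊗-neg : ∀ x y → (- x) ⊗ (- y) ≈ x ⊗ y
  neg-⊗-neg x y = ≈-trans (≈-sym (-‿distribˡ-* x (- y))) (≈-trans (-‿cong (≈-sym (-‿distribʳ-* x y))) (neg-neg _))

  sum-cong : ∀ b {f g : Fin b → Carrier} → (∀ j → f j ≈ g j) → sumFin b f ≈ sumFin b g
  sum-cong zero h = ≈-refl
  sum-cong (suc b) h = +-cong (h fzero) (sum-cong b (λ j → h (fsuc j)))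

  sum-0 : ∀ b {f : Fin b → Carrier} → (∀ j → f j ≈ 0#) → sumFin b f ≈ 0#
  sum-0 zero h = ≈-refl
  sum-0 (suc b) h = 0⊕0 (h fzero) (sum-0 b (λ j → h (fsuc j)))

  sum-⊕ : ∀ b (f g : Fin b → Carrier) → sumFin b (λ j → f j ⊕ g j) ≈ sumFin b f ⊕ sumFin b g
  sum-⊕ zero f g = ≈-sym (⊕-identityˡ 0#)
  sum-⊕ (suc b) f g = ≈-trans (+-congˡ (sum-⊕ b (f ∘ fsuc) (g ∘ fsuc))) (⊕-interchange (f fzero) (g fzero) _ _)

  sum-⊗ : ∀ b x (f : Fin b → Carrier) → sumFin b (λ j → x ⊗ f j) ≈ x ⊗ sumFin b f
  sum-⊗ zero x f = ≈-sym (zeroʳ x)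
  sum-⊗ (suc b) x f = ≈-trans (+-congˡ (sum-⊗ b x (f ∘ fsuc))) (≈-sym (distribˡ x (f fzero) _))

  sum-swap : ∀ b m (f : Fin b → Fin m → Carrier) → sumFin b (λ j → sumFin m (f j)) ≈ sumFin m (λ k → sumFin b (λ j → f j k))
  sum-swap zero m f = ≈-sym (sum-0 m (λ _ → ≈-refl))
  sum-swap (suc b) m f = ≈-trans (+-congˡ (sum-swap b m (f ∘ fsuc))) (≈-sym (sum-⊕ m (f fzero) _))

  sum-only : ∀ b (f : Fin b → Carrier) i → (∀ j → j ≢ i → f j ≈ 0#) → sumFin b f ≈ f i
  sum-only (suc b) f fzero h = ≈-trans (+-congˡ (sum-0 b (λ j → h (fsuc j) λ ()))) (⊕-identityʳ _)
  sum-only (suc b) f (fsuc i) h = ≈-trans (+-congʳ (h fzero λ ())) (≈-trans (⊕-identityˡ _) (sum-only b (f ∘ fsuc) i (λ j ne → h (fsuc j) (λ e → ne (fsuc-injective e)))))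

  sum-remove : ∀ b (f : Fin (suc b) → Carrier) i → sumFin (suc b) f ≈ f i ⊕ sumFin b (f ∘ punchIn i)
  sum-remove b f fzero = ≈-refl
  sum-remove (suc b) f (fsuc i) = ≈-trans (+-congˡ (sum-remove b (f ∘ fsuc) i)) (≈-trans (≈-sym (⊕-assoc _ _ _)) (≈-trans (+-congʳ (⊕-comm _ _)) (⊕-assoc _ _ _)))

  sum-join : ∀ b m (f : Fin (b + m) → Carrier) → sumFin (b + m) f ≈ sumFin b (λ j → f (join b m (inj₁ j))) ⊕ sumFin m (λ k → f (join b m (inj₂ k)))
  sum-join zero m f = ≈-sym (⊕-identityˡ _)
  sum-join (suc b) m f = ≈-trans (+-congˡ (sum-join b m (f ∘ fsuc))) (≈-sym (⊕-assoc _ _ _))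

  sum-antisym : ∀ b (h : Fin b → Fin b → Carrier) → (∀ i j → i ≢ j → h i j ⊕ h j i ≈ 0#) → (∀ i → h i i ≈ 0#) → sumFin b (λ i → sumFin b (h i)) ≈ 0#
  sum-antisym zero h s d = ≈-refl
  sum-antisym (suc b) h s d = begin
    (h fzero fzero ⊕ r) ⊕ sumFin b (λ i → h (fsuc i) fzero ⊕ sumFin b (h (fsuc i) ∘ fsuc))
      ≈⟨ +-cong (≈-trans (+-congʳ (d fzero)) (⊕-identityˡ r)) (sum-⊕ b (λ i → h (fsuc i) fzero) _) ⟩
    r ⊕ (sumFin b (λ i → h (fsuc i) fzero) ⊕ sumFin b (λ i → sumFin b (h (fsuc i) ∘ fsuc)))
      ≈⟨ +-congˡ (≈-trans (+-congˡ (sum-antisym b (λ i j → h (fsuc i) (fsuc j)) (λ i j ne → s (fsuc i) (fsuc j) (λ e → ne (fsuc-injective e))) (λ i → d (fsuc i)))) (⊕-identityʳ _)) ⟩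
    r ⊕ sumFin b (λ i → h (fsuc i) fzero) ≈⟨ ≈-sym (sum-⊕ b (λ i → h fzero (fsuc i)) _) ⟩
    sumFin b (λ i → h fzero (fsuc i) ⊕ h (fsuc i) fzero) ≈⟨ sum-0 b (λ i → s fzero (fsuc i) λ ()) ⟩
    0# ∎
    where
    r : Carrier
    r = sumFin b (λ i → h fzero (fsuc i))

  all-¬¬ : ∀ b {P : Fin b → Set ℓ} → (∀ j → ¬ ¬ P j) → ¬ ¬ (∀ j → P j)
  all-¬¬ zero h k = k (λ ())
  all-¬¬ (suc b) h k = h fzero (λ p → all-¬¬ b (λ j → h (fsuc j)) (λ q → k (λ { fzero → p ; (fsuc j) → q j })))

  Independent : ∀ m p → (Fin m → Fin p → Carrier) → Set (a ⊔ ℓ)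
  Independent m p A = (x : Fin m → Carrier) → (∀ i → sumFin m (λ j → x j ⊗ A j i) ≈ 0#) → ∀ j → x j ≈ 0#

  -- Gaussian elimination; equality with 0 is decided under a double negation, which the goal ⊥ permits.
  dependent : ∀ p m → p < m → ∀ A → ¬ Independent m p A
  dependent zero (suc m) lt A ind = 0≉1 (≈-sym (ind (λ _ → 1#) (λ ()) fzero))
  dependent (suc p) (suc m) (s≤s lt) A ind = all-¬¬ (suc m) (λ j ne → pivot j ne) null-column
    where
    null-column : ¬ (∀ j → A j fzero ≈ 0#)
    null-column h = dependent p (suc m) (m≤n⇒m≤1+n lt) (λ j i → A j (fsuc i)) (λ x e → ind x λ { fzero → sum-0 (suc m) (λ j → ⊗0 (x j) (h j)) ; (fsuc i) → e i })
    pivot : ∀ j → ¬ ¬ (A j fzero ≈ 0#)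
    pivot j ne = dependent p m lt A' ind'
      where
      y : Carrier
      y = proj₁ (inverse (A j fzero) ne)
      q : Fin m → Carrier
      q k = A (punchIn j k) fzero ⊗ y
      A' : Fin m → Fin p → Carrier
      A' k i = A (punchIn j k) (fsuc i) ⊕ (- q k ⊗ A j (fsuc i))
      ind' : Independent m p A'
      ind' x e k = ≈-trans (≈-reflexive (sym (insertAt-punchIn x j x₀ k))) (ind z cols (punchIn j k))
        where
        -- The coefficient of the pivot row undoes the multiples of that row which were subtracted
        -- from the other rows.
        x₀ : Carrier
        x₀ = sumFin m (λ k → x k ⊗ - q k)
        z : Fin (suc m) → Carrier
        z = insertAt x j x₀
        expand : ∀ i → sumFin (suc m) (λ l → z l ⊗ A l i) ≈ sumFin m (λ k → x k ⊗ (A (punchIn j k) i ⊕ (- q k ⊗ A j i)))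
        expand i = begin
          sumFin (suc m) (λ l → z l ⊗ A l i) ≈⟨ sum-remove m (λ l → z l ⊗ A l i) j ⟩
          z j ⊗ A j i ⊕ sumFin m (λ k → z (punchIn j k) ⊗ A (punchIn j k) i)
            ≈⟨ +-cong (*-congʳ (≈-reflexive (insertAt-lookup x j x₀))) (sum-cong m (λ k → *-congʳ (≈-reflexive (insertAt-punchIn x j x₀ k)))) ⟩
          x₀ ⊗ A j i ⊕ sumFin m (λ k → x k ⊗ A (punchIn j k) i)
            ≈⟨ +-congʳ (≈-trans (⊗-comm x₀ (A j i)) (≈-trans (≈-sym (sum-⊗ m (A j i) _)) (sum-cong m (λ k → ≈-trans (⊗-comm _ _) (⊗-assoc _ _ _))))) ⟩
          sumFin m (λ k → x k ⊗ (- q k ⊗ A j i)) ⊕ sumFin m (λ k → x k ⊗ A (punchIn j k) i)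
            ≈⟨ ≈-sym (sum-⊕ m _ _) ⟩
          sumFin m (λ k → x k ⊗ (- q k ⊗ A j i) ⊕ x k ⊗ A (punchIn j k) i)
            ≈⟨ sum-cong m (λ k → ≈-trans (⊕-comm _ _) (≈-sym (distribˡ (x k) _ _))) ⟩
          sumFin m (λ k → x k ⊗ (A (punchIn j k) i ⊕ (- q k ⊗ A j i))) ∎
        cols : ∀ i → sumFin (suc m) (λ l → z l ⊗ A l i) ≈ 0#
        cols (fsuc i) = ≈-trans (expand (fsuc i)) (e i)
        cols fzero = ≈-trans (expand fzero) (sum-0 m (λ k → ⊗0 (x k) (begin
          b k ⊕ (- (b k ⊗ y) ⊗ A j fzero) ≈⟨ +-congˡ (≈-sym (-‿distribˡ-* (b k ⊗ y) (A j fzero))) ⟩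
          b k ⊕ - ((b k ⊗ y) ⊗ A j fzero) ≈⟨ +-congˡ (-‿cong (≈-trans (⊗-assoc (b k) y _) (≈-trans (*-congˡ (≈-trans (⊗-comm y _) (proj₂ (inverse (A j fzero) ne)))) (⊗-identityʳ (b k))))) ⟩
          b k ⊕ - b k ≈⟨ -‿inverseʳ (b k) ⟩
          0# ∎)))
          where
          b : Fin m → Carrier
          b k = A (punchIn j k) fzero

  independent-≤ : ∀ m p A → Independent m p A → m ≤ p
  independent-≤ m p A ind with m ≤? p
  ... | yes le = le
  ... | no nle = ⊥-elim (dependent p m (≰⇒> nle) A ind)

  -- The boundary operator

  sign² : ∀ k → signF k ⊗ signF k ≈ 1#
  sign² zero = ⊗-identityˡ 1#
  sign² (suc k) = ≈-trans (neg-⊗-neg (signF k) (signF k)) (sign² k)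

  sgn : ∀ {n} → Sub n → Sub n → Carrier
  sgn σ τ = signF (pos σ τ)

  -- Removing two elements in either order gives opposite signs, which makes ∂∂ vanish.
  sign-swap : ∀ {n} (σ : Sub n) x y → x ∈ σ → y ∈ σ → x ≢ y
    → sgn σ (del x σ) ⊗ sgn (del x σ) (del y (del x σ)) ≈ - (sgn σ (del y σ) ⊗ sgn (del y σ) (del x (del y σ)))
  sign-swap (b ∷ σ) fzero fzero p q h = ⊥-elim (h refl)
  sign-swap (true ∷ σ) fzero (fsuc y) p q h = ≈-trans (⊗-identityˡ _) (≈-sym (≈-trans (-‿cong (⊗-identityʳ _)) (neg-neg _)))
  sign-swap (true ∷ σ) (fsuc x) fzero p q h = ≈-trans (⊗-identityʳ _) (-‿cong (≈-sym (⊗-identityˡ _)))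
  sign-swap (true ∷ σ) (fsuc x) (fsuc y) p q h = ≈-trans (neg-⊗-neg _ _) (≈-trans (sign-swap σ x y p q (λ e → h (cong fsuc e))) (-‿cong (≈-sym (neg-⊗-neg _ _))))
  sign-swap (false ∷ σ) (fsuc x) (fsuc y) p q h = sign-swap σ x y p q (λ e → h (cong fsuc e))

  sign-swap-ins : ∀ {n} (τ : Sub n) x y → x ∉ τ → y ∉ τ → x ≢ y
    → sgn (ins x (ins y τ)) (ins y τ) ⊗ sgn (ins y τ) τ ≈ - (sgn (ins x (ins y τ)) (ins x τ) ⊗ sgn (ins x τ) τ)
  sign-swap-ins τ x y x∉ y∉ x≢y = subst₂ (λ σ σ' → sgn ω σ ⊗ sgn σ τ ≈ - (sgn ω σ' ⊗ sgn σ' τ)) del-x del-y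
    (subst₂ (λ ρ ρ' → sgn ω (del x ω) ⊗ sgn (del x ω) ρ ≈ - (sgn ω (del y ω) ⊗ sgn (del y ω) ρ'))
      (trans (cong (del y) del-x) (del-ins y τ y∉)) (trans (cong (del x) del-y) (del-ins x τ x∉))
      (sign-swap ω x y (mem-ins-same x (ins y τ)) (ins-⊒ x (ins y τ) y (mem-ins-same y τ)) x≢y))
    where
    ω : Sub _
    ω = ins x (ins y τ)
    del-x : del x ω ≡ ins y τ
    del-x = del-ins x (ins y τ) (ins-∉ x y τ x≢y x∉)
    del-y : del y ω ≡ ins x τ
    del-y = trans (cong (del y) (ins-comm x y τ)) (del-ins y (ins x τ) (ins-∉ y x τ (λ e → x≢y (sym e)) y∉))

  ΣL : ∀ {n} → (Sub n → Carrier) → Carrier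
  ΣL {zero} f = f []
  ΣL {suc n} f = ΣL (λ s → f (false ∷ s)) ⊕ ΣL (λ s → f (true ∷ s))

  sumL-ΣL : ∀ {n} (f : Sub n → Carrier) → sumL f ≈ ΣL f
  sumL-ΣL {n} f = go n f
    where
    onList : ∀ {m} → List (Sub m) → (Sub m → Carrier) → Carrier
    onList xs f = foldr (λ σ acc → f σ ⊕ acc) 0# xs
    on-++ : ∀ {m} xs ys (f : Sub m → Carrier) → onList (xs ++ ys) f ≈ onList xs f ⊕ onList ys f
    on-++ [] ys f = ≈-sym (⊕-identityˡ _)
    on-++ (x ∷ xs) ys f = ≈-trans (+-congˡ (on-++ xs ys f)) (≈-sym (⊕-assoc _ _ _))
    on-map : ∀ {m k} (φ : Sub m → Sub k) xs (f : Sub k → Carrier) → onList (mapL φ xs) f ≈ onList xs (f ∘ φ)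
    on-map φ [] f = ≈-refl
    on-map φ (x ∷ xs) f = +-congˡ (on-map φ xs f)
    go : ∀ m (f : Sub m → Carrier) → onList (allSubs m) f ≈ ΣL f
    go zero f = ⊕-identityʳ _
    go (suc m) f = ≈-trans (on-++ (mapL (false ∷_) (allSubs m)) _ f) (+-cong (≈-trans (on-map (false ∷_) (allSubs m) f) (go m _)) (≈-trans (on-map (true ∷_) (allSubs m) f) (go m _)))

  ΣL-cong : ∀ {n} {f g : Sub n → Carrier} → (∀ s → f s ≈ g s) → ΣL f ≈ ΣL g
  ΣL-cong {zero} h = h []
  ΣL-cong {suc n} h = +-cong (ΣL-cong (λ s → h (false ∷ s))) (ΣL-cong (λ s → h (true ∷ s)))

  ΣL-0 : ∀ {n} {f : Sub n → Carrier} → (∀ s → f s ≈ 0#) → ΣL f ≈ 0#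
  ΣL-0 {zero} h = h []
  ΣL-0 {suc n} h = 0⊕0 (ΣL-0 (λ s → h (false ∷ s))) (ΣL-0 (λ s → h (true ∷ s)))

  ΣL-only : ∀ {n} (f : Sub n → Carrier) σ → (∀ s → s ≢ σ → f s ≈ 0#) → ΣL f ≈ f σ
  ΣL-only f [] h = ≈-refl
  ΣL-only {suc n} f (false ∷ σ) h = ≈-trans (+-cong (ΣL-only (λ s → f (false ∷ s)) σ (λ s ne → h (false ∷ s) (λ { refl → ne refl }))) (ΣL-0 {n} (λ s → h (true ∷ s) λ ()))) (⊕-identityʳ _)
  ΣL-only {suc n} f (true ∷ σ) h = ≈-trans (+-cong (ΣL-0 {n} (λ s → h (false ∷ s) λ ())) (ΣL-only (λ s → f (true ∷ s)) σ (λ s ne → h (true ∷ s) (λ { refl → ne refl })))) (⊕-identityˡ _)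

  ΣL-cover : ∀ {n} (ρ : Sub n) (g : Sub n → Carrier) → ΣL (λ σ → if (ρ ⊆ᵇ σ) ∧ (card σ ≡ᵇ suc (card ρ)) then g σ else 0#)
    ≈ sumFin n (λ x → if mem x ρ then 0# else g (ins x ρ))
  ΣL-cover [] g = ≈-refl
  ΣL-cover {suc n} (true ∷ ρ) g = ≈-trans (+-congʳ (ΣL-0 {n} (λ _ → ≈-refl))) (+-congˡ (ΣL-cover ρ (λ s → g (true ∷ s))))
  ΣL-cover {suc n} (false ∷ ρ) g = ≈-trans (⊕-comm _ _) (+-cong first (ΣL-cover ρ (λ s → g (false ∷ s))))
    where
    e : Sub n → Carrier
    e s = if (ρ ⊆ᵇ s) ∧ (card s ≡ᵇ card ρ) then g (true ∷ s) else 0#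
    first : ΣL e ≈ g (true ∷ (ρ ∪ˢ emptyS))
    first = ≈-trans (ΣL-only e ρ off) (≈-reflexive (trans at (cong (λ s → g (true ∷ s)) (sym (∪-empty ρ)))))
      where
      at : e ρ ≡ g (true ∷ ρ)
      at rewrite ⇒⊆ᵇ {s = ρ} {ρ} (λ _ p → p) | ⇒eqᵇ {card ρ} refl = refl
      off : ∀ s → s ≢ ρ → e s ≈ 0#
      off s ne with decB ((ρ ⊆ᵇ s) ∧ (card s ≡ᵇ card ρ))
      ... | inj₂ q rewrite q = ≈-refl
      ... | inj₁ q = let u , w = ∧-el {ρ ⊆ᵇ s} q in ⊥-elim (ne (sym (card-eq (⊆ᵇ⇒ u) (≤-reflexive (eqᵇ⇒ w)))))

  module Boundary {n} (Δ Γ : Cx n) where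

    term : Chain n → Sub n → Fin n → Carrier
    term w τ x = if mem x τ then 0# else if rel Δ Γ (ins x τ) then sgn (ins x τ) τ ⊗ w (ins x τ) else 0#

    bd-term : ∀ w τ → bd Δ Γ w τ ≈ sumFin n (term w τ)
    bd-term w τ = ≈-trans (sumL-ΣL (λ σ → if rel Δ Γ σ ∧ ((τ ⊆ᵇ σ) ∧ (card σ ≡ᵇ suc (card τ))) then sgn σ τ ⊗ w σ else 0#)) (≈-trans (ΣL-cong (λ σ → ≈-reflexive (regroup σ))) (ΣL-cover τ (λ σ → if rel Δ Γ σ then sgn σ τ ⊗ w σ else 0#)))
      where
      regroup : ∀ σ → (if rel Δ Γ σ ∧ ((τ ⊆ᵇ σ) ∧ (card σ ≡ᵇ suc (card τ))) then sgn σ τ ⊗ w σ else 0#)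
        ≡ (if (τ ⊆ᵇ σ) ∧ (card σ ≡ᵇ suc (card τ)) then (if rel Δ Γ σ then sgn σ τ ⊗ w σ else 0#) else 0#)
      regroup σ with rel Δ Γ σ | (τ ⊆ᵇ σ) ∧ (card σ ≡ᵇ suc (card τ))
      ... | true | true = refl
      ... | true | false = refl
      ... | false | true = refl
      ... | false | false = refl

    term-in : ∀ w τ x → x ∉ τ → rel Δ Γ (ins x τ) ≡ true → term w τ x ≡ sgn (ins x τ) τ ⊗ w (ins x τ)
    term-in w τ x p q rewrite p | q = refl

    term-∈ : ∀ w τ x → x ∈ τ → term w τ x ≡ 0#
    term-∈ w τ x p rewrite p = refl

    term-out : ∀ w τ x → x ∉ τ → rel Δ Γ (ins x τ) ≡ false → term w τ x ≡ 0#
    term-out w τ x p q rewrite p | q = refl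

    -- Whether a vertex contributes to the boundary at `τ` does not depend on the chain, so one case
    -- distinction serves several chains at once.
    data Place (w : Chain n) (τ : Sub n) (x : Fin n) : Set a where
      vanishes : term w τ x ≡ 0# → (∀ w' → term w' τ x ≡ 0#) → Place w τ x
      counts : x ∉ τ → rel Δ Γ (ins x τ) ≡ true → (∀ w' → term w' τ x ≡ sgn (ins x τ) τ ⊗ w' (ins x τ)) → Place w τ x

    place : ∀ w τ x → Place w τ x
    place w τ x with decB (mem x τ)
    ... | inj₁ p = vanishes (term-∈ w τ x p) (λ w' → term-∈ w' τ x p)
    ... | inj₂ p with decB (rel Δ Γ (ins x τ))
    ...   | inj₁ q = counts p q (λ w' → term-in w' τ x p q)
    ...   | inj₂ q = vanishes (term-out w τ x p q) (λ w' → term-out w' τ x p q)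

    bd-cong : ∀ w w' τ → (∀ σ → rel Δ Γ σ ≡ true → card σ ≡ suc (card τ) → w σ ≈ w' σ) → bd Δ Γ w τ ≈ bd Δ Γ w' τ
    bd-cong w w' τ h = ≈-trans (bd-term w τ) (≈-trans (sum-cong n same) (≈-sym (bd-term w' τ)))
      where
      same : ∀ x → term w τ x ≈ term w' τ x
      same x with place w τ x
      ... | vanishes _ k = ≈-reflexive (trans (k w) (sym (k w')))
      ... | counts p q k = ≈-trans (≈-reflexive (k w)) (≈-trans (*-congˡ (h (ins x τ) q (card-ins x τ p))) (≈-reflexive (sym (k w'))))

    bd-0 : ∀ w τ → (∀ σ → rel Δ Γ σ ≡ true → card σ ≡ suc (card τ) → w σ ≈ 0#) → bd Δ Γ w τ ≈ 0#
    bd-0 w τ h = ≈-trans (bd-term w τ) (sum-0 n none)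
      where
      none : ∀ x → term w τ x ≈ 0#
      none x with place w τ x
      ... | vanishes e _ = ≈-reflexive e
      ... | counts p q k = ≈-trans (≈-reflexive (k w)) (⊗0 _ (h (ins x τ) q (card-ins x τ p)))

    bd-⊕ : ∀ w w' τ → bd Δ Γ (λ σ → w σ ⊕ w' σ) τ ≈ bd Δ Γ w τ ⊕ bd Δ Γ w' τ
    bd-⊕ w w' τ = ≈-trans (bd-term (λ σ → w σ ⊕ w' σ) τ) (≈-trans (sum-cong n add) (≈-trans (sum-⊕ n (term w τ) (term w' τ)) (≈-sym (+-cong (bd-term w τ) (bd-term w' τ)))))
      where
      add : ∀ x → term (λ σ → w σ ⊕ w' σ) τ x ≈ term w τ x ⊕ term w' τ x
      add x with place w τ x
      ... | vanishes e k = ≈-trans (≈-reflexive (k (λ σ → w σ ⊕ w' σ))) (≈-sym (0⊕0 (≈-reflexive (k w)) (≈-reflexive (k w'))))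
      ... | counts p q k = ≈-trans (≈-reflexive (k (λ σ → w σ ⊕ w' σ))) (≈-trans (distribˡ _ _ _) (≈-sym (+-cong (≈-reflexive (k w)) (≈-reflexive (k w')))))

    bd-⊗ : ∀ r w τ → bd Δ Γ (λ σ → r ⊗ w σ) τ ≈ r ⊗ bd Δ Γ w τ
    bd-⊗ r w τ = ≈-trans (bd-term (λ σ → r ⊗ w σ) τ) (≈-trans (sum-cong n scale) (≈-trans (sum-⊗ n r (term w τ)) (*-congˡ (≈-sym (bd-term w τ)))))
      where
      scale : ∀ x → term (λ σ → r ⊗ w σ) τ x ≈ r ⊗ term w τ x
      scale x with place w τ x
      ... | vanishes e k = ≈-trans (≈-reflexive (k (λ σ → r ⊗ w σ))) (≈-sym (⊗0 r (≈-reflexive (k w))))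
      ... | counts p q k = ≈-trans (≈-reflexive (k (λ σ → r ⊗ w σ))) (≈-trans (⊗-swap _ r _) (*-congˡ (≈-reflexive (sym (k w)))))

    bd-lin : ∀ b x (z : Fin b → Chain n) τ → bd Δ Γ (lin b x z) τ ≈ lin b x (λ j → bd Δ Γ (z j)) τ
    bd-lin zero x z τ = bd-0 (λ _ → 0#) τ (λ _ _ _ → ≈-refl)
    bd-lin (suc b) x z τ = ≈-trans (bd-⊕ (λ σ → x fzero ⊗ z fzero σ) (lin b (x ∘ fsuc) (z ∘ fsuc)) τ) (+-cong (bd-⊗ (x fzero) (z fzero) τ) (bd-lin b (x ∘ fsuc) (z ∘ fsuc) τ))

    module _ (Δ-down : ∀ {σ τ} → τ ⊑ σ → Δ σ ≡ true → Δ τ ≡ true) (Γ-down : ∀ {σ τ} → τ ⊑ σ → Γ σ ≡ true → Γ τ ≡ true) where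

      rel-el : ∀ σ → rel Δ Γ σ ≡ true → Δ σ ≡ true × Γ σ ≡ false
      rel-el σ p = let q , r = ∧-el p in q , not-el r

      -- A face between two relative faces is relative. Hence no intermediate face is lost in the
      -- quotient when the boundary is taken twice.
      rel-between : ∀ {ρ σ τ} → ρ ⊑ σ → σ ⊑ τ → rel Δ Γ ρ ≡ true → rel Δ Γ τ ≡ true → rel Δ Γ σ ≡ true
      rel-between {ρ} {σ} {τ} h k p q = ∧-in (Δ-down k (proj₁ (rel-el τ q))) (not-in (falseI (λ g → t≢f (Γ-down h g) (proj₂ (rel-el ρ p)))))

      bd-bd : ∀ w τ → rel Δ Γ τ ≡ true → bd Δ Γ (bd Δ Γ w) τ ≈ 0#
      bd-bd w τ rτ = ≈-trans (bd-term (bd Δ Γ w) τ) (≈-trans (sum-cong n outer) (sum-antisym n h h-anti h-diag))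
        where
        ok : Fin n → Fin n → Bool
        ok x y = not (mem x τ) ∧ (not (mem y (ins x τ)) ∧ rel Δ Γ (ins y (ins x τ)))
        h : Fin n → Fin n → Carrier
        h x y = if ok x y then sgn (ins x τ) τ ⊗ (sgn (ins y (ins x τ)) (ins x τ) ⊗ w (ins y (ins x τ))) else 0#
        h-in : ∀ x y → x ∉ τ → y ∉ ins x τ → rel Δ Γ (ins y (ins x τ)) ≡ true → h x y ≡ sgn (ins x τ) τ ⊗ (sgn (ins y (ins x τ)) (ins x τ) ⊗ w (ins y (ins x τ)))
        h-in x y p q r rewrite p | q | r = refl
        h-off : ∀ x y → ok x y ≡ false → h x y ≡ 0#
        h-off x y e rewrite e = refl
        outer : ∀ x → term (bd Δ Γ w) τ x ≈ sumFin n (h x)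
        outer x with decB (mem x τ) | decB (rel Δ Γ (ins x τ))
        ... | inj₁ p | _ = ≈-trans (≈-reflexive (term-∈ (bd Δ Γ w) τ x p)) (≈-sym (sum-0 n (λ y → ≈-reflexive (h-off x y (∧-falseˡ _ (cong not p))))))
        ... | inj₂ p | inj₂ q = ≈-trans (≈-reflexive (term-out (bd Δ Γ w) τ x p q)) (≈-sym (sum-0 n (λ y → ≈-reflexive (h-off x y
              (∧-falseʳ (not (mem x τ)) (∧-falseʳ (not (mem y (ins x τ))) (falseI (λ r → t≢f (rel-between (ins-⊒ x τ) (ins-⊒ y (ins x τ)) rτ r) q))))))))
        ... | inj₂ p | inj₁ q = ≈-trans (≈-reflexive (term-in (bd Δ Γ w) τ x p q)) (≈-trans (*-congˡ (bd-term w (ins x τ))) (≈-trans (≈-sym (sum-⊗ n _ (term w (ins x τ)))) (sum-cong n inner)))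
          where
          inner : ∀ y → sgn (ins x τ) τ ⊗ term w (ins x τ) y ≈ h x y
          inner y with decB (mem y (ins x τ)) | decB (rel Δ Γ (ins y (ins x τ)))
          ... | inj₁ r | _ = ≈-trans (⊗0 _ (≈-reflexive (term-∈ w (ins x τ) y r))) (≈-reflexive (sym (h-off x y (∧-falseʳ (not (mem x τ)) (∧-falseˡ (rel Δ Γ (ins y (ins x τ))) (cong not r))))))
          ... | inj₂ r | inj₁ s = ≈-trans (*-congˡ (≈-reflexive (term-in w (ins x τ) y r s))) (≈-reflexive (sym (h-in x y p r s)))
          ... | inj₂ r | inj₂ s = ≈-trans (⊗0 _ (≈-reflexive (term-out w (ins x τ) y r s))) (≈-reflexive (sym (h-off x y (∧-falseʳ (not (mem x τ)) (∧-falseʳ (not (mem y (ins x τ))) s)))))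
        h-diag : ∀ x → h x x ≈ 0#
        h-diag x = ≈-reflexive (h-off x x (∧-falseʳ (not (mem x τ)) (∧-falseˡ _ (cong not (mem-ins-same x τ)))))
        h-anti : ∀ x y → x ≢ y → h x y ⊕ h y x ≈ 0#
        h-anti x y x≢y with decB (ok x y)
        ... | inj₂ e = 0⊕0 (≈-reflexive (h-off x y e)) (≈-reflexive (h-off y x (trans (sym ok-sym) e)))
          where
          ok-sym : ok x y ≡ ok y x
          ok-sym rewrite mem-ins-other y x τ (λ q → x≢y (sym q)) | mem-ins-other x y τ x≢y | ins-comm y x τ = ∧-swap (not (mem x τ)) (not (mem y τ)) _
        ... | inj₁ o = begin
          h x y ⊕ h y x
            ≈⟨ +-cong (≈-reflexive (h-in x y x∉ y∉' rω)) (≈-reflexive (h-in y x y∉ (ins-∉ x y τ x≢y x∉) (subst (λ σ → rel Δ Γ σ ≡ true) (ins-comm y x τ) rω))) ⟩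
          sgn (ins x τ) τ ⊗ (sgn ω (ins x τ) ⊗ w ω) ⊕ sgn (ins y τ) τ ⊗ (sgn (ins x (ins y τ)) (ins y τ) ⊗ w (ins x (ins y τ)))
            ≈⟨ +-cong (regroup _ _ _) (≈-trans (regroup _ _ _) (≈-trans (*-congʳ (sign-swap-ins τ x y x∉ y∉ x≢y))
                 (≈-reflexive (cong (λ σ → (- (sgn σ (ins x τ) ⊗ sgn (ins x τ) τ)) ⊗ w σ) (ins-comm x y τ))))) ⟩
          (sgn ω (ins x τ) ⊗ sgn (ins x τ) τ) ⊗ w ω ⊕ (- (sgn ω (ins x τ) ⊗ sgn (ins x τ) τ)) ⊗ w ω ≈⟨ ≈-sym (distribʳ _ _ _) ⟩
          ((sgn ω (ins x τ) ⊗ sgn (ins x τ) τ) ⊕ - (sgn ω (ins x τ) ⊗ sgn (ins x τ) τ)) ⊗ w ω ≈⟨ *-congʳ (-‿inverseʳ _) ⟩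
          0# ⊗ w ω ≈⟨ zeroˡ _ ⟩
          0# ∎
          where
          ω : Sub n
          ω = ins y (ins x τ)
          x∉ : x ∉ τ
          x∉ = not-el (proj₁ (∧-el {not (mem x τ)} o))
          o₂ : not (mem y (ins x τ)) ∧ rel Δ Γ ω ≡ true
          o₂ = proj₂ (∧-el {not (mem x τ)} o)
          y∉' : y ∉ ins x τ
          y∉' = not-el (proj₁ (∧-el {not (mem y (ins x τ))} o₂))
          y∉ : y ∉ τ
          y∉ = ⊑-∉ y (ins-⊒ x τ) y∉'
          rω : rel Δ Γ ω ≡ true
          rω = proj₂ (∧-el {not (mem y (ins x τ))} o₂)
          regroup : ∀ p q r → p ⊗ (q ⊗ r) ≈ (q ⊗ p) ⊗ r
          regroup p q r = ≈-trans (⊗-swap p q r) (≈-sym (⊗-assoc q p r))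

-- Relative homology and links

InL : ∀ {b} {A : Set b} → A → List A → Set b
InL x xs = Σ (Fin (length xs)) λ i → lookup xs i ≡ x

inL-++ˡ : ∀ {b} {A : Set b} {x : A} xs ys → InL x xs → InL x (xs ++ ys)
inL-++ˡ (x ∷ xs) ys (fzero , e) = fzero , e
inL-++ˡ (x ∷ xs) ys (fsuc i , e) = let j , q = inL-++ˡ xs ys (i , e) in fsuc j , q

inL-++ʳ : ∀ {b} {A : Set b} {x : A} xs ys → InL x ys → InL x (xs ++ ys)
inL-++ʳ [] ys p = p
inL-++ʳ (x ∷ xs) ys p = let j , q = inL-++ʳ xs ys p in fsuc j , q

inL-map : ∀ {b b'} {A : Set b} {B : Set b'} (f : A → B) {x} xs → InL x xs → InL (f x) (mapL f xs)
inL-map f (x ∷ xs) (fzero , e) = fzero , cong f e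
inL-map f (x ∷ xs) (fsuc i , e) = let j , q = inL-map f xs (i , e) in fsuc j , q

length-mapL : ∀ {b b'} {A : Set b} {B : Set b'} (f : A → B) xs → length (mapL f xs) ≡ length xs
length-mapL f [] = refl
length-mapL f (x ∷ xs) = cong suc (length-mapL f xs)

length-append : ∀ {b} {A : Set b} (xs ys : List A) → length (xs ++ ys) ≡ length xs + length ys
length-append [] ys = refl
length-append (x ∷ xs) ys = cong suc (length-append xs ys)

enum : ∀ {n} (s : Sub n) → Fin (card s) → Fin n
enum (true ∷ s) fzero = fzero
enum (true ∷ s) (fsuc i) = fsuc (enum s i)
enum (false ∷ s) i = fsuc (enum s i)

enum-∈ : ∀ {n} (s : Sub n) i → enum s i ∈ s
enum-∈ (true ∷ s) fzero = refl
enum-∈ (true ∷ s) (fsuc i) = enum-∈ s i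
enum-∈ (false ∷ s) i = enum-∈ s i

enum-injective : ∀ {n} (s : Sub n) i j → enum s i ≡ enum s j → i ≡ j
enum-injective (true ∷ s) fzero fzero e = refl
enum-injective (true ∷ s) (fsuc i) (fsuc j) e = cong fsuc (enum-injective s i j (fsuc-injective e))
enum-injective (false ∷ s) i j e = enum-injective s i j (fsuc-injective e)

elems : ∀ {n} → Sub n → List (Fin n)
elems [] = []
elems (true ∷ s) = fzero ∷ mapL fsuc (elems s)
elems (false ∷ s) = mapL fsuc (elems s)

length-elems : ∀ {n} (s : Sub n) → length (elems s) ≡ card s
length-elems [] = refl
length-elems (true ∷ s) = cong suc (trans (length-mapL fsuc (elems s)) (length-elems s))
length-elems (false ∷ s) = trans (length-mapL fsuc (elems s)) (length-elems s)

elems-in : ∀ {n} (s : Sub n) x → x ∈ s → InL x (elems s)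
elems-in (true ∷ s) fzero p = fzero , refl
elems-in (true ∷ s) (fsuc x) p = let i , e = inL-map fsuc (elems s) (elems-in s x p) in fsuc i , e
elems-in (false ∷ s) (fsuc x) p = inL-map fsuc (elems s) (elems-in s x p)

tail : ∀ {n} → Sub (suc n) → Sub n
tail (_ ∷ s) = s

card-tail : ∀ {n} (s : Sub (suc n)) → card (tail s) ≤ card s
card-tail (true ∷ s) = n≤1+n _
card-tail (false ∷ s) = ≤-refl

card-2 : ∀ {n} (σ : Sub n) → card σ ≡ 2 → ∃ λ x → ∃ λ y → x ≢ y × σ ≡ pair x y
card-2 σ e with inhabited σ (≤-trans (s≤s z≤n) (≤-reflexive (sym e)))
... | y , y∈ with inhabited (del y σ) (≤-reflexive (sym (suc-injective (trans (card-del y σ y∈) e))))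
...   | x , x∈ = x , y , proj₁ (del-∈ x y σ x∈) , trans (sym (ins-del y σ y∈)) (cong (ins y) (sym (card-eq {s = single x} {del y σ}
    (single-⊑ x x∈) (≤-reflexive (trans (suc-injective (trans (card-del y σ y∈) e)) (sym (card-single x)))))))

either-all : ∀ {p q} b {P : Set p} {Q : Fin b → Set q} → (∀ j → P ⊎ Q j) → P ⊎ (∀ j → Q j)
either-all zero h = inj₂ (λ ())
either-all (suc b) h with h fzero | either-all b (λ j → h (fsuc j))
... | inj₁ p | _ = inj₁ p
... | inj₂ _ | inj₁ p = inj₁ p
... | inj₂ q | inj₂ r = inj₂ λ { fzero → q ; (fsuc j) → r j }

module Morse {a ℓ} (𝔽 : Field a ℓ) {n} (d : ℕ) (3≤d : 3 ≤ d) (Δ : Cx n) (pm : IsNormalPseudomanifold Δ d) where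
  open Linear 𝔽
  open Pseudomanifold d Δ pm
  open Boundary Δ ∂Δ

  module V (v : Fin n) = VertexLink d 3≤d Δ pm v

  -- The number of edges to be kept as generators when `v` follows the vertices of `W`: one for each
  -- component other than that of 0.
  f : Fin n → Sub n → ℕ
  f v W = pred (c (V.graph v) (cut (V.J v) W))

  open Averaging f using (total)

  components : ∀ v W → Comp (V.graph v) (cut (V.J v) W)
  components v W = comp (V.graph v) (cut (V.J v) W)

  -- The component of 0 has no leader: its edges to v are homologous to 0 modulo the boundary.
  leaders : Fin n → Sub n → Sub n
  leaders v W = tail (del (rep (components v W) fzero) (roots (components v W)))

  0∈cut : ∀ v W → fzero ∈ cut (V.J v) W
  0∈cut v W = cut-0 (V.J v) W refl

  card-leaders : ∀ v W → card (leaders v W) ≤ f v W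
  card-leaders v W = ≤-trans (card-tail (del (rep (components v W) fzero) (roots (components v W))))
    (≤-reflexive (trans (cong pred (card-del (rep (components v W) fzero) (roots (components v W)) (rep-root (components v W) fzero (0∈cut v W)))) (cong pred (sym (c-roots (components v W))))))

  gens : ∀ {W : Sub n} → Seq W → List (Sub n)
  gens [] = []
  gens (snoc {W} v _ s) = gens s ++ mapL (λ l → pair l v) (elems (leaders v W))

  length-gens : ∀ {W : Sub n} (s : Seq W) → length (gens s) ≤ total s
  length-gens [] = z≤n
  length-gens (snoc {W} v _ s) = ≤-trans (≤-reflexive (length-append (gens s) _)) (+-mono-≤ (length-gens s)
    (≤-trans (≤-reflexive (trans (length-mapL _ (elems (leaders v W))) (length-elems (leaders v W)))) (card-leaders v W)))

  δ : Sub n → Chain n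
  δ e σ = if σ ==ᵇ e then 1# else 0#

  δ-same : ∀ e → δ e e ≈ 1#
  δ-same e rewrite ==ᵇ-refl e = ≈-refl

  δ-other : ∀ e σ → σ ≢ e → δ e σ ≈ 0#
  δ-other e σ h rewrite ==ᵇ-≢ h = ≈-refl

  Interior₂ : (Sub n → Set ℓ) → Set ℓ
  Interior₂ P = ∀ σ → rel Δ ∂Δ σ ≡ true → card σ ≡ 2 → P σ

  -- `x` is homologous, as a relative chain on edges, to a chain supported on `gs`. The support is
  -- expressed by a disjunction, since being 0 is not decidable in the field.
  record Red (gs : List (Sub n)) (x : Chain n) : Set (a ⊔ ℓ) where
    constructor red
    field
      x' y : Chain n
      support : ∀ σ → InL σ gs ⊎ x' σ ≈ 0#
      homologous : Interior₂ (λ σ → x σ ≈ x' σ ⊕ bd Δ ∂Δ y σ)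
  open Red

  bd-zero : ∀ τ → bd Δ ∂Δ (λ _ → 0#) τ ≈ 0#
  bd-zero τ = bd-0 (λ _ → 0#) τ (λ _ _ _ → ≈-refl)

  red-0 : ∀ {gs} x → Interior₂ (λ σ → x σ ≈ 0#) → Red gs x
  red-0 x h = red (λ _ → 0#) (λ _ → 0#) (λ _ → inj₂ ≈-refl) (λ σ r e → ≈-trans (h σ r e) (≈-sym (0⊕0 ≈-refl (bd-zero σ))))

  red-cong : ∀ {gs} x z → Interior₂ (λ σ → x σ ≈ z σ) → Red gs z → Red gs x
  red-cong x z h (red x' y s k) = red x' y s (λ σ r e → ≈-trans (h σ r e) (k σ r e))

  red-⊕ : ∀ {gs} x z → Red gs x → Red gs z → Red gs (λ σ → x σ ⊕ z σ)
  red-⊕ x z (red x' y s k) (red z' w t l) = red (λ σ → x' σ ⊕ z' σ) (λ σ → y σ ⊕ w σ) sup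
    (λ σ r e → ≈-trans (+-cong (k σ r e) (l σ r e)) (≈-trans (⊕-interchange (x' σ) _ (z' σ) _) (+-congˡ (≈-sym (bd-⊕ y w σ)))))
    where
    sup : ∀ σ → _ ⊎ x' σ ⊕ z' σ ≈ 0#
    sup σ with s σ | t σ
    ... | inj₁ p | _ = inj₁ p
    ... | inj₂ _ | inj₁ q = inj₁ q
    ... | inj₂ p | inj₂ q = inj₂ (0⊕0 p q)

  red-⊗ : ∀ {gs} r x → Red gs x → Red gs (λ σ → r ⊗ x σ)
  red-⊗ r x (red x' y s k) = red (λ σ → r ⊗ x' σ) (λ σ → r ⊗ y σ) (λ σ → [ inj₁ , (λ p → inj₂ (⊗0 r p)) ]′ (s σ))
    (λ σ p e → ≈-trans (*-congˡ (k σ p e)) (≈-trans (distribˡ r _ _) (+-congˡ (≈-sym (bd-⊗ r y σ)))))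

  red-bd : ∀ {gs} y → Red gs (bd Δ ∂Δ y)
  red-bd y = red (λ _ → 0#) y (λ _ → inj₂ ≈-refl) (λ σ _ _ → ≈-sym (⊕-identityˡ _))

  red-gen : ∀ {gs} e → InL e gs → Red gs (δ e)
  red-gen {gs} e p = red (δ e) (λ _ → 0#) sup (λ σ _ _ → ≈-sym (≈-trans (+-congˡ (bd-zero σ)) (⊕-identityʳ _)))
    where
    sup : ∀ σ → InL σ gs ⊎ δ e σ ≈ 0#
    sup σ with decB (σ ==ᵇ e)
    ... | inj₁ q rewrite ==ᵇ⇒ {s = σ} {e} q = inj₁ p
    ... | inj₂ q rewrite q = inj₂ ≈-refl

  red-mono : ∀ {gs hs x} → (∀ σ → InL σ gs → InL σ hs) → Red gs x → Red hs x
  red-mono h (red x' y s k) = red x' y (λ σ → [ (λ p → inj₁ (h σ p)) , inj₂ ]′ (s σ)) k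

  red-ΣL : ∀ {gs m} (F : Sub m → Chain n) → (∀ s → Red gs (F s)) → Red gs (λ τ → ΣL (λ s → F s τ))
  red-ΣL {m = zero} F h = h []
  red-ΣL {m = suc m} F h = red-⊕ _ _ (red-ΣL (λ s → F (false ∷ s)) (λ s → h (false ∷ s))) (red-ΣL (λ s → F (true ∷ s)) (λ s → h (true ∷ s)))

  red-non-face : ∀ {gs} e → rel Δ ∂Δ e ≡ false → Red gs (δ e)
  red-non-face e h = red-0 (δ e) (λ σ r _ → δ-other e σ (λ { refl → t≢f r h }))

  bd-δ-in : ∀ t σ x → x ∉ σ → ins x σ ≡ t → rel Δ ∂Δ t ≡ true → bd Δ ∂Δ (δ t) σ ≈ sgn t σ
  bd-δ-in t σ x x∉ refl r = ≈-trans (bd-term (δ t) σ) (≈-trans (sum-only n (term (δ t) σ) x others)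
    (≈-trans (≈-reflexive (term-in (δ t) σ x x∉ r)) (≈-trans (*-congˡ (δ-same t)) (⊗-identityʳ _))))
    where
    others : ∀ z → z ≢ x → term (δ t) σ z ≈ 0#
    others z z≢x with place (δ t) σ z
    ... | vanishes e _ = ≈-reflexive e
    ... | counts p q k = ≈-trans (≈-reflexive (k (δ t))) (⊗0 _ (δ-other t (ins z σ) (λ e →
      t≢f (subst (x ∈_) (sym e) (mem-ins-same x σ)) (ins-∉ x z σ (λ w → z≢x (sym w)) x∉))))

  bd-δ-out : ∀ t σ → (∀ x → x ∉ σ → ins x σ ≢ t) → bd Δ ∂Δ (δ t) σ ≈ 0#
  bd-δ-out t σ h = ≈-trans (bd-term (δ t) σ) (sum-0 n others)
    where
    others : ∀ z → term (δ t) σ z ≈ 0#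
    others z with place (δ t) σ z
    ... | vanishes e _ = ≈-reflexive e
    ... | counts p q k = ≈-trans (≈-reflexive (k (δ t))) (⊗0 _ (δ-other t (ins z σ) (h z p)))

  -- The boundary of an interior triangle expresses its third edge through the other two. A triangle
  -- in the boundary complex has its edges there, and they vanish in the relative chains.
  red-triangle : ∀ {gs} x y z → x ≢ y → x ≢ z → y ≢ z → Δ (ins z (pair x y)) ≡ true → Red gs (δ (pair y z)) → Red gs (δ (pair x y)) → Red gs (δ (pair x z))
  red-triangle x y z x≢y x≢z y≢z Δt ryz rxy with decB (∂Δ (ins z (pair x y)))
  ... | inj₁ g = red-non-face (pair x z) (∧-falseʳ (Δ (pair x z)) (cong not (bdry-down sub g)))
    where
    sub : pair x z ⊑ ins z (pair x y)
    sub = ins-⊑ z (λ w p → ins-⊒ z (pair x y) w (∪-inˡ w (single x) (single y) p)) (mem-ins-same z (pair x y))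
  ... | inj₂ g = red-cong (δ (pair x z)) _ identity
      (red-⊕ _ _ (red-⊗ s₁ _ (red-bd (δ t))) (red-⊕ _ _ (red-⊗ (- (s₁ ⊗ s₂)) (δ e₂) ryz) (red-⊗ (- (s₁ ⊗ s₃)) (δ e₃) rxy)))
    where
    t e₁ e₂ e₃ : Sub n
    t = ins z (pair x y)
    e₁ = pair x z
    e₂ = pair y z
    e₃ = pair x y
    s₁ s₂ s₃ : Carrier
    s₁ = sgn t e₁
    s₂ = sgn t e₂
    s₃ = sgn t e₃
    rt : rel Δ ∂Δ t ≡ true
    rt = ∧-in Δt (not-in g)
    at : ∀ {b} (u w : Fin n) → b ≢ u → b ≢ w → b ∉ pair u w
    at {b} u w h k = ins-∉ b w (single u) k (mem-single-other b u h)
    y∉₁ : y ∉ e₁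
    y∉₁ = at x z (λ e → x≢y (sym e)) y≢z
    x∉₂ : x ∉ e₂
    x∉₂ = at y z x≢y x≢z
    z∉₃ : z ∉ e₃
    z∉₃ = at x y (λ e → x≢z (sym e)) (λ e → y≢z (sym e))
    t₁ : ins y e₁ ≡ t
    t₁ = ins-comm y z (single x)
    t₂ : ins x e₂ ≡ t
    t₂ = trans (ins-comm x z (single y)) (cong (ins z) (∪-comm (single y) (single x)))
    x∈₁ : x ∈ e₁
    x∈₁ = ins-⊒ z (single x) x (mem-single-same x)
    y∈₂ : y ∈ e₂
    y∈₂ = ins-⊒ z (single y) y (mem-single-same y)
    z∈₁ : z ∈ e₁
    z∈₁ = mem-ins-same z (single x)
    z∈₂ : z ∈ e₂
    z∈₂ = mem-ins-same z (single y)
    sep : ∀ b {s s' : Sub n} → b ∈ s → b ∉ s' → s ≢ s'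
    sep b p q refl = t≢f p q
    open Relation.Binary.Reasoning.Setoid setoid
    zero₂ : ∀ {p q r} → p ≈ 0# → q ≈ 0# → r ≈ 0# → p ⊕ (q ⊕ r) ≈ 0#
    zero₂ p q r = 0⊕0 p (0⊕0 q r)
    cancel : ∀ s → s₁ ⊗ s ⊕ (- (s₁ ⊗ s)) ⊗ 1# ≈ 0#
    cancel s = ≈-trans (+-congˡ (⊗-identityʳ _)) (-‿inverseʳ _)
    identity : Interior₂ (λ σ → δ e₁ σ ≈ s₁ ⊗ bd Δ ∂Δ (δ t) σ ⊕ ((- (s₁ ⊗ s₂)) ⊗ δ e₂ σ ⊕ (- (s₁ ⊗ s₃)) ⊗ δ e₃ σ))
    identity σ r e with decB (σ ==ᵇ e₁) | decB (σ ==ᵇ e₂) | decB (σ ==ᵇ e₃)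
    ... | inj₁ p | _ | _ rewrite ==ᵇ⇒ {s = σ} {e₁} p = begin
      δ e₁ e₁ ≈⟨ δ-same e₁ ⟩
      1# ≈⟨ ≈-sym (sign² (pos t e₁)) ⟩
      s₁ ⊗ s₁ ≈⟨ ≈-sym (⊕-identityʳ _) ⟩
      s₁ ⊗ s₁ ⊕ 0# ≈⟨ +-cong (*-congˡ (≈-sym (bd-δ-in t e₁ y y∉₁ t₁ rt))) (≈-sym (0⊕0 (⊗0 _ (δ-other e₂ e₁ (sep x x∈₁ x∉₂))) (⊗0 _ (δ-other e₃ e₁ (sep z z∈₁ z∉₃))))) ⟩
      s₁ ⊗ bd Δ ∂Δ (δ t) e₁ ⊕ ((- (s₁ ⊗ s₂)) ⊗ δ e₂ e₁ ⊕ (- (s₁ ⊗ s₃)) ⊗ δ e₃ e₁) ∎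
    ... | inj₂ _ | inj₁ p | _ rewrite ==ᵇ⇒ {s = σ} {e₂} p = begin
      δ e₁ e₂ ≈⟨ δ-other e₁ e₂ (sep y y∈₂ y∉₁) ⟩
      0# ≈⟨ ≈-sym (cancel s₂) ⟩
      s₁ ⊗ s₂ ⊕ (- (s₁ ⊗ s₂)) ⊗ 1# ≈⟨ +-cong (*-congˡ (≈-sym (bd-δ-in t e₂ x x∉₂ t₂ rt))) (≈-trans (*-congˡ (≈-sym (δ-same e₂)))
            (≈-trans (≈-sym (⊕-identityʳ _)) (+-congˡ (≈-sym (⊗0 _ (δ-other e₃ e₂ (sep z z∈₂ z∉₃))))))) ⟩
      s₁ ⊗ bd Δ ∂Δ (δ t) e₂ ⊕ ((- (s₁ ⊗ s₂)) ⊗ δ e₂ e₂ ⊕ (- (s₁ ⊗ s₃)) ⊗ δ e₃ e₂) ∎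
    ... | inj₂ _ | inj₂ _ | inj₁ p rewrite ==ᵇ⇒ {s = σ} {e₃} p = begin
      δ e₁ e₃ ≈⟨ δ-other e₁ e₃ (λ q → sep z z∈₁ z∉₃ (sym q)) ⟩
      0# ≈⟨ ≈-sym (cancel s₃) ⟩
      s₁ ⊗ s₃ ⊕ (- (s₁ ⊗ s₃)) ⊗ 1# ≈⟨ +-cong (*-congˡ (≈-sym (bd-δ-in t e₃ z z∉₃ refl rt))) (≈-trans (*-congˡ (≈-sym (δ-same e₃)))
            (≈-trans (≈-sym (⊕-identityˡ _)) (+-congʳ (≈-sym (⊗0 _ (δ-other e₂ e₃ (λ q → sep z z∈₂ z∉₃ (sym q)))))))) ⟩
      s₁ ⊗ bd Δ ∂Δ (δ t) e₃ ⊕ ((- (s₁ ⊗ s₂)) ⊗ δ e₂ e₃ ⊕ (- (s₁ ⊗ s₃)) ⊗ δ e₃ e₃) ∎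
    ... | inj₂ p | inj₂ q | inj₂ w = ≈-trans (δ-other e₁ σ ne₁) (≈-sym (zero₂ (⊗0 _ (bd-δ-out t σ off)) (⊗0 _ (δ-other e₂ σ ne₂)) (⊗0 _ (δ-other e₃ σ ne₃))))
      where
      ne : ∀ {e} → (σ ==ᵇ e) ≡ false → σ ≢ e
      ne h refl = t≢f (==ᵇ-refl σ) h
      ne₁ : σ ≢ e₁
      ne₁ = ne p
      ne₂ : σ ≢ e₂
      ne₂ = ne q
      ne₃ : σ ≢ e₃
      ne₃ = ne w
      drop : ∀ b {e} → b ∉ σ → b ∉ e → ins b σ ≡ t → ins b e ≡ t → σ ≡ e
      drop b {e} h k u l = trans (sym (del-ins b σ h)) (trans (cong (del b) (trans u (sym l))) (del-ins b e k))
      off : ∀ b → b ∉ σ → ins b σ ≢ t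
      off b b∉ u with ins-el b z (pair x y) (subst (b ∈_) u (mem-ins-same b σ))
      ... | inj₁ refl = ne₃ (drop b b∉ z∉₃ u refl)
      ... | inj₂ k with ins-el b y (single x) k
      ...   | inj₁ refl = ne₁ (drop b b∉ y∉₁ u t₁)
      ...   | inj₂ l with single-∈ b x l
      ...     | refl = ne₂ (drop b b∉ x∉₂ u t₂)

  pair-comm : ∀ x y → pair {n} x y ≡ pair y x
  pair-comm x y = ∪-comm (single x) (single y)

  -- Edges from `v` to one component of the link graph reduce to one another: two adjacent vertices
  -- of the component span a triangle with `v`, whose third edge lies in `W` and has been reduced
  -- before. So one edge for each component is enough, and none for the component of 0.
  module Star {W : Sub n} (v : Fin n) (v∉ : v ∉ W) (s : Seq W) (ih : ∀ x y → x ∈ W → y ∈ W → x ≢ y → Red (gens s) (δ (pair x y))) where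

    gs : List (Sub n)
    gs = gens (snoc v v∉ s)
    Co : Comp (V.graph v) (cut (V.J v) W)
    Co = components v W
    -- The edge from a vertex to `v`. The apex 0 stands for the boundary, where relative chains are
    -- 0.
    χ : Fin (suc n) → Chain n
    χ fzero = λ _ → 0#
    χ (fsuc y) = δ (pair y v)
    χ-0 : Red gs (χ fzero)
    χ-0 = red-0 (χ fzero) (λ _ _ _ → ≈-refl)
    χ-bdry : ∀ k → ∂Δ (pair k v) ≡ true → Red gs (χ (fsuc k))
    χ-bdry k p = red-non-face (pair k v) (∧-falseʳ (Δ (pair k v)) (cong not p))
    along : ∀ {z z'} → z ∈ cut (V.J v) W → z' ∈ cut (V.J v) W → adj (V.graph v) z z' ≡ true → Red gs (χ z) → Red gs (χ z')
    along {z} {fzero} _ _ _ _ = χ-0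
    along {fzero} {fsuc k} _ _ e _ = χ-bdry k (V.adj-0 v k (adj-sym (V.graph v) fzero (fsuc k) e))
    along {fsuc j} {fsuc k} j∈ k∈ e r with V.adj-el v (fsuc j) (fsuc k) e
    ... | j≢v , k≢v , j≢k , t = red-triangle k j v (λ q → j≢k (cong fsuc (sym q))) (λ q → k≢v (cong fsuc q)) (λ q → j≢v (cong fsuc q))
      (subst (λ σ → Δ (ins v σ) ≡ true) (pair-comm j k) t) r
      (red-mono (λ σ → inL-++ˡ (gens s) _) (ih k j (cut-W (V.J v) W k k∈) (cut-W (V.J v) W j j∈) (λ q → j≢k (cong fsuc (sym q)))))
    spread : ∀ {z z'} → Conn (V.graph v) (cut (V.J v) W) z z' → (Red gs (χ z) → Red gs (χ z')) × (Red gs (χ z') → Red gs (χ z))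
    spread (crefl _) = id , id
    spread (cedge p q e) = along p q e , along q p (adj-sym (V.graph v) _ _ e)
    spread (csym cn) = proj₂ (spread cn) , proj₁ (spread cn)
    spread (ctrans cn cn') = proj₁ (spread cn') ∘ proj₁ (spread cn) , proj₂ (spread cn) ∘ proj₂ (spread cn')
    root : ∀ r → r ∈ roots Co → Red gs (χ r)
    root fzero _ = χ-0
    root (fsuc l) r∈ with fsuc l ≟ rep Co fzero
    ... | yes e = subst (λ z → Red gs (χ z)) (sym e) (proj₁ (spread (joined Co fzero (0∈cut v W))) χ-0)
    ... | no ne = red-gen (pair l v) (inL-++ʳ (gens s) _ (inL-map (λ l → pair l v) (elems (leaders v W)) (elems-in (leaders v W) l (leader (del (rep Co fzero) (roots Co)) (del-in (fsuc l) (rep Co fzero) (roots Co) ne r∈)))))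
      where
      leader : ∀ (t : Sub (suc n)) → fsuc l ∈ t → l ∈ tail t
      leader (_ ∷ t) p = p
    star : ∀ y → y ∈ W → Red gs (δ (pair y v))
    star y y∈ with decB (rel Δ ∂Δ (pair y v))
    ... | inj₂ r = red-non-face (pair y v) r
    ... | inj₁ r = proj₂ (spread (joined Co (fsuc y) y∈S)) (root (rep Co (fsuc y)) (rep-root Co (fsuc y) y∈S))
      where
      y∈S : fsuc y ∈ cut (V.J v) W
      y∈S = cut-in (V.J v) W y y∈ (V.N-in v y (∉⇒≢ W y v y∈ v∉) (proj₁ (∧-el r)))

  red-edge : ∀ {W : Sub n} (s : Seq W) x y → x ∈ W → y ∈ W → x ≢ y → Red (gens s) (δ (pair x y))
  red-edge [] x y x∈ _ _ = ⊥-elim (t≢f x∈ (mem-empty x))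
  red-edge (snoc {W} v v∉ s) x y x∈ y∈ x≢y with ins-el x v W x∈ | ins-el y v W y∈
  ... | inj₁ refl | inj₁ refl = ⊥-elim (x≢y refl)
  ... | inj₂ p | inj₂ q = red-mono (λ σ → inL-++ˡ (gens s) _) (red-edge s x y p q x≢y)
  ... | inj₂ p | inj₁ refl = Star.star v v∉ s (red-edge s) x p
  ... | inj₁ refl | inj₂ q = subst (λ σ → Red (gens (snoc v v∉ s)) (δ σ)) (pair-comm y x) (Star.star v v∉ s (red-edge s) y q)

  red-all : (s : Seq (full {n})) → ∀ x → Red (gens s) x
  red-all s x = red-cong x (λ τ → ΣL (λ σ → x σ ⊗ δ σ τ)) (λ τ _ _ → ≈-sym (≈-trans (ΣL-only (λ σ → x σ ⊗ δ σ τ) τ (λ σ ne → ⊗0 _ (δ-other σ τ (λ e → ne (sym e)))))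
      (≈-trans (*-congˡ (δ-same τ)) (⊗-identityʳ _)))) (red-ΣL (λ σ τ → x σ ⊗ δ σ τ) (λ σ → red-⊗ (x σ) (δ σ) (basis σ)))
    where
    basis : ∀ σ → Red (gens s) (δ σ)
    basis σ with decB (card σ ≡ᵇ 2)
    ... | inj₂ q = red-0 (δ σ) (λ τ _ e → δ-other σ τ (λ { refl → t≢f (⇒eqᵇ e) q }))
    ... | inj₁ q with card-2 σ (eqᵇ⇒ q)
    ...   | u , w , u≢w , refl = red-edge s u w (∈-full u) (∈-full w) u≢w

  interior : Sub n
  interior = tab (λ v → rel Δ ∂Δ (single v))

  -- Each interior vertex is a combination of the `b0` classes up to the boundary of a chain `w₀`.
  -- These chains and the `b1` cycles are given coordinates: coefficients on `gens s`, and for the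
  -- vertices also the coefficients on the `b0` classes. Independence of the rows yields the bound.
  morse : (s : Seq (full {n})) → ∀ b0 b1 → ∂Δ emptyS ≡ true → IsBetti Δ ∂Δ 1 b0 → IsBetti Δ ∂Δ 2 b1 → b1 + card interior ≤ total s + b0
  morse s b0 b1 ∅∈ (z₀ , _ , _ , span₀) (z₁ , cycle₁ , indep₁ , _) =
    ≤-trans (independent-≤ (b1 + f0) (p + b0) A independent) (+-monoˡ-≤ b0 (length-gens s))
    where
    f0 p : ℕ
    f0 = card interior
    p = length (gens s)
    vx : Fin f0 → Sub n
    vx i = single (enum interior i)
    -- The empty face belongs to the boundary, so every relative vertex is a cycle.
    vx-cycle : ∀ i → Cycle Δ ∂Δ 1 (δ (vx i))
    vx-cycle i τ r e = ⊥-elim (t≢f ∅∈ (subst (λ σ → ∂Δ σ ≡ false) (card-0 τ (suc-injective e)) (not-el (proj₂ (∧-el {Δ τ} r)))))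
    k₀ : Fin f0 → Fin b0 → Carrier
    k₀ i = proj₁ (span₀ (δ (vx i)) (vx-cycle i))
    w₀ : Fin f0 → Chain n
    w₀ i = proj₁ (proj₂ (span₀ (δ (vx i)) (vx-cycle i)))
    X : Fin b1 ⊎ Fin f0 → Chain n
    X = [ z₁ , w₀ ]′
    K₀ : Fin b1 ⊎ Fin f0 → Fin b0 → Carrier
    K₀ = [ (λ _ _ → 0#) , k₀ ]′
    r : ∀ j → Red (gens s) (X j)
    r j = red-all s (X j)
    entry : Fin b1 ⊎ Fin f0 → Fin p ⊎ Fin b0 → Carrier
    entry j = [ (λ i → x' (r j) (lookup (gens s) i)) , K₀ j ]′
    A : Fin (b1 + f0) → Fin (p + b0) → Carrier
    A j i = entry (splitAt b1 j) (splitAt p i)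
    independent : Independent (b1 + f0) (p + b0) A
    independent t h j = subst (λ j → t j ≈ 0#) (join-splitAt b1 f0 j) (zeros (splitAt b1 j))
      where
      open Relation.Binary.Reasoning.Setoid setoid
      T : Fin b1 ⊎ Fin f0 → Carrier
      T j = t (join b1 f0 j)
      α : Fin b1 → Carrier
      α j = T (inj₁ j)
      μ : Fin f0 → Carrier
      μ i = T (inj₂ i)
      both : (Fin b1 ⊎ Fin f0 → Carrier) → Carrier
      both g = sumFin b1 (λ j → T (inj₁ j) ⊗ g (inj₁ j)) ⊕ sumFin f0 (λ i → T (inj₂ i) ⊗ g (inj₂ i))
      as-both : ∀ g → sumFin (b1 + f0) (λ j → t j ⊗ g (splitAt b1 j)) ≈ both g
      as-both g = ≈-trans (sum-join b1 f0 (λ j → t j ⊗ g (splitAt b1 j)))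
        (+-cong (sum-cong b1 (λ j → *-congˡ (≈-reflexive (cong g (splitAt-join b1 f0 (inj₁ j))))))
                (sum-cong f0 (λ i → *-congˡ (≈-reflexive (cong g (splitAt-join b1 f0 (inj₂ i)))))))
      column : ∀ i → both (λ j → entry j i) ≈ 0#
      column i = ≈-trans (≈-sym (as-both (λ j → entry j i))) (subst (λ i' → sumFin (b1 + f0) (λ j → t j ⊗ entry (splitAt b1 j) i') ≈ 0#) (splitAt-join p b0 i) (h (join p b0 i)))
      x'-0 : ∀ σ → both (λ j → x' (r j) σ) ≈ 0#
      x'-0 σ = [ hit , (λ u → [ hit , (λ w → 0⊕0 (sum-0 b1 (λ j → ⊗0 _ (u j))) (sum-0 f0 (λ i → ⊗0 _ (w i)))) ]′ (either-all f0 (λ i → support (r (inj₂ i)) σ))) ]′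
          (either-all b1 (λ j → support (r (inj₁ j)) σ))
        where
        hit : InL σ (gens s) → both (λ j → x' (r j) σ) ≈ 0#
        hit (i , q) = subst (λ σ → both (λ j → x' (r j) σ) ≈ 0#) q (column (inj₁ i))
      Y : Chain n
      Y σ = lin b1 α (λ j → y (r (inj₁ j))) σ ⊕ lin f0 μ (λ i → y (r (inj₂ i))) σ
      bd-Y : ∀ σ → bd Δ ∂Δ Y σ ≈ both (λ j → bd Δ ∂Δ (y (r j)) σ)
      bd-Y σ = ≈-trans (bd-⊕ (lin b1 α (λ j → y (r (inj₁ j)))) (lin f0 μ (λ i → y (r (inj₂ i)))) σ) (+-cong (bd-lin b1 α _ σ) (bd-lin f0 μ _ σ))
      X-sum : Chain n
      X-sum σ = lin b1 α z₁ σ ⊕ lin f0 μ w₀ σ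
      X≈bdY : Interior₂ (λ σ → X-sum σ ≈ bd Δ ∂Δ Y σ)
      X≈bdY σ rσ e = begin
        X-sum σ ≈⟨ +-cong (sum-cong b1 (λ j → ≈-trans (*-congˡ (homologous (r (inj₁ j)) σ rσ e)) (distribˡ _ _ _)))
                          (sum-cong f0 (λ i → ≈-trans (*-congˡ (homologous (r (inj₂ i)) σ rσ e)) (distribˡ _ _ _))) ⟩
        sumFin b1 (λ j → α j ⊗ x' (r (inj₁ j)) σ ⊕ α j ⊗ bd Δ ∂Δ (y (r (inj₁ j))) σ) ⊕ sumFin f0 (λ i → μ i ⊗ x' (r (inj₂ i)) σ ⊕ μ i ⊗ bd Δ ∂Δ (y (r (inj₂ i))) σ)
          ≈⟨ +-cong (sum-⊕ b1 (λ j → α j ⊗ x' (r (inj₁ j)) σ) (λ j → α j ⊗ bd Δ ∂Δ (y (r (inj₁ j))) σ)) (sum-⊕ f0 (λ i → μ i ⊗ x' (r (inj₂ i)) σ) (λ i → μ i ⊗ bd Δ ∂Δ (y (r (inj₂ i))) σ)) ⟩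
        _ ≈⟨ ⊕-interchange _ _ _ _ ⟩
        both (λ j → x' (r j) σ) ⊕ both (λ j → bd Δ ∂Δ (y (r j)) σ) ≈⟨ ≈-trans (+-congʳ (x'-0 σ)) (⊕-identityˡ _) ⟩
        both (λ j → bd Δ ∂Δ (y (r j)) σ) ≈⟨ ≈-sym (bd-Y σ) ⟩
        bd Δ ∂Δ Y σ ∎
      -- Taking the boundary once more kills the cycles as well as `bd Δ ∂Δ Y`, and only the chains
      -- `w₀` remain. The coefficients of the vertices are then 0, after which the independence of
      -- the cycles in homology can be used.
      bd-w₀ : ∀ τ → rel Δ ∂Δ τ ≡ true → card τ ≡ 1 → sumFin f0 (λ i → μ i ⊗ bd Δ ∂Δ (w₀ i) τ) ≈ 0#
      bd-w₀ τ rτ e = begin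
        sumFin f0 (λ i → μ i ⊗ bd Δ ∂Δ (w₀ i) τ) ≈⟨ ≈-sym (bd-lin f0 μ w₀ τ) ⟩
        bd Δ ∂Δ (lin f0 μ w₀) τ ≈⟨ ≈-sym (⊕-identityˡ _) ⟩
        0# ⊕ bd Δ ∂Δ (lin f0 μ w₀) τ ≈⟨ +-congʳ (≈-sym (≈-trans (bd-lin b1 α z₁ τ) (sum-0 b1 (λ j → ⊗0 _ (cycle₁ j τ rτ (cong suc e)))))) ⟩
        bd Δ ∂Δ (lin b1 α z₁) τ ⊕ bd Δ ∂Δ (lin f0 μ w₀) τ ≈⟨ ≈-sym (bd-⊕ (lin b1 α z₁) (lin f0 μ w₀) τ) ⟩
        bd Δ ∂Δ X-sum τ ≈⟨ bd-cong X-sum (bd Δ ∂Δ Y) τ (λ σ rσ e' → X≈bdY σ rσ (trans e' (cong suc e))) ⟩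
        bd Δ ∂Δ (bd Δ ∂Δ Y) τ ≈⟨ bd-bd down bdry-down Y τ rτ ⟩
        0# ∎
      vertex-sum : ∀ τ → rel Δ ∂Δ τ ≡ true → card τ ≡ 1 → sumFin f0 (λ i → μ i ⊗ δ (vx i) τ) ≈ 0#
      vertex-sum τ rτ e = begin
        sumFin f0 (λ i → μ i ⊗ δ (vx i) τ) ≈⟨ sum-cong f0 (λ i → ≈-trans (*-congˡ (proj₂ (proj₂ (span₀ (δ (vx i)) (vx-cycle i))) τ rτ e)) (distribˡ _ _ _)) ⟩
        sumFin f0 (λ i → μ i ⊗ lin b0 (k₀ i) z₀ τ ⊕ μ i ⊗ bd Δ ∂Δ (w₀ i) τ) ≈⟨ sum-⊕ f0 (λ i → μ i ⊗ lin b0 (k₀ i) z₀ τ) (λ i → μ i ⊗ bd Δ ∂Δ (w₀ i) τ) ⟩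
        sumFin f0 (λ i → μ i ⊗ lin b0 (k₀ i) z₀ τ) ⊕ sumFin f0 (λ i → μ i ⊗ bd Δ ∂Δ (w₀ i) τ) ≈⟨ ≈-trans (+-congˡ (bd-w₀ τ rτ e)) (⊕-identityʳ _) ⟩
        sumFin f0 (λ i → μ i ⊗ lin b0 (k₀ i) z₀ τ) ≈⟨ sum-cong f0 (λ i → ≈-sym (sum-⊗ b0 (μ i) (λ k → k₀ i k ⊗ z₀ k τ))) ⟩
        sumFin f0 (λ i → sumFin b0 (λ k → μ i ⊗ (k₀ i k ⊗ z₀ k τ))) ≈⟨ sum-swap f0 b0 (λ i k → μ i ⊗ (k₀ i k ⊗ z₀ k τ)) ⟩
        sumFin b0 (λ k → sumFin f0 (λ i → μ i ⊗ (k₀ i k ⊗ z₀ k τ)))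
          ≈⟨ sum-cong b0 (λ k → ≈-trans (sum-cong f0 (λ i → ≈-trans (≈-sym (⊗-assoc _ _ _)) (⊗-comm _ _))) (sum-⊗ f0 (z₀ k τ) (λ i → μ i ⊗ k₀ i k))) ⟩
        sumFin b0 (λ k → z₀ k τ ⊗ sumFin f0 (λ i → μ i ⊗ k₀ i k)) ≈⟨ sum-0 b0 (λ k → ⊗0 _ (relation k)) ⟩
        0# ∎
        where
        relation : ∀ k → sumFin f0 (λ i → μ i ⊗ k₀ i k) ≈ 0#
        relation k = ≈-trans (≈-sym (⊕-identityˡ _)) (≈-trans (+-congʳ (≈-sym (sum-0 b1 (λ j → zeroʳ _)))) (column (inj₂ k)))
      μ-0 : ∀ i → μ i ≈ 0#
      μ-0 i = ≈-trans (≈-sym (≈-trans (sum-only f0 (λ j → μ j ⊗ δ (vx j) (vx i)) i others) (≈-trans (*-congˡ (δ-same (vx i))) (⊗-identityʳ _))))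
        (vertex-sum (vx i) (trans (sym (mem-tab (λ v → rel Δ ∂Δ (single v)) (enum interior i))) (enum-∈ interior i)) (card-single (enum interior i)))
        where
        others : ∀ j → j ≢ i → μ j ⊗ δ (vx j) (vx i) ≈ 0#
        others j j≢i = ⊗0 _ (δ-other (vx j) (vx i) (λ e → j≢i (enum-injective interior j i
          (sym (single-∈ (enum interior i) (enum interior j) (subst (enum interior i ∈_) e (mem-single-same (enum interior i))))))))
      α-0 : ∀ j → α j ≈ 0#
      α-0 = indep₁ α Y (λ σ rσ e → ≈-trans (≈-sym (≈-trans (+-congˡ (sum-0 f0 (λ i → ≈-trans (*-congʳ (μ-0 i)) (zeroˡ _)))) (⊕-identityʳ _))) (X≈bdY σ rσ e))
      zeros : ∀ j → T j ≈ 0#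
      zeros (inj₁ j) = α-0 j
      zeros (inj₂ i) = μ-0 i

-- The inequality

bdry-empty : ∀ {n} d (Δ : Cx n) → IsNormalPseudomanifoldWithBoundary Δ d → bdry Δ d emptyS ≡ true
bdry-empty d Δ (pm , ρ , Δρ , e , o) = bdry-in emptyS ρ Δρ e (trans (sym (facetCount≡ ρ e)) o) (λ i p → ⊥-elim (t≢f p (mem-empty i)))
  where open Pseudomanifold d Δ pm

choose-2 : ∀ n → 2 * (suc n Comb.C 2) ≡ suc n * n
choose-2 zero = refl
choose-2 (suc n) = begin
  2 * (suc (suc n) Comb.C 2) ≡⟨ cong (2 *_) (sym (Comb.nCk+nC[k+1]≡[n+1]C[k+1] (suc n) 1)) ⟩
  2 * (suc n Comb.C 1 + suc n Comb.C 2) ≡⟨ *-distribˡ-+ 2 (suc n Comb.C 1) (suc n Comb.C 2) ⟩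
  2 * (suc n Comb.C 1) + 2 * (suc n Comb.C 2) ≡⟨ cong₂ (λ x y → 2 * x + y) (Comb.nC1≡n (suc n)) (choose-2 n) ⟩
  2 * suc n + suc n * n ≡⟨ solve 1 (λ n → con 2 :* (con 1 :+ n) :+ (con 1 :+ n) :* n := (con 2 :+ n) :* (con 1 :+ n)) refl n ⟩
  suc (suc n) * suc n ∎
  where
  open ≡-Reasoning
  open +-*-Solver

-- g₂ in terms of D, f₋₁, f₀ and f₁.
poly : ℕ → ℕ → ℕ → ℕ → ℤ.ℤ
poly D x y z =
  (ℤ.+ 1 ℤ.* (ℤ.+ (D Comb.C (D ∸ 2)) ℤ.* ℤ.+ x) ℤ.+ (ℤ.- (ℤ.+ 1) ℤ.* (ℤ.+ ((D ∸ 1) Comb.C (D ∸ 2)) ℤ.* ℤ.+ y)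
    ℤ.+ (ℤ.+ 1 ℤ.* (ℤ.+ ((D ∸ 2) Comb.C (D ∸ 2)) ℤ.* ℤ.+ z) ℤ.+ ℤ.+ 0)))
  ℤ.- (ℤ.- (ℤ.+ 1) ℤ.* (ℤ.+ (D Comb.C (D ∸ 1)) ℤ.* ℤ.+ x) ℤ.+ (ℤ.+ 1 ℤ.* (ℤ.+ ((D ∸ 1) Comb.C (D ∸ 1)) ℤ.* ℤ.+ y) ℤ.+ ℤ.+ 0))

choose-pred : ∀ d → 1 ≤ d → d Comb.C (d ∸ 1) ≡ d
choose-pred d 1≤d = trans (Comb.nCk≡nC[n∸k] (m∸n≤m d 1)) (trans (cong (d Comb.C_) (m∸[m∸n]≡n 1≤d)) (Comb.nC1≡n d))

poly-value : ∀ d y z → 1 ≤ d → poly (suc d) 0 y z ≡ ℤ.+ z ℤ.- ℤ.+ (suc d * y)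
poly-value d y z 1≤d rewrite Comb.nCn≡1 d | Comb.nCn≡1 (d ∸ 1) | choose-pred d 1≤d
  | ℤₚ.*-zeroʳ (ℤ.+ (suc d Comb.C (d ∸ 1))) | ℤₚ.*-zeroʳ (ℤ.+ (suc d Comb.C d)) =
  trans (ring (ℤ.+ d) (ℤ.+ y) (ℤ.+ z)) (cong (λ x → ℤ.+ z ℤ.- x) (sym (ℤₚ.pos-* (suc d) y)))
  where
  ring : ∀ e x y → (ℤ.+ 1 ℤ.* ℤ.+ 0 ℤ.+ (ℤ.- (ℤ.+ 1) ℤ.* (e ℤ.* x) ℤ.+ (ℤ.+ 1 ℤ.* (ℤ.+ 1 ℤ.* y) ℤ.+ ℤ.+ 0))) ℤ.- (ℤ.- (ℤ.+ 1) ℤ.* ℤ.+ 0 ℤ.+ (ℤ.+ 1 ℤ.* (ℤ.+ 1 ℤ.* x) ℤ.+ ℤ.+ 0))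
    ≡ y ℤ.- (ℤ.+ 1 ℤ.+ e) ℤ.* x
  ring = solve 3 (λ e x y → (con (ℤ.+ 1) :* con (ℤ.+ 0) :+ (:- con (ℤ.+ 1) :* (e :* x) :+ (con (ℤ.+ 1) :* (con (ℤ.+ 1) :* y) :+ con (ℤ.+ 0)))) :- (:- con (ℤ.+ 1) :* con (ℤ.+ 0) :+ (con (ℤ.+ 1) :* (con (ℤ.+ 1) :* x) :+ con (ℤ.+ 0)))
    := y :- (con (ℤ.+ 1) :+ e) :* x) refl
    where open ℤSolver.+-*-Solver

module Counting {a ℓ} (𝔽 : Field a ℓ) {n} (d : ℕ) (3≤d : 3 ≤ d) (Δ : Cx n) (pmb : IsNormalPseudomanifoldWithBoundary Δ d) where

  pm : IsNormalPseudomanifold Δ d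
  pm = proj₁ pmb

  open Pseudomanifold d Δ pm
  open Morse 𝔽 d 3≤d Δ pm
  open Averaging f using (total; local; average; local-total; g; g-attained)

  a-facet : Σ (Sub n) λ F → Δ F ≡ true × card F ≡ suc d
  a-facet = proj₁ (proj₁ (proj₂ pm))

  d<n : suc d ≤ n
  d<n = let F , _ , e = a-facet in subst (_≤ n) e (card-bound F)

  T : ℕ
  T = unit n d

  T-pos : 1 ≤ T
  T-pos with decB (1 ≤ᵇ T)
  ... | inj₁ p = leᵇ⇒ p
  ... | inj₂ p = ⊥-elim (<-irrefl (trans (cong (_* (suc d * suc (suc d))) (sym T≡0)) (unit-closed n d d<n)) (n!-pos (suc n)))
    where
    T≡0 : T ≡ 0
    T≡0 = n<1⇒n≡0 (≰⇒> (λ q → t≢f (⇒leᵇ {1} {T} q) p))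
    n!-pos : ∀ m → 0 < m !
    n!-pos zero = s≤s z≤n
    n!-pos (suc m) = *-mono-≤ {1} {suc m} (s≤s z≤n) (n!-pos m)

  loc : Fin n → ℕ
  loc v = ΣS (λ W → wt W * f v W)

  -- Every count is at least 1 because of the vertex 0, and removing this 1 subtracts the total
  -- mass.
  E-loc : ∀ v → E (V.graph v) (V.J v) ≡ loc v + mass n 0 0
  E-loc v = trans (ΣS-cong h) (trans (ΣS-+ (λ W → wt W * f v W) wt) (cong (loc v +_) (Σwt n)))
    where
    h : ∀ W → wt W * c (V.graph v) (cut (V.J v) W) ≡ wt W * f v W + wt W
    h W with c (V.graph v) (cut (V.J v) W) | c-pos (V.graph v) (cut (V.J v) W) fzero (0∈cut v W)
    ... | suc k | _ = trans (*-suc (wt W) k) (+-comm (wt W) _)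

  -- The number of interior edges at v, corrected for interior v.
  weight : Fin n → ℕ
  weight v = card (V.R v) + bit (rel Δ ∂Δ (single v)) * (d * suc d)

  -- What equality leaves behind: a sequence of steps to the whole link, starting at the boundary
  -- neighbours of `v` or at a facet.
  Reached : Fin n → Set
  Reached v = Σ (Sub (suc n)) λ I → Reach d (V.graph v) I (V.J v) ×
    ((∂Δ (single v) ≡ true × I ≡ true ∷ V.B v) ⊎ ∂Δ (single v) ≡ false × Σ (Sub n) λ F → Δ F ≡ true × card F ≡ suc d × v ∈ F × I ≡ true ∷ del v F)

  Bounded : Fin n → Set
  Bounded v = (loc v ≤ weight v * T × (Δ (single v) ≡ true → Reached v)) ⊎ loc v < weight v * T

  combine : ∀ v {A : Set} {i y} → (∀ x → (x + mass n 0 0) + i ≤ y → x ≤ weight v * T) → (A → Reached v)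
    → (A × (loc v + mass n 0 0) + i ≤ y) ⊎ suc (loc v + mass n 0 0) + i ≤ y → Bounded v
  combine v conclude as (inj₁ (r , le)) = inj₁ (conclude (loc v) le , λ _ → as r)
  combine v conclude as (inj₂ lt) = inj₂ (conclude (suc (loc v)) lt)

  -- The start costs one total mass, which is the share of 0; beyond that, only the vertices of `R`
  -- are added, at one unit each.
  bounded-boundary : ∀ v → ∂Δ (single v) ≡ true → Bounded v
  bounded-boundary v b = combine v conclude (λ r → I , r , inj₁ (b , refl)) good
    where
    open VertexLink.Boundary d 3≤d Δ pm v b using (I; start)
    conclude : ∀ x → (x + mass n 0 0) + card I * T ≤ E (V.graph v) I + card (V.J v) * T → x ≤ weight v * T
    conclude x le = subst (λ r → x ≤ (card (V.R v) + r) * T) (sym (cong (λ z → bit z * (d * suc d)) (∧-falseʳ (Δ (single v)) (cong not b))))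
      (subst (x ≤_) (cong (_* T) (sym (+-identityʳ (card (V.R v))))) (+-cancelʳ-≤ (mass n 0 0 + card I * T) _ _ (begin
        x + (mass n 0 0 + card I * T) ≡⟨ sym (+-assoc x _ _) ⟩
        (x + mass n 0 0) + card I * T ≤⟨ le ⟩
        E (V.graph v) I + card (V.J v) * T ≤⟨ +-monoˡ-≤ _ start ⟩
        mass n 0 0 + suc (card (V.N v)) * T ≡⟨ cong (λ z → mass n 0 0 + suc z * T) (sym (V.card-B+R v)) ⟩
        mass n 0 0 + suc (card (V.B v) + card (V.R v)) * T ≡⟨ ring (mass n 0 0) (card (V.B v)) (card (V.R v)) T ⟩
        card (V.R v) * T + (mass n 0 0 + suc (card (V.B v)) * T) ∎)))
      where
      open ≤-Reasoning hiding (start)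
      open +-*-Solver
      ring : ∀ m b r t → m + suc (b + r) * t ≡ r * t + (m + suc b * t)
      ring = solve 4 (λ m b r t → m :+ (con 1 :+ (b :+ r)) :* t := r :* t :+ (m :+ (con 1 :+ b) :* t)) refl
    good : (Reach d (V.graph v) I (V.J v) × (loc v + mass n 0 0) + card I * T ≤ E (V.graph v) I + card (V.J v) * T)
      ⊎ suc (loc v + mass n 0 0) + card I * T ≤ E (V.graph v) I + card (V.J v) * T
    good = subst (λ e → (Reach d (V.graph v) I (V.J v) × e + card I * T ≤ E (V.graph v) I + card (V.J v) * T) ⊎ e + card I * T < E (V.graph v) I + card (V.J v) * T)
      (E-loc v) (VertexLink.Boundary.good d 3≤d Δ pm v b)

  -- The correction d(d+1) is (d+1)(d+2) - (d+2) - d: the second total mass in the cost of the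
  -- start, less the saving when the clique is absent, less the `d` vertices that are in the start
  -- already.
  bounded-interior : ∀ v → ∂Δ (single v) ≡ false → Δ (single v) ≡ true → ∀ F → Δ F ≡ true → card F ≡ suc d → v ∈ F → Bounded v
  bounded-interior v b p F ΔF cF v∈F = combine v conclude (λ r → I , r , inj₂ (b , F , ΔF , cF , v∈F , refl)) good
    where
    open VertexLink.Interior d 3≤d Δ pm v F ΔF v∈F cF b using (I; start; cD)
    no-B : card (V.B v) ≡ 0
    no-B with decB (1 ≤ᵇ card (V.B v))
    ... | inj₂ q = n<1⇒n≡0 (≰⇒> (λ le → t≢f (⇒leᵇ le) q))
    ... | inj₁ q = let k , k∈ = inhabited (V.B v) (leᵇ⇒ q) in
      ⊥-elim (t≢f (bdry-down (single-⊑ v (∪-inʳ v (single k) (single v) (mem-single-same v))) (proj₂ (V.B-el v k k∈))) b)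
    total-mass : mass n 0 0 ≡ T * (suc d * suc (suc d))
    total-mass = trans (mass-total n) (sym (unit-closed n d d<n))
    conclude : ∀ x → (x + mass n 0 0) + card I * T ≤ E (V.graph v) I + card (V.J v) * T → x ≤ weight v * T
    conclude x le = subst (λ r → x ≤ (card (V.R v) + r) * T) (sym (trans (cong (λ z → bit z * (d * suc d)) (∧-in p (cong not b))) (+-identityʳ (d * suc d))))
      (+-cancelʳ-≤ (mass n 0 0 + card I * T + suc (suc d) * T) _ _ (begin
        x + (mass n 0 0 + card I * T + suc (suc d) * T) ≡⟨ assoc₃ x (mass n 0 0) (card I * T) (suc (suc d) * T) ⟩
        ((x + mass n 0 0) + card I * T) + suc (suc d) * T ≤⟨ +-monoˡ-≤ (suc (suc d) * T) le ⟩
        (E (V.graph v) I + card (V.J v) * T) + suc (suc d) * T ≡⟨ swap₃ (E (V.graph v) I) (card (V.J v) * T) (suc (suc d) * T) ⟩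
        (E (V.graph v) I + suc (suc d) * T) + card (V.J v) * T ≤⟨ +-monoˡ-≤ _ start ⟩
        2 * mass n 0 0 + suc (card (V.N v)) * T ≡⟨ cong (λ z → 2 * mass n 0 0 + suc z * T) (trans (sym (V.card-B+R v)) (cong (_+ card (V.R v)) no-B)) ⟩
        2 * mass n 0 0 + suc (card (V.R v)) * T ≡⟨ cong (λ m → m + (m + 0) + suc (card (V.R v)) * T) total-mass ⟩
        2 * (T * (suc d * suc (suc d))) + suc (card (V.R v)) * T ≡⟨ ring T d (card (V.R v)) ⟩
        (card (V.R v) + d * suc d) * T + (T * (suc d * suc (suc d)) + suc d * T + suc (suc d) * T)
          ≡⟨ cong₂ (λ m i → (card (V.R v) + d * suc d) * T + (m + i * T + suc (suc d) * T)) (sym total-mass) (cong suc (sym cD)) ⟩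
        (card (V.R v) + d * suc d) * T + (mass n 0 0 + card I * T + suc (suc d) * T) ∎))
      where
      open ≤-Reasoning hiding (start)
      open +-*-Solver
      assoc₃ : ∀ x m i k → x + (m + i + k) ≡ ((x + m) + i) + k
      assoc₃ = solve 4 (λ x m i k → x :+ (m :+ i :+ k) := ((x :+ m) :+ i) :+ k) refl
      swap₃ : ∀ x y z → (x + y) + z ≡ (x + z) + y
      swap₃ = solve 3 (λ x y z → (x :+ y) :+ z := (x :+ z) :+ y) refl
      ring : ∀ t d r → 2 * (t * (suc d * suc (suc d))) + suc r * t ≡ (r + d * suc d) * t + (t * (suc d * suc (suc d)) + suc d * t + suc (suc d) * t)
      ring = solve 3 (λ t d r → con 2 :* (t :* ((con 1 :+ d) :* (con 2 :+ d))) :+ (con 1 :+ r) :* t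
        := (r :+ d :* (con 1 :+ d)) :* t :+ (t :* ((con 1 :+ d) :* (con 2 :+ d)) :+ (con 1 :+ d) :* t :+ (con 2 :+ d) :* t)) refl
    good : (Reach d (V.graph v) I (V.J v) × (loc v + mass n 0 0) + card I * T ≤ E (V.graph v) I + card (V.J v) * T)
      ⊎ suc (loc v + mass n 0 0) + card I * T ≤ E (V.graph v) I + card (V.J v) * T
    good = subst (λ e → (Reach d (V.graph v) I (V.J v) × e + card I * T ≤ E (V.graph v) I + card (V.J v) * T) ⊎ e + card I * T < E (V.graph v) I + card (V.J v) * T)
      (E-loc v) (VertexLink.Interior.good d 3≤d Δ pm v F ΔF v∈F cF b)

  bounded-outside : ∀ v → Δ (single v) ≡ false → Bounded v
  bounded-outside v p = inj₁ (subst (_≤ weight v * T) (sym empty) z≤n , λ q → ⊥-elim (t≢f q p))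
    where
    empty : loc v ≡ 0
    empty = ΣS-0 (λ W → trans (cong (wt W *_) (n≤0⇒n≡0 (pred-mono-≤ (c-1 fzero (only W))))) (*-zeroʳ (wt W)))
      where
      only : ∀ W x → x ∈ cut (V.J v) W → Conn (V.graph v) (cut (V.J v) W) x fzero
      only W fzero q = crefl q
      only W (fsuc k) q = ⊥-elim (t≢f (down (single-⊑ v (∪-inʳ v (single k) (single v) (mem-single-same v))) (proj₂ (V.N-el v k (cut-J (V.J v) W (fsuc k) q)))) p)

  bounded : ∀ v → Bounded v
  bounded v = [ bounded-boundary v , (λ b → [ (λ p → let F , ΔF , cF , sub = pure (single v) p in bounded-interior v b p F ΔF cF (sub v (mem-single-same v))) , bounded-outside v ]′ (decB (Δ (single v)))) ]′
    (decB (∂Δ (single v)))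

  f₀ f₁ : ℕ
  f₀ = fc Δ ∂Δ 1
  f₁ = fc Δ ∂Δ 2

  face₀ : card interior ≡ f₀
  face₀ = trans (sym (ΣF-card (λ v → rel Δ ∂Δ (single v)))) (sym (trans (countB-ΣS (λ σ → rel Δ ∂Δ σ ∧ (card σ ≡ᵇ 1)))
    (trans (ΣS-cong regroup) (trans (ΣS-cover emptyS (λ σ → bit (rel Δ ∂Δ σ))) (ΣF-cong at)))))
    where
    regroup : ∀ σ → bit (rel Δ ∂Δ σ ∧ (card σ ≡ᵇ 1)) ≡ (if (emptyS ⊆ᵇ σ) ∧ (card σ ≡ᵇ suc (card (emptyS {n}))) then bit (rel Δ ∂Δ σ) else 0)
    regroup σ rewrite ⇒⊆ᵇ {s = emptyS} {σ} (λ i p → ⊥-elim (t≢f p (mem-empty i))) | card-empty n with rel Δ ∂Δ σ | card σ ≡ᵇ 1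
    ... | true | true = refl
    ... | true | false = refl
    ... | false | true = refl
    ... | false | false = refl
    at : ∀ x → (if mem x emptyS then 0 else bit (rel Δ ∂Δ (ins x emptyS))) ≡ bit (rel Δ ∂Δ (single x))
    at x rewrite mem-empty x = cong (λ σ → bit (rel Δ ∂Δ σ)) (trans (∪-comm emptyS (single x)) (∪-empty (single x)))

  -- Every interior edge is counted from both of its ends.
  face₁ : ΣF (λ v → card (V.R v)) ≡ 2 * f₁
  face₁ = begin
    ΣF (λ v → card (V.R v)) ≡⟨ ΣF-cong (λ v → sym (ΣF-card (λ k → not (eqF k v) ∧ rel Δ ∂Δ (pair k v)))) ⟩
    ΣF (λ v → ΣF (λ k → bit (not (eqF k v) ∧ rel Δ ∂Δ (pair k v)))) ≡⟨ ΣF-cong (λ v → trans (ΣF-cong (at v)) (sym (ΣS-cover (single v) (λ σ → bit (rel Δ ∂Δ σ))))) ⟩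
    ΣF (λ v → ΣS (λ σ → if (single v ⊆ᵇ σ) ∧ (card σ ≡ᵇ suc (card (single v))) then bit (rel Δ ∂Δ σ) else 0)) ≡⟨ ΣF-ΣS {n} {n} (λ v σ → if (single v ⊆ᵇ σ) ∧ (card σ ≡ᵇ suc (card (single v))) then bit (rel Δ ∂Δ σ) else 0) ⟩
    ΣS (λ σ → ΣF (λ v → if (single v ⊆ᵇ σ) ∧ (card σ ≡ᵇ suc (card (single v))) then bit (rel Δ ∂Δ σ) else 0)) ≡⟨ ΣS-cong inner ⟩
    ΣS (λ σ → 2 * bit (rel Δ ∂Δ σ ∧ (card σ ≡ᵇ 2))) ≡⟨ trans (ΣS-* 2 (λ σ → bit (rel Δ ∂Δ σ ∧ (card σ ≡ᵇ 2)))) (cong (2 *_) (sym (countB-ΣS (λ σ → rel Δ ∂Δ σ ∧ (card σ ≡ᵇ 2))))) ⟩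
    2 * f₁ ∎
    where
    open ≡-Reasoning
    at : ∀ v k → bit (not (eqF k v) ∧ rel Δ ∂Δ (pair k v)) ≡ (if mem k (single v) then 0 else bit (rel Δ ∂Δ (ins k (single v))))
    at v k with k ≟ v
    ... | yes refl rewrite eqF-refl k | mem-single-same k = refl
    ... | no ne rewrite eqF-≢ ne | mem-single-other k v ne | ∪-comm (single v) (single k) = refl
    sub : ∀ v σ → (single v ⊆ᵇ σ) ≡ mem v σ
    sub v σ = bool-iff (λ p → ⊆ᵇ⇒ {s = single v} {σ} p v (mem-single-same v)) (λ p → ⇒⊆ᵇ (single-⊑ v p))
    inner : ∀ σ → ΣF (λ v → if (single v ⊆ᵇ σ) ∧ (card σ ≡ᵇ suc (card (single v))) then bit (rel Δ ∂Δ σ) else 0) ≡ 2 * bit (rel Δ ∂Δ σ ∧ (card σ ≡ᵇ 2))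
    inner σ = trans (ΣF-cong pull) (trans (ΣF-∈ σ (bit (rel Δ ∂Δ σ ∧ (card σ ≡ᵇ 2)))) only-2)
      where
      pull : ∀ v → (if (single v ⊆ᵇ σ) ∧ (card σ ≡ᵇ suc (card (single v))) then bit (rel Δ ∂Δ σ) else 0) ≡ (if mem v σ then bit (rel Δ ∂Δ σ ∧ (card σ ≡ᵇ 2)) else 0)
      pull v rewrite sub v σ | card-single v with mem v σ | card σ ≡ᵇ 2
      ... | true | true = cong bit (sym (∧-identityʳ _))
      ... | true | false = cong bit (sym (∧-zeroʳ _))
      ... | false | _ = refl
      only-2 : card σ * bit (rel Δ ∂Δ σ ∧ (card σ ≡ᵇ 2)) ≡ 2 * bit (rel Δ ∂Δ σ ∧ (card σ ≡ᵇ 2))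
      only-2 with decB (card σ ≡ᵇ 2)
      ... | inj₁ p rewrite eqᵇ⇒ {card σ} p = refl
      ... | inj₂ p rewrite p | ∧-zeroʳ (rel Δ ∂Δ σ) = *-zeroʳ (card σ)

  weights : ΣF weight ≡ 2 * f₁ + f₀ * (d * suc d)
  weights = trans (ΣF-+ (λ v → card (V.R v)) _) (cong₂ _+_ face₁ (begin
    ΣF (λ v → bit (rel Δ ∂Δ (single v)) * (d * suc d)) ≡⟨ ΣF-cong (λ v → *-comm (bit (rel Δ ∂Δ (single v))) (d * suc d)) ⟩
    ΣF (λ v → (d * suc d) * bit (rel Δ ∂Δ (single v))) ≡⟨ ΣF-* (d * suc d) (λ v → bit (rel Δ ∂Δ (single v))) ⟩
    (d * suc d) * ΣF (λ v → bit (rel Δ ∂Δ (single v))) ≡⟨ cong ((d * suc d) *_) (trans (ΣF-card (λ v → rel Δ ∂Δ (single v))) face₀) ⟩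
    (d * suc d) * f₀ ≡⟨ *-comm (d * suc d) f₀ ⟩
    f₀ * (d * suc d) ∎))
    where open ≡-Reasoning

  loc-≤ : ∀ v → loc v ≤ weight v * T
  loc-≤ v = [ proj₁ , <⇒≤ ]′ (bounded v)

  module _ (b0 b1 : ℕ) (β₀ : Homology.IsBetti 𝔽 Δ ∂Δ 1 b0) (β₁ : Homology.IsBetti 𝔽 Δ ∂Δ 2 b1) where

    C₂ : ℕ
    C₂ = suc (suc d) Comb.C 2

    -- The Morse inequality is applied to the cheapest order, whose total is at most the average;
    -- everything is multiplied by (n+1)!.
    morse-bound : suc n ! * (b1 + f₀) ≤ ΣF loc + suc n ! * b0
    morse-bound = begin
      suc n ! * (b1 + f₀) ≡⟨ cong (λ z → suc n ! * (b1 + z)) (sym face₀) ⟩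
      suc n ! * (b1 + card interior) ≤⟨ *-monoʳ-≤ (suc n !) (morse (proj₁ (g-attained full)) b0 b1 (bdry-empty d Δ pmb) β₀ β₁) ⟩
      suc n ! * (total (proj₁ (g-attained full)) + b0) ≡⟨ cong (λ z → suc n ! * (z + b0)) (proj₂ (g-attained full)) ⟩
      suc n ! * (g full + b0) ≡⟨ *-distribˡ-+ (suc n !) (g full) b0 ⟩
      suc n ! * g full + suc n ! * b0 ≡⟨ cong (_+ suc n ! * b0) (*-assoc (suc n) (n !) (g full)) ⟩
      suc n * (n ! * g full) + suc n ! * b0 ≤⟨ +-monoˡ-≤ (suc n ! * b0) (*-monoʳ-≤ (suc n) average) ⟩
      suc n * ΣF local + suc n ! * b0 ≡⟨ cong (_+ suc n ! * b0) (trans (sym (ΣF-* (suc n) local)) (ΣF-cong (λ v → local-total v (forget v)))) ⟩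
      ΣF loc + suc n ! * b0 ∎
      where
      open ≤-Reasoning
      forget : ∀ v W → v ∉ W → f v (ins v W) ≡ f v W
      forget v W _ = cong (λ S → pred (c (V.graph v) S)) (cut-ins-W-out (V.J v) W v (falseI (λ p → proj₁ (V.N-el v v p) refl)))

    -- Here `x` stands for the total of the local costs. The slack below its upper bound is kept in
    -- the conclusion, so that equality in the theorem forces equality at each vertex. The
    -- coefficient of `f₀` is (d+1)(d+2) - d(d+1) = 2(d+1).
    finish : ∀ x → x ≤ ΣF weight * T → suc n ! * (b1 + f₀) ≤ x + suc n ! * b0 → T * (2 * (C₂ * b1 + suc d * f₀)) + (ΣF weight * T ∸ x) ≤ T * (2 * (f₁ + C₂ * b0))
    finish x le mb = +-cancelʳ-≤ (T * (f₀ * (d * suc d)) + x) _ _ (begin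
      T * (2 * (C₂ * b1 + suc d * f₀)) + (ΣF weight * T ∸ x) + (T * (f₀ * (d * suc d)) + x)
        ≡⟨ regroup₁ (T * (2 * (C₂ * b1 + suc d * f₀))) (ΣF weight * T ∸ x) (T * (f₀ * (d * suc d))) x ⟩
      (T * (2 * (C₂ * b1 + suc d * f₀)) + T * (f₀ * (d * suc d))) + ((ΣF weight * T ∸ x) + x) ≡⟨ cong₂ _+_ left (m∸n+n≡m le) ⟩
      suc n ! * (b1 + f₀) + ΣF weight * T ≤⟨ +-monoˡ-≤ _ mb ⟩
      (x + suc n ! * b0) + ΣF weight * T ≡⟨ cong₂ (λ p q → (x + p * b0) + q * T) (sym (unit-closed n d d<n)) weights ⟩
      (x + T * (suc d * suc (suc d)) * b0) + (2 * f₁ + f₀ * (d * suc d)) * T ≡⟨ cong (λ z → (x + T * z * b0) + (2 * f₁ + f₀ * (d * suc d)) * T) (sym twice) ⟩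
      (x + T * (2 * C₂) * b0) + (2 * f₁ + f₀ * (d * suc d)) * T ≡⟨ regroup₂ T x C₂ b0 f₁ (f₀ * (d * suc d)) ⟩
      T * (2 * (f₁ + C₂ * b0)) + (T * (f₀ * (d * suc d)) + x) ∎)
      where
      open ≤-Reasoning
      open +-*-Solver
      twice : 2 * C₂ ≡ suc d * suc (suc d)
      twice = trans (choose-2 (suc d)) (*-comm (suc (suc d)) (suc d))
      regroup₁ : ∀ p q r x → p + q + (r + x) ≡ (p + r) + (q + x)
      regroup₁ = solve 4 (λ p q r x → p :+ q :+ (r :+ x) := (p :+ r) :+ (q :+ x)) refl
      regroup₂ : ∀ t x k b f r → (x + t * (2 * k) * b) + (2 * f + r) * t ≡ t * (2 * (f + k * b)) + (t * r + x)
      regroup₂ = solve 6 (λ t x k b f r → (x :+ t :* (con 2 :* k) :* b) :+ (con 2 :* f :+ r) :* t := t :* (con 2 :* (f :+ k :* b)) :+ (t :* r :+ x)) refl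
      left : T * (2 * (C₂ * b1 + suc d * f₀)) + T * (f₀ * (d * suc d)) ≡ suc n ! * (b1 + f₀)
      left = trans (e₁ T C₂ b1 d f₀) (trans (cong (λ z → T * (z * b1 + suc d * suc (suc d) * f₀)) twice)
        (trans (e₂ T (suc d * suc (suc d)) b1 f₀) (cong (_* (b1 + f₀)) (unit-closed n d d<n))))
        where
        e₁ : ∀ t k b d f → t * (2 * (k * b + suc d * f)) + t * (f * (d * suc d)) ≡ t * (2 * k * b + suc d * suc (suc d) * f)
        e₁ = solve 5 (λ t k b d f → t :* (con 2 :* (k :* b :+ (con 1 :+ d) :* f)) :+ t :* (f :* (d :* (con 1 :+ d))) := t :* (con 2 :* k :* b :+ (con 1 :+ d) :* (con 2 :+ d) :* f)) refl
        e₂ : ∀ t k b f → t * (k * b + k * f) ≡ t * k * (b + f)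
        e₂ = solve 4 (λ t k b f → t :* (k :* b :+ k :* f) := t :* k :* (b :+ f)) refl

    T≢0 : NonZero T
    T≢0 = >-nonZero T-pos

    ΣT : (h : Fin n → ℕ) → ΣF (λ v → h v * T) ≡ ΣF h * T
    ΣT h = trans (ΣF-cong (λ v → *-comm (h v) T)) (trans (ΣF-* T h) (*-comm T _))

    inequality : C₂ * b1 + suc d * f₀ ≤ f₁ + C₂ * b0
    inequality = *-cancelˡ-≤ 2 (*-cancelˡ-≤ T {{T≢0}} (≤-trans (m≤m+n _ _) (finish (ΣF loc) (≤-trans (ΣF-mono loc-≤) (≤-reflexive (ΣT weight))) morse-bound)))

    all-reached : C₂ * b1 + suc d * f₀ ≡ f₁ + C₂ * b0 → ∀ v → Δ (single v) ≡ true → Reached v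
    all-reached eq v Δv = [ (λ r → proj₂ r Δv) , (λ lt → ⊥-elim (strictly lt)) ]′ (bounded v)
      where
      strictly : loc v < weight v * T → ⊥
      strictly lt = <-irrefl (cong (λ z → T * (2 * z)) eq)
        (≤-trans (≤-trans (≤-reflexive (+-comm 1 _)) (+-monoʳ-≤ (T * (2 * (C₂ * b1 + suc d * f₀))) (m<n⇒0<n∸m strict))) (finish (ΣF loc) (<⇒≤ strict) morse-bound))
        where
        strict : ΣF loc < ΣF weight * T
        strict = ≤-trans (ΣF-mono-< loc-≤ v lt) (≤-reflexive (ΣT weight))

  fold-max : ∀ m (h : Sub m → ℕ) σ → h σ ≤ foldr (λ σ acc → h σ ⊔ℕ acc) 0 (allSubs m)
  fold-max zero h [] = m≤m⊔n _ _
  fold-max (suc m) h (false ∷ σ) = ≤-trans (≤-trans (fold-max m (λ s → h (false ∷ s)) σ) (m≤m⊔n _ _)) (≤-reflexive (sym (fold-allSubs _⊔ℕ_ 0 ⊔-assoc (λ _ → refl) h)))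
  fold-max (suc m) h (true ∷ σ) = ≤-trans (≤-trans (fold-max m (λ s → h (true ∷ s)) σ) (m≤n⊔m _ _)) (≤-reflexive (sym (fold-allSubs _⊔ℕ_ 0 ⊔-assoc (λ _ → refl) h)))

  top-card : relTopCard Δ ∂Δ ≡ suc d
  top-card = ≤-antisym (below (allSubs n)) (≤-trans (≤-trans (≤-reflexive (sym at-F)) (fold-max n h F)) (≤-reflexive (sym (as-max (allSubs n)))))
    where
    F : Sub n
    F = proj₁ a-facet
    h : Sub n → ℕ
    h σ = if rel Δ ∂Δ σ then card σ else 0
    rF : rel Δ ∂Δ F ≡ true
    rF = ∧-in (proj₁ (proj₂ a-facet)) (not-in (falseI (λ b → <-irrefl refl (≤-trans (≤-reflexive (sym (proj₂ (proj₂ a-facet)))) (bdry-card F b)))))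
    at-F : h F ≡ suc d
    at-F rewrite rF = proj₂ (proj₂ a-facet)
    below : ∀ xs → foldr (λ σ acc → if rel Δ ∂Δ σ then card σ ⊔ℕ acc else acc) 0 xs ≤ suc d
    below [] = z≤n
    below (σ ∷ xs) with decB (rel Δ ∂Δ σ)
    ... | inj₁ p rewrite p = ⊔-lub (top σ (proj₁ (∧-el p))) (below xs)
    ... | inj₂ p rewrite p = below xs
    as-max : ∀ xs → foldr (λ σ acc → if rel Δ ∂Δ σ then card σ ⊔ℕ acc else acc) 0 xs ≡ foldr (λ σ acc → h σ ⊔ℕ acc) 0 xs
    as-max [] = refl
    as-max (σ ∷ xs) with rel Δ ∂Δ σ
    ... | true = cong (card σ ⊔ℕ_) (as-max xs)
    ... | false = as-max xs

  fc-0 : fc Δ ∂Δ 0 ≡ 0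
  fc-0 = trans (countB-ΣS (λ σ → rel Δ ∂Δ σ ∧ (card σ ≡ᵇ 0))) (ΣS-0 {n} none)
    where
    none : ∀ σ → bit (rel Δ ∂Δ σ ∧ (card σ ≡ᵇ 0)) ≡ 0
    none σ with decB (card σ ≡ᵇ 0)
    ... | inj₂ p rewrite p | ∧-zeroʳ (rel Δ ∂Δ σ) = refl
    ... | inj₁ p rewrite card-0 σ (eqᵇ⇒ p) | bdry-empty d Δ pmb | ∧-zeroʳ (Δ emptyS) = refl

  -- The empty face is in the boundary, so it does not contribute to the relative face numbers.
  gnum-2 : gnum Δ ∂Δ 2 ≡ ℤ.+ f₁ ℤ.- ℤ.+ (suc d * f₀)
  gnum-2 = trans (cong₂ (λ D x → poly D x f₀ f₁) top-card fc-0) (poly-value d f₀ f₁ (≤-trans (s≤s z≤n) 3≤d))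

diff-≤ : ∀ a b e k m → a * b + e ≤ k + a * m → ℤ.+ a ℤ.* (ℤ.+ b ℤ.- ℤ.+ m) ℤ.≤ ℤ.+ k ℤ.- ℤ.+ e
diff-≤ a b e k m le = subst₂ ℤ._≤_ (trans (cong (λ z → z ℤ.+ s) (expand a b e)) (r₁ (ℤ.+ a) (ℤ.+ b) (ℤ.+ e) (ℤ.+ m)))
    (trans (cong (λ z → z ℤ.+ s) (trans (ℤₚ.pos-+ k (a * m)) (cong (λ z → ℤ.+ k ℤ.+ z) (ℤₚ.pos-* a m)))) (r₂ (ℤ.+ a) (ℤ.+ k) (ℤ.+ e) (ℤ.+ m)))
    (ℤₚ.+-monoˡ-≤ s (ℤ.+≤+ le))
  where
  open ℤSolver.+-*-Solver
  s : ℤ.ℤ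
  s = ℤ.- (ℤ.+ e) ℤ.- ℤ.+ a ℤ.* ℤ.+ m
  expand : ∀ a b e → ℤ.+ (a * b + e) ≡ ℤ.+ a ℤ.* ℤ.+ b ℤ.+ ℤ.+ e
  expand a b e = trans (ℤₚ.pos-+ (a * b) e) (cong (λ z → z ℤ.+ ℤ.+ e) (ℤₚ.pos-* a b))
  r₁ : ∀ a b e m → (a ℤ.* b ℤ.+ e) ℤ.+ (ℤ.- e ℤ.- a ℤ.* m) ≡ a ℤ.* (b ℤ.- m)
  r₁ = solve 4 (λ a b e m → (a :* b :+ e) :+ (:- e :- a :* m) := a :* (b :- m)) refl
  r₂ : ∀ a k e m → (k ℤ.+ a ℤ.* m) ℤ.+ (ℤ.- e ℤ.- a ℤ.* m) ≡ k ℤ.- e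
  r₂ = solve 4 (λ a k e m → (k :+ a :* m) :+ (:- e :- a :* m) := k :- e) refl

diff-≡ : ∀ a b e k m → ℤ.+ k ℤ.- ℤ.+ e ≡ ℤ.+ a ℤ.* (ℤ.+ b ℤ.- ℤ.+ m) → a * b + e ≡ k + a * m
diff-≡ a b e k m h = ℤₚ.+-injective (begin
  ℤ.+ (a * b + e) ≡⟨ trans (ℤₚ.pos-+ (a * b) e) (cong (λ z → z ℤ.+ ℤ.+ e) (ℤₚ.pos-* a b)) ⟩
  ℤ.+ a ℤ.* ℤ.+ b ℤ.+ ℤ.+ e ≡⟨ r₁ (ℤ.+ a) (ℤ.+ b) (ℤ.+ e) (ℤ.+ m) ⟩
  ℤ.+ a ℤ.* (ℤ.+ b ℤ.- ℤ.+ m) ℤ.+ (ℤ.+ e ℤ.+ ℤ.+ a ℤ.* ℤ.+ m) ≡⟨ cong (λ z → z ℤ.+ (ℤ.+ e ℤ.+ ℤ.+ a ℤ.* ℤ.+ m)) (sym h) ⟩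
  (ℤ.+ k ℤ.- ℤ.+ e) ℤ.+ (ℤ.+ e ℤ.+ ℤ.+ a ℤ.* ℤ.+ m) ≡⟨ r₂ (ℤ.+ a) (ℤ.+ k) (ℤ.+ e) (ℤ.+ m) ⟩
  ℤ.+ k ℤ.+ ℤ.+ a ℤ.* ℤ.+ m ≡⟨ sym (trans (ℤₚ.pos-+ k (a * m)) (cong (λ z → ℤ.+ k ℤ.+ z) (ℤₚ.pos-* a m))) ⟩
  ℤ.+ (k + a * m) ∎)
  where
  open ≡-Reasoning
  open ℤSolver.+-*-Solver
  r₁ : ∀ a b e m → a ℤ.* b ℤ.+ e ≡ a ℤ.* (b ℤ.- m) ℤ.+ (e ℤ.+ a ℤ.* m)
  r₁ = solve 4 (λ a b e m → a :* b :+ e := a :* (b :- m) :+ (e :+ a :* m)) refl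
  r₂ : ∀ a k e m → (k ℤ.- e) ℤ.+ (e ℤ.+ a ℤ.* m) ≡ k ℤ.+ a ℤ.* m
  r₂ = solve 4 (λ a k e m → (k :- e) :+ (e :+ a :* m) := k :+ a :* m) refl

-- Removing vertices of minimal degree

-- A pure, strongly connected complex of dimension `d - 1` with at most two facets at a ridge. `R`
-- singles out ridges known to have a second facet: all ridges for the link of an interior vertex,
-- and for a boundary vertex those containing a vertex off the boundary.
record Pseudo {n} (d : ℕ) (R : Sub n → Set) (K : Cx n) : Set where
  field
    down : ∀ {σ τ} → τ ⊑ σ → K σ ≡ true → K τ ≡ true
    top : ∀ σ → K σ ≡ true → card σ ≤ d
    pure : ∀ σ → K σ ≡ true → Σ (Sub n) λ F → K F ≡ true × card F ≡ d × σ ⊑ F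
    no-three : ∀ ρ x y z → suc (card ρ) ≡ d → x ∉ ρ → y ∉ ρ → z ∉ ρ → K (ins x ρ) ≡ true → K (ins y ρ) ≡ true → K (ins z ρ) ≡ true
      → x ≢ y → x ≢ z → y ≢ z → ⊥
    other : ∀ σ x → K σ ≡ true → card σ ≡ d → x ∈ σ → R (del x σ) → ∃ λ y → y ∉ σ × K (ins y (del x σ)) ≡ true
    joined-facets : ∀ (X : Sub n → Bool)
      → (∀ ρ x y → suc (card ρ) ≡ d → x ∉ ρ → y ∉ ρ → K (ins x ρ) ≡ true → K (ins y ρ) ≡ true → X (ins x ρ) ≡ true → X (ins y ρ) ≡ true)
      → ∀ F F' → K F ≡ true → K F' ≡ true → card F ≡ d → card F' ≡ d → X F ≡ true → X F' ≡ true

pair-⊑ : ∀ {n} (x y : Fin n) {s} → x ∈ s → y ∈ s → pair x y ⊑ s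
pair-⊑ x y p q = ∪-⊑ (single x) (single y) (single-⊑ x p) (single-⊑ y q)

proper : ∀ {n} (s t : Sub n) → s ⊑ t → s ≢ t → ∃ λ x → x ∈ t × x ∉ s
proper s t h ne = extra s t (≰⇒> (λ le → ne (card-eq h le)))

module Peel {n} (d : ℕ) (1<d : 2 ≤ d) (R : Sub n → Set) (K : Cx n) (P : Pseudo d R K) (w : Fin n) (Kw : K (single w) ≡ true)
  (D : Sub n) (cD : card D ≡ d) (w∉D : w ∉ D) (nbrs : ∀ x → x ≢ w → K (pair x w) ≡ true → x ∈ D) (Rw : ∀ ρ → w ∈ ρ → R ρ) where

  open Pseudo P

  S : Sub n
  S = ins w D

  cS : card S ≡ suc d
  cS = trans (card-ins w D w∉D) (cong suc cD)

  in-S : ∀ σ → w ∈ σ → K σ ≡ true → σ ⊑ S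
  in-S σ w∈ k x x∈ with x ≟ w
  ... | yes refl = mem-ins-same x D
  ... | no x≢w = ins-⊒ w D x (nbrs x x≢w (down (pair-⊑ x w x∈ w∈) k))

  -- Some facet at `w` omits a single element `a` of `D`. Crossing its ridge opposite to `x` stays
  -- at `w`, so the vertex gained is a neighbour of `w`, hence in `D`, hence `a`. Therefore the star
  -- of `w` is the cone over the whole boundary of the simplex `D`.
  star-facet : ∀ x → x ∈ D → K (ins w (del x D)) ≡ true
  star-facet x x∈D with pure (single w) Kw
  ... | σ , Kσ , cσ , sub with extra (del w σ) D (subst₂ _≤_ (sym (trans (card-del w σ (sub w (mem-single-same w))) cσ)) (sym cD) ≤-refl)
  ...   | a , a∈D , a∉f = go
    where
    w∈σ : w ∈ σ
    w∈σ = sub w (mem-single-same w)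
    f : Sub n
    f = del w σ
    f⊑D : f ⊑ D
    f⊑D z p = let z≢w , z∈ = del-∈ z w σ p in nbrs z z≢w (down (pair-⊑ z w z∈ w∈σ) Kσ)
    D≡ : ins a f ≡ D
    D≡ = card-eq (ins-⊑ a f⊑D a∈D) (≤-reflexive (trans cD (trans (sym cσ) (trans (sym (card-del w σ w∈σ)) (sym (card-ins a f a∉f))))))
    go : K (ins w (del x D)) ≡ true
    go with ins-el x a f (subst (x ∈_) (sym D≡) x∈D)
    ... | inj₁ refl = subst (λ s → K s ≡ true) (trans (sym (ins-del w σ w∈σ)) (cong (ins w) (trans (sym (del-ins a f a∉f)) (cong (del a) D≡)))) Kσ
    ... | inj₂ x∈f with del-∈ x w σ x∈f
    ...   | x≢w , x∈σ with other σ x Kσ cσ x∈σ (Rw _ (del-in w x σ (λ e → x≢w (sym e)) w∈σ))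
    ...     | y , y∉σ , Ky = subst (λ s → K s ≡ true) (trans (cong (λ z → ins z (del x σ)) y≡a) shape) Ky
      where
      y≢w : y ≢ w
      y≢w refl = t≢f w∈σ y∉σ
      y∈D : y ∈ D
      y∈D = nbrs y y≢w (down (pair-⊑ y w (mem-ins-same y (del x σ)) (ins-⊒ y (del x σ) w (del-in w x σ (λ e → x≢w (sym e)) w∈σ))) Ky)
      y≡a : y ≡ a
      y≡a with ins-el y a f (subst (y ∈_) (sym D≡) y∈D)
      ... | inj₁ e = e
      ... | inj₂ p = ⊥-elim (t≢f (del-⊑ w σ y p) y∉σ)
      shape : ins a (del x σ) ≡ ins w (del x D)
      shape = begin
        ins a (del x σ) ≡⟨ cong (λ z → ins a (del x z)) (sym (ins-del w σ w∈σ)) ⟩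
        ins a (del x (ins w f)) ≡⟨ cong (ins a) (del-ins-other x w f x≢w) ⟩
        ins a (ins w (del x f)) ≡⟨ ins-comm a w (del x f) ⟩
        ins w (ins a (del x f)) ≡⟨ cong (ins w) (sym (del-ins-other x a f (λ { refl → t≢f x∈f a∉f }))) ⟩
        ins w (del x (ins a f)) ≡⟨ cong (λ z → ins w (del x z)) D≡ ⟩
        ins w (del x D) ∎
        where open ≡-Reasoning

  star-face : ∀ σ → w ∈ σ → σ ⊑ S → σ ≢ S → K σ ≡ true
  star-face σ w∈ h ne with proper σ S h ne
  ... | x , x∈S , x∉ with ins-el x w D x∈S
  ...   | inj₁ refl = ⊥-elim (t≢f w∈ x∉)
  ...   | inj₂ x∈D = down sub (star-facet x x∈D)
    where
    sub : σ ⊑ ins w (del x D)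
    sub z z∈ with ins-el z w D (h z z∈)
    ... | inj₁ refl = mem-ins-same z (del x D)
    ... | inj₂ q = ins-⊒ w (del x D) z (del-in z x D (∉⇒≢ σ z x z∈ x∉) q)

  boundary-face : ∀ τ → τ ⊑ D → τ ≢ D → K τ ≡ true
  boundary-face τ h ne with proper τ D h ne
  ... | x , x∈D , x∉ = down (λ z z∈ → ins-⊒ w (del x D) z (del-in z x D (∉⇒≢ τ z x z∈ x∉) (h z z∈))) (star-facet x x∈D)

  ≢S : ∀ σ → K σ ≡ true → σ ≢ S
  ≢S σ k refl = <-irrefl refl (≤-trans (≤-reflexive (sym cS)) (top S k))

  -- If D is a face then the boundary of the simplex D ∪ {w} is all of K.
  module Full (KD : K D ≡ true) where

    sub-facet : ∀ σ → σ ⊑ S → card σ ≡ d → K σ ≡ true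
    sub-facet σ h e with decB (mem w σ)
    ... | inj₁ p = star-face σ p h (λ { refl → <-irrefl (trans (sym e) cS) ≤-refl })
    ... | inj₂ p = subst (λ s → K s ≡ true) (sym (card-eq sub (≤-reflexive (trans cD (sym e))))) KD
      where
      sub : σ ⊑ D
      sub z z∈ with ins-el z w D (h z z∈)
      ... | inj₁ refl = ⊥-elim (t≢f z∈ p)
      ... | inj₂ q = q

    -- A ridge of the simplex `S` already has its two facets inside `S`, so strong connectedness
    -- cannot lead out of `S`.
    facets-⊑ : ∀ F → K F ≡ true → card F ≡ d → F ⊑ S
    facets-⊑ F k e = ⊆ᵇ⇒ (joined-facets (λ σ → σ ⊆ᵇ S) closed D F KD k cD e (⇒⊆ᵇ (ins-⊒ w D)))
      where
      closed : ∀ ρ x y → suc (card ρ) ≡ d → x ∉ ρ → y ∉ ρ → K (ins x ρ) ≡ true → K (ins y ρ) ≡ true → (ins x ρ ⊆ᵇ S) ≡ true → (ins y ρ ⊆ᵇ S) ≡ true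
      closed ρ x y cρ x∉ y∉ Kx Ky h with extra (ins x ρ) S (subst₂ _<_ (sym (trans (card-ins x ρ x∉) cρ)) (sym cS) ≤-refl)
      ... | x' , x'∈S , x'∉ with decB (mem y S)
      ...   | inj₁ p = ⇒⊆ᵇ (ins-⊑ y (λ z z∈ → ⊆ᵇ⇒ h z (ins-⊒ x ρ z z∈)) p)
      ...   | inj₂ p = ⊥-elim (no-three ρ x x' y cρ x∉ x'∉ρ y∉ Kx
          (sub-facet (ins x' ρ) (ins-⊑ x' (λ z z∈ → ⊆ᵇ⇒ h z (ins-⊒ x ρ z z∈)) x'∈S) (trans (card-ins x' ρ x'∉ρ) cρ)) Ky
          (λ { refl → t≢f (mem-ins-same x ρ) x'∉ }) (λ { refl → t≢f (⊆ᵇ⇒ h x (mem-ins-same x ρ)) p }) (λ { refl → t≢f x'∈S p }))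
        where
        x'∉ρ : x' ∉ ρ
        x'∉ρ = ⊑-∉ x' (ins-⊒ x ρ) x'∉

    all-⊑ : ∀ σ → K σ ≡ true → σ ⊑ S
    all-⊑ σ k with pure σ k
    ... | F , KF , cF , sub = λ x p → facets-⊑ F KF cF x (sub x p)

    is-boundary : ∀ σ → K σ ≡ ((σ ⊆ᵇ S) ∧ not (σ ==ᵇ S))
    is-boundary σ = bool-iff (λ k → ∧-in (⇒⊆ᵇ (all-⊑ σ k)) (not-in (==ᵇ-≢ (≢S σ k)))) from
      where
      from : (σ ⊆ᵇ S) ∧ not (σ ==ᵇ S) ≡ true → K σ ≡ true
      from p with ∧-el {σ ⊆ᵇ S} p
      ... | p₁ , p₂ with decB (mem w σ)
      ...   | inj₁ q = star-face σ q (⊆ᵇ⇒ p₁) (λ { refl → t≢f (==ᵇ-refl S) (not-el p₂) })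
      ...   | inj₂ q = down sub KD
        where
        sub : σ ⊑ D
        sub z z∈ with ins-el z w D (⊆ᵇ⇒ p₁ z z∈)
        ... | inj₁ refl = ⊥-elim (t≢f z∈ q)
        ... | inj₂ r = r

  module Remove (D∉ : K D ≡ false) where

    -- The summand left after undoing a connected sum: `w` is deleted and the missing face `D` is
    -- filled in.
    K₀ : Cx n
    K₀ σ = (K σ ∧ not (mem w σ)) ∨ (σ ==ᵇ D)

    K₀-old : ∀ σ → K σ ≡ true → w ∉ σ → K₀ σ ≡ true
    K₀-old σ k p = ∨-inˡ _ (∧-in k (not-in p))

    K₀-D : K₀ D ≡ true
    K₀-D = ∨-inʳ (K D ∧ not (mem w D)) (==ᵇ-refl D)

    K₀-el : ∀ σ → K₀ σ ≡ true → (K σ ≡ true × w ∉ σ) ⊎ σ ≡ D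
    K₀-el σ p with ∨-el {K σ ∧ not (mem w σ)} p
    ... | inj₁ q = let a , b = ∧-el q in inj₁ (a , not-el b)
    ... | inj₂ q = inj₂ (==ᵇ⇒ q)

    K₀-w : ∀ σ → K₀ σ ≡ true → w ∉ σ
    K₀-w σ p with K₀-el σ p
    ... | inj₁ (_ , q) = q
    ... | inj₂ refl = w∉D

    missing : ∀ ρ → suc (card ρ) ≡ d → ρ ⊑ D → ∃ λ b → b ∉ ρ × ins b ρ ≡ D
    missing ρ e h with extra ρ D (subst₂ _≤_ (sym e) (sym cD) ≤-refl)
    ... | b , b∈ , b∉ = b , b∉ , card-eq (ins-⊑ b h b∈) (≤-reflexive (trans cD (trans (sym e) (sym (card-ins b ρ b∉)))))

    below-D : ∀ ρ → K (ins w ρ) ≡ true → w ∉ ρ → ρ ⊑ D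
    below-D ρ k w∉ z z∈ with ins-el z w D (in-S (ins w ρ) (mem-ins-same w ρ) k z (ins-⊒ w ρ z z∈))
    ... | inj₁ refl = ⊥-elim (t≢f z∈ w∉)
    ... | inj₂ q = q

    over-ridge : ∀ ρ z → z ∉ ρ → ins z ρ ≡ D → K (ins w ρ) ≡ true
    over-ridge ρ z z∉ refl = subst (λ s → K (ins w s) ≡ true) (del-ins z ρ z∉) (star-facet z (mem-ins-same z ρ))

    P₀ : Pseudo d R K₀
    P₀ = record { down = down₀ ; top = top₀ ; pure = pure₀ ; no-three = three₀ ; other = other₀ ; joined-facets = joined₀ }
      where
      down₀ : ∀ {σ τ} → τ ⊑ σ → K₀ σ ≡ true → K₀ τ ≡ true
      down₀ {σ} {τ} h p with K₀-el σ p
      ... | inj₁ (k , w∉) = K₀-old τ (down h k) (⊑-∉ w h w∉)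
      ... | inj₂ refl with decB (τ ==ᵇ D)
      ...   | inj₁ e = ∨-inʳ (K τ ∧ not (mem w τ)) e
      ...   | inj₂ e = K₀-old τ (boundary-face τ h (λ { refl → t≢f (==ᵇ-refl D) e })) (⊑-∉ w h w∉D)
      top₀ : ∀ σ → K₀ σ ≡ true → card σ ≤ d
      top₀ σ p with K₀-el σ p
      ... | inj₁ (k , _) = top σ k
      ... | inj₂ refl = ≤-reflexive cD
      pure₀ : ∀ σ → K₀ σ ≡ true → Σ (Sub n) λ F → K₀ F ≡ true × card F ≡ d × σ ⊑ F
      pure₀ σ p with K₀-el σ p
      ... | inj₂ refl = D , K₀-D , cD , (λ _ q → q)
      ... | inj₁ (k , w∉) with pure σ k
      ...   | F , KF , cF , sub with decB (mem w F)
      ...     | inj₂ q = F , K₀-old F KF q , cF , sub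
      ...     | inj₁ q = D , K₀-D , cD , λ z z∈ → [ (λ e → ⊥-elim (t≢f (subst (_∈ σ) e z∈) w∉)) , id ]′ (ins-el z w D (in-S F q KF z (sub z z∈)))
      with-D : ∀ ρ x y z → suc (card ρ) ≡ d → x ∉ ρ → y ∉ ρ → z ∉ ρ → K₀ (ins x ρ) ≡ true → K₀ (ins y ρ) ≡ true → ins z ρ ≡ D
        → x ≢ y → x ≢ z → y ≢ z → ⊥
      with-D ρ x y z cρ x∉ y∉ z∉ Kx Ky e h k l with K₀-el (ins x ρ) Kx | K₀-el (ins y ρ) Ky
      ... | inj₂ e' | _ = k ([ id , (λ p → ⊥-elim (t≢f p x∉)) ]′ (ins-el x z ρ (subst (x ∈_) (trans e' (sym e)) (mem-ins-same x ρ))))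
      ... | inj₁ _ | inj₂ e' = l ([ id , (λ p → ⊥-elim (t≢f p y∉)) ]′ (ins-el y z ρ (subst (y ∈_) (trans e' (sym e)) (mem-ins-same y ρ))))
      ... | inj₁ (kx , wx) | inj₁ (ky , wy) = no-three ρ x y w cρ x∉ y∉ (⊑-∉ w (ins-⊒ x ρ) wx) kx ky (over-ridge ρ z z∉ e) h
        (λ { refl → t≢f (mem-ins-same x ρ) wx }) (λ { refl → t≢f (mem-ins-same y ρ) wy })
      three₀ : ∀ ρ x y z → suc (card ρ) ≡ d → x ∉ ρ → y ∉ ρ → z ∉ ρ → K₀ (ins x ρ) ≡ true → K₀ (ins y ρ) ≡ true → K₀ (ins z ρ) ≡ true
        → x ≢ y → x ≢ z → y ≢ z → ⊥
      three₀ ρ x y z cρ x∉ y∉ z∉ Kx Ky Kz h k l with K₀-el (ins x ρ) Kx | K₀-el (ins y ρ) Ky | K₀-el (ins z ρ) Kz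
      ... | _ | _ | inj₂ e = with-D ρ x y z cρ x∉ y∉ z∉ Kx Ky e h k l
      ... | _ | inj₂ e | inj₁ _ = with-D ρ x z y cρ x∉ z∉ y∉ Kx Kz e k h (λ q → l (sym q))
      ... | inj₂ e | inj₁ _ | inj₁ _ = with-D ρ y z x cρ y∉ z∉ x∉ Ky Kz e l (λ q → h (sym q)) (λ q → k (sym q))
      ... | inj₁ (kx , _) | inj₁ (ky , _) | inj₁ (kz , _) = no-three ρ x y z cρ x∉ y∉ z∉ kx ky kz h k l
      -- Facets at `w` are exchanged with `D`: if the second facet at a ridge contains `w`, the
      -- ridge lies in `D`, which replaces that facet; from `D`, one crosses the same ridge starting
      -- at the facet that joins it to `w`.
      other₀ : ∀ σ x → K₀ σ ≡ true → card σ ≡ d → x ∈ σ → R (del x σ) → ∃ λ y → y ∉ σ × K₀ (ins y (del x σ)) ≡ true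
      other₀ σ x p e x∈ r with K₀-el σ p
      ... | inj₂ refl with other (ins w (del x D)) w (star-facet x x∈) (trans (card-ins w (del x D) (del-∉ w x D w∉D)) (trans (card-del x D x∈) cD)) (mem-ins-same w (del x D))
              (subst R (sym (del-ins w (del x D) (del-∉ w x D w∉D))) r)
      ...   | y , y∉ , Ky = y , y∉D , K₀-old _ Ky' (ins-∉ w y (del x D) (λ q → y≢w (sym q)) (del-∉ w x D w∉D))
        where
        y≢w : y ≢ w
        y≢w = proj₁ (∉-ins y w (del x D) y∉)
        Ky' : K (ins y (del x D)) ≡ true
        Ky' = subst (λ s → K (ins y s) ≡ true) (del-ins w (del x D) (del-∉ w x D w∉D)) Ky
        y∉D : y ∉ D
        y∉D with y ≟ x
        ... | yes refl = ⊥-elim (t≢f (subst (λ s → K s ≡ true) (ins-del y D x∈) Ky') D∉)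
        ... | no y≢x = falseI (λ q → t≢f (ins-⊒ w (del x D) y (del-in y x D y≢x q)) y∉)
      other₀ σ x p e x∈ r | inj₁ (k , w∉) with other σ x k e x∈ r
      ... | y , y∉ , Ky with y ≟ w
      ...   | no y≢w = y , y∉ , K₀-old _ Ky (ins-∉ w y (del x σ) (λ q → y≢w (sym q)) (del-∉ w x σ w∉))
      ...   | yes refl with missing (del x σ) (trans (card-del x σ x∈) e) (below-D (del x σ) Ky (del-∉ w x σ w∉))
      ...     | b , b∉ , D≡ = b , b∉σ , trans (cong K₀ D≡) K₀-D
        where
        b∉σ : b ∉ σ
        b∉σ with b ≟ x
        ... | yes refl = ⊥-elim (t≢f (subst (λ s → K s ≡ true) (trans (sym (ins-del b σ x∈)) D≡) k) D∉)
        ... | no b≢x = falseI (λ q → t≢f (del-in b x σ b≢x q) b∉)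
      joined₀ : ∀ (X : Sub n → Bool)
        → (∀ ρ x y → suc (card ρ) ≡ d → x ∉ ρ → y ∉ ρ → K₀ (ins x ρ) ≡ true → K₀ (ins y ρ) ≡ true → X (ins x ρ) ≡ true → X (ins y ρ) ≡ true)
        → ∀ F F' → K₀ F ≡ true → K₀ F' ≡ true → card F ≡ d → card F' ≡ d → X F ≡ true → X F' ≡ true
      joined₀ X₀ closed₀ F F' p p' e e' XF = finish (lifted F p e) (lifted F' p' e')
        where
        -- A property of the facets of `K₀` is carried over to `K` by giving all facets at `w` the
        -- value of `D`.
        X : Sub n → Bool
        X σ = if mem w σ then X₀ D else X₀ σ
        X-w : ∀ σ → w ∈ σ → X σ ≡ X₀ D
        X-w σ q rewrite q = refl
        X-o : ∀ σ → w ∉ σ → X σ ≡ X₀ σ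
        X-o σ q rewrite q = refl
        lifted : ∀ F → K₀ F ≡ true → card F ≡ d → Σ (Sub n) λ F̃ → K F̃ ≡ true × card F̃ ≡ d × X F̃ ≡ X₀ F
        lifted F p e with K₀-el F p
        ... | inj₁ (k , q) = F , k , e , X-o F q
        ... | inj₂ refl with inhabited D (≤-trans (≤-trans (s≤s z≤n) 1<d) (≤-reflexive (sym cD)))
        ...   | x , x∈ = ins w (del x D) , star-facet x x∈ , trans (card-ins w (del x D) (del-∉ w x D w∉D)) (trans (card-del x D x∈) cD) , X-w _ (mem-ins-same w (del x D))
        closed : ∀ ρ x y → suc (card ρ) ≡ d → x ∉ ρ → y ∉ ρ → K (ins x ρ) ≡ true → K (ins y ρ) ≡ true → X (ins x ρ) ≡ true → X (ins y ρ) ≡ true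
        closed ρ x y cρ x∉ y∉ kx ky h with decB (mem w (ins x ρ)) | decB (mem w (ins y ρ))
        ... | inj₁ a | inj₁ b = trans (X-w _ b) (trans (sym (X-w _ a)) h)
        ... | inj₂ a | inj₂ b = trans (X-o _ b) (closed₀ ρ x y cρ x∉ y∉ (K₀-old _ kx a) (K₀-old _ ky b) (trans (sym (X-o _ a)) h))
        ... | inj₁ a | inj₂ b with ins-el w x ρ a
        ...   | inj₂ q = ⊥-elim (t≢f (ins-⊒ y ρ w q) b)
        ...   | inj₁ refl with missing ρ cρ (below-D ρ kx x∉)
        ...     | z , z∉ , D≡ = trans (X-o _ b) (closed₀ ρ z y cρ z∉ y∉ (trans (cong K₀ D≡) K₀-D) (K₀-old _ ky b) (trans (cong X₀ D≡) (trans (sym (X-w _ a)) h)))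
        closed ρ x y cρ x∉ y∉ kx ky h | inj₂ a | inj₁ b with ins-el w y ρ b
        ...   | inj₂ q = ⊥-elim (t≢f (ins-⊒ x ρ w q) a)
        ...   | inj₁ refl with missing ρ cρ (below-D ρ ky y∉)
        ...     | z , z∉ , D≡ = trans (X-w _ b) (trans (cong X₀ (sym D≡)) (closed₀ ρ x z cρ x∉ z∉ (K₀-old _ kx a) (trans (cong K₀ D≡) K₀-D) (trans (sym (X-o _ a)) h)))
        finish : (Σ (Sub n) λ F̃ → K F̃ ≡ true × card F̃ ≡ d × X F̃ ≡ X₀ F) → (Σ (Sub n) λ F̃ → K F̃ ≡ true × card F̃ ≡ d × X F̃ ≡ X₀ F') → X₀ F' ≡ true
        finish (A , a₁ , a₂ , a₃) (B , b₁ , b₂ , b₃) = trans (sym b₃) (joined-facets X closed A B a₁ b₁ a₂ b₂ (trans a₃ XF))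

    as-sum : ∀ σ → K σ ≡ connSumSimplex K₀ D w σ
    as-sum σ = bool-iff to from
      where
      to : K σ ≡ true → connSumSimplex K₀ D w σ ≡ true
      to k with decB (mem w σ)
      ... | inj₂ p = ∨-inˡ _ (∧-in (K₀-old σ k p) (not-in (==ᵇ-≢ {s = σ} {D} (λ { refl → t≢f k D∉ }))))
      ... | inj₁ p = ∨-inʳ (K₀ σ ∧ not (σ ==ᵇ D)) (∧-in (⇒⊆ᵇ (in-S σ p k)) (∧-in (not-in (==ᵇ-≢ (≢S σ k))) (not-in (==ᵇ-≢ {s = σ} {D} (λ { refl → t≢f p w∉D })))))
      from : connSumSimplex K₀ D w σ ≡ true → K σ ≡ true
      from q with ∨-el {K₀ σ ∧ not (σ ==ᵇ D)} q
      ... | inj₁ r with ∧-el {K₀ σ} r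
      ...   | r₁ , r₂ with K₀-el σ r₁
      ...     | inj₁ (k , _) = k
      ...     | inj₂ refl = ⊥-elim (t≢f (==ᵇ-refl D) (not-el r₂))
      from q | inj₂ r with ∧-el {σ ⊆ᵇ S} r
      ... | r₁ , r₂ with ∧-el {not (σ ==ᵇ S)} r₂
      ...   | r₃ , r₄ with decB (mem w σ)
      ...     | inj₁ p = star-face σ p (⊆ᵇ⇒ r₁) (λ { refl → t≢f (==ᵇ-refl S) (not-el r₃) })
      ...     | inj₂ p = boundary-face σ sub (λ { refl → t≢f (==ᵇ-refl D) (not-el r₄) })
        where
        sub : σ ⊑ D
        sub z z∈ with ins-el z w D (⊆ᵇ⇒ r₁ z z∈)
        ... | inj₁ refl = ⊥-elim (t≢f z∈ p)
        ... | inj₂ s = s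

    vertices₀ : ∀ x → K₀ (single x) ≡ true → K (single x) ≡ true
    vertices₀ x p with K₀-el (single x) p
    ... | inj₁ (k , _) = k
    ... | inj₂ e = ⊥-elim (<-irrefl (trans (sym (card-single x)) (trans (cong card e) cD)) 1<d)

    -- No edge is created, since the new face `D` has at least three vertices and its proper faces
    -- were present before.
    edges₀ : ∀ x y → x ≢ y → K₀ (pair x y) ≡ true → (3 ≤ d) → K (pair x y) ≡ true
    edges₀ x y x≢y p 3≤d with K₀-el (pair x y) p
    ... | inj₁ (k , _) = k
    ... | inj₂ e = ⊥-elim (<-irrefl (trans (sym (trans (card-ins y (single x) (mem-single-other y x (λ q → x≢y (sym q)))) (cong suc (card-single x)))) (trans (cong card e) cD)) 3≤d)

-- Homology of connected sums

-- The faces of `U` outside `A` are paired off by inserting and deleting `x₀`. The quotient of the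
-- two chain complexes is therefore contractible, and `A` and `U` have the same Betti numbers.
module Toggle {a ℓ} (𝔽 : Field a ℓ) {n} (A U : Cx n)
  (A-down : ∀ {σ τ} → τ ⊑ σ → A σ ≡ true → A τ ≡ true) (U-down : ∀ {σ τ} → τ ⊑ σ → U σ ≡ true → U τ ≡ true)
  (A⊆U : ∀ σ → A σ ≡ true → U σ ≡ true) (x₀ : Fin n)
  (toggle-ins : ∀ σ → U σ ≡ true → A σ ≡ false → U (ins x₀ σ) ≡ true)
  (toggle-del : ∀ σ → U σ ≡ true → A σ ≡ false → A (del x₀ σ) ≡ false) where

  open Linear 𝔽
  module BU = Boundary U emptyCx
  module BA = Boundary A emptyCx
  open Relation.Binary.Reasoning.Setoid setoid

  bdU bdA : Chain n → Chain n
  bdU = bd U emptyCx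
  bdA = bd A emptyCx

  rel-in : ∀ (K : Cx n) {σ} → K σ ≡ true → rel K emptyCx σ ≡ true
  rel-in K p = ∧-in p refl

  rel-out : ∀ (K : Cx n) {σ} → rel K emptyCx σ ≡ true → K σ ≡ true
  rel-out K p = proj₁ (∧-el p)

  -- The cone with apex x₀, a contraction of the chains of U modulo those of A.
  H : Chain n → Chain n
  H z τ = if (U τ ∧ not (A τ)) ∧ mem x₀ τ then sgn τ (del x₀ τ) ⊗ z (del x₀ τ) else 0#

  H-in : ∀ z τ → U τ ≡ true → A τ ≡ false → x₀ ∈ τ → H z τ ≡ sgn τ (del x₀ τ) ⊗ z (del x₀ τ)
  H-in z τ p q r rewrite p | q | r = refl

  H-out : ∀ z τ → x₀ ∉ τ → H z τ ≡ 0#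
  H-out z τ r rewrite r | ∧-zeroʳ (U τ ∧ not (A τ)) = refl

  A-up : ∀ {σ τ} → τ ⊑ σ → A τ ≡ false → A σ ≡ false
  A-up h p = falseI (λ q → t≢f (A-down h q) p)

  not-term : ∀ w τ x → x ∉ τ → U (ins x τ) ≡ false → BU.term w τ x ≡ 0#
  not-term w τ x p q = BU.term-out w τ x p (∧-falseˡ true q)

  -- The homotopy formula ∂H + H∂ = 1 on the quotient, applied to chains whose boundary vanishes
  -- there.
  cone : ∀ w k → (∀ σ → U σ ≡ true → A σ ≡ false → suc (card σ) ≡ k → bdU w σ ≈ 0#)
    → ∀ σ → U σ ≡ true → A σ ≡ false → card σ ≡ k → bdU (H w) σ ≈ w σ
  cone w k h σ Uσ Aσ e with decB (mem x₀ σ)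
  ... | inj₂ x∉ = ≈-trans (BU.bd-term (H w) σ) (≈-trans (sum-only n (BU.term (H w) σ) x₀ others) here-x₀)
    where
    others : ∀ y → y ≢ x₀ → BU.term (H w) σ y ≈ 0#
    others y ne with BU.place (H w) σ y
    ... | BU.vanishes q _ = ≈-reflexive q
    ... | BU.counts _ _ q = ≈-trans (≈-reflexive (q (H w))) (⊗0 _ (≈-reflexive (H-out w (ins y σ) (ins-∉ x₀ y σ (λ r → ne (sym r)) x∉))))
    here-x₀ : BU.term (H w) σ x₀ ≈ w σ
    here-x₀ = begin
      BU.term (H w) σ x₀ ≈⟨ ≈-reflexive (BU.term-in (H w) σ x₀ x∉ (rel-in U (toggle-ins σ Uσ Aσ))) ⟩
      sgn (ins x₀ σ) σ ⊗ H w (ins x₀ σ) ≈⟨ *-congˡ (≈-reflexive (H-in w (ins x₀ σ) (toggle-ins σ Uσ Aσ) (A-up (ins-⊒ x₀ σ) Aσ) (mem-ins-same x₀ σ))) ⟩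
      sgn (ins x₀ σ) σ ⊗ (sgn (ins x₀ σ) (del x₀ (ins x₀ σ)) ⊗ w (del x₀ (ins x₀ σ))) ≈⟨ ≈-reflexive (cong (λ τ → sgn (ins x₀ σ) σ ⊗ (sgn (ins x₀ σ) τ ⊗ w τ)) (del-ins x₀ σ x∉)) ⟩
      sgn (ins x₀ σ) σ ⊗ (sgn (ins x₀ σ) σ ⊗ w σ) ≈⟨ ≈-trans (≈-sym (⊗-assoc _ _ _)) (*-congʳ (sign² (pos (ins x₀ σ) σ))) ⟩
      1# ⊗ w σ ≈⟨ ⊗-identityˡ (w σ) ⟩
      w σ ∎
  ... | inj₁ x∈ = begin
    bdU (H w) σ ≈⟨ ≈-sym (⊕-identityʳ _) ⟩
    bdU (H w) σ ⊕ 0# ≈⟨ +-congˡ (≈-sym (⊗0 s (h ρ Uρ Aρ (trans (card-del x₀ σ x∈) e)))) ⟩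
    bdU (H w) σ ⊕ s ⊗ bdU w ρ ≈⟨ +-cong (BU.bd-term (H w) σ) (≈-trans (*-congˡ (BU.bd-term w ρ)) (≈-sym (sum-⊗ n s (BU.term w ρ)))) ⟩
    sumFin n (BU.term (H w) σ) ⊕ sumFin n (λ y → s ⊗ BU.term w ρ y) ≈⟨ ≈-sym (sum-⊕ n (BU.term (H w) σ) (λ y → s ⊗ BU.term w ρ y)) ⟩
    sumFin n (λ y → BU.term (H w) σ y ⊕ s ⊗ BU.term w ρ y) ≈⟨ sum-only n (λ y → BU.term (H w) σ y ⊕ s ⊗ BU.term w ρ y) x₀ others ⟩
    BU.term (H w) σ x₀ ⊕ s ⊗ BU.term w ρ x₀ ≈⟨ +-cong (≈-reflexive (BU.term-∈ (H w) σ x₀ x∈)) (*-congˡ (≈-reflexive (BU.term-in w ρ x₀ (mem-del-same x₀ σ) (rel-in U (subst (λ τ → U τ ≡ true) (sym σ≡) Uσ))))) ⟩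
    0# ⊕ s ⊗ (sgn (ins x₀ ρ) ρ ⊗ w (ins x₀ ρ)) ≈⟨ ≈-trans (⊕-identityˡ _) (≈-reflexive (cong (λ τ → s ⊗ (sgn τ ρ ⊗ w τ)) σ≡)) ⟩
    s ⊗ (s ⊗ w σ) ≈⟨ ≈-trans (≈-sym (⊗-assoc _ _ _)) (*-congʳ (sign² (pos σ ρ))) ⟩
    1# ⊗ w σ ≈⟨ ⊗-identityˡ (w σ) ⟩
    w σ ∎
    where
    ρ : Sub n
    ρ = del x₀ σ
    s : Carrier
    s = sgn σ ρ
    σ≡ : ins x₀ ρ ≡ σ
    σ≡ = ins-del x₀ σ x∈
    Uρ : U ρ ≡ true
    Uρ = U-down (del-⊑ x₀ σ) Uσ
    Aρ : A ρ ≡ false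
    Aρ = toggle-del σ Uσ Aσ
    others : ∀ y → y ≢ x₀ → BU.term (H w) σ y ⊕ s ⊗ BU.term w ρ y ≈ 0#
    others y ne with decB (mem y σ)
    ... | inj₁ y∈ = 0⊕0 (≈-reflexive (BU.term-∈ (H w) σ y y∈)) (⊗0 s (≈-reflexive (BU.term-∈ w ρ y (del-in y x₀ σ ne y∈))))
    ... | inj₂ y∉ with decB (U (ins y σ))
    ...   | inj₂ q = 0⊕0 (≈-reflexive (not-term (H w) σ y y∉ q)) (⊗0 s (≈-reflexive (not-term w ρ y (del-∉ y x₀ σ y∉)
              (falseI (λ u → t≢f (subst (λ τ → U τ ≡ true) (trans (ins-comm x₀ y ρ) (cong (ins y) σ≡)) (toggle-ins (ins y ρ) u (A-up (ins-⊒ y ρ) Aρ))) q)))))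
    ...   | inj₁ q = begin
      BU.term (H w) σ y ⊕ s ⊗ BU.term w ρ y ≈⟨ +-cong (≈-reflexive (BU.term-in (H w) σ y y∉ (rel-in U q)))
          (*-congˡ (≈-reflexive (BU.term-in w ρ y y∉ρ (rel-in U (U-down (ins-⊑ y (λ z p → ins-⊒ y σ z (del-⊑ x₀ σ z p)) (mem-ins-same y σ)) q))))) ⟩
      sgn ω σ ⊗ H w ω ⊕ s ⊗ (b ⊗ w (ins y ρ)) ≈⟨ +-congʳ (*-congˡ (≈-reflexive (trans (H-in w ω q (A-up (ins-⊒ y σ) Aσ) (ins-⊒ y σ x₀ x∈)) (cong (λ τ → sgn ω τ ⊗ w τ) delω)))) ⟩
      sgn ω σ ⊗ (c' ⊗ w (ins y ρ)) ⊕ s ⊗ (b ⊗ w (ins y ρ)) ≈⟨ +-cong (≈-sym (⊗-assoc _ _ _)) (≈-sym (⊗-assoc _ _ _)) ⟩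
      (sgn ω σ ⊗ c') ⊗ w (ins y ρ) ⊕ (s ⊗ b) ⊗ w (ins y ρ) ≈⟨ ≈-sym (distribʳ _ _ _) ⟩
      ((sgn ω σ ⊗ c') ⊕ (s ⊗ b)) ⊗ w (ins y ρ) ≈⟨ *-congʳ signs ⟩
      0# ⊗ w (ins y ρ) ≈⟨ zeroˡ _ ⟩
      0# ∎
      where
      ω : Sub n
      ω = ins y σ
      y∉ρ : y ∉ ρ
      y∉ρ = del-∉ y x₀ σ y∉
      b c' : Carrier
      b = sgn (ins y ρ) ρ
      c' = sgn ω (ins y ρ)
      delω : del x₀ ω ≡ ins y ρ
      delω = del-ins-other x₀ y σ (λ r → ne (sym r))
      swap : c' ⊗ b ≈ - (sgn ω σ ⊗ s)
      swap = subst₂ (λ τ τ' → sgn τ (ins y ρ) ⊗ b ≈ - (sgn τ τ' ⊗ sgn τ' ρ)) (trans (ins-comm x₀ y ρ) (cong (ins y) σ≡)) σ≡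
        (sign-swap-ins ρ x₀ y (mem-del-same x₀ σ) y∉ρ (λ r → ne (sym r)))
      signs : (sgn ω σ ⊗ c') ⊕ (s ⊗ b) ≈ 0#
      signs = begin
        (sgn ω σ ⊗ c') ⊕ (s ⊗ b) ≈⟨ +-congˡ (≈-sym (≈-trans (*-congʳ (sign² (pos ω (ins y ρ)))) (⊗-identityˡ _))) ⟩
        (sgn ω σ ⊗ c') ⊕ (c' ⊗ c') ⊗ (s ⊗ b) ≈⟨ +-congˡ (≈-trans (⊗-assoc c' c' _) (*-congˡ (≈-trans (⊗-swap c' s b) (*-congˡ swap)))) ⟩
        (sgn ω σ ⊗ c') ⊕ c' ⊗ (s ⊗ - (sgn ω σ ⊗ s)) ≈⟨ +-congˡ (*-congˡ (≈-trans (≈-sym (-‿distribʳ-* s _)) (-‿cong (≈-trans (⊗-swap s _ s) (≈-trans (*-congˡ (sign² (pos σ ρ))) (⊗-identityʳ _)))))) ⟩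
        (sgn ω σ ⊗ c') ⊕ c' ⊗ - sgn ω σ ≈⟨ +-congˡ (≈-trans (≈-sym (-‿distribʳ-* c' _)) (-‿cong (⊗-comm c' _))) ⟩
        (sgn ω σ ⊗ c') ⊕ - (sgn ω σ ⊗ c') ≈⟨ -‿inverseʳ _ ⟩
        0# ∎

  -- The map 1 - ∂H. It changes a chain by a boundary and pushes the cycles of `U` into `A`.
  r : Chain n → Chain n
  r w σ = w σ ⊕ (- 1#) ⊗ bdU (H w) σ

  neg-1 : ∀ x → x ⊕ (- 1#) ⊗ x ≈ 0#
  neg-1 x = ≈-trans (+-congˡ (≈-trans (≈-sym (-‿distribˡ-* 1# x)) (-‿cong (⊗-identityˡ x)))) (-‿inverseʳ x)

  r-vanishes : ∀ w k → (∀ σ → U σ ≡ true → A σ ≡ false → suc (card σ) ≡ k → bdU w σ ≈ 0#)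
    → ∀ σ → U σ ≡ true → A σ ≡ false → card σ ≡ k → r w σ ≈ 0#
  r-vanishes w k h σ p q e = ≈-trans (+-congʳ (≈-sym (cone w k h σ p q e))) (neg-1 _)

  r-bd : ∀ w τ → U τ ≡ true → bdU (r w) τ ≈ bdU w τ
  r-bd w τ p = ≈-trans (BU.bd-⊕ w (λ σ → (- 1#) ⊗ bdU (H w) σ) τ) (≈-trans (+-congˡ (≈-trans (BU.bd-⊗ (- 1#) (bdU (H w)) τ)
    (⊗0 _ (BU.bd-bd U-down (λ _ ()) (H w) τ (rel-in U p))))) (⊕-identityʳ _))

  r-split : ∀ w σ → w σ ≈ r w σ ⊕ bdU (H w) σ
  r-split w σ = ≈-sym (≈-trans (⊕-assoc _ _ _) (≈-trans (+-congˡ (≈-trans (⊕-comm _ _) (neg-1 _))) (⊕-identityʳ _)))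

  -- Extension by 0, the chain map of the inclusion of `A` in `U`; on homology it is inverse to `r`.
  ext₀ : Chain n → Chain n
  ext₀ z σ = if A σ then z σ else 0#

  ext₀-in : ∀ z σ → A σ ≡ true → ext₀ z σ ≡ z σ
  ext₀-in z σ p rewrite p = refl

  ext₀-out : ∀ z σ → A σ ≡ false → ext₀ z σ ≡ 0#
  ext₀-out z σ p rewrite p = refl

  bd-restrict : ∀ w τ → (∀ σ → U σ ≡ true → A σ ≡ false → card σ ≡ suc (card τ) → w σ ≈ 0#) → bdU w τ ≈ bdA w τ
  bd-restrict w τ h = ≈-trans (BU.bd-term w τ) (≈-trans (sum-cong n same) (≈-sym (BA.bd-term w τ)))
    where
    same : ∀ x → BU.term w τ x ≈ BA.term w τ x
    same x with decB (mem x τ)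
    ... | inj₁ p = ≈-reflexive (trans (BU.term-∈ w τ x p) (sym (BA.term-∈ w τ x p)))
    ... | inj₂ p with decB (U (ins x τ)) | decB (A (ins x τ))
    ...   | inj₁ q | inj₁ s = ≈-reflexive (trans (BU.term-in w τ x p (rel-in U q)) (sym (BA.term-in w τ x p (rel-in A s))))
    ...   | inj₁ q | inj₂ s = ≈-trans (≈-reflexive (BU.term-in w τ x p (rel-in U q))) (≈-trans (⊗0 _ (h (ins x τ) q s (card-ins x τ p)))
              (≈-reflexive (sym (BA.term-out w τ x p (∧-falseˡ true s)))))
    ...   | inj₂ q | inj₁ s = ⊥-elim (t≢f (A⊆U _ s) q)
    ...   | inj₂ q | inj₂ s = ≈-reflexive (trans (not-term w τ x p q) (sym (BA.term-out w τ x p (∧-falseˡ true s))))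

  bd-ext₀ : ∀ z τ → bdU (ext₀ z) τ ≈ bdA z τ
  bd-ext₀ z τ = ≈-trans (bd-restrict (ext₀ z) τ (λ σ _ q _ → ≈-reflexive (ext₀-out z σ q)))
    (BA.bd-cong (ext₀ z) z τ (λ σ q _ → ≈-reflexive (ext₀-in z σ (rel-out A q))))

  bdA-out : ∀ z τ → A τ ≡ false → bdA z τ ≈ 0#
  bdA-out z τ p = ≈-trans (BA.bd-term z τ) (sum-0 n none)
    where
    none : ∀ x → BA.term z τ x ≈ 0#
    none x with BA.place z τ x
    ... | BA.vanishes q _ = ≈-reflexive q
    ... | BA.counts _ q _ = ⊥-elim (t≢f (A-down (ins-⊒ x τ) (rel-out A q)) p)

  data Side (σ : Sub n) : Set where
    inside : A σ ≡ true → Side σ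
    outside : A σ ≡ false → Side σ

  side : ∀ σ → Side σ
  side σ = [ inside , outside ]′ (decB (A σ))

  r-cycle : ∀ k z → Cycle U emptyCx k z → Cycle A emptyCx k (r z)
  r-cycle k z cyc τ p e = ≈-trans (≈-sym (bd-restrict (r z) τ (λ σ u q e' → r-vanishes z k (λ ρ u' _ e'' → cyc ρ (rel-in U u') e'') σ u q (trans e' e))))
    (≈-trans (r-bd z τ (A⊆U τ (rel-out A p))) (cyc τ (rel-in U (A⊆U τ (rel-out A p))) e))

  r-vanishes-cycle : ∀ k z → Cycle U emptyCx k z → ∀ σ → U σ ≡ true → A σ ≡ false → card σ ≡ k → r z σ ≈ 0#
  r-vanishes-cycle k z cyc = r-vanishes z k (λ ρ u _ e → cyc ρ (rel-in U u) e)

  ext₀-cycle : ∀ k z → Cycle A emptyCx k z → Cycle U emptyCx k (ext₀ z)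
  ext₀-cycle k z cyc τ p e with side τ
  ... | inside q = ≈-trans (bd-ext₀ z τ) (cyc τ (rel-in A q) e)
  ... | outside q = ≈-trans (bd-ext₀ z τ) (bdA-out z τ q)

  lin-ext₀ : ∀ b x (z : Fin b → Chain n) σ → A σ ≡ true → lin b x (λ j → ext₀ (z j)) σ ≈ lin b x z σ
  lin-ext₀ b x z σ p = sum-cong b (λ j → *-congˡ (≈-reflexive (ext₀-in (z j) σ p)))

  lin-0 : ∀ b x (z : Fin b → Chain n) σ → (∀ j → z j σ ≈ 0#) → lin b x z σ ≈ 0#
  lin-0 b x z σ h = sum-0 b (λ j → ⊗0 _ (h j))

  betti-up : ∀ k b → IsBetti A emptyCx k b → IsBetti U emptyCx k b
  betti-up k b (z , cyc , ind , spans) = (λ j → ext₀ (z j)) , (λ j → ext₀-cycle k (z j) (cyc j)) , ind' , spans'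
    where
    ind' : ∀ x w → EqIn U emptyCx k (lin b x (λ j → ext₀ (z j))) (bdU w) → ∀ j → x j ≈ 0#
    ind' x w eq = ind x (r w) (λ σ p e → begin
      lin b x z σ ≈⟨ ≈-sym (lin-ext₀ b x z σ (rel-out A p)) ⟩
      lin b x (λ j → ext₀ (z j)) σ ≈⟨ eq σ (rel-in U (A⊆U σ (rel-out A p))) e ⟩
      bdU w σ ≈⟨ ≈-sym (r-bd w σ (A⊆U σ (rel-out A p))) ⟩
      bdU (r w) σ ≈⟨ bd-restrict (r w) σ (λ τ u q e' → r-vanishes w (suc k) flat₀ τ u q (trans e' (cong suc e))) ⟩
      bdA (r w) σ ∎)
      where
      flat₀ : ∀ σ → U σ ≡ true → A σ ≡ false → suc (card σ) ≡ suc k → bdU w σ ≈ 0#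
      flat₀ σ u q e = ≈-trans (≈-sym (eq σ (rel-in U u) (suc-injective e))) (lin-0 b x (λ j → ext₀ (z j)) σ (λ j → ≈-reflexive (ext₀-out (z j) σ q)))
    spans' : ∀ z' → Cycle U emptyCx k z' → Σ (Fin b → Carrier) λ x → Σ (Chain n) λ w → EqIn U emptyCx k z' (λ σ → lin b x (λ j → ext₀ (z j)) σ ⊕ bdU w σ)
    spans' z' cyc' with spans (r z') (r-cycle k z' cyc')
    ... | x , w , eq = x , (λ σ → ext₀ w σ ⊕ H z' σ) , eq'
      where
      eq' : EqIn U emptyCx k z' (λ σ → lin b x (λ j → ext₀ (z j)) σ ⊕ bdU (λ σ → ext₀ w σ ⊕ H z' σ) σ)
      eq' σ p e = ≈-trans (r-split z' σ) (≈-trans (+-congʳ main) (≈-trans (⊕-assoc _ _ _) (+-congˡ (≈-sym (BU.bd-⊕ (ext₀ w) (H z') σ)))))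
        where
        main : r z' σ ≈ lin b x (λ j → ext₀ (z j)) σ ⊕ bdU (ext₀ w) σ
        main with side σ
        ... | inside q = ≈-trans (eq σ (rel-in A q) e) (+-cong (≈-sym (lin-ext₀ b x z σ q)) (≈-sym (bd-ext₀ w σ)))
        ... | outside q = ≈-trans (r-vanishes-cycle k z' cyc' σ (rel-out U p) q e)
          (≈-sym (0⊕0 (lin-0 b x (λ j → ext₀ (z j)) σ (λ j → ≈-reflexive (ext₀-out (z j) σ q))) (≈-trans (bd-ext₀ w σ) (bdA-out w σ q))))

  lin-split : ∀ b x (z : Fin b → Chain n) σ → lin b x z σ ≈ lin b x (λ j → r (z j)) σ ⊕ bdU (lin b x (λ j → H (z j))) σ
  lin-split b x z σ = ≈-trans (sum-cong b (λ j → ≈-trans (*-congˡ (r-split (z j) σ)) (distribˡ _ _ _)))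
    (≈-trans (sum-⊕ b (λ j → x j ⊗ r (z j) σ) (λ j → x j ⊗ bdU (H (z j)) σ)) (+-congˡ (≈-sym (BU.bd-lin b x (λ j → H (z j)) σ))))

  betti-down : ∀ k b → IsBetti U emptyCx k b → IsBetti A emptyCx k b
  betti-down k b (z , cyc , ind , spans) = (λ j → r (z j)) , (λ j → r-cycle k (z j) (cyc j)) , ind' , spans'
    where
    vanish : ∀ x σ → U σ ≡ true → A σ ≡ false → card σ ≡ k → lin b x (λ j → r (z j)) σ ≈ 0#
    vanish x σ u q e = lin-0 b x (λ j → r (z j)) σ (λ j → r-vanishes-cycle k (z j) (cyc j) σ u q e)
    ind' : ∀ x w → EqIn A emptyCx k (lin b x (λ j → r (z j))) (bdA w) → ∀ j → x j ≈ 0#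
    ind' x w eq = ind x (λ σ → ext₀ w σ ⊕ lin b x (λ j → H (z j)) σ) (λ σ p e → ≈-trans (lin-split b x z σ)
        (≈-trans (+-congʳ (main σ (rel-out U p) e)) (≈-sym (BU.bd-⊕ (ext₀ w) (lin b x (λ j → H (z j))) σ))))
      where
      main : ∀ σ → U σ ≡ true → card σ ≡ k → lin b x (λ j → r (z j)) σ ≈ bdU (ext₀ w) σ
      main σ u e with side σ
      ... | inside q = ≈-trans (eq σ (rel-in A q) e) (≈-sym (bd-ext₀ w σ))
      ... | outside q = ≈-trans (vanish x σ u q e) (≈-sym (≈-trans (bd-ext₀ w σ) (bdA-out w σ q)))
    spans' : ∀ z' → Cycle A emptyCx k z' → Σ (Fin b → Carrier) λ x → Σ (Chain n) λ w → EqIn A emptyCx k z' (λ σ → lin b x (λ j → r (z j)) σ ⊕ bdA w σ)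
    spans' z' cyc' with spans (ext₀ z') (ext₀-cycle k z' cyc')
    ... | x , w , eq = x , r w₂ , λ σ p e → begin
      z' σ ≈⟨ ≈-reflexive (sym (ext₀-in z' σ (rel-out A p))) ⟩
      ext₀ z' σ ≈⟨ eq₂ σ (A⊆U σ (rel-out A p)) e ⟩
      lin b x (λ j → r (z j)) σ ⊕ bdU w₂ σ ≈⟨ +-congˡ (≈-sym (r-bd w₂ σ (A⊆U σ (rel-out A p)))) ⟩
      lin b x (λ j → r (z j)) σ ⊕ bdU (r w₂) σ ≈⟨ +-congˡ (bd-restrict (r w₂) σ (λ τ u q e' → r-vanishes w₂ (suc k) flat₀ τ u q (trans e' (cong suc e)))) ⟩
      lin b x (λ j → r (z j)) σ ⊕ bdA (r w₂) σ ∎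
      where
      w₂ : Chain n
      w₂ σ = lin b x (λ j → H (z j)) σ ⊕ w σ
      eq₂ : ∀ σ → U σ ≡ true → card σ ≡ k → ext₀ z' σ ≈ lin b x (λ j → r (z j)) σ ⊕ bdU w₂ σ
      eq₂ σ u e = ≈-trans (eq σ (rel-in U u) e) (≈-trans (+-congʳ (lin-split b x z σ)) (≈-trans (⊕-assoc _ _ _) (+-congˡ (≈-sym (BU.bd-⊕ (lin b x (λ j → H (z j))) w σ)))))
      flat₀ : ∀ σ → U σ ≡ true → A σ ≡ false → suc (card σ) ≡ suc k → bdU w₂ σ ≈ 0#
      flat₀ σ u q e = ≈-trans (≈-sym (≈-trans (eq₂ σ u (suc-injective e)) (≈-trans (+-congʳ (vanish x σ u q (suc-injective e))) (⊕-identityˡ _)))) (≈-reflexive (ext₀-out z' σ q))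

module _ {a ℓ} (𝔽 : Field a ℓ) {n : ℕ} where
  open Homology 𝔽

  -- Complexes are functions and may agree only pointwise. The transfer of Betti numbers is the case
  -- of `Toggle` in which no face lies outside `A`.
  betti-ext : Fin n → (K K' : Cx n) → (∀ {σ τ} → τ ⊑ σ → K σ ≡ true → K τ ≡ true) → (∀ σ → K σ ≡ K' σ) → ∀ k b → IsBetti K emptyCx k b → IsBetti K' emptyCx k b
  betti-ext x₀ K K' K-down e = Toggle.betti-up 𝔽 K K' K-down (λ {σ} {τ} h p → trans (sym (e τ)) (K-down h (trans (e σ) p))) (λ σ p → trans (sym (e σ)) p) x₀
    (λ σ u q → ⊥-elim (t≢f (trans (e σ) u) q)) (λ σ u q → ⊥-elim (t≢f (trans (e σ) u) q))

-- Both complexes are compared with `U`, the union of `K` and the full simplex `S`. From `U`, the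
-- complex `K'` lacks just `F` and `S`, which differ by `w`; the complex `K` lacks the faces of `S`
-- containing `w`, which are paired off by a vertex of `F`.
module ConnectedSum {a ℓ} (𝔽 : Field a ℓ) {n} (K K' : Cx n) (K-down : ∀ {σ τ} → τ ⊑ σ → K σ ≡ true → K τ ≡ true) (F : Sub n) (w : Fin n)
  (KF : K F ≡ true) (max : ∀ σ → K σ ≡ true → F ⊑ σ → σ ≡ F) (1≤F : 1 ≤ card F) (new : ∀ σ → K σ ≡ true → w ∉ σ)
  (sum : ∀ σ → K' σ ≡ connSumSimplex K F w σ) where

  open Homology 𝔽

  S : Sub n
  S = ins w F

  K'-el : ∀ σ → K' σ ≡ true → (K σ ≡ true × σ ≢ F) ⊎ (σ ⊑ S × σ ≢ S × σ ≢ F)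
  K'-el σ p with ∨-el {K σ ∧ not (σ ==ᵇ F)} (trans (sym (sum σ)) p)
  ... | inj₁ q = let a , b = ∧-el q in inj₁ (a , λ { refl → t≢f (==ᵇ-refl F) (not-el b) })
  ... | inj₂ q with ∧-el {σ ⊆ᵇ S} q
  ...   | q₁ , q₂ with ∧-el {not (σ ==ᵇ S)} q₂
  ...     | q₃ , q₄ = inj₂ (⊆ᵇ⇒ q₁ , (λ { refl → t≢f (==ᵇ-refl S) (not-el q₃) }) , (λ { refl → t≢f (==ᵇ-refl F) (not-el q₄) }))

  K'-old : ∀ σ → K σ ≡ true → σ ≢ F → K' σ ≡ true
  K'-old σ k h = trans (sum σ) (∨-inˡ _ (∧-in k (not-in (==ᵇ-≢ h))))

  K'-new : ∀ σ → σ ⊑ S → σ ≢ S → σ ≢ F → K' σ ≡ true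
  K'-new σ h k l = trans (sum σ) (∨-inʳ (K σ ∧ not (σ ==ᵇ F)) (∧-in (⇒⊆ᵇ h) (∧-in (not-in (==ᵇ-≢ k)) (not-in (==ᵇ-≢ l)))))

  w∉F : w ∉ F
  w∉F = new F KF

  K'F : K' F ≡ false
  K'F = falseI (λ p → [ (λ q → proj₂ q refl) , (λ q → proj₂ (proj₂ q) refl) ]′ (K'-el F p))

  between : ∀ σ → F ⊑ σ → σ ⊑ S → σ ≡ F ⊎ σ ≡ S
  between σ h k with decB (mem w σ)
  ... | inj₁ p = inj₂ (⊑-antisym k (ins-⊑ w h p))
  ... | inj₂ p = inj₁ (⊑-antisym (λ z z∈ → [ (λ { refl → ⊥-elim (t≢f z∈ p) }) , id ]′ (ins-el z w F (k z z∈))) h)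

  K'-down : ∀ {σ τ} → τ ⊑ σ → K' σ ≡ true → K' τ ≡ true
  K'-down {σ} {τ} h p with K'-el σ p
  ... | inj₁ (k , ne) = K'-old τ (K-down h k) (λ { refl → ne (max σ k h) })
  ... | inj₂ (s , ne , ne') = K'-new τ (λ z z∈ → s z (h z z∈)) (λ { refl → ne (⊑-antisym s h) }) (λ { refl → [ ne' , ne ]′ (between σ h s) })

  U : Cx n
  U σ = K σ ∨ (σ ⊆ᵇ S)

  U-down : ∀ {σ τ} → τ ⊑ σ → U σ ≡ true → U τ ≡ true
  U-down {σ} {τ} h p with ∨-el {K σ} p
  ... | inj₁ k = ∨-inˡ _ (K-down h k)
  ... | inj₂ s = ∨-inʳ (K τ) (⇒⊆ᵇ (λ z z∈ → ⊆ᵇ⇒ s z (h z z∈)))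

  U-S : ∀ σ → σ ⊑ S → U σ ≡ true
  U-S σ h = ∨-inʳ (K σ) (⇒⊆ᵇ h)

  removed : ∀ σ → U σ ≡ true → K' σ ≡ false → σ ≡ F ⊎ σ ≡ S
  removed σ u p with decB (σ ==ᵇ F) | decB (σ ==ᵇ S)
  ... | inj₁ q | _ = inj₁ (==ᵇ⇒ q)
  ... | inj₂ _ | inj₁ q = inj₂ (==ᵇ⇒ q)
  ... | inj₂ q | inj₂ s with ∨-el {K σ} u
  ...   | inj₁ k = ⊥-elim (t≢f (K'-old σ k (λ { refl → t≢f (==ᵇ-refl F) q })) p)
  ...   | inj₂ h = ⊥-elim (t≢f (K'-new σ (⊆ᵇ⇒ h) (λ { refl → t≢f (==ᵇ-refl S) s }) (λ { refl → t≢f (==ᵇ-refl F) q })) p)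

  cone-w : ∀ σ → U σ ≡ true → K' σ ≡ false → U (ins w σ) ≡ true
  cone-w σ u p with removed σ u p
  ... | inj₁ refl = U-S S (λ _ q → q)
  ... | inj₂ refl = U-S (ins w S) (ins-⊑ w (λ _ q → q) (mem-ins-same w F))

  uncone-w : ∀ σ → U σ ≡ true → K' σ ≡ false → K' (del w σ) ≡ false
  uncone-w σ u p with removed σ u p
  ... | inj₁ refl = trans (cong K' (⊑-antisym (del-⊑ w F) (λ z q → del-in z w F (∉⇒≢ F z w q w∉F) q))) K'F
  ... | inj₂ refl = trans (cong K' (del-ins w F w∉F)) K'F

  module T' = Toggle 𝔽 K' U K'-down U-down (λ σ p → [ (λ q → ∨-inˡ _ (proj₁ q)) , (λ q → U-S σ (proj₁ q)) ]′ (K'-el σ p)) w cone-w uncone-w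

  x₀ : Fin n
  x₀ = proj₁ (inhabited F 1≤F)

  x₀∈F : x₀ ∈ F
  x₀∈F = proj₂ (inhabited F 1≤F)

  added : ∀ σ → U σ ≡ true → K σ ≡ false → σ ⊑ S × w ∈ σ
  added σ u p with ∨-el {K σ} u
  ... | inj₁ k = ⊥-elim (t≢f k p)
  ... | inj₂ h with decB (mem w σ)
  ...   | inj₁ q = ⊆ᵇ⇒ h , q
  ...   | inj₂ q = ⊥-elim (t≢f (K-down (λ z z∈ → [ (λ { refl → ⊥-elim (t≢f z∈ q) }) , id ]′ (ins-el z w F (⊆ᵇ⇒ h z z∈))) KF) p)

  module T = Toggle 𝔽 K U K-down U-down (λ σ p → ∨-inˡ _ p) x₀
    (λ σ u p → U-S (ins x₀ σ) (ins-⊑ x₀ (proj₁ (added σ u p)) (ins-⊒ w F x₀ x₀∈F)))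
    (λ σ u p → falseI (λ k → t≢f (del-in w x₀ σ (λ e → t≢f (subst (_∈ F) (sym e) x₀∈F) w∉F) (proj₂ (added σ u p))) (new (del x₀ σ) k)))

  betti-summand : ∀ k b → IsBetti K' emptyCx k b → IsBetti K emptyCx k b
  betti-summand k b β = T.betti-down k b (T'.betti-up k b β)

  betti-sum : ∀ k b → IsBetti K emptyCx k b → IsBetti K' emptyCx k b
  betti-sum k b β = T'.betti-down k b (T.betti-up k b β)

open import Data.Unit using (⊤)

-- Building the links

-- `Reach` read from its end, because the vertex added last is the first one to be removed.
data Built {n} (d : ℕ) (G : Graph (suc n)) (I : Sub (suc n)) : Sub (suc n) → Set where
  initial : Built d G I I
  more : ∀ {J} → Built d G I J → ∀ v → v ∉ J → card (nbr G J v) ≡ d → Built d G I (ins v J)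

reach-built : ∀ {n d} {G : Graph (suc n)} {I J L} → Built d G I J → Reach d G J L → Built d G I L
reach-built b stop = b
reach-built b (grow v v∉ (deg , _) r) = reach-built (more b v v∉ deg) r

built-⊑ : ∀ {n d} {G : Graph (suc n)} {I J} → Built d G I J → I ⊑ J
built-⊑ initial x p = p
built-⊑ (more {J} b v _ _) x p = ins-⊒ v J x (built-⊑ b x p)

module Unroll {n} (d : ℕ) (3≤d : 3 ≤ d) (G : Graph (suc n)) (I₀ : Sub n) (far : ∀ w → w ∉ I₀ → adj G (fsuc w) fzero ≡ false)
  (R : Sub n → Set) (R-new : ∀ ρ w → w ∈ ρ → w ∉ I₀ → R ρ) where

  I : Sub (suc n)
  I = true ∷ I₀

  record Shape (K : Cx n) (J : Sub (suc n)) : Set where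
    field
      verts : ∀ x → K (single x) ≡ true → fsuc x ∈ J
      verts' : ∀ x → fsuc x ∈ J → K (single x) ≡ true
      edges : ∀ x y → x ≢ y → K (pair x y) ≡ true → adj G (fsuc x) (fsuc y) ≡ true

  -- When nothing has been added after `w`, its neighbours are just the `d` vertices it was attached
  -- to, so it can be peeled off.
  module Last {J} (b : Built d G I J) (w : Fin n) (w∉ : fsuc w ∉ J) (deg : card (nbr G J (fsuc w)) ≡ d)
    (K : Cx n) (P : Pseudo d R K) (shape : Shape K (ins (fsuc w) J)) where

    open Shape shape

    w∉I : w ∉ I₀
    w∉I = ⊑-∉ (fsuc w) (built-⊑ b) w∉

    D : Sub n
    D = tail (nbr G J (fsuc w))

    D-in : ∀ x → fsuc x ∈ J → adj G (fsuc w) (fsuc x) ≡ true → x ∈ D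
    D-in x p e = filt-in (fsuc x) J (adj G (fsuc w)) p e

    D-J : ∀ x → x ∈ D → fsuc x ∈ J
    D-J x p = proj₁ (filt-el (fsuc x) J (adj G (fsuc w)) p)

    cD : card D ≡ d
    cD = trans (no-head (nbr G J (fsuc w)) (falseI (λ p → t≢f (proj₂ (filt-el fzero J (adj G (fsuc w)) p)) (far w w∉I)))) deg
      where
      no-head : ∀ (s : Sub (suc n)) → fzero ∉ s → card (tail s) ≡ card s
      no-head (false ∷ s) _ = refl

    w∉D : w ∉ D
    w∉D = falseI (λ p → t≢f (D-J w p) w∉)

    open Peel d (≤-trans (s≤s (s≤s z≤n)) 3≤d) R K P w (verts' w (mem-ins-same (fsuc w) J)) D cD w∉D
      (λ x x≢w k → D-in x ([ (λ e → ⊥-elim (x≢w (fsuc-injective e))) , id ]′ (ins-el (fsuc x) (fsuc w) J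
          (verts x (Pseudo.down P (single-⊑ x (∪-inˡ x (single x) (single w) (mem-single-same x))) k))))
        (adj-sym G (fsuc x) (fsuc w) (edges x w x≢w k)))
      (λ ρ p → R-new ρ w p w∉I) public

    module Rest (D∉ : K D ≡ false) where
      open Remove D∉ public

      shape₀ : Shape K₀ J
      shape₀ = record
        { verts = λ x p → [ (λ { refl → ⊥-elim (t≢f (mem-single-same x) (K₀-w (single x) p)) }) , id ]′ (ins-el (fsuc x) (fsuc w) J (verts x (vertices₀ x p)))
        ; verts' = λ x p → K₀-old (single x) (verts' x (ins-⊒ (fsuc w) J (fsuc x) p)) (mem-single-other w x (λ { refl → t≢f p w∉ }))
        ; edges = λ x y x≢y p → edges x y x≢y (edges₀ x y x≢y p 3≤d) }

  head∈ : ∀ {J} → Built d G I J → fzero ∈ J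
  head∈ b = built-⊑ b fzero refl

  no-0 : ∀ {J a} {A : Set a} → Built d G I J → fzero ∉ J → A
  no-0 b p = ⊥-elim (t≢f (head∈ b) p)

  card-built : ∀ {J} → Built d G I J → card I ≤ card J
  card-built b = card-mono (built-⊑ b)

module Stacked {n} (d : ℕ) (3≤d : 3 ≤ d) (G : Graph (suc n)) (Q : Sub n) (cQ : card Q ≡ d) (far : ∀ w → w ∉ Q → adj G (fsuc w) fzero ≡ false) where
  open Unroll d 3≤d G Q far (λ _ → ⊤) (λ _ _ _ _ → _)

  stacked : ∀ {J} → Built d G I J → ∀ K → Pseudo d (λ _ → ⊤) K → Shape K J → K Q ≡ true → IsStackedSphere d K
  -- This case is void: a ridge of `Q` has a second facet, which needs a vertex outside `Q`.
  stacked initial K P shape KQ with inhabited Q (≤-trans (≤-trans (s≤s z≤n) 3≤d) (≤-reflexive (sym cQ)))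
  ... | x , x∈ with Pseudo.other P Q x KQ cQ x∈ _
  ...   | y , y∉ , Ky = ⊥-elim (t≢f (Shape.verts shape y (Pseudo.down P (single-⊑ y (mem-ins-same y (del x Q))) Ky)) y∉)
  stacked (more b fzero v∉ _) = no-0 b v∉
  -- A single vertex attached to `d` vertices is attached to all of `Q`, and as `Q` is a face, the
  -- complex is the boundary of a simplex.
  stacked (more initial (fsuc w) w∉ deg) K P shape KQ = base K K (L.S , L.cS , L.Full.is-boundary KD) (λ _ → refl)
    where
    module L = Last initial w w∉ deg K P shape
    KD : K L.D ≡ true
    KD = trans (cong K (card-eq (λ x p → L.D-J x p) (≤-reflexive (trans cQ (sym L.cD))))) KQ
  stacked (more (more b' fzero v∉ _) _ _ _) = no-0 b' v∉
  stacked (more {J} b@(more {J'} b' (fsuc w') w'∉ deg') (fsuc w) w∉ deg) K P shape KQ =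
    sumStep Re.K₀ K L.D w (stacked b Re.K₀ Re.P₀ Re.shape₀ (Re.K₀-old Q KQ L.w∉I)) Re.K₀-D L.cD Re.K₀-w Re.as-sum
    where
    module L = Last b w w∉ deg K P shape
    -- If `D` were a face, all vertices would be among the d + 1 elements of `S`; but `Q` and the
    -- last two additions make at least d + 2.
    D∉ : K L.D ≡ false
    D∉ = falseI (λ KD → <-irrefl refl (≤-trans (≤-trans (many (ins (fsuc w) J) (head∈ (more b (fsuc w) w∉ deg)) big) (card-mono (sub KD))) (≤-reflexive L.cS)))
      where
      many : ∀ (s : Sub (suc n)) → fzero ∈ s → suc (suc (suc d)) ≤ card s → suc (suc d) ≤ card (tail s)
      many (true ∷ s) _ (s≤s h) = h
      big : suc (suc (suc d)) ≤ card (ins (fsuc w) J)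
      big = subst (suc (suc (suc d)) ≤_) (sym (trans (card-ins (fsuc w) J w∉) (cong suc (card-ins (fsuc w') J' w'∉))))
        (s≤s (s≤s (≤-trans (≤-reflexive (cong suc (sym cQ))) (card-built b'))))
      sub : (KD : K L.D ≡ true) → tail (ins (fsuc w) J) ⊑ L.S
      sub KD x p = L.Full.all-⊑ KD (single x) (Shape.verts' shape x (in-tail (ins (fsuc w) J) p)) x (mem-single-same x)
        where
        in-tail : ∀ (s : Sub (suc n)) → x ∈ tail s → fsuc x ∈ s
        in-tail (_ ∷ s) q = q
    module Re = L.Rest D∉

module BallBuilt {n p b} (d : ℕ) (3≤d : 3 ≤ d) (G : Graph (suc n)) (I₀ : Sub n) (far : ∀ w → w ∉ I₀ → adj G (fsuc w) fzero ≡ false)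
  (Ball : Cx n → Set p) (Base : Cx n → Set b)
  (finish : ∀ K → (∀ x → K (single x) ≡ true → x ∈ I₀) → Ball K → Base K) where

  R : Sub n → Set
  R ρ = ∃ λ w → w ∈ ρ × w ∉ I₀

  open Unroll d 3≤d G I₀ far R (λ ρ w p q → w , p , q)

  module _ (remove : ∀ K K₀ D w → Pseudo d R K₀ → K₀ D ≡ true → card D ≡ d → (∀ σ → K₀ σ ≡ true → w ∉ σ) → (∀ σ → K σ ≡ connSumSimplex K₀ D w σ) → w ∉ I₀ → Ball K → Ball K₀)
    where

    -- A ridge with only one facet. It keeps the complex from being the boundary of a simplex, where
    -- each ridge has two, so every added vertex is removed as a proper summand.
    record Ridge (K : Cx n) : Set where
      field
        ρ : Sub n
        cρ : suc (card ρ) ≡ d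
        ρ⊑ : ρ ⊑ I₀
        x : Fin n
        x∉ : x ∉ ρ
        Kx : K (ins x ρ) ≡ true
        only : ∀ y → y ∉ ρ → K (ins y ρ) ≡ true → y ≡ x

    ball-built : ∀ {J} → Built d G I J → ∀ K → Pseudo d R K → Shape K J → Ridge K → Ball K → BuiltBySums Base d K
    ball-built initial K P shape ridge ball = base K K (finish K (Shape.verts shape) ball) (λ _ → refl)
    ball-built (more b fzero v∉ _) = no-0 b v∉
    ball-built (more b (fsuc w) w∉ deg) K P shape ridge ball =
      sumStep Re.K₀ K L.D w (ball-built b Re.K₀ Re.P₀ Re.shape₀ ridge₀ (remove K Re.K₀ L.D w Re.P₀ Re.K₀-D L.cD Re.K₀-w Re.as-sum L.w∉I ball))
        Re.K₀-D L.cD Re.K₀-w Re.as-sum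
      where
      module L = Last b w w∉ deg K P shape
      open Ridge ridge
      w∉ρ : w ∉ ρ
      w∉ρ = ⊑-∉ w ρ⊑ L.w∉I
      D∉ : K L.D ≡ false
      D∉ = falseI absurd
        where
        absurd : K L.D ≡ true → ⊥
        absurd KD with extra (ins x ρ) L.S (subst₂ _<_ (sym (trans (card-ins x ρ x∉) cρ)) (sym L.cS) ≤-refl)
        ... | x' , x'∈ , x'∉ = t≢f (subst (_∈ ins x ρ) (sym (only x' x'∉ρ (L.Full.sub-facet KD (ins x' ρ)
              (ins-⊑ x' (λ z z∈ → L.Full.all-⊑ KD (ins x ρ) Kx z (ins-⊒ x ρ z z∈)) x'∈) (trans (card-ins x' ρ x'∉ρ) cρ)))) (mem-ins-same x ρ)) x'∉
          where
          x'∉ρ : x' ∉ ρ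
          x'∉ρ = ⊑-∉ x' (ins-⊒ x ρ) x'∉
      module Re = L.Rest D∉
      -- If the only facet at the ridge is the one at `w`, the removal puts `D` in its place.
      ridge₀ : Ridge Re.K₀
      ridge₀ with x ≟ w
      ... | no x≢w = record { ρ = ρ ; cρ = cρ ; ρ⊑ = ρ⊑ ; x = x ; x∉ = x∉ ; Kx = Re.K₀-old (ins x ρ) Kx (ins-∉ w x ρ (λ e → x≢w (sym e)) w∉ρ) ; only = only₀ }
        where
        only₀ : ∀ y → y ∉ ρ → Re.K₀ (ins y ρ) ≡ true → y ≡ x
        only₀ y y∉ k with Re.K₀-el (ins y ρ) k
        ... | inj₁ (k' , _) = only y y∉ k'
        ... | inj₂ e = ⊥-elim (x≢w (sym (only w w∉ρ (Re.over-ridge ρ y y∉ e))))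
      ... | yes refl with Re.missing ρ cρ (Re.below-D ρ Kx x∉)
      ...   | a , a∉ , D≡ = record { ρ = ρ ; cρ = cρ ; ρ⊑ = ρ⊑ ; x = a ; x∉ = a∉ ; Kx = trans (cong Re.K₀ D≡) Re.K₀-D ; only = only₀ }
        where
        only₀ : ∀ y → y ∉ ρ → Re.K₀ (ins y ρ) ≡ true → y ≡ a
        only₀ y y∉ k with Re.K₀-el (ins y ρ) k
        ... | inj₁ (k' , w∉y) = ⊥-elim (t≢f (subst (_∈ ins y ρ) (only y y∉ k') (mem-ins-same y ρ)) w∉y)
        ... | inj₂ e = [ id , (λ q → ⊥-elim (t≢f q y∉)) ]′ (ins-el y a ρ (subst (y ∈_) (trans e (sym D≡)) (mem-ins-same y ρ)))

-- The link of a vertex as a pseudomanifold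

module LinkComplex {n} (d : ℕ) (3≤d : 3 ≤ d) (Δ : Cx n) (pm : IsNormalPseudomanifold Δ d) (v : Fin n) where
  open Pseudomanifold d Δ pm hiding (no-three)
  module Ps = Pseudomanifold d Δ pm
  module V = VertexLink d 3≤d Δ pm v

  L : Cx n
  L = link Δ (single v)

  L-el : ∀ σ → L σ ≡ true → Δ (ins v σ) ≡ true × v ∉ σ
  L-el σ p = let a , b = ∧-el {Δ (ins v σ)} p in a , single-disj v σ b

  L-in : ∀ σ → Δ (ins v σ) ≡ true → v ∉ σ → L σ ≡ true
  L-in σ p q = ∧-in p (disj-single v σ q)

  coface-L : ∀ ρ x → v ∉ ρ → x ∉ ρ → L (ins x ρ) ≡ true → x ∈ cofaces (ins v ρ)
  coface-L ρ x v∉ x∉ p = let a , b = L-el (ins x ρ) p in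
    cofaces-in (ins v ρ) x (ins-∉ x v ρ (λ { refl → t≢f (mem-ins-same x ρ) b }) x∉) (trans (cong Δ (ins-comm x v ρ)) a)

  -- The properties are those of `Δ` at faces containing `v`. A second facet at a ridge comes from
  -- parity, as the ridge with `v` added is not in the boundary.
  pseudo : ∀ R → (∀ ρ → R ρ → v ∉ ρ → ∂Δ (ins v ρ) ≡ false) → Pseudo d R L
  pseudo R inner = record { down = down' ; top = top' ; pure = pure' ; no-three = three ; other = other ; joined-facets = joined' }
    where
    down' : ∀ {σ τ} → τ ⊑ σ → L σ ≡ true → L τ ≡ true
    down' {σ} {τ} h p = let a , b = L-el σ p in L-in τ (down (ins-⊑ v (λ z q → ins-⊒ v σ z (h z q)) (mem-ins-same v σ)) a) (⊑-∉ v h b)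
    top' : ∀ σ → L σ ≡ true → card σ ≤ d
    top' σ p = let a , b = L-el σ p in ≤-pred (≤-trans (≤-reflexive (sym (card-ins v σ b))) (top (ins v σ) a))
    as-facet : ∀ F → Δ F ≡ true → v ∈ F → card F ≡ suc d → L (del v F) ≡ true × card (del v F) ≡ d
    as-facet F p v∈ e = L-in (del v F) (trans (cong Δ (ins-del v F v∈)) p) (mem-del-same v F) , suc-injective (trans (card-del v F v∈) e)
    pure' : ∀ σ → L σ ≡ true → Σ (Sub n) λ F → L F ≡ true × card F ≡ d × σ ⊑ F
    pure' σ p with L-el σ p
    ... | a , b with pure (ins v σ) a
    ...   | F , ΔF , cF , sub = let l , cl = as-facet F ΔF (sub v (mem-ins-same v σ)) cF in
      del v F , l , cl , λ z q → del-in z v F (∉⇒≢ σ z v q b) (sub z (ins-⊒ v σ z q))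
    v∉ρ : ∀ ρ x → L (ins x ρ) ≡ true → v ∉ ρ
    v∉ρ ρ x p = ⊑-∉ v (ins-⊒ x ρ) (proj₂ (L-el (ins x ρ) p))
    three : ∀ ρ x y z → suc (card ρ) ≡ d → x ∉ ρ → y ∉ ρ → z ∉ ρ → L (ins x ρ) ≡ true → L (ins y ρ) ≡ true → L (ins z ρ) ≡ true
      → x ≢ y → x ≢ z → y ≢ z → ⊥
    three ρ x y z e x∉ y∉ z∉ p q r = Ps.no-three (ins v ρ) (trans (card-ins v ρ v∉) e) x y z (coface-L ρ x v∉ x∉ p) (coface-L ρ y v∉ y∉ q) (coface-L ρ z v∉ z∉ r)
      where
      v∉ : v ∉ ρ
      v∉ = v∉ρ ρ x p
    other : ∀ σ x → L σ ≡ true → card σ ≡ d → x ∈ σ → R (del x σ) → ∃ λ y → y ∉ σ × L (ins y (del x σ)) ≡ true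
    other σ x p e x∈ r with xsum-other (coface (ins v ρ)) (trans (sym (bdry-ridge (ins v ρ) (trans (card-ins v ρ v∉) (trans (card-del x σ x∈) e)))) (inner ρ r v∉)) x
        (trans (sym (mem-tab (coface (ins v ρ)) x)) (coface-L ρ x v∉ (mem-del-same x σ) (trans (cong L (ins-del x σ x∈)) p)))
      where
      ρ : Sub n
      ρ = del x σ
      v∉ : v ∉ ρ
      v∉ = del-∉ v x σ (proj₂ (L-el σ p))
    ... | y , y≢x , c' with ∧-el {not (mem y (ins v (del x σ)))} c'
    ...   | y∉ , Δy with ∉-ins y v (del x σ) (not-el y∉)
    ...     | y≢v , y∉ρ = y , falseI (λ q → t≢f (del-in y x σ y≢x q) y∉ρ) ,
      L-in (ins y (del x σ)) (trans (cong Δ (ins-comm v y (del x σ))) Δy) (ins-∉ v y (del x σ) (λ e → y≢v (sym e)) (del-∉ v x σ (proj₂ (L-el σ p))))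
    joined' : ∀ (X : Sub n → Bool)
      → (∀ ρ x y → suc (card ρ) ≡ d → x ∉ ρ → y ∉ ρ → L (ins x ρ) ≡ true → L (ins y ρ) ≡ true → X (ins x ρ) ≡ true → X (ins y ρ) ≡ true)
      → ∀ F F' → L F ≡ true → L F' ≡ true → card F ≡ d → card F' ≡ d → X F ≡ true → X F' ≡ true
    joined' X cl F F' p p' e e' XF with L-el F p | L-el F' p'
    ... | ΔF , v∉F | ΔF' , v∉F' = trans (cong X (sym (del-ins v F' v∉F'))) (strongly-connected (d ∸ 1) (single v) (down (single-⊑ v (mem-ins-same v F)) ΔF)
        (≤-reflexive (sym (card-single v))) (trans (cong (d ∸ 1 +_) (card-single v)) (m∸n+n≡m (≤-trans (s≤s z≤n) 3≤d))) (λ σ → X (del v σ)) closed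
        (ins v F) (ins v F') (single-⊑ v (mem-ins-same v F)) (single-⊑ v (mem-ins-same v F')) ΔF ΔF' (trans (card-ins v F v∉F) (cong suc e)) (trans (card-ins v F' v∉F') (cong suc e'))
        (trans (cong X (del-ins v F v∉F)) XF))
      where
      closed : Closed (single v) (λ σ → X (del v σ))
      closed ρ x y h cρ x∉ y∉ Δx Δy Xx = trans (cong X (del-ins-other v y ρ (λ { refl → t≢f v∈ y∉ })))
          (cl (del v ρ) x y (trans (card-del v ρ v∈) cρ) (del-∉ x v ρ x∉) (del-∉ y v ρ y∉) (face x x∉ Δx) (face y y∉ Δy) (trans (cong X (sym (del-ins-other v x ρ (λ { refl → t≢f v∈ x∉ })))) Xx))
        where
        v∈ : v ∈ ρ
        v∈ = h v (mem-single-same v)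
        face : ∀ x → x ∉ ρ → Δ (ins x ρ) ≡ true → L (ins x (del v ρ)) ≡ true
        face x x∉ Δx = L-in (ins x (del v ρ)) (trans (cong Δ (trans (ins-comm v x (del v ρ)) (cong (ins x) (ins-del v ρ v∈)))) Δx)
          (ins-∉ v x (del v ρ) (λ { refl → t≢f v∈ x∉ }) (mem-del-same v ρ))

  L-vertex : ∀ x → L (single x) ≡ true → x ∈ V.N
  L-vertex x p = let a , b = L-el (single x) p in V.N-in x (λ { refl → t≢f (mem-single-same x) b }) a

  vertex-L : ∀ x → x ∈ V.N → L (single x) ≡ true
  vertex-L x p = let a , b = V.N-el x p in L-in (single x) b (mem-single-other v x (λ e → a (sym e)))

  L-edge : ∀ x y → x ≢ y → L (pair x y) ≡ true → adj V.graph (fsuc x) (fsuc y) ≡ true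
  L-edge x y x≢y p with L-el (pair x y) p
  ... | a , b = V.adj-in (fsuc x) (fsuc y) (false ∷ ins v (pair x y)) (λ { refl → t≢f x∈ b }) (λ { refl → t≢f y∈ b }) (λ e → x≢y (fsuc-injective e)) a
      (mem-ins-same v (pair x y)) (ins-⊒ v (pair x y) x x∈) (ins-⊒ v (pair x y) y y∈)
    where
    x∈ : x ∈ pair x y
    x∈ = ∪-inˡ x (single x) (single y) (mem-single-same x)
    y∈ : y ∈ pair x y
    y∈ = ∪-inʳ y (single x) (single y) (mem-single-same y)

  interior-stacked : ∀ F → Δ F ≡ true → v ∈ F → card F ≡ suc d → ∂Δ (single v) ≡ false → Reach d V.graph (true ∷ del v F) V.J → IsStackedSphere d L
  interior-stacked F ΔF v∈ cF inner r = stacked (reach-built initial r) L (pseudo (λ _ → ⊤) (λ ρ _ _ → falseI (λ q → t≢f (bdry-down (single-⊑ v (mem-ins-same v ρ)) q) inner)))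
      (record { verts = L-vertex ; verts' = vertex-L ; edges = L-edge })
      (L-in (del v F) (trans (cong Δ (ins-del v F v∈)) ΔF) (mem-del-same v F))
    where
    open Stacked d 3≤d V.graph (del v F) (suc-injective (trans (card-del v F v∈) cF)) (λ w _ → V.Interior.far F ΔF v∈ cF inner w)

-- Homology balls

diff : ∀ {n} → Sub n → Sub n → Sub n
diff s t = filt s (λ x → not (mem x t))

diff-in : ∀ {n} x (s t : Sub n) → x ∈ s → x ∉ t → x ∈ diff s t
diff-in x s t p q = filt-in x s (λ x → not (mem x t)) p (not-in q)

diff-el : ∀ {n} x (s t : Sub n) → x ∈ diff s t → x ∈ s × x ∉ t
diff-el x s t p = let a , b = filt-el x s (λ x → not (mem x t)) p in a , not-el b

diff-∪ : ∀ {n} (s t : Sub n) → t ⊑ s → diff s t ∪ˢ t ≡ s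
diff-∪ s t h = ⊑-antisym (∪-⊑ (diff s t) t (λ x p → proj₁ (diff-el x s t p)) h)
  (λ x p → [ (λ q → ∪-inʳ x (diff s t) t q) , (λ q → ∪-inˡ x (diff s t) t (diff-in x s t p q)) ]′ (decB (mem x t)))

∪-diff : ∀ {n} (H t s : Sub n) → (∀ x → x ∈ H → x ∉ t) → H ∪ˢ t ≡ s → H ≡ diff s t
∪-diff H t s off refl = ⊑-antisym (λ x p → diff-in x s t (∪-inˡ x H t p) (off x p))
  (λ x p → let a , b = diff-el x s t p in [ id , (λ q → ⊥-elim (t≢f q b)) ]′ (∪-el x H t a))

card-∪ : ∀ {n} (s t : Sub n) → (∀ x → x ∈ s → x ∉ t) → card (s ∪ˢ t) ≡ card s + card t
card-∪ {n} s t h = trans (sym (+-identityʳ _)) (trans (cong (card (s ∪ˢ t) +_) (sym none)) (card-∪∩ s t))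
  where
  none : card (s ∩ˢ t) ≡ 0
  none = trans (cong card (⊑-antisym {s = s ∩ˢ t} {emptyS} (λ x p → let a , b = ∩-el x s t p in ⊥-elim (t≢f b (h x a))) (λ x p → ⊥-elim (t≢f p (mem-empty x))))) (card-empty n)

link-down : ∀ {n} (K : Cx n) τ → (∀ {σ ρ} → ρ ⊑ σ → K σ ≡ true → K ρ ≡ true) → ∀ {σ ρ} → ρ ⊑ σ → link K τ σ ≡ true → link K τ ρ ≡ true
link-down K τ down {σ} {ρ} h p = let a , b = link-el K τ σ p in
  link-in K τ ρ (down (∪-⊑ ρ τ (λ x q → ∪-inˡ x σ τ (h x q)) (λ x q → ∪-inʳ x σ τ q)) a) (λ x q → b x (h x q))

link-link : ∀ {n} (K : Cx n) τ ρ → (∀ x → x ∈ ρ → x ∉ τ) → ∀ H → link (link K τ) ρ H ≡ link K (ρ ∪ˢ τ) H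
link-link K τ ρ off H = bool-iff to from
  where
  to : link (link K τ) ρ H ≡ true → link K (ρ ∪ˢ τ) H ≡ true
  to p with link-el (link K τ) ρ H p
  ... | a , b with link-el K τ (H ∪ˢ ρ) a
  ...   | c' , e = link-in K (ρ ∪ˢ τ) H (trans (cong K (sym (∪-assoc H ρ τ))) c') (λ x q → falseI (λ r → [ (λ s → t≢f s (b x q)) , (λ s → t≢f s (e x (∪-inˡ x H ρ q))) ]′ (∪-el x ρ τ r)))
  from : link K (ρ ∪ˢ τ) H ≡ true → link (link K τ) ρ H ≡ true
  from p with link-el K (ρ ∪ˢ τ) H p
  ... | a , b = link-in (link K τ) ρ H (link-in K τ (H ∪ˢ ρ) (trans (cong K (∪-assoc H ρ τ)) a)
      (λ x q → [ (λ r → ⊑-∉ x (λ z s → ∪-inʳ z ρ τ s) (b x r)) , off x ]′ (∪-el x H ρ q))) (λ x q → ⊑-∉ x (λ z s → ∪-inˡ z ρ τ s) (b x q))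

complex-down : ∀ {n} {K : Cx n} → IsComplex K → ∀ {σ τ} → τ ⊑ σ → K σ ≡ true → K τ ≡ true
complex-down cx {σ} {τ} h = cx σ τ (⇒⊆ᵇ h)

down-complex : ∀ {n} {K : Cx n} → (∀ {σ τ} → τ ⊑ σ → K σ ≡ true → K τ ≡ true) → IsComplex K
down-complex down σ τ h = down (⊆ᵇ⇒ h)

module HomologyBalls {a ℓ} (𝔽 : Field a ℓ) {n} (v₀ : Fin n) where
  open Linear 𝔽

  Betti : Cx n → ℕ → ℕ → Set (a ⊔ ℓ)
  Betti K = IsBetti K emptyCx

  ext-iso : (K K' : Cx n) → (∀ {σ τ} → τ ⊑ σ → K σ ≡ true → K τ ≡ true) → (∀ σ → K σ ≡ K' σ) → ∀ k b → Betti K k b → Betti K' k b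
  ext-iso = betti-ext 𝔽 v₀

  hom-sphere-ext : (K K' : Cx n) → (∀ σ → K σ ≡ K' σ) → ∀ k → IsHomSphere K k → IsHomSphere K' k
  hom-sphere-ext K K' e k (cx , ((σ , p , q) , top) , links) =
    (λ σ τ h p → trans (sym (e τ)) (cx σ τ h (trans (e σ) p))) , ((σ , trans (sym (e σ)) p , q) , (λ σ p → top σ (trans (e σ) p))) ,
    (λ τ p j → ext-iso (link K τ) (link K' τ) (link-down K τ (complex-down cx)) (λ H → cong (_∧ disjointᵇ H τ) (e (H ∪ˢ τ))) j _ (links τ (trans (e τ) p) j))

  module _ (K : Cx n) where
    open Boundary K emptyCx

    bd-top : ∀ w σ → (∀ x → x ∉ σ → K (ins x σ) ≡ false) → bd K emptyCx w σ ≈ 0#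
    bd-top w σ h = ≈-trans (bd-term w σ) (sum-0 n none)
      where
      none : ∀ x → term w σ x ≈ 0#
      none x with place w σ x
      ... | vanishes e _ = ≈-reflexive e
      ... | counts p q _ = ⊥-elim (t≢f (proj₁ (∧-el q)) (h x p))

    module _ (only : ∀ σ → K σ ≡ true → σ ≡ emptyS) (K∅ : K emptyS ≡ true) where

      no-vertex : ∀ x → K (ins x emptyS) ≡ false
      no-vertex x = falseI (λ p → t≢f (subst (x ∈_) (only _ p) (mem-ins-same x emptyS)) (mem-empty x))

      -- The complex with the empty face alone is the sphere of dimension -1; it occurs as the link
      -- of a facet.
      point-sphere : SphereHomology K 0
      point-sphere zero = (λ _ _ → 1#) , (λ _ τ _ ()) , independent , spans
        where
        independent : ∀ x w → EqIn K emptyCx 0 (lin 1 x (λ _ _ → 1#)) (bd K emptyCx w) → ∀ j → x j ≈ 0#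
        independent x w eq fzero = ≈-trans (≈-sym (≈-trans (⊕-identityʳ _) (⊗-identityʳ _))) (≈-trans (eq emptyS (∧-in K∅ refl) (card-empty n)) (bd-top w emptyS (λ x _ → no-vertex x)))
        spans : ∀ z' → Cycle K emptyCx 0 z' → Σ (Fin 1 → Carrier) λ x → Σ (Chain n) λ w → EqIn K emptyCx 0 z' (λ σ → lin 1 x (λ _ _ → 1#) σ ⊕ bd K emptyCx w σ)
        spans z' _ = (λ _ → z' emptyS) , (λ _ → 0#) , λ σ p _ → subst (λ τ → z' τ ≈ lin 1 (λ _ → z' emptyS) (λ _ _ → 1#) τ ⊕ bd K emptyCx (λ _ → 0#) τ) (sym (only σ (proj₁ (∧-el p))))
          (≈-sym (≈-trans (+-cong (≈-trans (⊕-identityʳ _) (⊗-identityʳ _)) (bd-0 (λ _ → 0#) emptyS (λ _ _ _ → ≈-refl))) (⊕-identityʳ _)))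
      point-sphere (suc k) = (λ ()) , (λ ()) , (λ _ _ _ ()) , λ z' _ → (λ ()) , (λ _ → 0#) , λ σ p e → ⊥-elim (absurd σ (proj₁ (∧-el p)) e)
        where
        absurd : ∀ σ → K σ ≡ true → card σ ≡ suc k → ⊥
        absurd σ p e with trans (sym (card-empty n)) (trans (cong card (sym (only σ p))) e)
        ... | ()

      point-not-zero : ¬ ZeroHomology K
      point-not-zero z with proj₂ (proj₂ (proj₂ (z 0))) (λ _ → 1#) (λ τ _ ())
      ... | _ , w , eq = 0≉1 (≈-sym (≈-trans (eq emptyS (∧-in K∅ refl) (card-empty n)) (0⊕0 ≈-refl (bd-top w emptyS (λ x _ → no-vertex x)))))

  void-betti : ∀ k → Betti (λ _ → false) k 0
  void-betti k = (λ ()) , (λ ()) , (λ _ _ _ ()) , λ z' _ → (λ ()) , (λ _ → 0#) , λ σ ()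

  -- The case of `Toggle` in which `A` has no face at all, not even the empty one.
  cone-zero : (K : Cx n) → (∀ {σ τ} → τ ⊑ σ → K σ ≡ true → K τ ≡ true) → ∀ x → (∀ σ → K σ ≡ true → K (ins x σ) ≡ true) → ZeroHomology K
  cone-zero K down x h k = Toggle.betti-up 𝔽 (λ _ → false) K (λ _ ()) down (λ _ ()) x (λ σ p _ → h σ p) (λ _ _ _ → refl) k 0 (void-betti k)

  pos-single : ∀ {m} (x : Fin m) → pos (single x) emptyS ≡ 0
  pos-single fzero = refl
  pos-single (fsuc x) = pos-single x

  -- The difference of the two points is a reduced 0-cycle that is not a boundary.
  two-points : (K : Cx n) → (∀ x y → x ≢ y → K (pair x y) ≡ false) → ∀ x y → x ≢ y → K (single x) ≡ true → K (single y) ≡ true → ¬ ZeroHomology K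
  two-points K apart x y x≢y Kx Ky acyclic with proj₂ (proj₂ (proj₂ (acyclic 1))) z cyc
    where
    open Boundary K emptyCx
    z : Chain n
    z σ = (if mem x σ then 1# else 0#) ⊕ (if mem y σ then - 1# else 0#)
    cyc : Cycle K emptyCx 1 z
    cyc τ p e = subst (λ τ → bd K emptyCx z τ ≈ 0#) (sym (card-0 τ (suc-injective e))) at-∅
      where
      single≡ : ∀ u → ins u emptyS ≡ single u
      single≡ u = trans (∪-comm emptyS (single u)) (∪-empty (single u))
      ax ay : Fin n → Carrier
      ax u = if eqF x u then 1# else 0#
      ay u = if eqF y u then - 1# else 0#
      mem-single : ∀ b u → mem b (single u) ≡ eqF b u
      mem-single b u with b ≟ u
      ... | yes refl = trans (mem-single-same b) (sym (eqF-refl b))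
      ... | no ne = trans (mem-single-other b u ne) (sym (eqF-≢ ne))
      z-single : ∀ u → z (single u) ≡ ax u ⊕ ay u
      z-single u rewrite mem-single x u | mem-single y u = refl
      ax-≢ : ∀ u → u ≢ x → ax u ≡ 0#
      ax-≢ u ne rewrite eqF-≢ {i = x} {u} (λ e → ne (sym e)) = refl
      ay-≢ : ∀ u → u ≢ y → ay u ≡ 0#
      ay-≢ u ne rewrite eqF-≢ {i = y} {u} (λ e → ne (sym e)) = refl
      at-u : ∀ u → term z emptyS u ≈ ax u ⊕ ay u
      at-u u with place z emptyS u
      ... | counts p q k = ≈-trans (≈-reflexive (k z)) (≈-trans (≈-reflexive (cong (λ σ → sgn σ emptyS ⊗ z σ) (single≡ u)))
            (≈-trans (*-congʳ (≈-reflexive (cong signF (pos-single u)))) (≈-trans (⊗-identityˡ _) (≈-reflexive (z-single u)))))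
      ... | vanishes q k with u ≟ x | u ≟ y
      ...   | no ne | no ne' = ≈-trans (≈-reflexive q) (≈-sym (0⊕0 (≈-reflexive (ax-≢ u ne)) (≈-reflexive (ay-≢ u ne'))))
      ...   | yes refl | _ = ⊥-elim (face-counts u Kx k)
        where
        face-counts : ∀ u → K (single u) ≡ true → (∀ w' → term w' emptyS u ≡ 0#) → ⊥
        face-counts u Ku k = 0≉1 (≈-sym (≈-trans (≈-sym (≈-trans (*-congʳ (≈-reflexive (cong signF (trans (cong (λ σ → pos σ emptyS) (single≡ u)) (pos-single u))))) (⊗-identityˡ 1#)))
          (≈-reflexive (trans (sym (term-in (λ _ → 1#) emptyS u (mem-empty u) (∧-in (trans (cong K (single≡ u)) Ku) refl))) (k (λ _ → 1#))))))
      ...   | no _ | yes refl = ⊥-elim (0≉1 (≈-sym (≈-trans (≈-sym (≈-trans (*-congʳ (≈-reflexive (cong signF (trans (cong (λ σ → pos σ emptyS) (single≡ u)) (pos-single u))))) (⊗-identityˡ 1#)))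
          (≈-reflexive (trans (sym (term-in (λ _ → 1#) emptyS u (mem-empty u) (∧-in (trans (cong K (single≡ u)) Ky) refl))) (k (λ _ → 1#)))))))
      at-∅ : bd K emptyCx z emptyS ≈ 0#
      at-∅ = ≈-trans (bd-term z emptyS) (≈-trans (sum-cong n at-u) (≈-trans (sum-⊕ n ax ay)
        (≈-trans (+-cong (sum-only n ax x (λ u ne → ≈-reflexive (ax-≢ u ne))) (sum-only n ay y (λ u ne → ≈-reflexive (ay-≢ u ne))))
          (≈-trans (≈-reflexive (cong₂ (λ b b' → (if b then 1# else 0#) ⊕ (if b' then - 1# else 0#)) (eqF-refl x) (eqF-refl y))) (-‿inverseʳ 1#)))))
  ... | _ , w , eq = 0≉1 (≈-sym (≈-trans (≈-sym one) (≈-trans (eq (single x) (∧-in Kx refl) (card-single x)) (0⊕0 ≈-refl (bd-top K w (single x)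
      (λ u u∉ → apart x u (λ { refl → t≢f (mem-single-same x) u∉ })))))))
    where
    one : (if mem x (single x) then 1# else 0#) ⊕ (if mem y (single x) then - 1# else 0#) ≈ 1#
    one rewrite mem-single-same x | mem-single-other y x (λ e → x≢y (sym e)) = ⊕-identityʳ 1#

  module Summand (m : ℕ) (K K₀ : Cx n) (K-down : ∀ {σ τ} → τ ⊑ σ → K σ ≡ true → K τ ≡ true) (K₀-down : ∀ {σ τ} → τ ⊑ σ → K₀ σ ≡ true → K₀ τ ≡ true)
    (K₀-top : ∀ σ → K₀ σ ≡ true → card σ ≤ m) (D : Sub n) (w : Fin n) (K₀D : K₀ D ≡ true) (cD : card D ≡ m) (1≤m : 1 ≤ m)
    (new : ∀ σ → K₀ σ ≡ true → w ∉ σ) (sum : ∀ σ → K σ ≡ connSumSimplex K₀ D w σ) where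

    top-max : ∀ σ → K₀ σ ≡ true → D ⊑ σ → σ ≡ D
    top-max σ p h = sym (card-eq h (≤-trans (K₀-top σ p) (≤-reflexive (sym cD))))

    module CS = ConnectedSum 𝔽 K₀ K K₀-down D w K₀D top-max (subst (1 ≤_) (sym cD) 1≤m) new sum

    -- The link of a proper face `G` of `D` is again a connected sum with the boundary of a simplex,
    -- along the facet of the link opposite to `G` in `D`. Homology is thus carried along link by
    -- link.
    module Near (G : Sub n) (G⊑ : G ⊑ D) (G≢ : G ≢ D) where

      F : Sub n
      F = diff D G

      1≤F : 1 ≤ card F
      1≤F = let x , p , q = proper G D G⊑ G≢ in 1≤card F x (diff-in x D G p q)

      w∉G : w ∉ G
      w∉G = ⊑-∉ w G⊑ CS.w∉F

      F-link : link K₀ G F ≡ true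
      F-link = link-in K₀ G F (trans (cong K₀ (diff-∪ D G G⊑)) K₀D) (λ x p → proj₂ (diff-el x D G p))

      max : ∀ σ → link K₀ G σ ≡ true → F ⊑ σ → σ ≡ F
      max σ p h with link-el K₀ G σ p
      ... | a' , b' = ∪-diff σ G D b' (top-max (σ ∪ˢ G) a' (λ x q → [ (λ r → ∪-inʳ x σ G r) , (λ r → ∪-inˡ x σ G (h x (diff-in x D G q r))) ]′ (decB (mem x G))))

      same : ∀ H → link K G H ≡ connSumSimplex (link K₀ G) F w H
      same H = bool-iff to from
        where
        S' : Sub n
        S' = ins w F
        S≡ : S' ∪ˢ G ≡ CS.S
        S≡ = ⊑-antisym (∪-⊑ S' G (ins-⊑ w (λ x p → ins-⊒ w D x (proj₁ (diff-el x D G p))) (mem-ins-same w D)) (λ x p → ins-⊒ w D x (G⊑ x p)))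
          (ins-⊑ w (λ x p → [ (λ q → ∪-inʳ x S' G q) , (λ q → ∪-inˡ x S' G (ins-⊒ w F x (diff-in x D G p q))) ]′ (decB (mem x G))) (∪-inˡ w S' G (mem-ins-same w F)))
        ≢F : (∀ x → x ∈ H → x ∉ G) → H ≢ F → H ∪ˢ G ≢ D
        ≢F off ne e = ne (∪-diff H G D off e)
        ≢S' : (∀ x → x ∈ H → x ∉ G) → H ≢ S' → H ∪ˢ G ≢ CS.S
        ≢S' off ne e = ne (trans (∪-diff H G CS.S off e) (sym (∪-diff S' G CS.S (λ x p → [ (λ { refl → w∉G }) , (λ q → proj₂ (diff-el x D G q)) ]′ (ins-el x w F p)) S≡)))
        to : link K G H ≡ true → connSumSimplex (link K₀ G) F w H ≡ true
        to p with link-el K G H p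
        ... | a' , off with CS.K'-el (H ∪ˢ G) a'
        ...   | inj₁ (k , ne) = ∨-inˡ _ (∧-in (link-in K₀ G H k off) (not-in (==ᵇ-≢ {s = H} {F} (λ { refl → ne (diff-∪ D G G⊑) }))))
        ...   | inj₂ (h , ne , ne') = ∨-inʳ (link K₀ G H ∧ not (H ==ᵇ F)) (∧-in (⇒⊆ᵇ sub) (∧-in (not-in (==ᵇ-≢ {s = H} {S'} (λ { refl → ne S≡ }))) (not-in (==ᵇ-≢ {s = H} {F} (λ { refl → ne' (diff-∪ D G G⊑) })))))
          where
          sub : H ⊑ S'
          sub x q with ins-el x w D (h x (∪-inˡ x H G q))
          ... | inj₁ refl = mem-ins-same x F
          ... | inj₂ r = ins-⊒ w F x (diff-in x D G r (off x q))
        from : connSumSimplex (link K₀ G) F w H ≡ true → link K G H ≡ true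
        from p with ∨-el {link K₀ G H ∧ not (H ==ᵇ F)} p
        ... | inj₁ q with ∧-el {link K₀ G H} q
        ...   | q₁ , q₂ with link-el K₀ G H q₁
        ...     | k , off = link-in K G H (CS.K'-old (H ∪ˢ G) k (≢F off (λ { refl → t≢f (==ᵇ-refl F) (not-el q₂) }))) off
        from p | inj₂ q with ∧-el {H ⊆ᵇ S'} q
        ... | q₁ , q₂ with ∧-el {not (H ==ᵇ S')} q₂
        ...   | q₃ , q₄ = link-in K G H (CS.K'-new (H ∪ˢ G) (∪-⊑ H G (λ x r → subst (x ∈_) S≡ (∪-inˡ x S' G (⊆ᵇ⇒ q₁ x r))) (λ x r → ins-⊒ w D x (G⊑ x r)))
            (≢S' off (λ { refl → t≢f (==ᵇ-refl S') (not-el q₃) })) (≢F off (λ { refl → t≢f (==ᵇ-refl F) (not-el q₄) }))) off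
          where
          off : ∀ x → x ∈ H → x ∉ G
          off x r with ins-el x w F (⊆ᵇ⇒ q₁ x r)
          ... | inj₁ refl = w∉G
          ... | inj₂ s = proj₂ (diff-el x D G s)

      open ConnectedSum 𝔽 (link K₀ G) (link K G) (link-down K₀ G K₀-down) F w F-link max 1≤F
        (λ σ p → ⊑-∉ w (λ x q → ∪-inˡ x σ G q) (new (σ ∪ˢ G) (proj₁ (link-el K₀ G σ p)))) same public using (betti-summand; betti-sum)

    module Far (G : Sub n) (G⋢ : ¬ (G ⊑ D)) (w∉G : w ∉ G) where

      same : ∀ H → link K₀ G H ≡ link K G H
      same H = cong (_∧ disjointᵇ H G) (bool-iff to from)
        where
        to : K₀ (H ∪ˢ G) ≡ true → K (H ∪ˢ G) ≡ true
        to p = CS.K'-old (H ∪ˢ G) p (λ e → G⋢ (λ x q → subst (x ∈_) e (∪-inʳ x H G q)))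
        from : K (H ∪ˢ G) ≡ true → K₀ (H ∪ˢ G) ≡ true
        from p with CS.K'-el (H ∪ˢ G) p
        ... | inj₁ (k , _) = k
        ... | inj₂ (h , _) = ⊥-elim (G⋢ (λ x q → [ (λ { refl → ⊥-elim (t≢f q w∉G) }) , id ]′ (ins-el x w D (h x (∪-inʳ x H G q)))))

    top-link : ∀ H → link K₀ D H ≡ true → H ≡ emptyS
    top-link H p with link-el K₀ D H p
    ... | k , off = ⊑-antisym (λ x q → ⊥-elim (t≢f (subst (x ∈_) (top-max (H ∪ˢ D) k (λ z r → ∪-inʳ z H D r)) (∪-inˡ x H D q)) (off x q))) (λ x q → ⊥-elim (t≢f q (mem-empty x)))

    top-link-∅ : link K₀ D emptyS ≡ true
    top-link-∅ = link-in K₀ D emptyS (trans (cong K₀ (trans (∪-comm emptyS D) (∪-empty D))) K₀D) (λ x p → ⊥-elim (t≢f p (mem-empty x)))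

    data Position (G : Sub n) : Set where
      isD : G ≡ D → Position G
      near : G ⊑ D → G ≢ D → Position G
      away : ¬ (G ⊑ D) → Position G

    position : ∀ G → Position G
    position G with decB (G ==ᵇ D) | decB (G ⊆ᵇ D)
    ... | inj₁ p | _ = isD (==ᵇ⇒ p)
    ... | inj₂ p | inj₁ q = near (⊆ᵇ⇒ q) (λ { refl → t≢f (==ᵇ-refl G) p })
    ... | inj₂ p | inj₂ q = away (λ h → t≢f (⇒⊆ᵇ h) q)

    links-down : ∀ G → K₀ G ≡ true → G ≢ D → ∀ k b → Betti (link K G) k b → Betti (link K₀ G) k b
    links-down G p ne with position G
    ... | isD e = ⊥-elim (ne e)
    ... | near h ne' = Near.betti-summand G h ne'
    ... | away h = ext-iso (link K G) (link K₀ G) (link-down K G K-down) (λ H → sym (Far.same G h (new G p) H))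

    links-up : ∀ G → K₀ G ≡ true → G ≢ D → ∀ k b → Betti (link K₀ G) k b → Betti (link K G) k b
    links-up G p ne with position G
    ... | isD e = ⊥-elim (ne e)
    ... | near h ne' = Near.betti-sum G h ne'
    ... | away h = ext-iso (link K₀ G) (link K G) (link-down K₀ G K₀-down) (Far.same G h (new G p))

  -- The boundary `B` is a parameter because it stays the same while summands are removed; its being
  -- a sphere and a manifold is then established only once.
  record Ball (m : ℕ) (B : Cx n) (K : Cx n) : Set (a ⊔ ℓ) where
    field
      down : ∀ {σ τ} → τ ⊑ σ → K σ ≡ true → K τ ≡ true
      top : ∀ σ → K σ ≡ true → card σ ≤ m
      facet : Σ (Sub n) λ σ → K σ ≡ true × card σ ≡ m
      zeroH : ZeroHomology K
      links : ∀ G → K G ≡ true → 1 ≤ card G → SphereHomology (link K G) (m ∸ card G) ⊎ ZeroHomology (link K G)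
      bdryH : IsHomBoundary K B

  -- The summand has the Betti numbers of the sum, and so have all links except that of `D`, which
  -- is a sphere of dimension -1. No face of `B` contains `w`, so the faces with acyclic link are
  -- the same.
  ball-summand : ∀ m B K K₀ D w → 1 ≤ m → (∀ {σ τ} → τ ⊑ σ → K₀ σ ≡ true → K₀ τ ≡ true) → (∀ σ → K₀ σ ≡ true → card σ ≤ m) → K₀ D ≡ true → card D ≡ m
    → (∀ σ → K₀ σ ≡ true → w ∉ σ) → (∀ σ → K σ ≡ connSumSimplex K₀ D w σ) → (∀ σ → B σ ≡ true → w ∉ σ) → Ball m B K → Ball m B K₀
  ball-summand m B K K₀ D w 1≤m K₀-down K₀-top K₀D cD new sum B∌w ball = record
    { down = K₀-down ; top = K₀-top ; facet = D , K₀D , cD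
    ; zeroH = λ k → S.CS.betti-summand k 0 (zeroH k)
    ; links = links₀
    ; bdryH = λ σ → mk⇔ (to σ) (from σ) }
    where
    open Ball ball
    module S = Summand m K K₀ down K₀-down K₀-top D w K₀D cD 1≤m new sum
    K-face : ∀ G → K₀ G ≡ true → G ≢ D → K G ≡ true
    K-face G p ne = S.CS.K'-old G p ne
    links₀ : ∀ G → K₀ G ≡ true → 1 ≤ card G → SphereHomology (link K₀ G) (m ∸ card G) ⊎ ZeroHomology (link K₀ G)
    links₀ G p 1≤ with decB (G ==ᵇ D)
    ... | inj₁ e rewrite ==ᵇ⇒ {s = G} {D} e = inj₁ (subst (SphereHomology (link K₀ D)) (sym (trans (cong (m ∸_) cD) (n∸n≡0 m))) (point-sphere (link K₀ D) S.top-link S.top-link-∅))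
    ... | inj₂ e with links G (K-face G p (λ { refl → t≢f (==ᵇ-refl G) e })) 1≤
    ...   | inj₁ s = inj₁ (λ k → S.links-down G p (λ { refl → t≢f (==ᵇ-refl G) e }) k _ (s k))
    ...   | inj₂ z = inj₂ (λ k → S.links-down G p (λ { refl → t≢f (==ᵇ-refl G) e }) k 0 (z k))
    to : ∀ σ → B σ ≡ true → (σ ≡ emptyS) ⊎ (K₀ σ ≡ true × 1 ≤ card σ × ZeroHomology (link K₀ σ))
    to σ b with Equivalence.to (bdryH σ) b
    ... | inj₁ e = inj₁ e
    ... | inj₂ (k , 1≤ , z) with S.CS.K'-el σ k
    ...   | inj₁ (k₀ , ne) = inj₂ (k₀ , 1≤ , λ j → S.links-down σ k₀ ne j 0 (z j))
    ...   | inj₂ (h , _ , ne) = inj₂ (K₀-down sub K₀D , 1≤ , λ j → S.links-down σ (K₀-down sub K₀D) ne j 0 (z j))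
      where
      sub : σ ⊑ D
      sub x q with ins-el x w D (h x q)
      ... | inj₁ refl = ⊥-elim (t≢f q (B∌w σ b))
      ... | inj₂ r = r
    from : ∀ σ → (σ ≡ emptyS) ⊎ (K₀ σ ≡ true × 1 ≤ card σ × ZeroHomology (link K₀ σ)) → B σ ≡ true
    from σ (inj₁ e) = Equivalence.from (bdryH σ) (inj₁ e)
    from σ (inj₂ (k , 1≤ , z)) with decB (σ ==ᵇ D)
    ... | inj₁ e rewrite ==ᵇ⇒ {s = σ} {D} e = ⊥-elim (point-not-zero (link K₀ D) S.top-link S.top-link-∅ z)
    ... | inj₂ e = Equivalence.from (bdryH σ) (inj₂ (K-face σ k (λ { refl → t≢f (==ᵇ-refl σ) e }) , 1≤ , λ j → S.links-up σ k (λ { refl → t≢f (==ᵇ-refl σ) e }) j 0 (z j)))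

-- Links of boundary vertices in homology manifolds

module HomologyBoundary {a ℓ} (𝔽 : Field a ℓ) (e : ℕ) (3≤d : 3 ≤ suc e) {n} (Δ : Cx n) (pm : IsNormalPseudomanifold Δ (suc e))
  (hm : Homology.IsHomManifoldWithBdry 𝔽 Δ (suc e)) (v : Fin n) (v∈∂ : bdry Δ (suc e) (single v) ≡ true) where

  open Linear 𝔽
  open HomologyBalls 𝔽 v
  open LinkComplex (suc e) 3≤d Δ pm v
  open Pseudomanifold (suc e) Δ pm using (down; top; pure; cofaces; cofaces-in; cofaces-el; cofaces≤2; ∂Δ; bdry-el; bdry-in; bdry-down)

  d : ℕ
  d = suc e

  B : Cx n
  B = proj₁ (proj₂ (proj₂ (proj₂ hm)))

  isB : IsHomBoundary Δ B
  isB = proj₁ (proj₂ (proj₂ (proj₂ (proj₂ hm))))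

  B-manifold : IsHomManifoldNoBdry B d
  B-manifold = proj₂ (proj₂ (proj₂ (proj₂ (proj₂ hm))))

  B-down : ∀ {σ τ} → τ ⊑ σ → B σ ≡ true → B τ ≡ true
  B-down = complex-down (proj₁ B-manifold)

  same-coface : ∀ ρ x y → card (cofaces ρ) ≡ 1 → x ∈ cofaces ρ → y ∈ cofaces ρ → y ≡ x
  same-coface ρ x y one x∈ y∈ with y ≟ x
  ... | yes e = e
  ... | no ne = ⊥-elim (<-irrefl refl (≤-trans (2≤card (cofaces ρ) y x y∈ x∈ ne) (≤-reflexive one)))

  coface-link : ∀ ρ x → x ∈ cofaces ρ → link Δ ρ (single x) ≡ true
  coface-link ρ x x∈ = let x∉ , p = cofaces-el ρ x x∈ in
    link-in Δ ρ (single x) (trans (cong Δ (∪-comm (single x) ρ)) p) (λ z q → subst (_∉ ρ) (sym (single-∈ z x q)) x∉)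

  -- The link of a ridge with a single coface is a point. This is a cone, hence acyclic.
  bdry⊆B : ∀ τ → ∂Δ τ ≡ true → B τ ≡ true
  bdry⊆B τ p with bdry-el τ p
  ... | ρ , Δρ , cρ , one , sub with inhabited (cofaces ρ) (≤-reflexive (sym one))
  ...   | x , x∈ = B-down sub (Equivalence.from (isB ρ) (inj₂ (Δρ , subst (1 ≤_) (sym cρ) (s≤s z≤n) , cone-zero (link Δ ρ) (link-down Δ ρ down) x apex)))
    where
    apex : ∀ σ → link Δ ρ σ ≡ true → link Δ ρ (ins x σ) ≡ true
    apex σ q with link-el Δ ρ σ q
    ... | k , off = link-down Δ ρ down (ins-⊑ x in-x (mem-single-same x)) (coface-link ρ x x∈)
      where
      in-x : σ ⊑ single x
      in-x y y∈ = subst (_∈ single x) (sym (same-coface ρ x y one x∈ (cofaces-in ρ y (off y y∈) (down (ins-⊑ y (λ z r → ∪-inʳ z σ ρ r) (∪-inˡ y σ ρ y∈)) k)))) (mem-single-same x)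

  -- A ridge lying in two facets would have a link consisting of two isolated points.
  B-ridge : ∀ ρ → card ρ ≡ d → Δ ρ ≡ true → ZeroHomology (link Δ ρ) → card (cofaces ρ) ≡ 1
  B-ridge ρ cρ Δρ acyclic = [ eqᵇ⇒ , (λ many → ⊥-elim (two many)) ]′ (decB (card (cofaces ρ) ≡ᵇ 1))
    where
    apart : ∀ x y → x ≢ y → link Δ ρ (pair x y) ≡ false
    apart x y x≢y = falseI (λ p → let k , off = link-el Δ ρ (pair x y) p in
      <-irrefl refl (≤-trans (subst (suc (suc d) ≤_) (sym (card-∪ (pair x y) ρ off)) (+-mono-≤ (2≤card (pair x y) x y
        (∪-inˡ x (single x) (single y) (mem-single-same x)) (∪-inʳ y (single x) (single y) (mem-single-same y)) x≢y) (≤-reflexive (sym cρ)))) (top (pair x y ∪ˢ ρ) k)))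
    some : Σ (Fin n) λ x → x ∈ cofaces ρ
    some = let F , ΔF , cF , sub = pure ρ Δρ ; x , x∉ , e = facet-ins ρ F sub (trans cF (cong suc (sym cρ))) in
      x , cofaces-in ρ x x∉ (trans (cong Δ (sym e)) ΔF)
    two : (card (cofaces ρ) ≡ᵇ 1) ≡ false → ⊥
    two many = let x , x∈ = some
                   y , y∈ , y∉ = extra (single x) (cofaces ρ) (subst (_< card (cofaces ρ)) (sym (card-single x))
                     (≤∧≢⇒< (1≤card (cofaces ρ) x x∈) (λ e → t≢f (⇒eqᵇ (sym e)) many)))
      in two-points (link Δ ρ) apart x y (λ e → t≢f (mem-single-same x) (subst (_∉ single x) (sym e) y∉)) (coface-link ρ x x∈) (coface-link ρ y y∈) acyclic

  -- The link of `σ` in `B` has the full dimension, so `σ` lies in a face of `B` with `d` vertices.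
  -- This is a ridge of `Δ` with acyclic link.
  B⊆bdry : ∀ σ → 1 ≤ card σ → B σ ≡ true → ∂Δ σ ≡ true
  B⊆bdry σ 1≤ b with proj₁ (proj₁ (proj₂ (proj₂ (proj₂ B-manifold) σ b 1≤)))
  ... | H , LH , cH = conclude (Equivalence.to (isB ρ) (proj₁ Bρ))
    where
    ρ : Sub n
    ρ = H ∪ˢ σ
    Bρ : B ρ ≡ true × (∀ x → x ∈ H → x ∉ σ)
    Bρ = link-el B σ H LH
    cρ : card ρ ≡ d
    cρ = trans (card-∪ H σ (proj₂ Bρ)) (trans (cong (_+ card σ) cH) (m∸n+n≡m (proj₂ (proj₁ (proj₂ B-manifold)) σ b)))
    conclude : (ρ ≡ emptyS) ⊎ (Δ ρ ≡ true × 1 ≤ card ρ × ZeroHomology (link Δ ρ)) → ∂Δ σ ≡ true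
    conclude (inj₁ empty) = ⊥-elim (0≢1+n (trans (sym (card-empty n)) (trans (cong card (sym empty)) cρ)))
    conclude (inj₂ (Δρ , _ , acyclic)) = bdry-in σ ρ Δρ cρ (B-ridge ρ cρ Δρ acyclic) (λ x p → ∪-inʳ x H σ p)

  B' : Cx n
  B' = link B (single v)

  v∈B : B (single v) ≡ true
  v∈B = bdry⊆B (single v) v∈∂

  off-v : ∀ G → v ∉ G → ∀ x → x ∈ G → x ∉ single v
  off-v G v∉ x x∈ = mem-single-other x v (∉⇒≢ G x v x∈ v∉)

  B'-el : ∀ σ → B' σ ≡ true → B (ins v σ) ≡ true × v ∉ σ
  B'-el σ p = let k , off = link-el B (single v) σ p in k , falseI (λ q → t≢f (mem-single-same v) (off v q))

  B'-in : ∀ σ → B (ins v σ) ≡ true → v ∉ σ → B' σ ≡ true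
  B'-in σ p q = link-in B (single v) σ p (off-v σ q)

  link-to-L : ∀ G → v ∉ G → ∀ k b → Betti (link Δ (ins v G)) k b → Betti (link L G) k b
  link-to-L G v∉ = ext-iso (link Δ (ins v G)) (link L G) (link-down Δ (ins v G) down) (λ H → sym (link-link Δ (single v) G (off-v G v∉) H))

  link-from-L : ∀ G → v ∉ G → ∀ k b → Betti (link L G) k b → Betti (link Δ (ins v G)) k b
  link-from-L G v∉ = ext-iso (link L G) (link Δ (ins v G)) (link-down L G (link-down Δ (single v) down)) (λ H → link-link Δ (single v) G (off-v G v∉) H)

  single≢∅ : ∀ (x : Fin n) → single x ≢ emptyS
  single≢∅ x e = t≢f (subst (x ∈_) e (mem-single-same x)) (mem-empty x)

  1≤ins : ∀ (x : Fin n) σ → 1 ≤ card (ins x σ)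
  1≤ins x σ = 1≤card (ins x σ) x (mem-ins-same x σ)

  -- Links of faces of `L` are links in `Δ` of the same faces with `v` added.
  B'-boundary : IsHomBoundary L B'
  B'-boundary σ = mk⇔ to from
    where
    to : B' σ ≡ true → (σ ≡ emptyS) ⊎ (L σ ≡ true × 1 ≤ card σ × ZeroHomology (link L σ))
    to p with B'-el σ p | decB (1 ≤ᵇ card σ)
    ... | _ | inj₂ q = inj₁ (card-0 σ (n<1⇒n≡0 (≰⇒> (λ le → t≢f (⇒leᵇ le) q))))
    ... | b , v∉ | inj₁ q with Equivalence.to (isB (ins v σ)) b
    ...   | inj₁ e = ⊥-elim (t≢f (subst (v ∈_) e (mem-ins-same v σ)) (mem-empty v))
    ...   | inj₂ (k , _ , z) = inj₂ (L-in σ k v∉ , leᵇ⇒ q , λ j → link-to-L σ v∉ j 0 (z j))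
    from : (σ ≡ emptyS) ⊎ (L σ ≡ true × 1 ≤ card σ × ZeroHomology (link L σ)) → B' σ ≡ true
    from (inj₁ refl) = B'-in emptyS (trans (cong B (trans (∪-comm emptyS (single v)) (∪-empty (single v)))) v∈B) (mem-empty v)
    from (inj₂ (p , _ , z)) = let k , v∉ = L-el σ p in
      B'-in σ (Equivalence.from (isB (ins v σ)) (inj₂ (k , 1≤ins v σ , λ j → link-from-L σ v∉ j 0 (z j)))) v∉

  R : Sub n → Set
  R ρ = ∃ λ w → w ∈ ρ × w ∉ V.B

  P : Pseudo d R L
  P = pseudo R inner
    where
    inner : ∀ ρ → R ρ → v ∉ ρ → ∂Δ (ins v ρ) ≡ false
    inner ρ (w , w∈ , w∉) v∉ = falseI (λ q → t≢f (V.B-in w (∉⇒≢ ρ w v w∈ v∉) (bdry-down (pair-⊑ w v (ins-⊒ v ρ w w∈) (mem-ins-same v ρ)) q)) w∉)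

  ball : Ball d B' L
  ball = record
    { down = link-down Δ (single v) down
    ; top = Pseudo.top P
    ; facet = facet
    ; zeroH = zeroH (Equivalence.to (isB (single v)) v∈B)
    ; links = links
    ; bdryH = B'-boundary }
    where
    facet : Σ (Sub n) λ σ → L σ ≡ true × card σ ≡ d
    facet with bdry-el (single v) v∈∂
    ... | ρ , Δρ , _ , _ , sub with Pseudo.pure P emptyS (L-in emptyS (down (λ x p → sub x (subst (x ∈_) (trans (∪-comm emptyS (single v)) (∪-empty (single v))) p)) Δρ) (mem-empty v))
    ...   | F , LF , cF , _ = F , LF , cF
    zeroH : (single v ≡ emptyS) ⊎ (Δ (single v) ≡ true × 1 ≤ card (single v) × ZeroHomology L) → ZeroHomology L
    zeroH (inj₁ e) = ⊥-elim (single≢∅ v e)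
    zeroH (inj₂ (_ , _ , z)) = z
    links : ∀ G → L G ≡ true → 1 ≤ card G → SphereHomology (link L G) (d ∸ card G) ⊎ ZeroHomology (link L G)
    links G p _ with L-el G p
    ... | k , v∉ with proj₁ (proj₂ (proj₂ hm)) (ins v G) k (1≤ins v G)
    ...   | inj₁ s = inj₁ (subst (SphereHomology (link L G)) (cong (suc d ∸_) (card-ins v G v∉)) (λ j → link-to-L G v∉ j _ (s j)))
    ...   | inj₂ z = inj₂ (λ j → link-to-L G v∉ j 0 (z j))

  B'-sphere : IsHomSphere B' e
  B'-sphere = subst (IsHomSphere B') (cong (d ∸_) (card-single v)) (proj₂ (proj₂ B-manifold) (single v) v∈B (≤-reflexive (sym (card-single v))))

  B'-manifold : IsHomManifoldNoBdry B' e
  B'-manifold = proj₁ B'-sphere , proj₁ (proj₂ B'-sphere) , links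
    where
    links : ∀ G → B' G ≡ true → 1 ≤ card G → IsHomSphere (link B' G) (e ∸ card G)
    links G p _ = let b , v∉ = B'-el G p in
      subst (IsHomSphere (link B' G)) (cong (d ∸_) (card-ins v G v∉)) (hom-sphere-ext (link B (ins v G)) (link B' G)
        (λ H → sym (link-link B (single v) G (off-v G v∉) H)) (d ∸ card (ins v G)) (proj₂ (proj₂ B-manifold) (ins v G) b (1≤ins v G)))

  -- This is what allows vertices outside `V.B` to be removed without touching the boundary sphere:
  -- the two notions of boundary agree, so such a vertex shares no edge of `B` with `v`.
  B'∌ : ∀ w → w ∉ V.B → ∀ σ → B' σ ≡ true → w ∉ σ
  B'∌ w w∉ σ p = falseI (λ w∈ → let b , v∉ = B'-el σ p in
    t≢f (V.B-in w (∉⇒≢ σ w v w∈ v∉) (B⊆bdry (pair w v) (1≤ins v (single w)) (B-down (pair-⊑ w v (ins-⊒ v σ w w∈) (mem-ins-same v σ)) b))) w∉)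

  B'-vertex : ∀ x → x ∈ V.B → B' (single x) ≡ true
  B'-vertex x x∈ = let x≢v , p = V.B-el x x∈ in B'-in (single x) (bdry⊆B (pair x v) p) (mem-single-other v x (λ e → x≢v (sym e)))

  -- Once only vertices of `V.B` are left, each of them belongs to `B'`, whose nonempty faces have
  -- acyclic links.
  no-interior : ∀ K → (∀ x → K (single x) ≡ true → x ∈ V.B) → IsHomBoundary K B' → NoInteriorVertices K
  no-interior K verts bd x Kx = [ (λ e → ⊥-elim (single≢∅ x e)) , (λ z → proj₂ (proj₂ z)) ]′ (Equivalence.to (bd (single x)) (B'-vertex x (verts x Kx)))

  hom-ball : ∀ K → Ball d B' K → IsHomBall K e
  hom-ball K b = (down-complex (Ball.down b) , (Ball.facet b , Ball.top b) , Ball.links b , B' , Ball.bdryH b , B'-manifold) , Ball.zeroH b , B' , Ball.bdryH b , B'-sphere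

  finish : ∀ K → (∀ x → K (single x) ≡ true → x ∈ V.B) → Ball d B' K → IsHomBall K e × NoInteriorVertices K
  finish K verts b = hom-ball K b , no-interior K verts (Ball.bdryH b)

  far : ∀ w → w ∉ V.B → adj V.graph (fsuc w) fzero ≡ false
  far w w∉ = falseI (λ q → t≢f (V.B-in w (λ r → proj₁ (V.adj-el (fsuc w) fzero q) (cong fsuc r)) (V.adj-0 w q)) w∉)

  open BallBuilt d 3≤d V.graph V.B far (Ball d B') (λ K → IsHomBall K e × NoInteriorVertices K) finish hiding (R)

  remove : ∀ K K₀ D w → Pseudo d R K₀ → K₀ D ≡ true → card D ≡ d → (∀ σ → K₀ σ ≡ true → w ∉ σ) → (∀ σ → K σ ≡ connSumSimplex K₀ D w σ) → w ∉ V.B → Ball d B' K → Ball d B' K₀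
  remove K K₀ D w P₀ K₀D cD new sum w∉ = ball-summand d B' K K₀ D w (s≤s z≤n) (Pseudo.down P₀) (Pseudo.top P₀) K₀D cD new sum (B'∌ w w∉)

  ridge-at : ∀ ρ x → v ∈ ρ → Δ ρ ≡ true → card ρ ≡ d → card (cofaces ρ) ≡ 1 → x ∈ cofaces ρ → Ridge remove L
  ridge-at ρ x v∈ Δρ cρ one x∈ = record
    { ρ = del v ρ
    ; cρ = trans (card-del v ρ v∈) cρ
    ; ρ⊑ = λ y p → let y≢v , y∈ = del-∈ y v ρ p in V.B-in y y≢v (bdry-in (pair y v) ρ Δρ cρ one (pair-⊑ y v y∈ v∈))
    ; x = x
    ; x∉ = del-∉ x v ρ x∉
    ; Kx = L-in (ins x (del v ρ)) (trans (cong Δ (trans (ins-comm v x (del v ρ)) (cong (ins x) (ins-del v ρ v∈)))) (proj₂ (cofaces-el ρ x x∈)))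
        (ins-∉ v x (del v ρ) (λ e → t≢f (subst (_∈ ρ) e v∈) x∉) (mem-del-same v ρ))
    ; only = λ y y∉ k → same-coface ρ x y one x∈ (subst (λ ρ → y ∈ cofaces ρ) (ins-del v ρ v∈) (coface-L (del v ρ) y (mem-del-same v ρ) y∉ k)) }
    where
    x∉ : x ∉ ρ
    x∉ = proj₁ (cofaces-el ρ x x∈)

  ridge : Ridge remove L
  ridge = let ρ , Δρ , cρ , one , sub = bdry-el (single v) v∈∂ ; x , x∈ = inhabited (cofaces ρ) (≤-reflexive (sym one)) in
    ridge-at ρ x (sub v (mem-single-same v)) Δρ cρ one x∈

  boundary-built : Reach d V.graph (true ∷ V.B) V.J → BuiltBySums (λ K → IsHomBall K e × NoInteriorVertices K) d L
  boundary-built r = ball-built remove (reach-built initial r) L P (record { verts = L-vertex ; verts' = vertex-L ; edges = L-edge }) ridge ball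

open import Data.Nat.Combinatorics using (_C_)
open import Data.Integer using (+_) renaming (_*_ to _*ℤ_; _-_ to _-ℤ_; _≤_ to _≤ℤ_)

theorem1p3 : ∀ {c ℓ : Level} (𝔽 : Field c ℓ) (n d : ℕ) (Δ : Cx n)
    → 3 ≤ d → IsNormalPseudomanifoldWithBoundary Δ d
    → (∀ b0 b1 → Homology.IsBetti 𝔽 Δ (bdry Δ d) 1 b0 → Homology.IsBetti 𝔽 Δ (bdry Δ d) 2 b1
         → (+ ((suc (suc d)) C 2) *ℤ (+ b1 -ℤ + b0)) ≤ℤ gnum Δ (bdry Δ d) 2)
      × (∀ b0 b1 → Homology.IsBetti 𝔽 Δ (bdry Δ d) 1 b0 → Homology.IsBetti 𝔽 Δ (bdry Δ d) 2 b1
         → Homology.IsHomManifoldWithBdry 𝔽 Δ d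
         → gnum Δ (bdry Δ d) 2 ≡ (+ ((suc (suc d)) C 2) *ℤ (+ b1 -ℤ + b0))
         → (∀ (v : Fin n) → InteriorVertex Δ d v → IsStackedSphere d (link Δ (single v)))
           × (∀ (v : Fin n) → BoundaryVertex Δ d v
                → BuiltBySums (λ K → Homology.IsHomBall 𝔽 K (d ∸ 1) × Homology.NoInteriorVertices 𝔽 K)
                              d (link Δ (single v))))
-- Writing the dimension as a successor makes `d ∸ 1` in the conclusion reduce to `e`.
theorem1p3 𝔽 n (suc e) Δ 3≤d pmb = bound , λ b0 b1 β₀ β₁ hm eq → interior b0 b1 β₀ β₁ eq , boundary b0 b1 β₀ β₁ hm eq
  where
  d : ℕ
  d = suc e
  C₂ : ℕ
  C₂ = suc (suc d) C 2
  open Counting 𝔽 d 3≤d Δ pmb using (pm; f₀; f₁; inequality; all-reached; gnum-2)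

  bound : ∀ b0 b1 → Homology.IsBetti 𝔽 Δ (bdry Δ d) 1 b0 → Homology.IsBetti 𝔽 Δ (bdry Δ d) 2 b1
    → (+ C₂ *ℤ (+ b1 -ℤ + b0)) ≤ℤ gnum Δ (bdry Δ d) 2
  bound b0 b1 β₀ β₁ = subst (+ C₂ *ℤ (+ b1 -ℤ + b0) ≤ℤ_) (sym gnum-2) (diff-≤ C₂ b1 (suc d * f₀) f₁ b0 (inequality b0 b1 β₀ β₁))

  module _ b0 b1 (β₀ : Homology.IsBetti 𝔽 Δ (bdry Δ d) 1 b0) (β₁ : Homology.IsBetti 𝔽 Δ (bdry Δ d) 2 b1) where

    module _ (eq : gnum Δ (bdry Δ d) 2 ≡ (+ C₂ *ℤ (+ b1 -ℤ + b0))) where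

      reached : ∀ v → Δ (single v) ≡ true → Counting.Reached 𝔽 d 3≤d Δ pmb v
      reached = all-reached b0 b1 β₀ β₁ (diff-≡ C₂ b1 (suc d * f₀) f₁ b0 (trans (sym gnum-2) eq))

      interior : ∀ v → InteriorVertex Δ d v → IsStackedSphere d (link Δ (single v))
      interior v (Δv , inner) = conclude (reached v Δv)
        where
        conclude : Counting.Reached 𝔽 d 3≤d Δ pmb v → IsStackedSphere d (link Δ (single v))
        conclude (_ , _ , inj₁ (v∈∂ , _)) = ⊥-elim (t≢f v∈∂ inner)
        conclude (_ , r , inj₂ (_ , F , ΔF , cF , v∈F , refl)) = LinkComplex.interior-stacked d 3≤d Δ pm v F ΔF v∈F cF inner r

    boundary : Homology.IsHomManifoldWithBdry 𝔽 Δ d → gnum Δ (bdry Δ d) 2 ≡ (+ C₂ *ℤ (+ b1 -ℤ + b0))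
      → ∀ v → BoundaryVertex Δ d v → BuiltBySums (λ K → Homology.IsHomBall 𝔽 K e × Homology.NoInteriorVertices 𝔽 K) d (link Δ (single v))
    boundary hm eq v v∈∂ = conclude (reached eq v (Pseudomanifold.bdry⊆ d Δ pm (single v) v∈∂))
      where
      conclude : Counting.Reached 𝔽 d 3≤d Δ pmb v → BuiltBySums (λ K → Homology.IsHomBall 𝔽 K e × Homology.NoInteriorVertices 𝔽 K) d (link Δ (single v))
      conclude (_ , r , inj₁ (_ , refl)) = HomologyBoundary.boundary-built 𝔽 e 3≤d Δ pm hm v v∈∂ r
      conclude (_ , _ , inj₂ (inner , _)) = ⊥-elim (t≢f v∈∂ inner)
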